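{- For every $\beta > 0$ there exist $N=N(\beta)$ and $\delta=\delta(\beta)>0$ such that every graph $G$ with $n > N$ vertices and $m \ge \beta n^2$ edges satisfying $\tau_t(G) \ge (1-\delta)\frac{m}{2}$ also satisfies $$\nu_t(G) \ge \left(1+\frac{\beta^2}{800}\right)\frac{m}{4}.$$
   Context: All graphs are finite, simple and undirected. A triangle cover of a graph $G$ is a set of edges meeting every triangle of $G$; $\tau_t(G)$ is the minimum size of a triangle cover. A triangle packing is a set of pairwise edge-disjoint triangles of $G$; $\nu_t(G)$ is the maximum size of a triangle packing. A graph with $m$ edges satisfying $\tau_t(G)\ge(1-\delta)m/2$ is called $(1-\delta)$-hard to make triangle-free.
   Formalization: The parameter β ranges over positive rational numbers instead of positive real numbers; δ is also rational, which loses nothing. -}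

module Defs where

open import Data.Bool using (Bool; true; false; T; _∧_)
open import Data.Nat as ℕ using (ℕ; _^_)
open import Data.Fin using (Fin; toℕ)
open import Data.Product using (_×_; _,_; Σ; ∃; ∃-syntax)
open import Data.List using (List; length; filterᵇ; allFin; concatMap; map)
open import Data.List.Membership.Propositional using (_∈_)
open import Data.List.Relation.Unary.All using (All)
open import Data.List.Relation.Unary.Any using (Any)
open import Data.List.Relation.Unary.Unique.Propositional using (Unique)
open import Data.List.Relation.Unary.AllPairs using (AllPairs)
open import Data.Integer using (+_)
open import Data.Rational using (ℚ; _/_; _≤_)
open import Relation.Binary.PropositionalEquality using (_≡_)
open import Relation.Nullary using (¬_)

record Graph (n : ℕ) : Set where
  field
    adj   : Fin n → Fin n → Bool
    sym   : ∀ i j → adj i j ≡ adj j i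
    irrefl : ∀ i → adj i i ≡ false
open Graph public

_<ᶠ_ : ∀ {n} → Fin n → Fin n → Bool
i <ᶠ j = toℕ i ℕ.<ᵇ toℕ j

Edge : ℕ → Set
Edge n = Fin n × Fin n

edges : ∀ {n} → Graph n → List (Edge n)
edges {n} G =
  filterᵇ (λ { (i , j) → (i <ᶠ j) ∧ adj G i j })
    (concatMap (λ i → map (i ,_) (allFin n)) (allFin n))

numEdges : ∀ {n} → Graph n → ℕ
numEdges G = length (edges G)

Triangle : ℕ → Set
Triangle n = Fin n × Fin n × Fin n

triangles : ∀ {n} → Graph n → List (Triangle n)
triangles {n} G =
  filterᵇ (λ { (i , j , k) → (i <ᶠ j) ∧ (j <ᶠ k) ∧ adj G i j ∧ adj G j k ∧ adj G i k })
    (concatMap (λ i → concatMap (λ j → map (λ k → (i , j , k)) (allFin n)) (allFin n)) (allFin n))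

-- the three edges of a triangle (in the same i < j normal form as `edges`)
triEdges : ∀ {n} → Triangle n → List (Edge n)
triEdges (i , j , k) = (i , j) Data.List.∷ (j , k) Data.List.∷ (i , k) Data.List.∷ Data.List.[]

IsTriangleCover : ∀ {n} → Graph n → List (Edge n) → Set
IsTriangleCover G C =
  Unique C × All (_∈ edges G) C × All (λ t → Any (_∈ C) (triEdges t)) (triangles G)

EdgeDisjoint : ∀ {n} → Triangle n → Triangle n → Set
EdgeDisjoint s t = All (λ e → ¬ (e ∈ triEdges t)) (triEdges s)

IsTrianglePacking : ∀ {n} → Graph n → List (Triangle n) → Set
IsTrianglePacking G P = All (_∈ triangles G) P × AllPairs EdgeDisjoint P

ℕ→ℚ : ℕ → ℚ
ℕ→ℚ k = + k / 1

-- τ_t(G) ≥ x  :⇔  every triangle cover has size ≥ x (τ_t is the minimum size)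
τt≥ : ∀ {n} → Graph n → ℚ → Set
τt≥ G x = ∀ C → IsTriangleCover G C → x ≤ ℕ→ℚ (length C)

-- ν_t(G) ≥ y  :⇔  some triangle packing has size ≥ y (ν_t is the maximum size)
νt≥ : ∀ {n} → Graph n → ℚ → Set
νt≥ G y = ∃[ P ] (IsTrianglePacking G P × y ≤ ℕ→ℚ (length P))

{-# OPTIONS --safe #-}
-- Deleting the edges inside the two parts of a bipartition leaves no triangle, so hardness makes the quadratic form of
-- the adjacency matrix at least −δM on [-1,1]ⁿ (M is twice the number of edges). Pass to a regular partition and to the
-- linear program of fractional triangle packings of the reduced graph, with value V and dual g. If few class pairs have
-- g = 0, complementary slackness bounds V from below. Otherwise consider neighbourhoods in the pairs with g = 0: the
-- covering constraint forces g ≥ 1 on the regular pairs between them, and testing the form with 1_U − t shows that such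
-- pairs carry mass at least c β² M. Taking these pairs and Krivelevich's rounding of the others as a cover, hardness
-- gives V ≥ ¾M + c′β²M. The fractional packing spreads to small weights on the triangles of G, where regularity controls
-- the loads of the edges, and a derandomised nibble turns these weights into a packing.
module Submission where

open import Defs hiding (sym)
open import Data.Bool using (Bool; true; false; if_then_else_; _∧_; not; _∨_)
import Data.Bool.Properties as Bool
open import Data.Empty using (⊥; ⊥-elim)
open import Data.Fin using (Fin; zero; suc; combine; remQuot; funToFin; finToFun; _↑ˡ_; _↑ʳ_; splitAt; toℕ)
import Data.Fin.Properties as Fin
open import Data.Fin.Subset using (Subset)
open import Data.Fin.Subset.Properties using (anySubset?)
open import Data.Integer as ℤ using (-[1+_]) renaming (+_ to int)
import Data.Integer.Properties as ℤ
open import Data.List using (List; []; _∷_; _++_; map; length; allFin; filter; concatMap; filterᵇ)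
open import Data.List.Membership.Propositional using (_∈_)
open import Data.List.Membership.Propositional.Properties using (∈-allFin; ∈-++⁻; ∈-map⁻; ∈-map⁺; ∈-filter⁺; ∈-filter⁻; ∈-++⁺ˡ; ∈-++⁺ʳ; ∈-concatMap⁺; ∈-concatMap⁻)
open import Data.List.Properties using (map-tabulate; length-tabulate)
open import Data.List.Relation.Unary.All as All using (All; []; _∷_)
import Data.List.Relation.Unary.All.Properties as All
open import Data.List.Relation.Unary.AllPairs as AllPairs using ([]; _∷_; AllPairs)
open import Data.List.Relation.Unary.Any as Any using (here; there; Any)
open import Data.List.Relation.Unary.Unique.Propositional using (Unique)
open import Data.List.Relation.Unary.Unique.Propositional.Properties as Unique using (allFin⁺)
open import Data.Nat as ℕ using (ℕ; zero; suc; _^_)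
import Data.Nat.Properties as ℕ
open import Data.Product using (_×_; _,_; ∃-syntax; proj₁; proj₂; uncurry)
open import Data.Product.Properties using (≡-dec)
open import Data.Rational hiding (truncate)
open import Data.Rational.Properties
import Data.Rational.Unnormalised as ℚᵘ
import Data.Rational.Unnormalised.Properties as ℚᵘ
open import Data.Sum using (_⊎_; inj₁; inj₂; [_,_]′)
open import Data.Unit using (tt)
open import Data.Vec.Properties using (lookup∘tabulate)
open import Function using (_∘_)
open import Relation.Binary.Definitions using (DecidableEquality; Tri; tri<; tri≈; tri>)
open import Relation.Binary.PropositionalEquality hiding ([_])
open import Relation.Nullary using (¬_; Dec; yes; no; does)
open import Relation.Nullary.Decidable using (dec⇒maybe; _⊎-dec_; T?)
open import Tactic.RingSolver.Core.AlmostCommutativeRing using (AlmostCommutativeRing; fromCommutativeRing)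
open import Tactic.RingSolver.Core.Expression using (Expr)

-- Sums run over ordered pairs and triples: `M` counts every edge twice and a class packing of value
-- V stands for V/6 triangles, so the target m/4 reads V = ¾M. Krivelevich's bound τ ≤ 2ν* and
-- hardness yield this much up to errors; the theorem is about the surplus. It comes from class
-- pairs of dual weight at least 1: rounding may charge a pair twice its dual weight, yet such a
-- pair costs only 1, so pairs of mass μ save enough to add 3μ/2 to V. The order β² of μ comes from
-- the test vector 1_U - t: it gains 2t times a quantity of relative size β/18 and loses t², and t =
-- β/18 leaves β²/324. The resulting surplus β²M/300 in V then pays for lifting and nibble.
-- Uniformity dictates the order of choices: the nibble's bound `η` on weights depends on β alone,
-- the number of classes is bounded before the size threshold `σ` is set, and n comes last; only the
-- step length of the nibble depends on the graph. Everything is rational and finite: expectations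
-- are replaced by an outcome at least as good as the mean, limits by Bernoulli estimates.

module Sums where

  -- Rational inequalities, finite sums, averaging.

  ℚ-ring : AlmostCommutativeRing _ _
  ℚ-ring = fromCommutativeRing +-*-commutativeRing (λ x → dec⇒maybe (0ℚ ≟ x))

  open import Tactic.RingSolver.NonReflective ℚ-ring public using (solve) renaming (_⊜_ to infix 4 _:=_)
  open import Tactic.RingSolver.Core.Expression public using () renaming (Κ to cst; _⊕_ to infixl 6 _:+_; _⊗_ to infixl 7 _:*_; ⊝_ to infix 8 :-_)

  infixl 6 _:-_
  _:-_ : ∀ {n} → Expr ℚ n → Expr ℚ n → Expr ℚ n
  x :- y = x :+ (:- y)

  2ℚ 3ℚ 4ℚ 5ℚ 6ℚ 12ℚ 27ℚ : ℚ
  2ℚ = 1ℚ + 1ℚ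
  3ℚ = 2ℚ + 1ℚ
  4ℚ = 3ℚ + 1ℚ
  5ℚ = 3ℚ + 2ℚ
  6ℚ = 3ℚ + 3ℚ
  12ℚ = 3ℚ * 4ℚ
  27ℚ = 3ℚ * (3ℚ * 3ℚ)

  -- The form of most inequalities below: `r` is a sum of products of nonnegative slacks found by
  -- hand, and an `-identity` lemma proved by the ring solver certifies that it is the difference.
  lin : ∀ {a b r} → 0ℚ ≤ r → b ≡ a + r → a ≤ b
  lin {a} {r = r} 0≤r refl = subst (_≤ a + r) (+-identityʳ a) (+-monoʳ-≤ a 0≤r)

  infixl 4 _≤≡_
  infixr 5 _≡≤_

  _≤≡_ : ∀ {a b c} → a ≤ b → b ≡ c → a ≤ c
  p ≤≡ refl = p

  _≡≤_ : ∀ {a b c : ℚ} → a ≡ b → b ≤ c → a ≤ c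
  refl ≡≤ p = p

  0≤- : ∀ {a b} → a ≤ b → 0ℚ ≤ b - a
  0≤- {a} {b} a≤b = subst (_≤ b - a) (+-inverseʳ a) (+-monoˡ-≤ (- a) a≤b)

  -≥0 : ∀ {a b} → 0ℚ ≤ b - a → a ≤ b
  -≥0 {a} {b} h = lin h (lem a b)
    where lem : ∀ a b → b ≡ a + (b - a)
          lem = solve 2 (λ a b → b := a :+ (b :- a)) refl

  infixl 6 _⊕_
  infixl 7 _⊛_

  _⊕_ : ∀ {a b} → 0ℚ ≤ a → 0ℚ ≤ b → 0ℚ ≤ a + b
  _⊕_ = +-mono-≤

  _⊛_ : ∀ {a b} → 0ℚ ≤ a → 0ℚ ≤ b → 0ℚ ≤ a * b
  _⊛_ {a} {b} p q = subst (_≤ a * b) (*-zeroʳ a) (*-monoˡ-≤-nonNeg a {{nonNegative p}} q)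

  *-mono-≥0 : ∀ c {a b} → 0ℚ ≤ c → a ≤ b → c * a ≤ c * b
  *-mono-≥0 c p q = *-monoˡ-≤-nonNeg c {{nonNegative p}} q

  *-mono-≥0ʳ : ∀ c {a b} → 0ℚ ≤ c → a ≤ b → a * c ≤ b * c
  *-mono-≥0ʳ c p q = *-monoʳ-≤-nonNeg c {{nonNegative p}} q

  *-mono² : ∀ {a b c d} → 0ℚ ≤ a → 0ℚ ≤ d → a ≤ b → c ≤ d → a * c ≤ b * d
  *-mono² {a} {d = d} 0≤a 0≤d p q = ≤-trans (*-mono-≥0 a 0≤a q) (*-mono-≥0ʳ d 0≤d p)

  sq≥0 : ∀ a → 0ℚ ≤ a * a
  sq≥0 a with ≤-total 0ℚ a
  ... | inj₁ p = p ⊛ p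
  ... | inj₂ p = subst (0ℚ ≤_) (lem a) (h ⊛ h)
    where lem : ∀ a → (0ℚ - a) * (0ℚ - a) ≡ a * a
          lem = solve 1 (λ a → (cst 0ℚ :- a) :* (cst 0ℚ :- a) := a :* a) refl
          h = 0≤- p

  0<* : ∀ {a b} → 0ℚ < a → 0ℚ < b → 0ℚ < a * b
  0<* {a} {b} p q = positive⁻¹ (a * b) {{pos*pos⇒pos a {{positive p}} b {{positive q}}}}

  0<+ : ∀ {a b} → 0ℚ < a → 0ℚ ≤ b → 0ℚ < a + b
  0<+ = +-mono-<-≤

  0≤1 : 0ℚ ≤ 1ℚ
  0≤1 = nonNegative⁻¹ 1ℚ

  0≤2 : 0ℚ ≤ 2ℚ
  0≤2 = nonNegative⁻¹ 2ℚ

  0≤3 : 0ℚ ≤ 3ℚ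
  0≤3 = nonNegative⁻¹ 3ℚ

  *-cancel-≤ : ∀ c {a b} → 0ℚ < c → c * a ≤ c * b → a ≤ b
  *-cancel-≤ c p = *-cancelˡ-≤-pos c {{positive p}}

  inv : ∀ c → 0ℚ < c → ∃[ d ] (0ℚ < d × c * d ≡ 1ℚ)
  inv c p = (1/ c) {{nz}} , positive⁻¹ _ {{1/pos⇒pos c {{positive p}}}} , *-inverseʳ c {{nz}}
    where nz = pos⇒nonZero c {{positive p}}

  𝟙 : Bool → ℚ
  𝟙 true = 1ℚ
  𝟙 false = 0ℚ

  𝟙≥0 : ∀ b → 0ℚ ≤ 𝟙 b
  𝟙≥0 true = 0≤1
  𝟙≥0 false = ≤-refl

  𝟙≤1 : ∀ b → 𝟙 b ≤ 1ℚ
  𝟙≤1 true = ≤-refl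
  𝟙≤1 false = 0≤1

  𝟙-∧ : ∀ a b → 𝟙 (a ∧ b) ≡ 𝟙 a * 𝟙 b
  𝟙-∧ true b = sym (*-identityˡ (𝟙 b))
  𝟙-∧ false b = sym (*-zeroˡ (𝟙 b))

  𝟙-sq : ∀ b → 𝟙 b * 𝟙 b ≡ 𝟙 b
  𝟙-sq true = refl
  𝟙-sq false = refl

  module _ {A : Set} where

    ∑ : List A → (A → ℚ) → ℚ
    ∑ [] f = 0ℚ
    ∑ (x ∷ xs) f = f x + ∑ xs f

    ∑-cong∈ : ∀ xs {f g : A → ℚ} → (∀ x → x ∈ xs → f x ≡ g x) → ∑ xs f ≡ ∑ xs g
    ∑-cong∈ [] h = refl
    ∑-cong∈ (x ∷ xs) h = cong₂ _+_ (h x (here refl)) (∑-cong∈ xs (λ y m → h y (there m)))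

    ∑-cong : ∀ xs {f g : A → ℚ} → (∀ x → f x ≡ g x) → ∑ xs f ≡ ∑ xs g
    ∑-cong xs h = ∑-cong∈ xs (λ x _ → h x)

    ∑-mono∈ : ∀ xs {f g : A → ℚ} → (∀ x → x ∈ xs → f x ≤ g x) → ∑ xs f ≤ ∑ xs g
    ∑-mono∈ [] h = ≤-refl
    ∑-mono∈ (x ∷ xs) h = +-mono-≤ (h x (here refl)) (∑-mono∈ xs (λ y m → h y (there m)))

    ∑-mono : ∀ xs {f g : A → ℚ} → (∀ x → f x ≤ g x) → ∑ xs f ≤ ∑ xs g
    ∑-mono xs h = ∑-mono∈ xs (λ x _ → h x)

    ∑-0 : ∀ xs → ∑ xs (λ _ → 0ℚ) ≡ 0ℚ
    ∑-0 [] = refl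
    ∑-0 (x ∷ xs) = trans (+-identityˡ _) (∑-0 xs)

    ∑-≥0 : ∀ xs {f : A → ℚ} → (∀ x → 0ℚ ≤ f x) → 0ℚ ≤ ∑ xs f
    ∑-≥0 [] h = ≤-refl
    ∑-≥0 (x ∷ xs) h = h x ⊕ ∑-≥0 xs h

    ∑-+ : ∀ xs (f g : A → ℚ) → ∑ xs (λ x → f x + g x) ≡ ∑ xs f + ∑ xs g
    ∑-+ [] f g = refl
    ∑-+ (x ∷ xs) f g = trans (cong (f x + g x +_) (∑-+ xs f g)) (lem (f x) (g x) (∑ xs f) (∑ xs g))
      where lem : ∀ a b c d → a + b + (c + d) ≡ a + c + (b + d)
            lem = solve 4 (λ a b c d → a :+ b :+ (c :+ d) := a :+ c :+ (b :+ d)) refl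

    ∑-* : ∀ xs c (f : A → ℚ) → ∑ xs (λ x → c * f x) ≡ c * ∑ xs f
    ∑-* [] c f = sym (*-zeroʳ c)
    ∑-* (x ∷ xs) c f = trans (cong (c * f x +_) (∑-* xs c f)) (sym (*-distribˡ-+ c (f x) (∑ xs f)))

    ∑-*ʳ : ∀ xs c (f : A → ℚ) → ∑ xs (λ x → f x * c) ≡ ∑ xs f * c
    ∑-*ʳ xs c f = trans (∑-cong xs (λ x → *-comm (f x) c)) (trans (∑-* xs c f) (*-comm c _))

    ∑-- : ∀ xs (f g : A → ℚ) → ∑ xs (λ x → f x - g x) ≡ ∑ xs f - ∑ xs g
    ∑-- [] f g = refl
    ∑-- (x ∷ xs) f g = trans (cong (f x - g x +_) (∑-- xs f g)) (lem (f x) (g x) (∑ xs f) (∑ xs g))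
      where lem : ∀ a b c d → a - b + (c - d) ≡ a + c - (b + d)
            lem = solve 4 (λ a b c d → a :- b :+ (c :- d) := a :+ c :- (b :+ d)) refl

    ∑-++ : ∀ xs ys (f : A → ℚ) → ∑ (xs ++ ys) f ≡ ∑ xs f + ∑ ys f
    ∑-++ [] ys f = sym (+-identityˡ _)
    ∑-++ (x ∷ xs) ys f = trans (cong (f x +_) (∑-++ xs ys f)) (sym (+-assoc (f x) (∑ xs f) (∑ ys f)))

    ∑-∈≤ : ∀ {xs x} {f : A → ℚ} → (∀ y → 0ℚ ≤ f y) → x ∈ xs → f x ≤ ∑ xs f
    ∑-∈≤ {x ∷ xs} {f = f} h (here refl) = lin (∑-≥0 xs h) refl
    ∑-∈≤ {y ∷ xs} {x} {f = f} h (there m) = ≤-trans (∑-∈≤ h m) (lin (h y) (+-comm (f y) (∑ xs f)))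

    -- The tail of the list may carry no weight at all, so the induction needs the weak inequality
    -- beside the strict one.
    ∑-pick⊎ : ∀ xs (p f : A → ℚ) t → (∀ x → 0ℚ ≤ p x) →
              (∃[ x ] (x ∈ xs × 0ℚ < p x × f x ≤ t)) ⊎
              (∑ xs p * t ≤ ∑ xs (λ x → p x * f x) × (0ℚ < ∑ xs p → ∑ xs p * t < ∑ xs (λ x → p x * f x)))
    ∑-pick⊎ [] p f t p≥0 = inj₂ (≤-reflexive (*-zeroˡ t) , λ h → ⊥-elim (<-irrefl refl h))
    ∑-pick⊎ (x ∷ xs) p f t p≥0 with ∑-pick⊎ xs p f t p≥0
    ... | inj₁ (y , m , r) = inj₁ (y , there m , r)
    ... | inj₂ (weak , strict) with p x ≤? 0ℚ | f x ≤? t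
    ...   | no p≰0 | yes f≤t = inj₁ (x , here refl , ≰⇒> p≰0 , f≤t)
    ...   | yes p≤0 | _ rewrite ≤-antisym p≤0 (p≥0 x) | *-zeroˡ (f x) | +-identityˡ (∑ xs p)
                              | +-identityˡ (∑ xs (λ x → p x * f x)) = inj₂ (weak , strict)
    ...   | no p≰0 | no f≰t = inj₂ (<⇒≤ s , λ _ → s)
      where
      s : (p x + ∑ xs p) * t < p x * f x + ∑ xs (λ x → p x * f x)
      s = <-respˡ-≡ (sym (*-distribʳ-+ t (p x) (∑ xs p)))
            (+-mono-<-≤ (*-monoʳ-<-pos (p x) {{positive (≰⇒> p≰0)}} (≰⇒> f≰t)) weak)

    ∑-pick : ∀ xs (p f : A → ℚ) t → (∀ x → 0ℚ ≤ p x) → 0ℚ < ∑ xs p →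
             ∑ xs (λ x → p x * f x) ≤ ∑ xs p * t → ∃[ x ] (x ∈ xs × 0ℚ < p x × f x ≤ t)
    ∑-pick xs p f t p≥0 pos h with ∑-pick⊎ xs p f t p≥0
    ... | inj₁ r = r
    ... | inj₂ (_ , s) = ⊥-elim (<-irrefl refl (<-≤-trans (s pos) h))

  ∑-swap : ∀ {A B : Set} (xs : List A) (ys : List B) (f : A → B → ℚ) →
           ∑ xs (λ x → ∑ ys (f x)) ≡ ∑ ys (λ y → ∑ xs (λ x → f x y))
  ∑-swap [] ys f = sym (∑-0 ys)
  ∑-swap (x ∷ xs) ys f = trans (cong (∑ ys (f x) +_) (∑-swap xs ys f)) (sym (∑-+ ys (f x) _))

  ∑-map : ∀ {A B : Set} (g : A → B) xs (f : B → ℚ) → ∑ (map g xs) f ≡ ∑ xs (λ x → f (g x))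
  ∑-map g [] f = refl
  ∑-map g (x ∷ xs) f = cong (f (g x) +_) (∑-map g xs f)

  _⁺ : ℚ → ℚ
  a ⁺ = 0ℚ ⊔ a

  ⁺≥0 : ∀ a → 0ℚ ≤ a ⁺
  ⁺≥0 a = p≤p⊔q 0ℚ a

  ⁺≥ : ∀ a → a ≤ a ⁺
  ⁺≥ a = p≤q⊔p 0ℚ a

  ⁺-cases : ∀ a → (a ≤ 0ℚ × a ⁺ ≡ 0ℚ) ⊎ (0ℚ ≤ a × a ⁺ ≡ a)
  ⁺-cases a with ≤-total a 0ℚ
  ... | inj₁ p = inj₁ (p , p≥q⇒p⊔q≡p p)
  ... | inj₂ p = inj₂ (p , p≤q⇒p⊔q≡q p)

  -- Derandomisation: a combination of three statistics is averaged, so one outcome does at least as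
  -- well as the bounds on the three means. Positive probability of that outcome is kept, because
  -- the nibble reads off from it that a picked block has positive weight.
  ∑-pick-linear : ∀ {A : Set} (xs : List A) (p f g h : A → ℚ) c b {F G H : ℚ} → (∀ x → 0ℚ ≤ p x) → ∑ xs p ≡ 1ℚ →
    0ℚ ≤ c → 0ℚ ≤ b →
    F ≤ ∑ xs (λ x → p x * f x) → G ≤ ∑ xs (λ x → p x * g x) → ∑ xs (λ x → p x * h x) ≤ H →
    ∃[ x ] (x ∈ xs × 0ℚ < p x × F + c * G - b * H ≤ f x + c * g x - b * h x)
  ∑-pick-linear xs p f g h c b {F} {G} {H} p≥0 Σp 0≤c 0≤b F≤ G≤ H≥
    = finish (∑-pick xs p (λ x → - (f x + c * g x - b * h x)) (- (F + c * G - b * H)) p≥0 (subst (0ℚ <_) (sym Σp) (positive⁻¹ 1ℚ)) mean)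
    where
    sf = ∑ xs (λ x → p x * f x)
    sg = ∑ xs (λ x → p x * g x)
    sh = ∑ xs (λ x → p x * h x)
    e₁ : ∀ p f g h b c → p * (- (f + c * g - b * h)) ≡ (b * (p * h) - c * (p * g)) - p * f
    e₁ = solve 6 (λ p f g h b c → p :* (:- (f :+ c :* g :- b :* h)) := b :* (p :* h) :- c :* (p :* g) :- p :* f) refl
    eq : ∑ xs (λ x → p x * (- (f x + c * g x - b * h x))) ≡ (b * sh - c * sg) - sf
    eq = trans (∑-cong xs (λ x → e₁ (p x) (f x) (g x) (h x) b c))
       (trans (∑-- xs (λ x → b * (p x * h x) - c * (p x * g x)) (λ x → p x * f x))
       (cong (_- sf) (trans (∑-- xs (λ x → b * (p x * h x)) (λ x → c * (p x * g x))) (cong₂ _-_ (∑-* xs b (λ x → p x * h x)) (∑-* xs c (λ x → p x * g x))))))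
    e₂ : ∀ x y z → (x - y) - z ≡ - (z + y - x)
    e₂ = solve 3 (λ x y z → x :- y :- z := :- (z :+ y :- x)) refl
    mean : ∑ xs (λ x → p x * (- (f x + c * g x - b * h x))) ≤ ∑ xs p * (- (F + c * G - b * H))
    mean = trans eq (e₂ (b * sh) (c * sg) sf)
      ≡≤ neg-antimono-≤ (+-mono-≤ (+-mono-≤ F≤ (*-mono-≥0 c 0≤c G≤)) (neg-antimono-≤ (*-mono-≥0 b 0≤b H≥)))
      ≤≡ trans (sym (*-identityˡ _)) (cong (_* (- (F + c * G - b * H))) (sym Σp))
    n₃ : ∀ g f → f ≡ g + (- g - - f)
    n₃ = solve 2 (λ g f → f := g :+ (:- g :- :- f)) refl
    finish : ∃[ x ] (x ∈ xs × 0ℚ < p x × - (f x + c * g x - b * h x) ≤ - (F + c * G - b * H)) →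
             ∃[ x ] (x ∈ xs × 0ℚ < p x × F + c * G - b * H ≤ f x + c * g x - b * h x)
    finish (x , x∈ , pos , le) = x , x∈ , pos , lin (0≤- le) (n₃ (F + c * G - b * H) (f x + c * g x - b * h x))

  opaque

    -- Opaque, so that case distinctions go through `lt-cases` and no comparison of rationals
    -- unfolds inside a type.
    lt : ℚ → ℚ → Bool
    lt a b = does (a <? b)

    lt-cases : ∀ a b → (lt a b ≡ true × a < b) ⊎ (lt a b ≡ false × b ≤ a)
    lt-cases a b = from (a <? b)
      where
      from : (d : Dec (a < b)) → (does d ≡ true × a < b) ⊎ (does d ≡ false × b ≤ a)
      from (yes p) = inj₁ (refl , p)
      from (no p) = inj₂ (refl , ≮⇒≥ p)

  lt-true : ∀ {a b} → lt a b ≡ true → a < b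
  lt-true {a} {b} e with lt-cases a b
  ... | inj₁ (_ , p) = p
  ... | inj₂ (e′ , _) with trans (sym e) e′
  ... | ()

  lt-false : ∀ {a b} → lt a b ≡ false → b ≤ a
  lt-false {a} {b} e with lt-cases a b
  ... | inj₂ (_ , p) = p
  ... | inj₁ (e′ , _) with trans (sym e) e′
  ... | ()

-- Naturals as rationals, powers, and elementary estimates in place of limits.

module Num where

  open Sums

  -- Unlike `ℕ→ℚ`, which goes through a normalised fraction, this computes on `suc` and so admits
  -- induction.
  ι : ℕ → ℚ
  ι zero = 0ℚ
  ι (suc n) = 1ℚ + ι n

  ι≥0 : ∀ n → 0ℚ ≤ ι n
  ι≥0 zero = ≤-refl
  ι≥0 (suc n) = 0≤1 ⊕ ι≥0 n

  ι-mono : ∀ {m n} → m ℕ.≤ n → ι m ≤ ι n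
  ι-mono {n = n} ℕ.z≤n = ι≥0 n
  ι-mono (ℕ.s≤s h) = +-monoʳ-≤ 1ℚ (ι-mono h)

  ι-+ : ∀ m n → ι (m ℕ.+ n) ≡ ι m + ι n
  ι-+ zero n = sym (+-identityˡ (ι n))
  ι-+ (suc m) n = trans (cong (1ℚ +_) (ι-+ m n)) (sym (+-assoc 1ℚ (ι m) (ι n)))

  ι-* : ∀ m n → ι (m ℕ.* n) ≡ ι m * ι n
  ι-* zero n = sym (*-zeroˡ (ι n))
  ι-* (suc m) n = trans (ι-+ n (m ℕ.* n)) (trans (cong (ι n +_) (ι-* m n)) (lem (ι m) (ι n)))
    where lem : ∀ a b → b + a * b ≡ (1ℚ + a) * b
          lem = solve 2 (λ a b → b :+ a :* b := (cst 1ℚ :+ a) :* b) refl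

  toℚᵘ-ℕ : ∀ n → toℚᵘ (ℕ→ℚ n) ℚᵘ.≃ ℚᵘ.mkℚᵘ (int n) 0
  toℚᵘ-ℕ n = toℚᵘ-fromℚᵘ (ℚᵘ.mkℚᵘ (int n) 0)

  ℕ→ℚ≡ι : ∀ n → ℕ→ℚ n ≡ ι n
  ℕ→ℚ≡ι zero = refl
  ℕ→ℚ≡ι (suc n) = trans (toℚᵘ-injective (ℚᵘ.≃-trans (toℚᵘ-ℕ (suc n)) (ℚᵘ.≃-sym
      (ℚᵘ.≃-trans (toℚᵘ-homo-+ 1ℚ (ℕ→ℚ n)) (ℚᵘ.≃-trans (ℚᵘ.+-congʳ ℚᵘ.1ℚᵘ (toℚᵘ-ℕ n)) (ℚᵘ.*≡* (cong (ℤ._* int 1) (cong₂ ℤ._+_ (ℤ.*-identityˡ (int 1)) (ℤ.*-identityʳ (int n))))))))))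
    (cong (1ℚ +_) (ℕ→ℚ≡ι n))

  archimedes : ∀ p → ∃[ n ] p ≤ ι n
  archimedes p = ℤ.∣ ↥ p ∣ , (toℚᵘ-cancel-≤ (ℚᵘ.≤-respʳ-≃ (ℚᵘ.≃-sym (toℚᵘ-ℕ ℤ.∣ ↥ p ∣)) (bound p)) ≤≡ ℕ→ℚ≡ι ℤ.∣ ↥ p ∣)
    where
    bound : ∀ p → toℚᵘ p ℚᵘ.≤ ℚᵘ.mkℚᵘ (int ℤ.∣ ↥ p ∣) 0
    bound (mkℚ (int n) d _) = ℚᵘ.*≤* (subst₂ ℤ._≤_ (sym (ℤ.*-identityʳ (int n))) (ℤ.pos-* n (suc d)) (ℤ.+≤+ (ℕ.m≤m*n n (suc d))))
    bound (mkℚ -[1+ n ] d _) = ℚᵘ.*≤* ℤ.-≤+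

  -- The witness is ε/(1 + X), which also makes sense at X = 0.
  shrink : ∀ ε X → 0ℚ < ε → 0ℚ ≤ X → ∃[ y ] (0ℚ < y × y * X ≤ ε)
  shrink ε X 0<ε 0≤X = from (inv (1ℚ + X) (0<+ (positive⁻¹ 1ℚ) 0≤X))
    where
    lem : ∀ ε d X → ε * ((1ℚ + X) * d) ≡ ε * d * X + ε * d
    lem = solve 3 (λ ε d X → ε :* ((cst 1ℚ :+ X) :* d) := ε :* d :* X :+ ε :* d) refl
    from : ∃[ d ] (0ℚ < d × (1ℚ + X) * d ≡ 1ℚ) → ∃[ y ] (0ℚ < y × y * X ≤ ε)
    from (d , 0<d , e) = ε * d , 0<* 0<ε 0<d ,
      lin (<⇒≤ (0<* 0<ε 0<d)) (trans (sym (*-identityʳ ε)) (trans (cong (ε *_) (sym e)) (lem ε d X)))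

  infixr 8 _^^_

  _^^_ : ℚ → ℕ → ℚ
  x ^^ zero = 1ℚ
  x ^^ suc n = x * x ^^ n

  ^^≥0 : ∀ {x} n → 0ℚ ≤ x → 0ℚ ≤ x ^^ n
  ^^≥0 zero h = 0≤1
  ^^≥0 (suc n) h = h ⊛ ^^≥0 n h

  ^^-mono : ∀ {x y} n → 0ℚ ≤ x → x ≤ y → x ^^ n ≤ y ^^ n
  ^^-mono zero p q = ≤-refl
  ^^-mono {x} {y} (suc n) p q = *-mono² p (^^≥0 n (≤-trans p q)) q (^^-mono n p q)

  1^^ : ∀ n → 1ℚ ^^ n ≡ 1ℚ
  1^^ zero = refl
  1^^ (suc n) = trans (*-identityˡ _) (1^^ n)

  ^^-dist : ∀ x y n → (x * y) ^^ n ≡ x ^^ n * y ^^ n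
  ^^-dist x y zero = refl
  ^^-dist x y (suc n) = trans (cong (x * y *_) (^^-dist x y n)) (lem x y (x ^^ n) (y ^^ n))
    where lem : ∀ a b c d → a * b * (c * d) ≡ a * c * (b * d)
          lem = solve 4 (λ a b c d → a :* b :* (c :* d) := a :* c :* (b :* d)) refl

  ^^-+ : ∀ x m n → x ^^ (m ℕ.+ n) ≡ x ^^ m * x ^^ n
  ^^-+ x zero n = sym (*-identityˡ _)
  ^^-+ x (suc m) n = trans (cong (x *_) (^^-+ x m n)) (sym (*-assoc x (x ^^ m) (x ^^ n)))

  ^^-* : ∀ x m n → x ^^ (n ℕ.* m) ≡ (x ^^ m) ^^ n
  ^^-* x m zero = refl
  ^^-* x m (suc n) = trans (^^-+ x m (n ℕ.* m)) (cong (x ^^ m *_) (^^-* x m n))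

  bernoulli : ∀ x n → 0ℚ ≤ 1ℚ + x → 1ℚ + ι n * x ≤ (1ℚ + x) ^^ n
  bernoulli x zero h = ≤-reflexive (lem x)
    where lem : ∀ x → 1ℚ + 0ℚ * x ≡ 1ℚ
          lem = solve 1 (λ x → cst 1ℚ :+ cst 0ℚ :* x := cst 1ℚ) refl
  bernoulli x (suc n) h = ≤-trans (lin (ι≥0 n ⊛ sq≥0 x) (lem x (ι n))) (*-mono-≥0 (1ℚ + x) h (bernoulli x n h))
    where lem : ∀ x n → (1ℚ + x) * (1ℚ + n * x) ≡ 1ℚ + (1ℚ + n) * x + n * (x * x)
          lem = solve 2 (λ x n → (cst 1ℚ :+ x) :* (cst 1ℚ :+ n :* x) := cst 1ℚ :+ (cst 1ℚ :+ n) :* x :+ n :* (x :* x)) refl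

  ¼ ⅓ ⅙ ⅔ 1½ : ℚ
  ¼ = ½ * ½
  ⅓ = 1/ 3ℚ
  ⅙ = 1/ 6ℚ
  ⅔ = int 2 / 3
  1½ = int 3 / 2

  -- Bernoulli gives (3/2)^L ≥ 1 + L/2, which exceeds 1/ε once L ≥ 2/ε.
  ⅔^-small : ∀ ε → 0ℚ < ε → ∃[ L ] ⅔ ^^ L ≤ ε
  ⅔^-small ε 0<ε = from (inv ε 0<ε)
    where
    l₁ : ∀ n d → 1ℚ + n * ½ ≡ d + (½ * (n - 2ℚ * d) + 1ℚ)
    l₁ = solve 2 (λ n d → cst 1ℚ :+ n :* cst ½ := d :+ (cst ½ :* (n :- cst 2ℚ :* d) :+ cst 1ℚ)) refl
    l₂ : ∀ y ε z → y * (ε * z) ≡ ε * (y * z)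
    l₂ = solve 3 (λ y ε z → y :* (ε :* z) := ε :* (y :* z)) refl
    from : ∃[ d ] (0ℚ < d × ε * d ≡ 1ℚ) → ∃[ L ] ⅔ ^^ L ≤ ε
    from (d , 0<d , e) = L , (begin
        y           ≡⟨ sym (*-identityʳ y) ⟩
        y * 1ℚ      ≡⟨ cong (y *_) (sym e) ⟩
        y * (ε * d) ≤⟨ *-mono-≥0 y y≥0 (*-mono-≥0 ε (<⇒≤ 0<ε) d≤z) ⟩
        y * (ε * z) ≡⟨ l₂ y ε z ⟩
        ε * (y * z) ≡⟨ cong (ε *_) (trans (sym (^^-dist ⅔ 1½ L)) (1^^ L)) ⟩
        ε * 1ℚ      ≡⟨ *-identityʳ ε ⟩
        ε           ∎)
      where
      open ≤-Reasoning
      L = proj₁ (archimedes (2ℚ * d))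
      y = ⅔ ^^ L
      z = 1½ ^^ L
      y≥0 : 0ℚ ≤ y
      y≥0 = ^^≥0 L (nonNegative⁻¹ ⅔)
      d≤z : d ≤ z
      d≤z = ≤-trans (lin (nonNegative⁻¹ ½ ⊛ 0≤- (proj₂ (archimedes (2ℚ * d))) ⊕ 0≤1) (l₁ (ι L) d)) (bernoulli ½ L (nonNegative⁻¹ (1ℚ + ½)))

-- Sums over finite index types and Kronecker deltas.

module Fins where

  open Sums
  open Num

  ∑-δ : ∀ {A : Set} (_≟_ : DecidableEquality A) {xs x} (f : A → ℚ) → Unique xs → x ∈ xs →
        ∑ xs (λ y → 𝟙 (does (x ≟ y)) * f y) ≡ f x
  ∑-δ {A} _≟_ {x₀ ∷ xs} {x} f (x₀∉ ∷ un) (here refl) with x ≟ x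
  ... | no ¬p = ⊥-elim (¬p refl)
  ... | yes _ = trans (cong₂ _+_ (*-identityˡ (f x)) (trans (∑-cong∈ xs off) (∑-0 xs))) (+-identityʳ (f x))
    where
    off : ∀ y → y ∈ xs → 𝟙 (does (x ≟ y)) * f y ≡ 0ℚ
    off y y∈ with x ≟ y
    ... | yes p = ⊥-elim (All.lookup x₀∉ y∈ p)
    ... | no _ = *-zeroˡ (f y)
  ∑-δ {A} _≟_ {x₀ ∷ xs} {x} f (x₀∉ ∷ un) (there x∈) with x ≟ x₀
  ... | yes refl = ⊥-elim (All.lookup x₀∉ x∈ refl)
  ... | no _ = trans (cong₂ _+_ (*-zeroˡ (f x₀)) (∑-δ _≟_ f un x∈)) (+-identityˡ (f x))

  opaque
    ∑ᶠ : ∀ {n} → (Fin n → ℚ) → ℚ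
    ∑ᶠ {n} f = ∑ (allFin n) f

    ∑ᶠ-def : ∀ {n} (f : Fin n → ℚ) → ∑ᶠ f ≡ ∑ (allFin n) f
    ∑ᶠ-def f = refl

  ∑² : ∀ {m n} → (Fin m → Fin n → ℚ) → ℚ
  ∑² f = ∑ᶠ (λ x → ∑ᶠ (f x))

  δ : ∀ {n} → Fin n → Fin n → ℚ
  δ x y = 𝟙 (does (x Fin.≟ y))

  δ≥0 : ∀ {n} (x y : Fin n) → 0ℚ ≤ δ x y
  δ≥0 x y = 𝟙≥0 (does (x Fin.≟ y))

  module _ {n : ℕ} where

    opaque
      unfolding ∑ᶠ

      ∑ᶠ-cong : {f g : Fin n → ℚ} → (∀ x → f x ≡ g x) → ∑ᶠ f ≡ ∑ᶠ g
      ∑ᶠ-cong = ∑-cong (allFin n)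

      ∑ᶠ-mono : {f g : Fin n → ℚ} → (∀ x → f x ≤ g x) → ∑ᶠ f ≤ ∑ᶠ g
      ∑ᶠ-mono = ∑-mono (allFin n)

      ∑ᶠ-≥0 : {f : Fin n → ℚ} → (∀ x → 0ℚ ≤ f x) → 0ℚ ≤ ∑ᶠ f
      ∑ᶠ-≥0 = ∑-≥0 (allFin n)

      ∑ᶠ-+ : (f g : Fin n → ℚ) → ∑ᶠ (λ x → f x + g x) ≡ ∑ᶠ f + ∑ᶠ g
      ∑ᶠ-+ = ∑-+ (allFin n)

      ∑ᶠ-- : (f g : Fin n → ℚ) → ∑ᶠ (λ x → f x - g x) ≡ ∑ᶠ f - ∑ᶠ g
      ∑ᶠ-- = ∑-- (allFin n)

      ∑ᶠ-* : ∀ c (f : Fin n → ℚ) → ∑ᶠ (λ x → c * f x) ≡ c * ∑ᶠ f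
      ∑ᶠ-* = ∑-* (allFin n)

      ∑ᶠ-*ʳ : ∀ c (f : Fin n → ℚ) → ∑ᶠ (λ x → f x * c) ≡ ∑ᶠ f * c
      ∑ᶠ-*ʳ = ∑-*ʳ (allFin n)

      ∑ᶠ-∈≤ : ∀ {f : Fin n → ℚ} x → (∀ y → 0ℚ ≤ f y) → f x ≤ ∑ᶠ f
      ∑ᶠ-∈≤ x h = ∑-∈≤ h (∈-allFin x)

  opaque
    unfolding ∑ᶠ

    ∑ᶠ-swap : ∀ {m n} (f : Fin m → Fin n → ℚ) → ∑² f ≡ ∑² (λ y x → f x y)
    ∑ᶠ-swap {m} {n} = ∑-swap (allFin m) (allFin n)

    ∑ᶠ-δ : ∀ {n} (x : Fin n) (f : Fin n → ℚ) → ∑ᶠ (λ y → δ x y * f y) ≡ f x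
    ∑ᶠ-δ {n} x f = ∑-δ Fin._≟_ f (allFin⁺ n) (∈-allFin x)

  module _ {m n : ℕ} where

    ∑²-cong : {f g : Fin m → Fin n → ℚ} → (∀ x y → f x y ≡ g x y) → ∑² f ≡ ∑² g
    ∑²-cong h = ∑ᶠ-cong (λ x → ∑ᶠ-cong (h x))

    ∑²-mono : {f g : Fin m → Fin n → ℚ} → (∀ x y → f x y ≤ g x y) → ∑² f ≤ ∑² g
    ∑²-mono h = ∑ᶠ-mono (λ x → ∑ᶠ-mono (h x))

    ∑²-≥0 : {f : Fin m → Fin n → ℚ} → (∀ x y → 0ℚ ≤ f x y) → 0ℚ ≤ ∑² f
    ∑²-≥0 h = ∑ᶠ-≥0 (λ x → ∑ᶠ-≥0 (h x))

    ∑²-+ : (f g : Fin m → Fin n → ℚ) → ∑² (λ x y → f x y + g x y) ≡ ∑² f + ∑² g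
    ∑²-+ f g = trans (∑ᶠ-cong (λ x → ∑ᶠ-+ (f x) (g x))) (∑ᶠ-+ (λ x → ∑ᶠ (f x)) (λ x → ∑ᶠ (g x)))

    ∑²-- : (f g : Fin m → Fin n → ℚ) → ∑² (λ x y → f x y - g x y) ≡ ∑² f - ∑² g
    ∑²-- f g = trans (∑ᶠ-cong (λ x → ∑ᶠ-- (f x) (g x))) (∑ᶠ-- (λ x → ∑ᶠ (f x)) (λ x → ∑ᶠ (g x)))

    ∑²-* : ∀ c (f : Fin m → Fin n → ℚ) → ∑² (λ x y → c * f x y) ≡ c * ∑² f
    ∑²-* c f = trans (∑ᶠ-cong (λ x → ∑ᶠ-* c (f x))) (∑ᶠ-* c (λ x → ∑ᶠ (f x)))

    ∑²-× : (f : Fin m → ℚ) (g : Fin n → ℚ) → ∑² (λ x y → f x * g y) ≡ ∑ᶠ f * ∑ᶠ g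
    ∑²-× f g = trans (∑ᶠ-cong (λ x → ∑ᶠ-* (f x) g)) (∑ᶠ-*ʳ (∑ᶠ g) f)

  ∑ᶠ-class : ∀ {n k} (c : Fin n → Fin k) (f : Fin k → Fin n → ℚ) →
             ∑ᶠ (λ x → f (c x) x) ≡ ∑² (λ a x → δ (c x) a * f a x)
  ∑ᶠ-class c f = trans (∑ᶠ-cong (λ x → sym (∑ᶠ-δ (c x) (λ a → f a x)))) (∑ᶠ-swap _)

  ∑-swap₄ : ∀ {k l m n} (f : Fin k → Fin l → Fin m → Fin n → ℚ) →
    ∑² (λ x y → ∑² (f x y)) ≡ ∑² (λ a b → ∑² (λ x y → f x y a b))
  ∑-swap₄ f = trans (∑ᶠ-cong (λ x → trans (∑ᶠ-swap (λ y a → ∑ᶠ (f x y a))) (∑ᶠ-cong (λ a → ∑ᶠ-swap (λ y b → f x y a b)))))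
             (trans (∑ᶠ-swap (λ x a → ∑² (λ b y → f x y a b))) (∑ᶠ-cong (λ a → ∑ᶠ-swap (λ x b → ∑ᶠ (λ y → f x y a b)))))

  -- Makes the classes of the two vertices free indices, so that estimates valid for a fixed class
  -- pair can be summed.
  ∑²-class : ∀ {n k} (c : Fin n → Fin k) (f : Fin k → Fin k → Fin n → Fin n → ℚ) →
    ∑² (λ x y → f (c x) (c y) x y) ≡ ∑² (λ a b → ∑² (λ x y → δ (c x) a * δ (c y) b * f a b x y))
  ∑²-class c f = trans (∑²-cong (λ x y → sym (eq x y))) (∑-swap₄ (λ x y a b → δ (c x) a * δ (c y) b * f a b x y))
    where
    eq : ∀ x y → ∑² (λ a b → δ (c x) a * δ (c y) b * f a b x y) ≡ f (c x) (c y) x y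
    eq x y = trans (∑ᶠ-cong (λ a → trans (∑ᶠ-cong (λ b → *-assoc (δ (c x) a) (δ (c y) b) (f a b x y)))
               (trans (∑ᶠ-* (δ (c x) a) (λ b → δ (c y) b * f a b x y)) (cong (δ (c x) a *_) (∑ᶠ-δ (c y) (λ b → f a b x y))))))
             (∑ᶠ-δ (c x) (λ a → f a (c y) x y))

  ∑1≡ι : ∀ {A : Set} (xs : List A) → ∑ xs (λ _ → 1ℚ) ≡ ι (length xs)
  ∑1≡ι [] = refl
  ∑1≡ι (x ∷ xs) = cong (1ℚ +_) (∑1≡ι xs)

  δ-sym : ∀ {n} (x y : Fin n) → δ x y ≡ δ y x
  δ-sym x y with x Fin.≟ y | y Fin.≟ x
  ... | yes _ | yes _ = refl
  ... | no _ | no _ = refl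
  ... | yes p | no q = ⊥-elim (q (sym p))
  ... | no p | yes q = ⊥-elim (p (sym q))

  ∑²-δ : ∀ {m n} (x : Fin m) (y : Fin n) (f : Fin m → Fin n → ℚ) → ∑² (λ a b → δ x a * δ y b * f a b) ≡ f x y
  ∑²-δ x y f = trans (∑ᶠ-cong (λ a → trans (∑ᶠ-cong (λ b → *-assoc (δ x a) (δ y b) (f a b))) (trans (∑ᶠ-* (δ x a) _) (cong (δ x a *_) (∑ᶠ-δ y (f a)))))) (∑ᶠ-δ x (λ a → f a y))

-- A derandomised nibble for weighted systems of blocks with three points.

module Nibble where

  open Sums
  open Num

  bool-cases : ∀ b → b ≡ false ⊎ b ≡ true
  bool-cases false = inj₁ refl
  bool-cases true = inj₂ refl

  -- Taylor expansion of the squared positive part at a. It is a global upper bound because the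
  -- second derivative never exceeds 2.
  ⁺²-bound : ∀ a b → ((a - b) ⁺) * ((a - b) ⁺) ≤ (a ⁺) * (a ⁺) - 2ℚ * (a ⁺) * b + b * b
  ⁺²-bound a b with ⁺-cases (a - b) | ⁺-cases a
  ... | inj₁ (_ , e) | _ rewrite e = lin (sq≥0 (a ⁺ - b)) (lem (a ⁺) b)
    where lem : ∀ x b → x * x - 2ℚ * x * b + b * b ≡ 0ℚ * 0ℚ + (x - b) * (x - b)
          lem = solve 2 (λ x b → x :* x :- cst 2ℚ :* x :* b :+ b :* b := cst 0ℚ :* cst 0ℚ :+ (x :- b) :* (x :- b)) refl
  ... | inj₂ (_ , e) | inj₂ (_ , e′) rewrite e | e′ = ≤-reflexive (lem a b)
    where lem : ∀ a b → (a - b) * (a - b) ≡ a * a - 2ℚ * a * b + b * b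
          lem = solve 2 (λ a b → (a :- b) :* (a :- b) := a :* a :- cst 2ℚ :* a :* b :+ b :* b) refl
  ... | inj₂ (p , e) | inj₁ (q , e′) rewrite e | e′ = lin (0≤- q ⊛ (p ⊕ (p ⊕ 0≤- q))) (lem a b)
    where lem : ∀ a b → 0ℚ * 0ℚ - 2ℚ * 0ℚ * b + b * b ≡ (a - b) * (a - b) + (0ℚ - a) * ((a - b) + ((a - b) + (0ℚ - a)))
          lem = solve 2 (λ a b → cst 0ℚ :* cst 0ℚ :- cst 2ℚ :* cst 0ℚ :* b :+ b :* b := (a :- b) :* (a :- b) :+ (cst 0ℚ :- a) :* (a :- b :+ (a :- b :+ (cst 0ℚ :- a)))) refl

  ∑w∑-identity : ∀ a b c → a * (b * c) ≡ b * a * c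
  ∑w∑-identity = solve 3 (λ a b c → a :* (b :* c) := b :* a :* c) refl

  Σp-identity : ∀ a b → 1ℚ - (a + b) + (a + b) ≡ 1ℚ
  Σp-identity = solve 2 (λ a b → cst 1ℚ :- (a :+ b) :+ (a :+ b) := cst 1ℚ) refl

  q≤mx-identity : ∀ q ρ O → ρ + O ≡ q + (O - (q - ρ))
  q≤mx-identity = solve 3 (λ q ρ O → ρ :+ O := q :+ (O :- (q :- ρ))) refl

  mx≤1-identity : ∀ q ρ → ρ + (q - ρ) ≡ q
  mx≤1-identity = solve 2 (λ q ρ → ρ :+ (q :- ρ) := q) refl

  D≤-identity : ∀ a b c → a * (b * c) ≡ b * (c * a)
  D≤-identity = solve 3 (λ a b c → a :* (b :* c) := b :* (c :* a)) refl

  θ≤3-identity : ∀ a b → a ≡ a - b + b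
  θ≤3-identity = solve 2 (λ a b → a := a :- b :+ b) refl

  Ex-w-identity : ∀ κ wt wj I → κ * wt * (wj * (1ℚ - I)) ≡ wj * (κ * wt) - κ * wj * (wt * I)
  Ex-w-identity = solve 4 (λ κ wt wj I → κ :* wt :* (wj :* (cst 1ℚ :- I)) := wj :* (κ :* wt) :- κ :* wj :* (wt :* I)) refl

  Ex-w-identity₂ : ∀ κ wt wj I → κ * wt * (wj * (1ℚ - I)) ≡ wj * (κ * wt) - κ * wj * (I * wt)
  Ex-w-identity₂ = solve 4 (λ κ wt wj I → κ :* wt :* (wj :* (cst 1ℚ :- I)) := wj :* (κ :* wt) :- κ :* wj :* (I :* wt)) refl

  Ex-w-identity₃ : ∀ w a b κ D m → (1ℚ - (a + b)) * w + ((w * a - κ * w * D) + (w * b - κ * w * (m - D))) ≡ w - κ * (w * m)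
  Ex-w-identity₃ = solve 6 (λ w a b κ D m → (cst 1ℚ :- (a :+ b)) :* w :+ (w :* a :- κ :* w :* D :+ (w :* b :- κ :* w :* (m :- D))) := w :- κ :* (w :* m)) refl

  Ex-total≥-identity : ∀ t κ ρ o x → t - κ * x ≡ t - 3ℚ * (κ * ρ) * t - κ * o + κ * (3ℚ * ρ * t + o - x)
  Ex-total≥-identity = solve 5 (λ t κ ρ o x → t :- κ :* x := t :- cst 3ℚ :* (κ :* ρ) :* t :- κ :* o :+ κ :* (cst 3ℚ :* ρ :* t :+ o :- x)) refl

  Ex-picked-identity : ∀ a → 0ℚ + (a + 0ℚ) ≡ a
  Ex-picked-identity = solve 1 (λ a → cst 0ℚ :+ (a :+ cst 0ℚ) := a) refl

  excess-U-identity : ∀ q ρ d r → q - ρ - (d - r) ≡ q - d - (ρ - r)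
  excess-U-identity = solve 4 (λ q ρ d r → q :- ρ :- (d :- r) := q :- d :- (ρ :- r)) refl

  excess-U-identity₂ : ∀ O d r → O * O + 2ℚ * O * r + r * r - 2ℚ * O * d + d * d ≡ O * O - 2ℚ * O * (d - r) + (d - r) * (d - r) + 2ℚ * d * r
  excess-U-identity₂ = solve 3 (λ O d r → O :* O :+ cst 2ℚ :* O :* r :+ r :* r :- cst 2ℚ :* O :* d :+ d :* d := O :* O :- cst 2ℚ :* O :* (d :- r) :+ (d :- r) :* (d :- r) :+ cst 2ℚ :* d :* r) refl

  Φ-event-identity : ∀ q → q ≡ q - 0ℚ
  Φ-event-identity = solve 1 (λ q → q := q :- cst 0ℚ) refl

  Φ-event-identity₂ : ∀ i w x → i * (w * (1ℚ - x)) ≡ i * w - x * (i * w)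
  Φ-event-identity₂ = solve 3 (λ i w x → i :* (w :* (cst 1ℚ :- x)) := i :* w :- x :* (i :* w)) refl

  Φ-event-identity₃ : ∀ i w x → i * (w * (1ℚ - x)) ≡ i * w - i * w * x
  Φ-event-identity₃ = solve 3 (λ i w x → i :* (w :* (cst 1ℚ :- x)) := i :* w :- i :* w :* x) refl

  eq₁-identity : ∀ a → 0ℚ ≡ 0ℚ - a + a
  eq₁-identity = solve 1 (λ a → cst 0ℚ := cst 0ℚ :- a :+ a) refl

  Φ-event-identity₄ : ∀ O r → O * O + 2ℚ * O * r + r * r - 2ℚ * O * 0ℚ + 0ℚ * 0ℚ ≡ 0ℚ + (O + r) * (O + r)
  Φ-event-identity₄ = solve 2 (λ O r → O :* O :+ cst 2ℚ :* O :* r :+ r :* r :- cst 2ℚ :* O :* cst 0ℚ :+ cst 0ℚ :* cst 0ℚ := cst 0ℚ :+ (O :+ r) :* (O :+ r)) refl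

  Ex-Δ-identity : ∀ κ x D q m → κ * x * (D - q) + κ * (m - D) * x ≡ κ * (x * (m - q))
  Ex-Δ-identity = solve 5 (λ κ x D q m → κ :* x :* (D :- q) :+ κ :* (m :- D) :* x := κ :* (x :* (m :- q))) refl

  Ex-Δ-identity₂ : ∀ w x → w * (1ℚ - 0ℚ) * x ≡ w * x - 0ℚ * w
  Ex-Δ-identity₂ = solve 2 (λ w x → w :* (cst 1ℚ :- cst 0ℚ) :* x := w :* x :- cst 0ℚ :* w) refl

  Ex-Δ-identity₃ : ∀ w → w * (1ℚ - 1ℚ) * 1ℚ ≡ w * 1ℚ - 1ℚ * w
  Ex-Δ-identity₃ = solve 1 (λ w → w :* (cst 1ℚ :- cst 1ℚ) :* cst 1ℚ := w :* cst 1ℚ :- cst 1ℚ :* w) refl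

  Ex-Δ-identity₄ : ∀ κ w x y z → κ * w * x * (y * z) ≡ κ * y * (w * x * z)
  Ex-Δ-identity₄ = solve 5 (λ κ w x y z → κ :* w :* x :* (y :* z) := κ :* y :* (w :* x :* z)) refl

  Ex-Δ≥-identity : ∀ κ ρ q → 2ℚ * (κ * ρ) * q ≡ κ * (q * (2ℚ * ρ))
  Ex-Δ≥-identity = solve 3 (λ κ ρ q → cst 2ℚ :* (κ :* ρ) :* q := κ :* (q :* (cst 2ℚ :* ρ))) refl

  Ex-Δ≥-identity₂ : ∀ x y → 0ℚ * x * y ≡ 0ℚ
  Ex-Δ≥-identity₂ = solve 2 (λ x y → cst 0ℚ :* x :* y := cst 0ℚ) refl

  Ex-Δ≥-identity₃ : ∀ m q O ρ s → m - q ≡ 2ℚ * ρ + ((m - (3ℚ * ρ + s)) + (s - 1ℚ * O) + (ρ + O - q))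
  Ex-Δ≥-identity₃ = solve 5 (λ m q O ρ s → m :- q := cst 2ℚ :* ρ :+ (m :- (cst 3ℚ :* ρ :+ s) :+ (s :- cst 1ℚ :* O) :+ (ρ :+ O :- q))) refl

  Ex-U-identity : ∀ p O r d → p * (O * O + 2ℚ * O * r + r * r - 2ℚ * O * d + d * d) ≡ p * (O * O + 2ℚ * O * r + r * r) - 2ℚ * O * (p * d) + p * (d * d)
  Ex-U-identity = solve 4 (λ p O r d → p :* (O :* O :+ cst 2ℚ :* O :* r :+ r :* r :- cst 2ℚ :* O :* d :+ d :* d) := p :* (O :* O :+ cst 2ℚ :* O :* r :+ r :* r) :- cst 2ℚ :* O :* (p :* d) :+ p :* (d :* d)) refl

  Ex-U-identity₂ : ∀ v O x → O * (2ℚ * v * x) ≡ 2ℚ * v * (O * x)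
  Ex-U-identity₂ = solve 3 (λ v O x → O :* (cst 2ℚ :* v :* x) := cst 2ℚ :* v :* (O :* x)) refl

  Ex-U-identity₃ : ∀ O r x s → O * O + r * r + s ≡ O * O + 2ℚ * O * r + r * r - 2ℚ * O * x + s + 2ℚ * (O * x - O * r)
  Ex-U-identity₃ = solve 4 (λ O r x s → O :* O :+ r :* r :+ s := O :* O :+ cst 2ℚ :* O :* r :+ r :* r :- cst 2ℚ :* O :* x :+ s :+ cst 2ℚ :* (O :* x :- O :* r)) refl

  ∑iw≤3-identity : ∀ a b c → a * (b * c) ≡ c * (b * a)
  ∑iw≤3-identity = solve 3 (λ a b c → a :* (b :* c) := c :* (b :* a)) refl

  pick-Δ≤-identity : ∀ x b c → x * (b * c) ≡ c * (x * b)
  pick-Δ≤-identity = solve 3 (λ x b c → x :* (b :* c) := c :* (x :* b)) refl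

  ∑pickΔ²-identity : ∀ η → 3ℚ * η * (3ℚ * 3ℚ) ≡ 27ℚ * η
  ∑pickΔ²-identity = solve 1 (λ η → cst 3ℚ :* η :* (cst 3ℚ :* cst 3ℚ) := cst 27ℚ :* η) refl

  ∑thinΔ²-identity : ∀ i w → i * w * (i * w) ≡ i * i * (w * w)
  ∑thinΔ²-identity = solve 2 (λ i w → i :* w :* (i :* w) := i :* i :* (w :* w)) refl

  ∑Δ²-identity : ∀ κ w η → κ * w * (27ℚ * η) + κ * 3ℚ * (3ℚ * (η * w)) ≡ 12ℚ * κ * η * 3ℚ * w
  ∑Δ²-identity = solve 3 (λ κ w η → κ :* w :* (cst 27ℚ :* η) :+ κ :* cst 3ℚ :* (cst 3ℚ :* (η :* w)) := cst 12ℚ :* κ :* η :* cst 3ℚ :* w) refl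

  Ex-Φ-identity : ∀ a b c d → a + (d + b) ≡ a + b + c + (d - c)
  Ex-Φ-identity = solve 4 (λ a b c d → a :+ (d :+ b) := a :+ b :+ c :+ (d :- c)) refl

  v≤1-identity : ∀ v → 3ℚ * v ≡ v + 2ℚ * v
  v≤1-identity = solve 1 (λ v → cst 3ℚ :* v := v :+ cst 2ℚ :* v) refl

  u≤1-identity : ∀ v → 1ℚ ≡ 1ℚ - v + v
  u≤1-identity = solve 1 (λ v → cst 1ℚ := cst 1ℚ :- v :+ v) refl

  r̃≤u-identity : ∀ v → (1ℚ - v) * (1ℚ - v) * (1ℚ - v) ≡ 1ℚ - 3ℚ * v + v * v * (2ℚ + (1ℚ - v))
  r̃≤u-identity = solve 1 (λ v → (cst 1ℚ :- v) :* (cst 1ℚ :- v) :* (cst 1ℚ :- v) := cst 1ℚ :- cst 3ℚ :* v :+ v :* v :* (cst 2ℚ :+ (cst 1ℚ :- v))) refl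

  r̃≤u-identity₂ : ∀ a u → a * (u * u * u) ≡ a * (u * u) * u
  r̃≤u-identity₂ = solve 2 (λ a u → a :* (u :* u :* u) := a :* (u :* u) :* u) refl

  C≤1-identity : ∀ v → v + (1ℚ - v) * 1ℚ ≡ 1ℚ
  C≤1-identity = solve 1 (λ v → v :+ (cst 1ℚ :- v) :* cst 1ℚ := cst 1ℚ) refl

  ∑excess≤-identity : ∀ τ τ′ O → τ * 1ℚ + τ′ * (O * O) ≡ 4ℚ * (τ * τ′) * O + τ * ((1ℚ - 2ℚ * τ′ * O) * (1ℚ - 2ℚ * τ′ * O)) + τ′ * (O * O) * (1ℚ - 4ℚ * (τ * τ′))
  ∑excess≤-identity = solve 3 (λ τ τ′ O → τ :* cst 1ℚ :+ τ′ :* (O :* O) := cst 4ℚ :* (τ :* τ′) :* O :+ τ :* ((cst 1ℚ :- cst 2ℚ :* τ′ :* O) :* (cst 1ℚ :- cst 2ℚ :* τ′ :* O)) :+ τ′ :* (O :* O) :* (cst 1ℚ :- cst 4ℚ :* (τ :* τ′))) refl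

  l₂-identity : ∀ O x y → 1ℚ * O + x + y * (1ℚ - 1ℚ) ≡ O + x
  l₂-identity = solve 3 (λ O x y → cst 1ℚ :* O :+ x :+ y :* (cst 1ℚ :- cst 1ℚ) := O :+ x) refl

  iterate-identity : ∀ i t x → i * 0ℚ * t - 0ℚ * x ≡ 0ℚ
  iterate-identity = solve 3 (λ i t x → i :* cst 0ℚ :* t :- cst 0ℚ :* x := cst 0ℚ) refl

  1-u²-identity : ∀ v → 1ℚ - (1ℚ - v) * (1ℚ - v) ≡ 2ℚ * v - v * v
  1-u²-identity = solve 1 (λ v → cst 1ℚ :- (cst 1ℚ :- v) :* (cst 1ℚ :- v) := cst 2ℚ :* v :- v :* v) refl

  1-u²≤2v-identity : ∀ v → 2ℚ * v ≡ 2ℚ * v - v * v + v * v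
  1-u²≤2v-identity = solve 1 (λ v → cst 2ℚ :* v := cst 2ℚ :* v :- v :* v :+ v :* v) refl

  ρ-r-identity : ∀ ρ u → ρ - ρ * (1ℚ - u * u) ≡ ρ * (u * u)
  ρ-r-identity = solve 2 (λ ρ u → ρ :- ρ :* (cst 1ℚ :- u :* u) := ρ :* (u :* u)) refl

  ρ″iρ″-identity : ∀ ρ u i a → ρ * (u * u) * (i * a) ≡ (ρ * i) * (a * (u * u))
  ρ″iρ″-identity = solve 4 (λ ρ u i a → ρ :* (u :* u) :* (i :* a) := ρ :* i :* (a :* (u :* u))) refl

  cκ≤-identity : ∀ c v i → c * (v * i) ≡ v * (c * i)
  cκ≤-identity = solve 3 (λ c v i → c :* (v :* i) := v :* (c :* i)) refl

  cκO≤-identity : ∀ x y t z → x * (y + t * z) ≡ x * y + x * t * z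
  cκO≤-identity = solve 4 (λ x y t z → x :* (y :+ t :* z) := x :* y :+ x :* t :* z) refl

  ξ₀≤ξ-identity : ∀ v → 2ℚ * v * (2ℚ * v) ≡ 4ℚ * (v * v)
  ξ₀≤ξ-identity = solve 1 (λ v → cst 2ℚ :* v :* (cst 2ℚ :* v) := cst 4ℚ :* (v :* v)) refl

  R≡-identity : ∀ i v a C t O → v * i * t + i * a * C * (t - 3ℚ * v * t - v * i * O) ≡ i * (v + a * (1ℚ - 3ℚ * v) * C) * t - i * a * C * (v * i) * O
  R≡-identity = solve 6 (λ i v a C t O → v :* i :* t :+ i :* a :* C :* (t :- cst 3ℚ :* v :* t :- v :* i :* O) := i :* (v :+ a :* (cst 1ℚ :- cst 3ℚ :* v) :* C) :* t :- i :* a :* C :* (v :* i) :* O) refl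

  R≡-identity₂ : ∀ s β φ x → s * β * (φ + x) ≡ s * (β * φ + β * x)
  R≡-identity₂ = solve 4 (λ s β φ x → s :* β :* (φ :+ x) := s :* (β :* φ :+ β :* x)) refl

  gain-identity : ∀ Q α X Y Y₀ K s → Q - K - s * (X + Y₀) - s * (α + s * Y) ≡
    Q - (1ℚ + s) * (α + X + (1ℚ + s) * Y) + ((α + X - K) + s * (Y - Y₀) + (1ℚ + s) * Y)
  gain-identity = solve 7 (λ Q α X Y Y₀ K s → Q :- K :- s :* (X :+ Y₀) :- s :* (α :+ s :* Y) := Q :- (cst 1ℚ :+ s) :* (α :+ X :+ (cst 1ℚ :+ s) :* Y) :+ (α :+ X :- K :+ s :* (Y :- Y₀) :+ (cst 1ℚ :+ s) :* Y)) refl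

  count-identity : ∀ n l R T F′ e → n + l ≡ R - e + ((n + T - F′ - R) + (l - (T - (F′ + e))))
  count-identity = solve 6 (λ n l R T F′ e → n :+ l := R :- e :+ (n :+ T :- F′ :- R :+ (l :- (T :- (F′ :+ e))))) refl

  count-identity₂ : ∀ α s β F Y → s * (α + β * F + s * Y) ≡ s * β * F + s * (α + s * Y)
  count-identity₂ = solve 5 (λ α s β F Y → s :* (α :+ β :* F :+ s :* Y) := s :* β :* F :+ s :* (α :+ s :* Y)) refl

  -- The nibble only sees an incidence structure; points will be edges and blocks will be triangles.
  module Packing
    {E B : Set} (ps : List E) (bs : List B) (inc : B → E → Bool) (meets eqB : B → B → Bool)
    (inc-3 : ∀ {j} → j ∈ bs → ∑ ps (λ e → 𝟙 (inc j e)) ≡ 3ℚ)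
    (meets-≤ : ∀ j t → 𝟙 (meets j t) ≤ ∑ ps (λ e → 𝟙 (inc j e) * 𝟙 (inc t e)))
    (meets-∋ : ∀ j t {e} → e ∈ ps → inc j e ≡ true → inc t e ≡ true → meets j t ≡ true)
    (eqB-sym : ∀ j l → 𝟙 (eqB j l) ≡ 𝟙 (eqB l j))
    (eqB-∑ : ∀ {j} (f : B → ℚ) → j ∈ bs → ∑ bs (λ l → 𝟙 (eqB j l) * f l) ≡ f j)
    where

    i : B → E → ℚ
    i j e = 𝟙 (inc j e)

    I : B → B → ℚ
    I j t = 𝟙 (meets j t)

    i≥0 : ∀ j e → 0ℚ ≤ i j e
    i≥0 j e = 𝟙≥0 (inc j e)

    load : (B → ℚ) → E → ℚ
    load w e = ∑ bs (λ j → i j e * w j)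

    excess : ℚ → (B → ℚ) → E → ℚ
    excess ρ w e = (load w e - ρ) ⁺

    -- The potential of the process. A load below the current level ρ does no harm, hence the
    -- positive part.
    Φ : ℚ → (B → ℚ) → ℚ
    Φ ρ w = ∑ ps (λ e → excess ρ w e * excess ρ w e)

    total : (B → ℚ) → ℚ
    total w = ∑ bs w

    ∣P∣ ∣B∣ : ℚ
    ∣P∣ = ∑ ps (λ _ → 1ℚ)
    ∣B∣ = ∑ bs (λ _ → 1ℚ)

    -- One step does at most one thing: it picks a block and deletes all blocks meeting it, or it
    -- deletes a single block. With single picks of tiny probability no conflicts arise within a
    -- step.
    data Event : Set where
      pick thin : B → Event
      none : Event

    kill : Event → (B → ℚ) → B → ℚ
    kill (pick t) w j = w j * (1ℚ - I j t)
    kill (thin l) w j = w j * (1ℚ - 𝟙 (eqB j l))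
    kill none w j = w j

    picked : Event → ℚ
    picked (pick t) = 1ℚ
    picked (thin l) = 0ℚ
    picked none = 0ℚ

    events : List Event
    events = none ∷ map pick bs ++ map thin bs

    -- In `codeg` the block t certifies that the points e and f differ; the bound is the usual small
    -- codegree hypothesis.
    record Small (η : ℚ) (w : B → ℚ) : Set where
      field
        w≥0 : ∀ j → 0ℚ ≤ w j
        load≤1 : ∀ {e} → e ∈ ps → load w e ≤ 1ℚ
        w≤η : ∀ {j} → j ∈ bs → w j ≤ η
        w≤1 : ∀ {j} → j ∈ bs → w j ≤ 1ℚ
        codeg : ∀ t {e f} → e ∈ ps → f ∈ ps → inc t e ≡ false → inc t f ≡ true →
                ∑ bs (λ j → i j e * w j * i j f) ≤ η

    1-𝟙≥0 : ∀ b → 0ℚ ≤ 1ℚ - 𝟙 b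
    1-𝟙≥0 b = 0≤- (𝟙≤1 b)

    1-𝟙≤1 : ∀ b → 1ℚ - 𝟙 b ≤ 1ℚ
    1-𝟙≤1 true = 0≤1
    1-𝟙≤1 false = ≤-refl

    *-≤1 : ∀ {a b} → 0ℚ ≤ a → b ≤ 1ℚ → a * b ≤ a
    *-≤1 {a} p q = *-mono-≥0 a p q ≤≡ *-identityʳ a

    kill-≤ : ∀ ev {w} → (∀ j → 0ℚ ≤ w j) → ∀ j → kill ev w j ≤ w j
    kill-≤ (pick t) p j = *-≤1 (p j) (1-𝟙≤1 (meets j t))
    kill-≤ (thin l) p j = *-≤1 (p j) (1-𝟙≤1 (eqB j l))
    kill-≤ none p j = ≤-refl

    kill-≥0 : ∀ ev {w} → (∀ j → 0ℚ ≤ w j) → ∀ j → 0ℚ ≤ kill ev w j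
    kill-≥0 (pick t) p j = p j ⊛ 1-𝟙≥0 (meets j t)
    kill-≥0 (thin l) p j = p j ⊛ 1-𝟙≥0 (eqB j l)
    kill-≥0 none p j = p j

    Small-kill : ∀ {η w} ev → Small η w → Small η (kill ev w)
    Small-kill {η} {w} ev sm = record
      { w≥0 = kill-≥0 ev w≥0
      ; load≤1 = λ m → ≤-trans (∑-mono bs (λ j → *-mono-≥0 _ (i≥0 j _) (kill-≤ ev w≥0 j))) (load≤1 m)
      ; w≤η = λ m → ≤-trans (kill-≤ ev w≥0 _) (w≤η m)
      ; w≤1 = λ m → ≤-trans (kill-≤ ev w≥0 _) (w≤1 m)
      ; codeg = λ t m m′ p q → ≤-trans (∑-mono bs (λ j → *-mono-≥0ʳ _ (i≥0 j _) (*-mono-≥0 _ (i≥0 j _) (kill-≤ ev w≥0 j)))) (codeg t m m′ p q)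
      }
      where open Small sm

    module _ {η : ℚ} {w : B → ℚ} (sm : Small η w) where
      open Small sm
      ∑w∑ : ∀ (f : E → ℚ) → ∑ bs (λ j → w j * ∑ ps (λ e → i j e * f e)) ≡ ∑ ps (λ e → load w e * f e)
      ∑w∑ f = begin
        ∑ bs (λ j → w j * ∑ ps (λ e → i j e * f e)) ≡⟨ ∑-cong bs (λ j → sym (∑-* ps (w j) _)) ⟩
        ∑ bs (λ j → ∑ ps (λ e → w j * (i j e * f e))) ≡⟨ ∑-swap bs ps _ ⟩
        ∑ ps (λ e → ∑ bs (λ j → w j * (i j e * f e))) ≡⟨ ∑-cong ps (λ e → trans (∑-cong bs (λ j → ∑w∑-identity (w j) (i j e) (f e))) (∑-*ʳ bs (f e) _)) ⟩
        ∑ ps (λ e → load w e * f e) ∎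
        where
        open ≡-Reasoning

      3total : 3ℚ * total w ≡ ∑ ps (load w)
      3total = begin
        3ℚ * total w ≡⟨ sym (∑-* bs 3ℚ w) ⟩
        ∑ bs (λ j → 3ℚ * w j) ≡⟨ ∑-cong∈ bs (λ j j∈ → trans (*-comm 3ℚ (w j)) (cong (w j *_) (sym (trans (∑-cong ps (λ e → *-identityʳ _)) (inc-3 j∈))))) ⟩
        ∑ bs (λ j → w j * ∑ ps (λ e → i j e * 1ℚ)) ≡⟨ ∑w∑ (λ _ → 1ℚ) ⟩
        ∑ ps (λ e → load w e * 1ℚ) ≡⟨ ∑-cong ps (λ e → *-identityʳ _) ⟩
        ∑ ps (load w) ∎
        where open ≡-Reasoning

      3total≤P : 3ℚ * total w ≤ ∣P∣
      3total≤P = subst (_≤ ∣P∣) (sym 3total) (∑-mono∈ ps (λ e m → load≤1 m))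

    module Step (η κ ρ v r : ℚ) (w : B → ℚ) (sm : Small η w)
      (0<κ : 0ℚ < κ) (0≤ρ : 0ℚ ≤ ρ) (ρ≤1 : ρ ≤ 1ℚ) (κρ≡v : κ * ρ ≡ v)
      (0≤r : 0ℚ ≤ r) (r≤ρ : r ≤ ρ) (r≤2vρ : r ≤ 2ℚ * v * ρ) (κB≤1 : κ * (4ℚ * ∣B∣) ≤ 1ℚ) where
      open Small sm

      0≤κ = <⇒≤ 0<κ

      q O mx : E → ℚ
      q = load w
      O = excess ρ w
      mx e = ρ + O e

      -- `D` is the rate at which picks delete j, `m` the desired deletion rate and `θ` the thinning
      -- that makes up the difference. As `mx` is the larger of load and level, `m` is never below
      -- `D`.
      D m θ : B → ℚ
      D j = ∑ bs (λ t → w t * I j t)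
      m j = ∑ ps (λ e → i j e * mx e)
      θ j = m j - D j

      p : Event → ℚ
      p (pick t) = κ * w t
      p (thin l) = κ * θ l
      p none = 1ℚ - (∑ bs (λ t → κ * w t) + ∑ bs (λ l → κ * θ l))

      Ex : (Event → ℚ) → ℚ
      Ex F = ∑ events (λ ev → p ev * F ev)

      Ex-≡ : ∀ F → Ex F ≡ p none * F none + (∑ bs (λ t → κ * w t * F (pick t)) + ∑ bs (λ l → κ * θ l * F (thin l)))
      Ex-≡ F = cong (p none * F none +_) (trans (∑-++ (map pick bs) (map thin bs) _) (cong₂ _+_ (∑-map pick bs _) (∑-map thin bs _)))

      Σp : ∑ events p ≡ 1ℚ
      Σp = trans (cong (p none +_) (trans (∑-++ (map pick bs) (map thin bs) _) (cong₂ _+_ (∑-map pick bs _) (∑-map thin bs _))))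
             (Σp-identity (∑ bs (λ t → κ * w t)) (∑ bs (λ l → κ * θ l)))

      O≥0 : ∀ e → 0ℚ ≤ O e
      O≥0 e = ⁺≥0 (q e - ρ)

      q≤mx : ∀ e → q e ≤ mx e
      q≤mx e = lin (0≤- (⁺≥ (q e - ρ))) (q≤mx-identity (q e) ρ (O e))

      mx≤1 : ∀ {e} → e ∈ ps → mx e ≤ 1ℚ
      mx≤1 {e} e∈ with ⁺-cases (q e - ρ)
      ... | inj₁ (_ , eq) rewrite eq = subst (_≤ 1ℚ) (sym (+-identityʳ ρ)) ρ≤1
      ... | inj₂ (_ , eq) rewrite eq = subst (_≤ 1ℚ) (sym (mx≤1-identity (q e) ρ)) (load≤1 e∈)

      -- Double counting: blocks meeting j, weighted by w, are seen from the points of j.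
      D≤ : ∀ j → D j ≤ ∑ ps (λ e → i j e * q e)
      D≤ j = ≤-trans (∑-mono bs (λ t → *-mono-≥0 (w t) (w≥0 t) (meets-≤ j t)))
        (≤-reflexive (begin
          ∑ bs (λ t → w t * ∑ ps (λ e → i j e * i t e)) ≡⟨ ∑-cong bs (λ t → sym (∑-* ps (w t) _)) ⟩
          ∑ bs (λ t → ∑ ps (λ e → w t * (i j e * i t e))) ≡⟨ ∑-swap bs ps _ ⟩
          ∑ ps (λ e → ∑ bs (λ t → w t * (i j e * i t e))) ≡⟨ ∑-cong ps (λ e → trans (∑-cong bs (λ t → D≤-identity (w t) (i j e) (i t e))) (∑-* bs (i j e) _)) ⟩
          ∑ ps (λ e → i j e * q e) ∎))
        where
        open ≡-Reasoning

      θ≥0 : ∀ j → 0ℚ ≤ θ j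
      θ≥0 j = 0≤- (≤-trans (D≤ j) (∑-mono ps (λ e → *-mono-≥0 _ (i≥0 j e) (q≤mx e))))

      ∑i-≤3 : ∀ {j} (f : E → ℚ) → j ∈ bs → (∀ {e} → e ∈ ps → f e ≤ 1ℚ) → ∑ ps (λ e → i j e * f e) ≤ 3ℚ
      ∑i-≤3 {j} f j∈ h = ∑-mono∈ ps (λ e e∈ → *-≤1 (i≥0 j e) (h e∈)) ≤≡ inc-3 j∈

      D≥0 : ∀ j → 0ℚ ≤ D j
      D≥0 j = ∑-≥0 bs (λ t → w≥0 t ⊛ 𝟙≥0 (meets j t))

      θ≤3 : ∀ {j} → j ∈ bs → θ j ≤ 3ℚ
      θ≤3 {j} j∈ = ≤-trans (lin (D≥0 j) (θ≤3-identity (m j) (D j))) (∑i-≤3 mx j∈ mx≤1)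

      p≥0 : ∀ ev → 0ℚ ≤ p ev
      p≥0 (pick t) = 0≤κ ⊛ w≥0 t
      p≥0 (thin l) = 0≤κ ⊛ θ≥0 l
      -- All rates together are at most κ(1 + 3) per block; for this the step length has to shrink
      -- with the number of blocks.
      p≥0 none = 0≤- (≤-trans (≤-reflexive (sym (∑-+ bs _ _))) (≤-trans
          (∑-mono∈ bs (λ j j∈ → sym (*-distribˡ-+ κ (w j) (θ j)) ≡≤ *-mono-≥0 κ 0≤κ (+-mono-≤ (w≤1 j∈) (θ≤3 j∈))))
          (sym eq ≡≤ κB≤1)))
        where
        eq : κ * (4ℚ * ∣B∣) ≡ ∑ bs (λ _ → κ * 4ℚ)
        eq = trans (sym (*-assoc κ 4ℚ ∣B∣)) (trans (sym (∑-* bs (κ * 4ℚ) (λ _ → 1ℚ))) (∑-cong bs (λ _ → *-identityʳ _)))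

      Ex-mono : ∀ {F G} → (∀ ev → ev ∈ events → F ev ≤ G ev) → Ex F ≤ Ex G
      Ex-mono h = ∑-mono∈ events (λ ev m → *-mono-≥0 (p ev) (p≥0 ev) (h ev m))

      ∑∑-const : ∀ {j} → j ∈ bs → ∑ ps (λ e → i j e * ρ) ≡ 3ℚ * ρ
      ∑∑-const j∈ = trans (∑-*ʳ ps ρ _) (cong (_* ρ) (inc-3 j∈))

      m-≡ : ∀ {j} → j ∈ bs → m j ≡ 3ℚ * ρ + ∑ ps (λ e → i j e * O e)
      m-≡ {j} j∈ = trans (∑-cong ps (λ e → *-distribˡ-+ (i j e) ρ (O e))) (trans (∑-+ ps _ _) (cong (_+ ∑ ps (λ e → i j e * O e)) (∑∑-const j∈)))

      -- Picks contribute `D j` and thinning `θ j`; their sum `m j` no longer depends on how the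
      -- blocks overlap.
      Ex-w : ∀ {j} → j ∈ bs → Ex (λ ev → kill ev w j) ≡ w j - κ * (w j * m j)
      Ex-w {j} j∈ = begin
        Ex (λ ev → kill ev w j) ≡⟨ Ex-≡ _ ⟩
        p none * w j + (∑ bs (λ t → κ * w t * (w j * (1ℚ - I j t))) + ∑ bs (λ l → κ * θ l * (w j * (1ℚ - 𝟙 (eqB j l)))))
          ≡⟨ cong (p none * w j +_) (cong₂ _+_ e₁ e₂) ⟩
        p none * w j + ((w j * a - κ * w j * D j) + (w j * b - κ * w j * θ j)) ≡⟨ Ex-w-identity₃ (w j) a b κ (D j) (m j) ⟩
        w j - κ * (w j * m j) ∎
        where
        open ≡-Reasoning
        a = ∑ bs (λ t → κ * w t)
        b = ∑ bs (λ l → κ * θ l)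
        e₁ : ∑ bs (λ t → κ * w t * (w j * (1ℚ - I j t))) ≡ w j * a - κ * w j * D j
        e₁ = trans (∑-cong bs (λ t → Ex-w-identity κ (w t) (w j) (I j t))) (trans (∑-- bs _ _) (cong₂ _-_ (∑-* bs (w j) _) (∑-* bs (κ * w j) _)))
        e₂ : ∑ bs (λ l → κ * θ l * (w j * (1ℚ - 𝟙 (eqB j l)))) ≡ w j * b - κ * w j * θ j
        e₂ = trans (∑-cong bs (λ l → Ex-w-identity₂ κ (θ l) (w j) (𝟙 (eqB j l)))) (trans (∑-- bs _ _)
               (cong₂ _-_ (∑-* bs (w j) _) (trans (∑-* bs (κ * w j) _) (cong (κ * w j *_) (eqB-∑ θ j∈)))))

      Ex-total : Ex (λ ev → total (kill ev w)) ≡ total w - κ * ∑ bs (λ j → w j * m j)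
      Ex-total = begin
        ∑ events (λ ev → p ev * ∑ bs (kill ev w)) ≡⟨ ∑-cong events (λ ev → sym (∑-* bs (p ev) _)) ⟩
        ∑ events (λ ev → ∑ bs (λ j → p ev * kill ev w j)) ≡⟨ ∑-swap events bs _ ⟩
        ∑ bs (λ j → Ex (λ ev → kill ev w j)) ≡⟨ ∑-cong∈ bs (λ j j∈ → Ex-w j∈) ⟩
        ∑ bs (λ j → w j - κ * (w j * m j)) ≡⟨ trans (∑-- bs _ _) (cong (λ z → total w - z) (∑-* bs κ _)) ⟩
        total w - κ * ∑ bs (λ j → w j * m j) ∎
        where open ≡-Reasoning

      ∑wm : ∑ bs (λ j → w j * m j) ≤ 3ℚ * ρ * total w + ∑ ps O
      ∑wm = eq ≡≤ +-monoʳ-≤ (3ℚ * ρ * total w) (∑-mono∈ ps (λ e e∈ → *-mono-≥0ʳ (O e) (O≥0 e) (load≤1 e∈) ≤≡ *-identityˡ (O e)))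
        where
        open ≡-Reasoning
        eq : ∑ bs (λ j → w j * m j) ≡ 3ℚ * ρ * total w + ∑ ps (λ e → q e * O e)
        eq = begin
          ∑ bs (λ j → w j * m j) ≡⟨ ∑-cong∈ bs (λ j j∈ → trans (cong (w j *_) (m-≡ j∈)) (trans (*-distribˡ-+ (w j) (3ℚ * ρ) _) (cong (_+ w j * ∑ ps (λ e → i j e * O e)) (*-comm (w j) (3ℚ * ρ))))) ⟩
          ∑ bs (λ j → 3ℚ * ρ * w j + w j * ∑ ps (λ e → i j e * O e)) ≡⟨ trans (∑-+ bs _ _) (cong₂ _+_ (∑-* bs (3ℚ * ρ) w) (∑w∑ sm O)) ⟩
          3ℚ * ρ * total w + ∑ ps (λ e → q e * O e) ∎

      Ex-total≥ : total w - 3ℚ * v * total w - κ * ∑ ps O ≤ Ex (λ ev → total (kill ev w))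
      Ex-total≥ = lin (0≤κ ⊛ 0≤- ∑wm) (trans (Ex-total≥-identity (total w) κ ρ (∑ ps O) (∑ bs (λ j → w j * m j)))
          (cong (λ z → total w - 3ℚ * z * total w - κ * ∑ ps O + κ * (3ℚ * ρ * total w + ∑ ps O - ∑ bs (λ j → w j * m j))) κρ≡v)) ≤≡ sym Ex-total

      Ex-picked : Ex picked ≡ κ * total w
      Ex-picked = trans (Ex-≡ picked) (trans (cong₂ _+_ (*-zeroʳ (p none)) (cong₂ _+_ (trans (∑-cong bs (λ t → *-identityʳ _)) (∑-* bs κ w))
         (trans (∑-cong bs (λ l → *-zeroʳ (κ * θ l))) (∑-0 bs)))) (Ex-picked-identity (κ * total w)))

      -- The loss of load at e; a pick through e is recorded as no loss, since then the load drops to 0 anyway.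
      Δ : Event → E → ℚ
      Δ (pick t) e = (1ℚ - i t e) * ∑ bs (λ j → i j e * w j * I j t)
      Δ (thin l) e = i l e * w l
      Δ none e = 0ℚ

      Δ≥0 : ∀ ev e → 0ℚ ≤ Δ ev e
      Δ≥0 (pick t) e = 1-𝟙≥0 (inc t e) ⊛ ∑-≥0 bs (λ j → i≥0 j e ⊛ w≥0 j ⊛ 𝟙≥0 (meets j t))
      Δ≥0 (thin l) e = i≥0 l e ⊛ w≥0 l
      Δ≥0 none e = ≤-refl

      thin∈ : ∀ {l} → thin l ∈ events → l ∈ bs
      thin∈ (there h) with ∈-++⁻ (map pick bs) h
      ... | inj₁ h′ with ∈-map⁻ pick h′
      ...   | _ , _ , ()
      thin∈ (there h) | inj₂ h′ with ∈-map⁻ thin h′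
      ...   | _ , l∈ , refl = l∈

      pick∈ : ∀ {l} → pick l ∈ events → l ∈ bs
      pick∈ (there h) with ∈-++⁻ (map pick bs) h
      ... | inj₂ h′ with ∈-map⁻ thin h′
      ...   | _ , _ , ()
      pick∈ (there h) | inj₁ h′ with ∈-map⁻ pick h′
      ...   | _ , l∈ , refl = l∈

      ρ′ : ℚ
      ρ′ = ρ - r

      U : Event → E → ℚ
      U ev e = O e * O e + 2ℚ * O e * r + r * r - 2ℚ * O e * Δ ev e + Δ ev e * Δ ev e

      -- `⁺²-bound` for the drop Δ - r relative to the lowered level; the cross term -2Δr of the
      -- square is nonpositive and is dropped.
      excess-U : ∀ ev e → load (kill ev w) e ≡ q e - Δ ev e → excess ρ′ (kill ev w) e * excess ρ′ (kill ev w) e ≤ U ev e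
      excess-U ev e eq rewrite eq = ≤-trans (cong (λ z → (z ⁺) * (z ⁺)) (sym (excess-U-identity (q e) ρ (Δ ev e) r)) ≡≤ ⁺²-bound (q e - ρ) (Δ ev e - r))
          (lin (0≤2 ⊛ Δ≥0 ev e ⊛ 0≤r) (excess-U-identity₂ (O e) (Δ ev e) r))

      Φ-event : ∀ ev → ev ∈ events → ∀ e → e ∈ ps → excess ρ′ (kill ev w) e * excess ρ′ (kill ev w) e ≤ U ev e
      Φ-event none _ e _ = excess-U none e (Φ-event-identity (q e))
      Φ-event (thin l) ev∈ e _ = excess-U (thin l) e (trans (∑-cong bs (λ j → Φ-event-identity₂ (i j e) (w j) (𝟙 (eqB j l))))
          (trans (∑-- bs _ _) (cong (λ z → q e - z) (trans (∑-cong bs (λ j → cong (_* (i j e * w j)) (eqB-sym j l))) (eqB-∑ (λ j → i j e * w j) (thin∈ ev∈))))))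
      Φ-event (pick t) _ e e∈ with bool-cases (inc t e)
      ... | inj₁ eq = excess-U (pick t) e (begin
          ∑ bs (λ j → i j e * (w j * (1ℚ - I j t))) ≡⟨ ∑-cong bs (λ j → Φ-event-identity₃ (i j e) (w j) (I j t)) ⟩
          ∑ bs (λ j → i j e * w j - i j e * w j * I j t) ≡⟨ ∑-- bs _ _ ⟩
          q e - ∑ bs (λ j → i j e * w j * I j t) ≡⟨ cong (λ z → q e - z) (sym (trans (cong (λ z → (1ℚ - 𝟙 z) * ∑ bs (λ j → i j e * w j * I j t)) eq) (*-identityˡ _))) ⟩
          q e - (1ℚ - i t e) * ∑ bs (λ j → i j e * w j * I j t) ∎)
        where
        open ≡-Reasoning
      -- Here t passes through e. Every block at e meets t, so the load becomes 0 and the excess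
      -- vanishes, while U is the square (O + r)².
      ... | inj₂ eq = subst (_≤ U (pick t) e) (sym eq₁) (lin (sq≥0 (O e + r)) (trans (cong (λ z → O e * O e + 2ℚ * O e * r + r * r - 2ℚ * O e * z + z * z) eq₂) (Φ-event-identity₄ (O e) r)))
        where
        dead : ∀ j → i j e * (w j * (1ℚ - I j t)) ≡ 0ℚ
        dead j with inc j e in eqj
        ... | false = *-zeroˡ (w j * (1ℚ - I j t))
        ... | true rewrite meets-∋ j t e∈ eqj eq = trans (*-identityˡ _) (*-zeroʳ (w j))
        load≡0 : load (kill (pick t) w) e ≡ 0ℚ
        load≡0 = trans (∑-cong bs dead) (∑-0 bs)
        eq₁ : excess ρ′ (kill (pick t) w) e * excess ρ′ (kill (pick t) w) e ≡ 0ℚ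
        eq₁ with ⁺-cases (load (kill (pick t) w) e - ρ′)
        ... | inj₁ (_ , z) rewrite z = refl
        ... | inj₂ (h , z) rewrite z | load≡0 = cong (λ x → x * x) (≤-antisym (lin (0≤- r≤ρ) (eq₁-identity (ρ - r))) h)
        eq₂ : Δ (pick t) e ≡ 0ℚ
        eq₂ = trans (cong (λ z → (1ℚ - 𝟙 z) * ∑ bs (λ j → i j e * w j * I j t)) eq) (*-zeroˡ (∑ bs (λ j → i j e * w j * I j t)))

      -- For a block j through e, picks contribute `D j` - `q e`, since those through e are recorded
      -- as no loss, and thinning contributes `m j` - `D j`.
      Ex-Δ : ∀ e → e ∈ ps → Ex (λ ev → Δ ev e) ≡ κ * ∑ bs (λ j → i j e * w j * (m j - q e))
      Ex-Δ e e∈ = begin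
        Ex (λ ev → Δ ev e) ≡⟨ Ex-≡ (λ ev → Δ ev e) ⟩
        p none * 0ℚ + (∑ bs (λ t → κ * w t * ((1ℚ - i t e) * ∑ bs (λ j → i j e * w j * I j t))) + ∑ bs (λ l → κ * θ l * (i l e * w l)))
          ≡⟨ cong₂ _+_ (*-zeroʳ (p none)) (cong (_+ ∑ bs (λ l → κ * θ l * (i l e * w l))) e₁) ⟩
        0ℚ + (∑ bs (λ j → κ * (i j e * w j) * (D j - q e)) + ∑ bs (λ l → κ * θ l * (i l e * w l)))
          ≡⟨ trans (+-identityˡ _) (sym (∑-+ bs _ _)) ⟩
        ∑ bs (λ j → κ * (i j e * w j) * (D j - q e) + κ * θ j * (i j e * w j))
          ≡⟨ trans (∑-cong bs (λ j → Ex-Δ-identity κ (i j e * w j) (D j) (q e) (m j))) (∑-* bs κ _) ⟩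
        κ * ∑ bs (λ j → i j e * w j * (m j - q e)) ∎
        where
        open ≡-Reasoning
        inner : ∀ j → i j e * w j * ∑ bs (λ t → w t * (1ℚ - i t e) * I j t) ≡ i j e * w j * (D j - q e)
        inner j with inc j e in eqj
        ... | false = trans (cong (_* ∑ bs (λ t → w t * (1ℚ - i t e) * I j t)) (*-zeroˡ (w j))) (trans (*-zeroˡ (∑ bs (λ t → w t * (1ℚ - i t e) * I j t))) (sym (trans (cong (_* (D j - q e)) (*-zeroˡ (w j))) (*-zeroˡ (D j - q e)))))
        ... | true = cong (1ℚ * w j *_) (trans (∑-cong bs term) (∑-- bs (λ t → w t * I j t) (λ t → i t e * w t)))
          where
          term : ∀ t → w t * (1ℚ - i t e) * I j t ≡ w t * I j t - i t e * w t
          term t with inc t e in eqt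
          ... | false = Ex-Δ-identity₂ (w t) (I j t)
          ... | true rewrite meets-∋ j t e∈ eqj eqt = Ex-Δ-identity₃ (w t)
        e₁ : ∑ bs (λ t → κ * w t * ((1ℚ - i t e) * ∑ bs (λ j → i j e * w j * I j t))) ≡ ∑ bs (λ j → κ * (i j e * w j) * (D j - q e))
        e₁ = begin
          ∑ bs (λ t → κ * w t * ((1ℚ - i t e) * ∑ bs (λ j → i j e * w j * I j t)))
            ≡⟨ ∑-cong bs (λ t → trans (sym (*-assoc (κ * w t) (1ℚ - i t e) _)) (sym (∑-* bs (κ * w t * (1ℚ - i t e)) _))) ⟩
          ∑ bs (λ t → ∑ bs (λ j → κ * w t * (1ℚ - i t e) * (i j e * w j * I j t)))
            ≡⟨ ∑-swap bs bs _ ⟩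
          ∑ bs (λ j → ∑ bs (λ t → κ * w t * (1ℚ - i t e) * (i j e * w j * I j t)))
            ≡⟨ ∑-cong bs (λ j → trans (∑-cong bs (λ t → Ex-Δ-identity₄ κ (w t) (1ℚ - i t e) (i j e * w j) (I j t))) (∑-* bs (κ * (i j e * w j)) _)) ⟩
          ∑ bs (λ j → κ * (i j e * w j) * ∑ bs (λ t → w t * (1ℚ - i t e) * I j t))
            ≡⟨ ∑-cong bs (λ j → trans (*-assoc κ _ _) (trans (cong (κ *_) (inner j)) (sym (*-assoc κ _ _)))) ⟩
          ∑ bs (λ j → κ * (i j e * w j) * (D j - q e)) ∎

      -- For j through e one has `m j` ≥ 3ρ + `O e` and ρ + `O e` ≥ `q e`: the two other points of j
      -- alone delete it at rate 2ρ.
      Ex-Δ≥ : ∀ e → e ∈ ps → 2ℚ * v * q e ≤ Ex (λ ev → Δ ev e)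
      Ex-Δ≥ e e∈ = (cong (λ z → 2ℚ * z * q e) (sym κρ≡v) ≡≤ Ex-Δ≥-identity κ ρ (q e) ≡≤ cong (κ *_) (sym (∑-*ʳ bs (2ℚ * ρ) _)) ≡≤ *-mono-≥0 κ 0≤κ (∑-mono∈ bs term)) ≤≡ sym (Ex-Δ e e∈)
        where
        term : ∀ j → j ∈ bs → i j e * w j * (2ℚ * ρ) ≤ i j e * w j * (m j - q e)
        term j j∈ with inc j e in eqj
        ... | false = ≤-reflexive (trans (Ex-Δ≥-identity₂ (w j) (2ℚ * ρ)) (sym (Ex-Δ≥-identity₂ (w j) (m j - q e))))
        ... | true = *-mono-≥0 (1ℚ * w j) (0≤1 ⊛ w≥0 j) (lin
               (0≤- (≤-reflexive (sym (m-≡ j∈))) ⊕ 0≤- (cong (λ z → 𝟙 z * O e) (sym eqj) ≡≤ ∑-∈≤ (λ f → i≥0 j f ⊛ O≥0 f) e∈) ⊕ 0≤- (q≤mx e))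
               (Ex-Δ≥-identity₃ (m j) (q e) (O e) ρ (∑ ps (λ f → i j f * O f))))

      O*ρ≤O*q : ∀ e → O e * ρ ≤ O e * q e
      O*ρ≤O*q e with ⁺-cases (q e - ρ)
      ... | inj₁ (_ , z) rewrite z = ≤-reflexive (trans (*-zeroˡ ρ) (sym (*-zeroˡ (q e))))
      ... | inj₂ (h , z) rewrite z = *-mono-≥0 (q e - ρ) h (-≥0 h)

      Δ² : E → ℚ
      Δ² e = Ex (λ ev → Δ ev e * Δ ev e)

      -- The term linear in `O e` is nonpositive: where `O e` is positive the load exceeds ρ, so its
      -- expected drop is at least 2vρ ≥ r.
      Ex-U : ∀ e → e ∈ ps → Ex (λ ev → U ev e) ≤ O e * O e + r * r + Δ² e
      Ex-U e e∈ = eq ≡≤ lin (0≤2 ⊛ (0≤- Or≤)) (Ex-U-identity₃ (O e) r (Ex (λ ev → Δ ev e)) (Δ² e))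
        where
        c = O e * O e + 2ℚ * O e * r + r * r
        eq : Ex (λ ev → U ev e) ≡ c - 2ℚ * O e * Ex (λ ev → Δ ev e) + Δ² e
        f₁ f₂ f₃ : Event → ℚ
        f₁ ev = p ev * c
        f₂ ev = 2ℚ * O e * (p ev * Δ ev e)
        f₃ ev = p ev * (Δ ev e * Δ ev e)
        eq = begin
          ∑ events (λ ev → p ev * U ev e) ≡⟨ ∑-cong events (λ ev → Ex-U-identity (p ev) (O e) r (Δ ev e)) ⟩
          ∑ events (λ ev → f₁ ev - f₂ ev + f₃ ev) ≡⟨ ∑-+ events (λ ev → f₁ ev - f₂ ev) f₃ ⟩
          ∑ events (λ ev → f₁ ev - f₂ ev) + Δ² e ≡⟨ cong (_+ Δ² e) (∑-- events f₁ f₂) ⟩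
          ∑ events f₁ - ∑ events f₂ + Δ² e ≡⟨ cong₂ (λ x y → x - y + Δ² e) (trans (∑-*ʳ events c p) (trans (cong (_* c) Σp) (*-identityˡ c))) (∑-* events (2ℚ * O e) (λ ev → p ev * Δ ev e)) ⟩
          c - 2ℚ * O e * Ex (λ ev → Δ ev e) + Δ² e ∎
          where open ≡-Reasoning
        0≤v : 0ℚ ≤ v
        0≤v = 0≤κ ⊛ 0≤ρ ≤≡ κρ≡v
        Or≤ : O e * r ≤ O e * Ex (λ ev → Δ ev e)
        Or≤ = ≤-trans (*-mono-≥0 (O e) (O≥0 e) r≤2vρ) (≤-trans (Ex-U-identity₂ v (O e) ρ ≡≤ *-mono-≥0 (2ℚ * v) (0≤2 ⊛ 0≤v) (O*ρ≤O*q e) ≤≡ sym (Ex-U-identity₂ v (O e) (q e)))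
                (*-mono-≥0 (O e) (O≥0 e) (Ex-Δ≥ e e∈)))

      ∑iw≤3 : ∀ {t} → t ∈ bs → ∑ bs (λ j → w j * I j t) ≤ 3ℚ
      ∑iw≤3 {t} t∈ = ≤-trans (∑-mono bs (λ j → *-mono-≥0 (w j) (w≥0 j) (meets-≤ j t))) (eq ≡≤ ∑i-≤3 q t∈ load≤1)
        where
        open ≡-Reasoning
        eq : ∑ bs (λ j → w j * ∑ ps (λ e → i j e * i t e)) ≡ ∑ ps (λ e → i t e * q e)
        eq = begin
          ∑ bs (λ j → w j * ∑ ps (λ e → i j e * i t e)) ≡⟨ ∑-cong bs (λ j → sym (∑-* ps (w j) _)) ⟩
          ∑ bs (λ j → ∑ ps (λ e → w j * (i j e * i t e))) ≡⟨ ∑-swap bs ps _ ⟩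
          ∑ ps (λ e → ∑ bs (λ j → w j * (i j e * i t e))) ≡⟨ ∑-cong ps (λ e → trans (∑-cong bs (λ j → ∑iw≤3-identity (w j) (i j e) (i t e))) (∑-* bs (i t e) _)) ⟩
          ∑ ps (λ e → i t e * q e) ∎

      ∑∑iw : ∀ t → ∑ ps (λ e → ∑ bs (λ j → i j e * w j * I j t)) ≡ 3ℚ * ∑ bs (λ j → w j * I j t)
      ∑∑iw t = begin
        ∑ ps (λ e → ∑ bs (λ j → i j e * w j * I j t)) ≡⟨ ∑-swap ps bs _ ⟩
        ∑ bs (λ j → ∑ ps (λ e → i j e * w j * I j t)) ≡⟨ ∑-cong∈ bs (λ j j∈ → trans (∑-cong ps (λ e → *-assoc (i j e) (w j) (I j t)))
                                                         (trans (∑-*ʳ ps (w j * I j t) _) (cong (_* (w j * I j t)) (inc-3 j∈)))) ⟩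
        ∑ bs (λ j → 3ℚ * (w j * I j t)) ≡⟨ ∑-* bs 3ℚ _ ⟩
        3ℚ * ∑ bs (λ j → w j * I j t) ∎
        where open ≡-Reasoning

      module _ (0≤η : 0ℚ ≤ η) where

        -- A block that contributes passes through e and through one of the three points of t, all
        -- different from e, so the codegree bound applies three times.
        pick-Δ≤ : ∀ {t} → t ∈ bs → ∀ {e} → e ∈ ps → Δ (pick t) e ≤ 3ℚ * η
        pick-Δ≤ {t} t∈ {e} e∈ with inc t e in eq
        ... | true = *-zeroˡ (∑ bs (λ j → i j e * w j * I j t)) ≡≤ 0≤3 ⊛ 0≤η
        ... | false = *-identityˡ (∑ bs (λ j → i j e * w j * I j t)) ≡≤ ≤-trans (∑-mono bs (λ j → *-mono-≥0 _ (i≥0 j e ⊛ w≥0 j) (meets-≤ j t)))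
                        (eq₁ ≡≤ ≤-trans (∑-mono∈ ps (λ f f∈ → bound f f∈)) (≤-reflexive (trans (∑-*ʳ ps η _) (cong (_* η) (inc-3 t∈)))))
          where
          open ≡-Reasoning
          eq₁ : ∑ bs (λ j → i j e * w j * ∑ ps (λ f → i j f * i t f)) ≡ ∑ ps (λ f → i t f * ∑ bs (λ j → i j e * w j * i j f))
          eq₁ = begin
            ∑ bs (λ j → i j e * w j * ∑ ps (λ f → i j f * i t f)) ≡⟨ ∑-cong bs (λ j → sym (∑-* ps (i j e * w j) _)) ⟩
            ∑ bs (λ j → ∑ ps (λ f → i j e * w j * (i j f * i t f))) ≡⟨ ∑-swap bs ps _ ⟩
            ∑ ps (λ f → ∑ bs (λ j → i j e * w j * (i j f * i t f))) ≡⟨ ∑-cong ps (λ f → trans (∑-cong bs (λ j → pick-Δ≤-identity (i j e * w j) (i j f) (i t f))) (∑-* bs (i t f) _)) ⟩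
            ∑ ps (λ f → i t f * ∑ bs (λ j → i j e * w j * i j f)) ∎
          bound : ∀ f → f ∈ ps → i t f * ∑ bs (λ j → i j e * w j * i j f) ≤ i t f * η
          bound f f∈ with inc t f in eqf
          ... | false = ≤-reflexive (trans (*-zeroˡ (∑ bs (λ j → i j e * w j * i j f))) (sym (*-zeroˡ η)))
          ... | true = *-mono-≥0 1ℚ 0≤1 (codeg t e∈ f∈ eq eqf)

        -- The maximum 3η times the sum, which is at most 9: blocks meeting t have total weight at
        -- most 3, and each has three points.
        ∑pickΔ² : ∀ {t} → t ∈ bs → ∑ ps (λ e → Δ (pick t) e * Δ (pick t) e) ≤ 27ℚ * η
        ∑pickΔ² {t} t∈ = ≤-trans (∑-mono∈ ps (λ e e∈ → *-mono² (Δ≥0 (pick t) e) (∑-≥0 bs (λ j → i≥0 j e ⊛ w≥0 j ⊛ 𝟙≥0 (meets j t))) (pick-Δ≤ t∈ e∈)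
              (*-mono-≥0ʳ _ (∑-≥0 bs (λ j → i≥0 j e ⊛ w≥0 j ⊛ 𝟙≥0 (meets j t))) (1-𝟙≤1 (inc t e)) ≤≡ *-identityˡ (∑ bs (λ j → i j e * w j * I j t)))))
            (trans (∑-* ps (3ℚ * η) _) (cong (3ℚ * η *_) (∑∑iw t)) ≡≤ *-mono-≥0 (3ℚ * η) (0≤3 ⊛ 0≤η) (*-mono-≥0 3ℚ 0≤3 (∑iw≤3 t∈)) ≤≡ ∑pickΔ²-identity η)

        ∑thinΔ² : ∀ {l} → l ∈ bs → ∑ ps (λ e → Δ (thin l) e * Δ (thin l) e) ≤ 3ℚ * (η * w l)
        ∑thinΔ² {l} l∈ = ≤-trans (∑-mono ps (λ e → ∑thinΔ²-identity (i l e) (w l) ≡≤ cong (_* (w l * w l)) (𝟙-sq (inc l e)) ≡≤ ≤-refl))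
            (trans (∑-*ʳ ps (w l * w l) _) (cong (_* (w l * w l)) (inc-3 l∈)) ≡≤ *-mono-≥0 3ℚ 0≤3 (*-mono-≥0ʳ (w l) (w≥0 l) (w≤η l∈)))

        -- Picks give 27κη times the total weight, thinning at most 9κη times it, and three times
        -- the total weight is at most the number of points.
        ∑Δ² : ∑ ps Δ² ≤ 12ℚ * κ * η * ∣P∣
        ∑Δ² = eq ≡≤ ≤-trans (+-mono-≤
                (∑-mono∈ bs (λ t t∈ → *-mono-≥0 (κ * w t) (0≤κ ⊛ w≥0 t) (∑pickΔ² t∈)))
                (∑-mono∈ bs (λ l l∈ → *-mono² (0≤κ ⊛ θ≥0 l) (0≤3 ⊛ (0≤η ⊛ w≥0 l)) (*-mono-≥0 κ 0≤κ (θ≤3 l∈)) (∑thinΔ² l∈))))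
              (trans (sym (∑-+ bs _ _)) (trans (∑-cong bs (λ t → ∑Δ²-identity κ (w t) η)) (trans (∑-* bs (12ℚ * κ * η * 3ℚ) w) (*-assoc (12ℚ * κ * η) 3ℚ (total w)))) ≡≤ *-mono-≥0 (12ℚ * κ * η) (nonNegative⁻¹ 12ℚ ⊛ 0≤κ ⊛ 0≤η) (3total≤P sm))
          where
          open ≡-Reasoning
          eq : ∑ ps Δ² ≡ ∑ bs (λ t → κ * w t * ∑ ps (λ e → Δ (pick t) e * Δ (pick t) e)) + ∑ bs (λ l → κ * θ l * ∑ ps (λ e → Δ (thin l) e * Δ (thin l) e))
          G : Event → ℚ
          G ev = ∑ ps (λ e → Δ ev e * Δ ev e)
          rest = ∑ bs (λ t → κ * w t * G (pick t)) + ∑ bs (λ l → κ * θ l * G (thin l))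
          eq = begin
            ∑ ps Δ² ≡⟨ ∑-swap ps events (λ e ev → p ev * (Δ ev e * Δ ev e)) ⟩
            ∑ events (λ ev → ∑ ps (λ e → p ev * (Δ ev e * Δ ev e))) ≡⟨ ∑-cong events (λ ev → ∑-* ps (p ev) (λ e → Δ ev e * Δ ev e)) ⟩
            Ex G ≡⟨ Ex-≡ G ⟩
            p none * G none + rest ≡⟨ cong (_+ rest) (trans (cong (p none *_) (∑-0 ps)) (*-zeroʳ (p none))) ⟩
            0ℚ + rest ≡⟨ +-identityˡ rest ⟩
            rest ∎

        Ex-Φ : Ex (λ ev → Φ ρ′ (kill ev w)) ≤ Φ ρ w + (12ℚ * κ * η * ∣P∣ + r * r * ∣P∣)
        Ex-Φ = ≤-trans (Ex-mono (λ ev ev∈ → ∑-mono∈ ps (Φ-event ev ev∈)))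
          (trans (∑-cong events (λ ev → sym (∑-* ps (p ev) _))) (∑-swap events ps _) ≡≤
           ≤-trans (∑-mono∈ ps Ex-U) (trans (∑-+ ps _ _) (cong (_+ ∑ ps Δ²) (trans (∑-+ ps _ _) (cong (Φ ρ w +_) rr))) ≡≤ lin (0≤- ∑Δ²) (Ex-Φ-identity (Φ ρ w) (r * r * ∣P∣) (∑ ps Δ²) (12ℚ * κ * η * ∣P∣))))
          where
          rr : ∑ ps (λ _ → r * r) ≡ r * r * ∣P∣
          rr = trans (∑-cong ps (λ _ → sym (*-identityʳ (r * r)))) (∑-* ps (r * r) _)

        total↓ Φ↑ : ℚ
        total↓ = total w - 3ℚ * v * total w - κ * ∑ ps O
        Φ↑ = Φ ρ w + (12ℚ * κ * η * ∣P∣ + r * r * ∣P∣)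

        -- `c` and `b` are the values that the remaining steps attach to leftover weight and to
        -- potential; the chosen event does not fall behind the expectation in this exchange.
        Good : ℚ → ℚ → Event → Set
        Good c b ev = κ * total w + c * total↓ - b * Φ↑ ≤ picked ev + c * total (kill ev w) - b * Φ ρ′ (kill ev w)

        good-event : ∀ c b → 0ℚ ≤ c → 0ℚ ≤ b → ∃[ ev ] (ev ∈ events × 0ℚ < p ev × Good c b ev)
        good-event c b 0≤c 0≤b =
          ∑-pick-linear events p picked (λ ev → total (kill ev w)) (λ ev → Φ ρ′ (kill ev w)) c b
            {κ * total w} {total↓} {Φ↑} p≥0 Σp 0≤c 0≤b (≤-reflexive (sym Ex-picked)) Ex-total≥ Ex-Φ

    Matching : List B → Set
    Matching = AllPairs (λ s t → meets t s ≡ false)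

    -- `v` is the step length. A step lowers the level by the factor u², following the decay 1 - 2v
    -- of the loads, whereas the total weight decays like 1 - 3v. `Im` bounds every 1/ρ, and 4ττ′ =
    -- 1 turns the sum of excesses into Φ by AM-GM.
    module Iteration (η v u a τ τ′ Im : ℚ) (0≤η : 0ℚ ≤ η) (0<v : 0ℚ < v) (3v≤1 : 3ℚ * v ≤ 1ℚ)
      (u≡ : u ≡ 1ℚ - v) (au²≡1 : a * (u * u) ≡ 1ℚ) (1≤a : 1ℚ ≤ a)
      (0≤τ : 0ℚ ≤ τ) (0≤τ′ : 0ℚ ≤ τ′) (4ττ′≡1 : 4ℚ * (τ * τ′) ≡ 1ℚ) (0≤Im : 0ℚ ≤ Im)
      (vB≤1 : v * Im * (4ℚ * ∣B∣) ≤ 1ℚ) where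

      0≤v = <⇒≤ 0<v
      0≤a = ≤-trans 0≤1 1≤a

      0≤P : 0ℚ ≤ ∣P∣
      0≤P = ∑-≥0 ps (λ _ → 0≤1)

      0≤B : 0ℚ ≤ ∣B∣
      0≤B = ∑-≥0 bs (λ _ → 0≤1)

      α β ξ r̃ : ℚ
      α = v * (Im * Im) * (τ * ∣P∣)
      β = v * (Im * Im) * τ′
      ξ = 12ℚ * (v * Im) * η * ∣P∣ + 4ℚ * (v * v) * ∣P∣
      r̃ = a * (1ℚ - 3ℚ * v)

      0≤β : 0ℚ ≤ β
      0≤β = 0≤v ⊛ (0≤Im ⊛ 0≤Im) ⊛ 0≤τ′

      0≤ξ : 0ℚ ≤ ξ
      0≤ξ = nonNegative⁻¹ 12ℚ ⊛ (0≤v ⊛ 0≤Im) ⊛ 0≤η ⊛ 0≤P ⊕ nonNegative⁻¹ 4ℚ ⊛ (0≤v ⊛ 0≤v) ⊛ 0≤P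

      -- The share of total/ρ that s steps turn into picked blocks: one step picks v·total/ρ, after
      -- which total/ρ has changed by the factor `r̃` = (1 - 3v)/(1 - v)².
      C : ℕ → ℚ
      C zero = 0ℚ
      C (suc s) = v + r̃ * C s

      0≤r̃ : 0ℚ ≤ r̃
      0≤r̃ = 0≤a ⊛ 0≤- 3v≤1

      v≤1 : v ≤ 1ℚ
      v≤1 = ≤-trans (lin (0≤2 ⊛ 0≤v) (v≤1-identity v)) 3v≤1

      0≤u : 0ℚ ≤ u
      0≤u = 0≤- v≤1 ≤≡ sym u≡

      u≤1 : u ≤ 1ℚ
      u≤1 = u≡ ≡≤ lin 0≤v (u≤1-identity v)

      -- (1 - v)³ ≥ 1 - 3v, and a u³ = u.
      r̃≤u : r̃ ≤ u
      r̃≤u = ≤-trans (*-mono-≥0 a 0≤a (lin (0≤v ⊛ 0≤v ⊛ (0≤2 ⊕ 0≤- v≤1)) (r̃≤u-identity v))) (≤-reflexive (trans (cong (λ z → a * (z * z * z)) (sym u≡)) (trans (r̃≤u-identity₂ a u) (trans (cong (_* u) au²≡1) (*-identityˡ u)))))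

      0≤C : ∀ s → 0ℚ ≤ C s
      0≤C zero = ≤-refl
      0≤C (suc s) = 0≤v ⊕ 0≤r̃ ⊛ 0≤C s

      C≤1 : ∀ s → C s ≤ 1ℚ
      C≤1 zero = 0≤1
      C≤1 (suc s) = ≤-trans (+-monoʳ-≤ v (*-mono² 0≤r̃ 0≤1 r̃≤u (C≤1 s))) (≤-reflexive (trans (cong (λ z → v + z * 1ℚ) u≡) (C≤1-identity v)))

      1≤a^ : ∀ s → 1ℚ ≤ a ^^ s
      1≤a^ zero = ≤-refl
      1≤a^ (suc s) = ≤-trans (1≤a^ s) (sym (*-identityˡ _) ≡≤ *-mono-≥0ʳ (a ^^ s) (^^≥0 s 0≤a) 1≤a)

      ∑excess≤ : ∀ ρ w → ∑ ps (excess ρ w) ≤ τ * ∣P∣ + τ′ * Φ ρ w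
      ∑excess≤ ρ w = ≤-trans (∑-mono ps (λ e → bound (excess ρ w e))) (≤-reflexive (trans (∑-+ ps _ _) (cong₂ _+_ (∑-* ps τ (λ _ → 1ℚ)) (∑-* ps τ′ _))))
        where
        l₂ : ∀ O x → 1ℚ * O + x + τ′ * (O * O) * (1ℚ - 1ℚ) ≡ O + x
        l₂ O x = l₂-identity O x (τ′ * (O * O))
        bound : ∀ O → O ≤ τ * 1ℚ + τ′ * (O * O)
        bound O = lin (0≤τ ⊛ sq≥0 (1ℚ - 2ℚ * τ′ * O)) (trans (∑excess≤-identity τ τ′ O) (trans (cong (λ z → z * O + τ * ((1ℚ - 2ℚ * τ′ * O) * (1ℚ - 2ℚ * τ′ * O)) + τ′ * (O * O) * (1ℚ - z)) 4ττ′≡1) (l₂ O _)))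

      positive-kill : ∀ x b → 0ℚ ≤ x → 0ℚ < x * (1ℚ - 𝟙 b) → 0ℚ < x × b ≡ false
      positive-kill x true p h = ⊥-elim (<-irrefl refl (<-respʳ-≡ (*-zeroʳ x) h))
      positive-kill x false p h = <-respʳ-≡ (*-identityʳ x) h , refl

      positive-factor : ∀ x y → 0ℚ ≤ x → 0ℚ < x * y → 0ℚ < y
      positive-factor x y p h with 0ℚ <? y
      ... | yes q = q
      ... | no q = ⊥-elim (<-irrefl refl (<-≤-trans h (*-mono-≥0 x p (≮⇒≥ q) ≤≡ *-zeroʳ x)))

      -- Each step loses at most α + βΦ, and Φ grows by at most ξ per step, whence the term
      -- quadratic in s. Positivity of the weights is part of the invariant because it encodes
      -- disjointness from earlier picks.
      Result : ℕ → ℚ → ℚ → (B → ℚ) → Set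
      Result s ρ iρ w = ∃[ P ] (All (λ t → t ∈ bs × 0ℚ < w t) P × Matching P ×
        iρ * C s * total w - ι s * (α + β * Φ ρ w + ι s * (β * ξ)) ≤ ι (length P))

      iterate : ∀ s w ρ iρ → Small η w → ρ * iρ ≡ 1ℚ → 0ℚ ≤ ρ → ρ ≤ 1ℚ → 0ℚ < iρ → iρ * a ^^ s ≤ Im → Result s ρ iρ w
      iterate zero w ρ iρ sm _ _ _ _ _ = [] , [] , [] , ≤-reflexive (iterate-identity iρ (total w) (α + β * Φ ρ w + 0ℚ * (β * ξ)))
      iterate (suc s) w ρ iρ sm ρiρ 0≤ρ ρ≤1 0<iρ iρ≤ = go (S.good-event 0≤η c b (0≤iρ ⊛ 0≤a ⊛ 0≤C s) (ι≥0 s ⊛ 0≤β))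
        where
        open Small sm
        0≤iρ = <⇒≤ 0<iρ
        κ r c b : ℚ
        κ = v * iρ
        r = ρ * (1ℚ - u * u)
        c = iρ * a * C s
        b = ι s * β
        iρa≤ : iρ * a ≤ Im
        iρa≤ = ≤-trans (sym (*-identityʳ (iρ * a)) ≡≤ *-mono-≥0 (iρ * a) (0≤iρ ⊛ 0≤a) (1≤a^ s)) (*-assoc iρ a (a ^^ s) ≡≤ iρ≤)
        iρ≤Im : iρ ≤ Im
        iρ≤Im = ≤-trans (sym (*-identityʳ iρ) ≡≤ *-mono-≥0 iρ 0≤iρ 1≤a) iρa≤
        κρ≡v : κ * ρ ≡ v
        κρ≡v = trans (trans (*-assoc v iρ ρ) (cong (v *_) (trans (*-comm iρ ρ) ρiρ))) (*-identityʳ v)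
        u²≤1 : u * u ≤ 1ℚ
        u²≤1 = *-mono² 0≤u 0≤1 u≤1 u≤1
        1-u² : 1ℚ - u * u ≡ 2ℚ * v - v * v
        1-u² = trans (cong (λ z → 1ℚ - z * z) u≡) (1-u²-identity v)
        1-u²≤2v : 1ℚ - u * u ≤ 2ℚ * v
        1-u²≤2v = 1-u² ≡≤ lin (0≤v ⊛ 0≤v) (1-u²≤2v-identity v)
        0≤r : 0ℚ ≤ r
        0≤r = 0≤ρ ⊛ 0≤- u²≤1
        ρ-r : ρ - r ≡ ρ * (u * u)
        ρ-r = ρ-r-identity ρ u
        r≤ρ : r ≤ ρ
        r≤ρ = -≥0 (0≤ρ ⊛ (0≤u ⊛ 0≤u) ≤≡ sym ρ-r)
        r≤2vρ : r ≤ 2ℚ * v * ρ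
        r≤2vρ = *-mono-≥0 ρ 0≤ρ 1-u²≤2v ≤≡ *-comm ρ (2ℚ * v)
        r≤2v : r ≤ 2ℚ * v
        r≤2v = ≤-trans r≤2vρ (*-mono-≥0 (2ℚ * v) (0≤2 ⊛ 0≤v) ρ≤1 ≤≡ *-identityʳ (2ℚ * v))
        κB≤1 : κ * (4ℚ * ∣B∣) ≤ 1ℚ
        κB≤1 = ≤-trans (*-mono-≥0ʳ (4ℚ * ∣B∣) (nonNegative⁻¹ 4ℚ ⊛ 0≤B) (*-mono-≥0 v 0≤v iρ≤Im)) vB≤1
        module S = Step η κ ρ v r w sm (0<* 0<v 0<iρ) 0≤ρ ρ≤1 κρ≡v 0≤r r≤ρ r≤2vρ κB≤1

        ρ″ iρ″ : ℚ
        ρ″ = ρ - r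
        iρ″ = iρ * a
        ρ″iρ″ : ρ″ * iρ″ ≡ 1ℚ
        ρ″iρ″ = trans (cong (_* iρ″) ρ-r) (trans (ρ″iρ″-identity ρ u iρ a) (trans (cong₂ _*_ ρiρ au²≡1) (*-identityˡ 1ℚ)))
        ρ″≤1 : ρ″ ≤ 1ℚ
        ρ″≤1 = ≤-trans (lin 0≤r (θ≤3-identity ρ r)) ρ≤1

        err : ℚ
        err = ι s * (α + ι s * (β * ξ))

        cκ≤ : c * κ ≤ v * (Im * Im)
        cκ≤ = cκ≤-identity c v iρ ≡≤ *-mono-≥0 v 0≤v (*-mono² (0≤iρ ⊛ 0≤a ⊛ 0≤C s) 0≤Im
                (≤-trans (*-mono-≥0 (iρ * a) (0≤iρ ⊛ 0≤a) (C≤1 s)) (*-identityʳ (iρ * a) ≡≤ iρa≤)) iρ≤Im)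

        cκO≤ : c * κ * ∑ ps (excess ρ w) ≤ α + β * Φ ρ w
        cκO≤ = ≤-trans (*-mono² (0≤iρ ⊛ 0≤a ⊛ 0≤C s ⊛ (0≤v ⊛ 0≤iρ)) 0≤τΦ cκ≤ (∑excess≤ ρ w)) (≤-reflexive (cκO≤-identity (v * (Im * Im)) (τ * ∣P∣) τ′ (Φ ρ w)))
          where
          0≤τΦ : 0ℚ ≤ τ * ∣P∣ + τ′ * Φ ρ w
          0≤τΦ = 0≤τ ⊛ 0≤P ⊕ 0≤τ′ ⊛ ∑-≥0 ps (λ e → sq≥0 (excess ρ w e))

        ξ₀ : ℚ
        ξ₀ = 12ℚ * κ * η * ∣P∣ + r * r * ∣P∣
        ξ₀≤ξ : ξ₀ ≤ ξ
        ξ₀≤ξ = +-mono-≤ (*-mono-≥0ʳ ∣P∣ 0≤P (*-mono-≥0ʳ η 0≤η (*-mono-≥0 12ℚ (nonNegative⁻¹ 12ℚ) (*-mono-≥0 v 0≤v iρ≤Im))))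
                  (*-mono-≥0ʳ ∣P∣ 0≤P (*-mono² 0≤r (0≤2 ⊛ 0≤v) r≤2v r≤2v ≤≡ ξ₀≤ξ-identity v))

        O = ∑ ps (excess ρ w)
        Q X Y Y₀ R : ℚ
        Q = iρ * C (suc s) * total w
        X = β * Φ ρ w
        Y = β * ξ
        Y₀ = β * ξ₀
        R = κ * total w + c * (total w - 3ℚ * v * total w - κ * O) - b * (Φ ρ w + ξ₀)

        R≡ : R - err ≡ Q - c * κ * O - ι s * (X + Y₀) - err
        R≡ = cong (_- err) (cong₂ _-_ (R≡-identity iρ v a (C s) (total w) O) (R≡-identity₂ (ι s) β (Φ ρ w) ξ₀))

        gain : Q - ι (suc s) * (α + X + ι (suc s) * Y) ≤ R - err
        gain = lin (0≤- cκO≤ ⊕ ι≥0 s ⊛ 0≤- (*-mono-≥0 β 0≤β ξ₀≤ξ) ⊕ (0≤1 ⊕ ι≥0 s) ⊛ (0≤β ⊛ 0≤ξ)) (trans R≡ (gain-identity Q α X Y Y₀ (c * κ * O) (ι s)))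

        count : ∀ ev (P : List B) → S.Good 0≤η c b ev →
          iρ″ * C s * total (kill ev w) - ι s * (α + β * Φ ρ″ (kill ev w) + ι s * Y) ≤ ι (length P) →
          Q - ι (suc s) * (α + X + ι (suc s) * Y) ≤ picked ev + ι (length P)
        count ev P good len = ≤-trans gain (lin (0≤- good ⊕ 0≤- len) err-eq)
          where
          F = Φ ρ″ (kill ev w)
          T = c * total (kill ev w)
          err-eq : picked ev + ι (length P) ≡ R - err + ((picked ev + T - b * F - R) + (ι (length P) - (T - ι s * (α + β * F + ι s * Y))))
          err-eq = trans (count-identity (picked ev) (ι (length P)) R T (b * F) err) (cong (λ z → R - err + ((picked ev + T - b * F - R) + (ι (length P) - (T - z)))) (sym (count-identity₂ α (ι s) β F Y)))

        finish : ∀ ev → ev ∈ events → 0ℚ < S.p ev → S.Good 0≤η c b ev → Result s ρ″ iρ″ (kill ev w) → Result (suc s) ρ iρ w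
        finish none ev∈ pos good (P , mem , disj , len) = P , mem , disj , (count none P good len ≤≡ +-identityˡ _)
        finish (thin l) ev∈ pos good (P , mem , disj , len) =
          P , All.map (λ { {j} (j∈ , h) → j∈ , proj₁ (positive-kill (w j) (eqB j l) (w≥0 j) h) }) mem , disj , (count (thin l) P good len ≤≡ +-identityˡ _)
        -- A later block has positive weight after the deletion around t and therefore does not meet
        -- t.
        finish (pick t) ev∈ pos good (P , mem , disj , len) = t ∷ P ,
          (S.pick∈ ev∈ , positive-factor κ (w t) (0≤v ⊛ 0≤iρ) pos) ∷ All.map (λ { {j} (j∈ , h) → j∈ , proj₁ (positive-kill (w j) (meets j t) (w≥0 j) h) }) mem ,
          All.map (λ { {j} (j∈ , h) → proj₂ (positive-kill (w j) (meets j t) (w≥0 j) h) }) mem ∷ disj ,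
          count (pick t) P good len

        go : ∃[ ev ] (ev ∈ events × 0ℚ < S.p ev × S.Good 0≤η c b ev) → Result (suc s) ρ iρ w
        go (ev , ev∈ , pos , good) = finish ev ev∈ pos good
          (iterate s (kill ev w) ρ″ iρ″ (Small-kill ev sm) ρ″iρ″ (0≤- r≤ρ) ρ″≤1 (0<* 0<iρ (<-≤-trans (positive⁻¹ 1ℚ) 1≤a)) (*-assoc iρ a (a ^^ s) ≡≤ iρ≤))

  M≤q-identity : ∀ M n → 2ℚ * (1ℚ + n) ≡ M + ((n - M) + (n + 2ℚ))
  M≤q-identity = solve 2 (λ M n → cst 2ℚ :* (cst 1ℚ :+ n) := M :+ (n :- M :+ (n :+ cst 2ℚ))) refl

  pick-v-identity : ∀ q v → q * v ≡ ½ * (2ℚ * q * v)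
  pick-v-identity = solve 2 (λ q v → q :* v := cst ½ :* (cst 2ℚ :* q :* v)) refl

  pick-v-identity₂ : ∀ b y → b + 3ℚ + y ≡ b + (3ℚ + y)
  pick-v-identity₂ = solve 2 (λ b y → b :+ cst 3ℚ :+ y := b :+ (cst 3ℚ :+ y)) refl

  pick-v-identity₃ : ∀ b y → b + 3ℚ + y ≡ 3ℚ + (b + y)
  pick-v-identity₃ = solve 2 (λ b y → b :+ cst 3ℚ :+ y := cst 3ℚ :+ (b :+ y)) refl

  pick-v-identity₄ : ∀ v y ε d → v * y * (ε * d) ≡ ε * (v * (y * d))
  pick-v-identity₄ = solve 4 (λ v y ε d → v :* y :* (ε :* d) := ε :* (v :* (y :* d))) refl

  pick-v-identity₅ : ∀ b y → b + 3ℚ + y ≡ y + (b + 3ℚ)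
  pick-v-identity₅ = solve 2 (λ b y → b :+ cst 3ℚ :+ y := y :+ (b :+ cst 3ℚ)) refl

  0<u-identity : ∀ v → 1ℚ - v ≡ 2ℚ * v + (1ℚ - 3ℚ * v)
  0<u-identity = solve 1 (λ v → cst 1ℚ :- v := cst 2ℚ :* v :+ (cst 1ℚ :- cst 3ℚ :* v)) refl

  ½≤uq-identity : ∀ q v → 1ℚ - q * v ≡ 1ℚ + q * (- v)
  ½≤uq-identity = solve 2 (λ q v → cst 1ℚ :- q :* v := cst 1ℚ :+ q :* (:- v)) refl

  aq-identity : ∀ x → x * 1ℚ ≡ 4ℚ * (x * (½ * ½))
  aq-identity = solve 1 (λ x → x :* cst 1ℚ := cst 4ℚ :* (x :* (cst ½ :* cst ½))) refl

  prod-identity : ∀ v → 1ℚ ≡ (1ℚ - v) * (1ℚ + v) + v * v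
  prod-identity = solve 1 (λ v → cst 1ℚ := (cst 1ℚ :- v) :* (cst 1ℚ :+ v) :+ v :* v) refl

  uq≤⅔-identity : ∀ x y → ⅔ ≡ x + ⅔ * ((1ℚ - x * y) + x * (y - 1½))
  uq≤⅔-identity = solve 2 (λ x y → cst ⅔ := x :+ cst ⅔ :* (cst 1ℚ :- x :* y :+ x :* (y :- cst 1½))) refl

  y≤-identity : ∀ a u y → y * (a * (u * u)) - a * y * y ≡ a * (u * u * y - y * y)
  y≤-identity = solve 3 (λ a u y → y :* (a :* (u :* u)) :- a :* y :* y := a :* (u :* u :* y :- y :* y)) refl

  y≤-identity₂ : ∀ v → (1ℚ - v) * (1ℚ - v) * v ≡ (1ℚ - v) * (1ℚ - v) * (1ℚ - 3ℚ * v) - (1ℚ - 3ℚ * v) * (1ℚ - 3ℚ * v) + v * v * v * 4ℚ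
  y≤-identity₂ = solve 1 (λ v → (cst 1ℚ :- v) :* (cst 1ℚ :- v) :* v := (cst 1ℚ :- v) :* (cst 1ℚ :- v) :* (cst 1ℚ :- cst 3ℚ :* v) :- (cst 1ℚ :- cst 3ℚ :* v) :* (cst 1ℚ :- cst 3ℚ :* v) :+ v :* v :* v :* cst 4ℚ) refl

  y≤-identity₃ : ∀ a u v → a * (u * u * v) ≡ v * (a * (u * u))
  y≤-identity₃ = solve 3 (λ a u v → a :* (u :* u :* v) := v :* (a :* (u :* u))) refl

  C≥-identity : ∀ y a v t C → v + a * y * C ≡ y * (1ℚ - a * y * t) + ((v - (y - a * y * y)) + a * y * (C - y * (1ℚ - t)))
  C≥-identity = solve 5 (λ y a v t C → v :+ a :* y :* C := y :* (cst 1ℚ :- a :* y :* t) :+ (v :- (y :- a :* y :* y) :+ a :* y :* (C :- y :* (cst 1ℚ :- t)))) refl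

  z-identity : ∀ x → 0ℚ ≡ x - 1ℚ + (1ℚ - x)
  z-identity = solve 1 (λ x → cst 0ℚ := x :- cst 1ℚ :+ (cst 1ℚ :- x)) refl

  loss-identity : ∀ s v M τ τ′ p ξ → s * (v * M * (τ * p) + v * M * τ′ * 0ℚ + s * (v * M * τ′ * ξ)) ≡ s * v * M * τ * p + s * v * M * τ′ * (s * ξ)
  loss-identity = solve 7 (λ s v M τ τ′ p ξ → s :* (v :* M :* (τ :* p) :+ v :* M :* τ′ :* cst 0ℚ :+ s :* (v :* M :* τ′ :* ξ)) := s :* v :* M :* τ :* p :+ s :* v :* M :* τ′ :* (s :* ξ)) refl

  loss-identity₂ : ∀ s v I η p → s * (12ℚ * (v * I) * η * p + 4ℚ * (v * v) * p) ≡ s * v * (12ℚ * I * η + 4ℚ * v) * p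
  loss-identity₂ = solve 5 (λ s v I η p → s :* (cst 12ℚ :* (v :* I) :* η :* p :+ cst 4ℚ :* (v :* v) :* p) := s :* v :* (cst 12ℚ :* I :* η :+ cst 4ℚ :* v) :* p) refl

  loss-identity₃ : ∀ e m l I τ p x → (e + (e + x)) * p ≡ l * m * τ * p + I * p + x * p + ((e - τ * (l * m)) * p + (e - I) * p)
  loss-identity₃ = solve 7 (λ e m l I τ p x → (e :+ (e :+ x)) :* p := l :* m :* τ :* p :+ I :* p :+ x :* p :+ ((e :- τ :* (l :* m)) :* p :+ (e :- I) :* p)) refl

  loss-identity₄ : ∀ l m τ′ K η v p → η * (l * l * m * τ′ * K) * p + 4ℚ * (l * l * m * τ′) * v * p ≡ l * m * τ′ * (l * (K * η + 4ℚ * v) * p)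
  loss-identity₄ = solve 7 (λ l m τ′ K η v p → η :* (l :* l :* m :* τ′ :* K) :* p :+ cst 4ℚ :* (l :* l :* m :* τ′) :* v :* p := l :* m :* τ′ :* (l :* (K :* η :+ cst 4ℚ :* v) :* p)) refl

  loss-identity₅ : ∀ a b c d → a + b + c + d ≡ a + (b + c) + d
  loss-identity₅ = solve 4 (λ a b c d → a :+ b :+ c :+ d := a :+ (b :+ c) :+ d) refl

  main-identity : ∀ C T v Z W p ε → C * W - (¼ * ε + (¼ * ε + 4ℚ * Z * v)) * p ≡ W - ε * p +
    ((C - (1ℚ - 3ℚ * v) * (1ℚ - T)) * W + (3ℚ * v + T) * (p - W) + 3ℚ * v * T * W + (¼ * ε - T) * p + (¼ * ε - v * (3ℚ + 4ℚ * Z)) * p)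
  main-identity = solve 7 (λ C T v Z W p ε → C :* W :- (cst ¼ :* ε :+ (cst ¼ :* ε :+ cst 4ℚ :* Z :* v)) :* p := W :- ε :* p :+ ((C :- (cst 1ℚ :- cst 3ℚ :* v) :* (cst 1ℚ :- T)) :* W :+ (cst 3ℚ :* v :+ T) :* (p :- W) :+ cst 3ℚ :* v :* T :* W :+ (cst ¼ :* ε :- T) :* p :+ (cst ¼ :* ε :- v :* (cst 3ℚ :+ cst 4ℚ :* Z)) :* p)) refl

  main-identity₂ : ∀ a b c → a - b ≡ a - c + (c - b)
  main-identity₂ = solve 3 (λ a b c → a :- b := a :- c :+ (c :- b)) refl

  -- The error ε is spent in quarters. The process runs for S = Lq steps of length v, hence for time
  -- `l` = L/2. All constants here depend on ε only; q and v may adapt to the number of blocks,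
  -- which `η` must not do.
  module Constants (ε : ℚ) (0<ε : 0ℚ < ε) where

    ε₄ : ℚ
    ε₄ = ¼ * ε

    0<ε₄ : 0ℚ < ε₄
    0<ε₄ = 0<* (positive⁻¹ ¼) 0<ε

    L : ℕ
    L = proj₁ (⅔^-small ε₄ 0<ε₄)

    l Im : ℚ
    l = ι L * ½
    Im = 4ℚ ^^ L

    0≤l : 0ℚ ≤ l
    0≤l = ι≥0 L ⊛ nonNegative⁻¹ ½

    0≤Im : 0ℚ ≤ Im
    0≤Im = ^^≥0 L (nonNegative⁻¹ 4ℚ)

    pick-τ : ∃[ τ ] (0ℚ < τ × τ * (l * (Im * Im)) ≤ ε₄)
    pick-τ = shrink ε₄ (l * (Im * Im)) 0<ε₄ (0≤l ⊛ (0≤Im ⊛ 0≤Im))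

    τ : ℚ
    τ = proj₁ pick-τ

    0<τ : 0ℚ < τ
    0<τ = proj₁ (proj₂ pick-τ)

    pick-τ′ : ∃[ τ′ ] (0ℚ < τ′ × 4ℚ * τ * τ′ ≡ 1ℚ)
    pick-τ′ = inv (4ℚ * τ) (0<* (positive⁻¹ 4ℚ) 0<τ)

    τ′ : ℚ
    τ′ = proj₁ pick-τ′

    -- The coefficient with which the growth of the potential, accumulated over time `l`, enters the
    -- loss.
    Z : ℚ
    Z = l * l * (Im * Im) * τ′

    0≤Z : 0ℚ ≤ Z
    0≤Z = 0≤l ⊛ 0≤l ⊛ (0≤Im ⊛ 0≤Im) ⊛ <⇒≤ (proj₁ (proj₂ pick-τ′))

    pick-η : ∃[ η ] (0ℚ < η × η * (Z * (12ℚ * Im)) ≤ ε₄)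
    pick-η = shrink ε₄ (Z * (12ℚ * Im)) 0<ε₄ (0≤Z ⊛ (nonNegative⁻¹ 12ℚ ⊛ 0≤Im))

    η : ℚ
    η = proj₁ pick-η

    0<η : 0ℚ < η
    0<η = proj₁ (proj₂ pick-η)

    -- v = 1/(2q), where 2q exceeds the sum of the three quantities that 1/v has to dominate.
    pick-v : ∀ b → 0ℚ ≤ b → ∃[ q ] ∃[ v ] (0ℚ < v × ι q * v ≡ ½ × v * b ≤ 1ℚ × 3ℚ * v ≤ 1ℚ × v * (3ℚ + 4ℚ * Z) ≤ ε₄)
    pick-v b 0≤b = from (inv ε₄ 0<ε₄)
      where
      from : ∃[ d ] (0ℚ < d × ε₄ * d ≡ 1ℚ) → ∃[ q ] ∃[ v ] (0ℚ < v × ι q * v ≡ ½ × v * b ≤ 1ℚ × 3ℚ * v ≤ 1ℚ × v * (3ℚ + 4ℚ * Z) ≤ ε₄)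
      from (d , 0<d , e) = from′ (inv (2ℚ * ι q) 0<2q)
        where
        Y M : ℚ
        Y = 3ℚ + 4ℚ * Z
        M = b + 3ℚ + Y * d
        0≤Yd : 0ℚ ≤ Y * d
        0≤Yd = (0≤3 ⊕ nonNegative⁻¹ 4ℚ ⊛ 0≤Z) ⊛ <⇒≤ 0<d
        q : ℕ
        q = suc (proj₁ (archimedes M))
        M≤q : M ≤ 2ℚ * ι q
        M≤q = lin (0≤- (proj₂ (archimedes M)) ⊕ (ι≥0 (proj₁ (archimedes M)) ⊕ 0≤2)) (M≤q-identity M (ι (proj₁ (archimedes M))))
        0<2q : 0ℚ < 2ℚ * ι q
        0<2q = 0<* (positive⁻¹ 2ℚ) (0<+ (positive⁻¹ 1ℚ) (ι≥0 (proj₁ (archimedes M))))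
        from′ : ∃[ v ] (0ℚ < v × 2ℚ * ι q * v ≡ 1ℚ) → ∃[ q ] ∃[ v ] (0ℚ < v × ι q * v ≡ ½ × v * b ≤ 1ℚ × 3ℚ * v ≤ 1ℚ × v * (3ℚ + 4ℚ * Z) ≤ ε₄)
        from′ (v , 0<v , e′) = q , v , 0<v , trans (pick-v-identity (ι q) v) (trans (cong (½ *_) e′) (*-identityʳ ½)) ,
            below b (lin (0≤3 ⊕ 0≤Yd) (pick-v-identity₂ b (Y * d))) , (*-comm 3ℚ v ≡≤ below 3ℚ (lin (0≤b ⊕ 0≤Yd) (pick-v-identity₃ b (Y * d)))) ,
            (sym (*-identityʳ (v * Y)) ≡≤ cong (v * Y *_) (sym e) ≡≤ pick-v-identity₄ v Y ε₄ d ≡≤ *-mono-≥0 ε₄ (<⇒≤ 0<ε₄) (below (Y * d) (lin (0≤b ⊕ 0≤3) (pick-v-identity₅ b (Y * d)))) ≤≡ *-identityʳ ε₄)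
          where
          below : ∀ x → x ≤ M → v * x ≤ 1ℚ
          below x h = *-mono-≥0 v (<⇒≤ 0<v) (≤-trans h M≤q) ≤≡ trans (*-comm v (2ℚ * ι q)) e′

    module Main
      {E B : Set} (ps : List E) (bs : List B) (inc : B → E → Bool) (meets eqB : B → B → Bool)
      (inc-3 : ∀ {j} → j ∈ bs → ∑ ps (λ e → 𝟙 (inc j e)) ≡ 3ℚ)
      (meets-≤ : ∀ j t → 𝟙 (meets j t) ≤ ∑ ps (λ e → 𝟙 (inc j e) * 𝟙 (inc t e)))
      (meets-∋ : ∀ j t {e} → e ∈ ps → inc j e ≡ true → inc t e ≡ true → meets j t ≡ true)
      (eqB-sym : ∀ j l → 𝟙 (eqB j l) ≡ 𝟙 (eqB l j))
      (eqB-∑ : ∀ {j} (f : B → ℚ) → j ∈ bs → ∑ bs (λ l → 𝟙 (eqB j l) * f l) ≡ f j)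
      where

      open Packing ps bs inc meets eqB inc-3 meets-≤ meets-∋ eqB-sym eqB-∑ public

      nibble : ∀ w → Small η w → ∃[ P ] (All (λ t → t ∈ bs × 0ℚ < w t) P × Matching P × total w - ε * ∣P∣ ≤ ι (length P))
      nibble w sm = from (pick-v (Im * (4ℚ * ∣B∣)) (0≤Im ⊛ (nonNegative⁻¹ 4ℚ ⊛ ∑-≥0 bs (λ _ → 0≤1))))
        where
        open Small sm
        from : ∃[ q ] ∃[ v ] (0ℚ < v × ι q * v ≡ ½ × v * (Im * (4ℚ * ∣B∣)) ≤ 1ℚ × 3ℚ * v ≤ 1ℚ × v * (3ℚ + 4ℚ * Z) ≤ ε₄) → ∃[ P ] (All (λ t → t ∈ bs × 0ℚ < w t) P × Matching P × total w - ε * ∣P∣ ≤ ι (length P))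
        from (q , v , 0<v , qv , vB , 3v≤1 , vY) = from′ (inv (u * u) (0<* 0<u 0<u))
          where
          u : ℚ
          u = 1ℚ - v
          0<u : 0ℚ < u
          0<u = <-≤-trans (0<* (positive⁻¹ 2ℚ) 0<v) (lin (0≤- 3v≤1) (0<u-identity v))
          0≤v = <⇒≤ 0<v
          0≤u = <⇒≤ 0<u
          from′ : ∃[ a ] (0ℚ < a × u * u * a ≡ 1ℚ) → ∃[ P ] (All (λ t → t ∈ bs × 0ℚ < w t) P × Matching P × total w - ε * ∣P∣ ≤ ι (length P))
          from′ (a , 0<a , uua) = finish (It.iterate S w 1ℚ 1ℚ sm refl 0≤1 ≤-refl (positive⁻¹ 1ℚ) (*-identityˡ (a ^^ S) ≡≤ aS))
            where
            0≤a = <⇒≤ 0<a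
            auu : a * (u * u) ≡ 1ℚ
            auu = trans (*-comm a (u * u)) uua
            1≤a : 1ℚ ≤ a
            1≤a = sym auu ≡≤ *-mono-≥0 a 0≤a (*-mono² 0≤u 0≤1 u≤1 u≤1) ≤≡ *-identityʳ a
              where u≤1 : u ≤ 1ℚ
                    u≤1 = lin 0≤v (u≤1-identity v)
            module It = Iteration η v u a τ τ′ Im (<⇒≤ 0<η) 0<v 3v≤1 refl auu 1≤a (<⇒≤ 0<τ) (<⇒≤ (proj₁ (proj₂ pick-τ′)))
                          (trans (sym (*-assoc 4ℚ τ τ′)) (proj₂ (proj₂ pick-τ′))) 0≤Im (*-assoc v Im (4ℚ * ∣B∣) ≡≤ vB)
            S : ℕ
            S = L ℕ.* q
            ½≤uq : ½ ≤ u ^^ q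
            ½≤uq = trans (cong (λ z → 1ℚ - z) (sym qv)) (½≤uq-identity (ι q) v) ≡≤ bernoulli (- v) q 0≤u
            aq : a ^^ q ≤ 4ℚ
            aq = sym (*-identityʳ (a ^^ q)) ≡≤ aq-identity (a ^^ q) ≡≤ *-mono-≥0 4ℚ (nonNegative⁻¹ 4ℚ) (*-mono-≥0 (a ^^ q) (^^≥0 q 0≤a) (*-mono² (nonNegative⁻¹ ½) (^^≥0 q 0≤u) ½≤uq ½≤uq)
                   ≤≡ trans (cong (a ^^ q *_) (sym (^^-dist u u q))) (trans (sym (^^-dist a (u * u) q)) (trans (cong (_^^ q) auu) (1^^ q))))
            aS : a ^^ S ≤ Im
            aS = ^^-* a q L ≡≤ ^^-mono L (^^≥0 q 0≤a) aq
            -- (1 - v)^q (1 + v)^q ≤ 1, and Bernoulli gives (1 + v)^q ≥ 1 + qv = 3/2.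
            uq≤⅔ : u ^^ q ≤ ⅔
            uq≤⅔ = lin (nonNegative⁻¹ ⅔ ⊛ (0≤- prod ⊕ ^^≥0 q 0≤u ⊛ 0≤- 1½≤)) (uq≤⅔-identity (u ^^ q) ((1ℚ + v) ^^ q))
              where
              1½≤ : 1½ ≤ (1ℚ + v) ^^ q
              1½≤ = cong (1ℚ +_) (sym qv) ≡≤ bernoulli v q (0≤1 ⊕ 0≤v)
              prod : u ^^ q * (1ℚ + v) ^^ q ≤ 1ℚ
              prod = sym (^^-dist u (1ℚ + v) q) ≡≤ ^^-mono q (0≤u ⊛ (0≤1 ⊕ 0≤v)) (lin (0≤v ⊛ 0≤v) (prod-identity v)) ≤≡ 1^^ q
            tS : It.r̃ ^^ S ≤ ε₄
            tS = ≤-trans (^^-mono S It.0≤r̃ It.r̃≤u) (≤-trans (^^-* u q L ≡≤ ^^-mono L (^^≥0 q 0≤u) uq≤⅔) (proj₂ (⅔^-small ε₄ 0<ε₄)))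
            y : ℚ
            y = 1ℚ - 3ℚ * v
            -- As `r̃` = a y, this says that y = 1 - 3v is a subsolution of the recursion for `C`.
            y≤ : y - a * y * y ≤ v
            y≤ = trans (cong (_- a * y * y) (trans (sym (*-identityʳ y)) (cong (y *_) (sym auu)))) (y≤-identity a u y) ≡≤ *-mono-≥0 a 0≤a (lin (0≤v ⊛ 0≤v ⊛ 0≤v ⊛ nonNegative⁻¹ 4ℚ) (y≤-identity₂ v)) ≤≡ trans (y≤-identity₃ a u v) (trans (cong (v *_) auu) (*-identityʳ v))
            C≥ : ∀ s → y * (1ℚ - It.r̃ ^^ s) ≤ It.C s
            C≥ zero = ≤-reflexive (*-zeroʳ y)
            C≥ (suc s) = lin (0≤- y≤ ⊕ It.0≤r̃ ⊛ 0≤- (C≥ s)) (C≥-identity y a v (It.r̃ ^^ s) (It.C s))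
            W≤P : total w ≤ ∣P∣
            W≤P = ≤-trans (lin (0≤2 ⊛ ∑-≥0 bs w≥0) (v≤1-identity (total w))) (3total≤P sm)
            -- The first level is 1, and no load exceeds 1.
            Φ≡0 : Φ 1ℚ w ≡ 0ℚ
            Φ≡0 = trans (∑-cong∈ ps (λ e e∈ → cong (λ z → z * z) (z (load≤1 e∈)))) (∑-0 ps)
              where z : ∀ {x} → x ≤ 1ℚ → (x - 1ℚ) ⁺ ≡ 0ℚ
                    z {x} h = p≥q⇒p⊔q≡p {0ℚ} {x - 1ℚ} (lin (0≤- h) (z-identity x))
            Sv : ι S * v ≡ l
            Sv = trans (cong (_* v) (ι-* L q)) (trans (*-assoc (ι L) (ι q) v) (cong (ι L *_) qv))
            p = ∣P∣
            0≤p : 0ℚ ≤ p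
            0≤p = It.0≤P
            loss : ι S * (It.α + It.β * Φ 1ℚ w + ι S * (It.β * It.ξ)) ≤ (ε₄ + (ε₄ + 4ℚ * Z * v)) * p
            loss = trans (cong (λ z → ι S * (It.α + It.β * z + ι S * (It.β * It.ξ))) Φ≡0) (trans (loss-identity (ι S) v (Im * Im) τ τ′ p It.ξ)
                 (trans (cong (λ z → z * (Im * Im) * τ * p + z * (Im * Im) * τ′ * (ι S * It.ξ)) Sv)
                 (cong (λ z → l * (Im * Im) * τ * p + l * (Im * Im) * τ′ * z) ξ≡)))
                 ≡≤ lin ((0≤- (proj₂ (proj₂ pick-τ)) ⊛ 0≤p) ⊕ (0≤- (proj₂ (proj₂ pick-η)) ⊛ 0≤p)) final
              where
              ξ≡ : ι S * It.ξ ≡ l * (12ℚ * Im * η + 4ℚ * v) * p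
              ξ≡ = trans (loss-identity₂ (ι S) v Im η p) (cong (λ z → z * (12ℚ * Im * η + 4ℚ * v) * p) Sv)
              K = 12ℚ * Im
              rest = (ε₄ - τ * (l * (Im * Im))) * p + (ε₄ - η * (Z * K)) * p
              final : (ε₄ + (ε₄ + 4ℚ * Z * v)) * p ≡ l * (Im * Im) * τ * p + l * (Im * Im) * τ′ * (l * (K * η + 4ℚ * v) * p) + rest
              final = trans (loss-identity₃ ε₄ (Im * Im) l (η * (Z * K)) τ p (4ℚ * Z * v)) (trans (loss-identity₅ (l * (Im * Im) * τ * p) (η * (Z * K) * p) (4ℚ * Z * v * p) rest)
                        (cong (λ z → l * (Im * Im) * τ * p + z + rest) (loss-identity₄ l (Im * Im) τ′ K η v p)))
            T = It.r̃ ^^ S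
            0≤T : 0ℚ ≤ T
            0≤T = ^^≥0 S It.0≤r̃
            main : total w - ε * p ≤ 1ℚ * It.C S * total w - ι S * (It.α + It.β * Φ 1ℚ w + ι S * (It.β * It.ξ))
            main = ≤-trans (lin (0≤- (C≥ S) ⊛ ∑-≥0 bs w≥0 ⊕ (0≤3 ⊛ 0≤v ⊕ 0≤T) ⊛ 0≤- W≤P ⊕ 0≤3 ⊛ 0≤v ⊛ 0≤T ⊛ ∑-≥0 bs w≥0 ⊕ 0≤- tS ⊛ 0≤p ⊕ 0≤- vY ⊛ 0≤p)
                       (main-identity (It.C S) T v Z (total w) p ε))
                     (≤-trans (lin (0≤- loss) (main-identity₂ (It.C S * total w) _ _)) (≤-reflexive (cong (λ z → z * total w - ι S * (It.α + It.β * Φ 1ℚ w + ι S * (It.β * It.ξ))) (sym (*-identityˡ (It.C S))))))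
            finish : It.Result S 1ℚ 1ℚ w → ∃[ P ] (All (λ t → t ∈ bs × 0ℚ < w t) P × Matching P × total w - ε * p ≤ ι (length P))
            finish (P , mem , disj , len) = P , mem , disj , ≤-trans main len

-- Szemerédi's regularity lemma, without equitable classes.

module Regularity where

  open Sums
  open Num
  open Fins
  open import Data.Vec using (lookup; tabulate)

  module _ {n : ℕ} (A : Fin n → Fin n → ℚ) where

    module Partition {k : ℕ} (c : Fin n → Fin k) (φ : Fin k → Fin k → ℚ) where

      size : Fin k → ℚ
      size a = ∑ᶠ (λ x → δ (c x) a)

      dev : Fin k → Fin k → (Fin n → Bool) → (Fin n → Bool) → ℚ
      dev a b S T = ∑² (λ x y → δ (c x) a * δ (c y) b * (𝟙 (S x) * 𝟙 (T y) * (A x y - φ a b)))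

    open Partition

    -- `φ` need not consist of the edge densities: any symmetric class function with small
    -- deviations serves. Deviations are measured against the full class sizes, so S and T are
    -- arbitrary, and the irregular part is counted in vertex pairs.
    record Regular (ε : ℚ) (K : ℕ) : Set where
      field
        {k} : ℕ
        k≤K : k ℕ.≤ K
        c : Fin n → Fin k
        φ : Fin k → Fin k → ℚ
        φ-sym : ∀ a b → φ a b ≡ φ b a
        bad : Fin k → Fin k → Bool
        bad-mass : ∑² (λ x y → 𝟙 (bad (c x) (c y))) ≤ ε * ∑² {n} {n} (λ _ _ → 1ℚ)
        dev≤ : ∀ a b → bad a b ≡ false → ∀ S T → dev c φ a b S T ≤ ε * (size c φ a * size c φ b)
        -dev≤ : ∀ a b → bad a b ≡ false → ∀ S T → - dev c φ a b S T ≤ ε * (size c φ a * size c φ b)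

  -- A class is cut by k witness sets in the role of S and k in the role of T.
  next : ℕ → ℕ
  next k = k ℕ.* (2 ℕ.^ k ℕ.* 2 ℕ.^ k)

  k≤next : ∀ k → k ℕ.≤ next k
  k≤next k = ℕ.m≤m*n k (2 ℕ.^ k ℕ.* 2 ℕ.^ k) {{ℕ.m*n≢0 (2 ℕ.^ k) (2 ℕ.^ k) {{ℕ.m^n≢0 2 k}} {{ℕ.m^n≢0 2 k}}}}

  bound : ℕ → ℕ → ℕ
  bound zero k = k
  bound (suc r) k = bound r (next k)

  k≤bound : ∀ r k → k ℕ.≤ bound r k
  k≤bound zero k = ℕ.≤-refl
  k≤bound (suc r) k = ℕ.≤-trans (k≤next k) (k≤bound r (next k))

  toBit : Bool → Fin 2
  toBit false = zero
  toBit true = suc zero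

  fromBit : Fin 2 → Bool
  fromBit zero = false
  fromBit (suc _) = true

  fromBit-toBit : ∀ b → fromBit (toBit b) ≡ b
  fromBit-toBit false = refl
  fromBit-toBit true = refl

  step-identity : ∀ e d → e * (- d) ≡ - e * d
  step-identity = solve 2 (λ e d → e :* (:- d) := :- e :* d) refl

  step-identity₂ : ∀ e → - e * - e ≡ 1ℚ * (e * e)
  step-identity₂ = solve 1 (λ e → :- e :* (:- e) := cst 1ℚ :* (e :* e)) refl

  ∑eH-identity : ∀ ε b s → ε * ε * (b * s) ≡ b * (ε * (ε * s))
  ∑eH-identity = solve 3 (λ ε b s → ε :* ε :* (b :* s) := b :* (ε :* (ε :* s))) refl

  ∑eH-identity₂ : ∀ d d′ b → d * d′ * b ≡ b * (d * d′)
  ∑eH-identity₂ = solve 3 (λ d d′ b → d :* d′ :* b := b :* (d :* d′)) refl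

  ∑eH-identity₃ : ∀ s d S T e → s * (d * (S * T * e)) ≡ d * (e * (s * (S * T)))
  ∑eH-identity₃ = solve 5 (λ s d S T e → s :* (d :* (S :* T :* e)) := d :* (e :* (s :* (S :* T)))) refl

  ∑H²-identity : ∀ s i j → s * (i * j) * (s * (i * j)) ≡ s * s * (i * i * (j * j))
  ∑H²-identity = solve 3 (λ s i j → s :* (i :* j) :* (s :* (i :* j)) := s :* s :* (i :* i :* (j :* j))) refl

  loss-drop-identity : ∀ A φ H H′ → (A - φ) * (A - φ) - ((A - φ) * H + (A - φ) * H′) + ½ * (H * H + H′ * H′) ≡
    (A - (φ + ½ * (H + H′))) * (A - (φ + ½ * (H + H′))) + ½ * ½ * ((H - H′) * (H - H′))
  loss-drop-identity = solve 4 (λ A φ H H′ → (A :- φ) :* (A :- φ) :- ((A :- φ) :* H :+ (A :- φ) :* H′) :+ cst ½ :* (H :* H :+ H′ :* H′) := (A :- (φ :+ cst ½ :* (H :+ H′))) :* (A :- (φ :+ cst ½ :* (H :+ H′))) :+ cst ½ :* cst ½ :* ((H :- H′) :* (H :- H′))) refl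

  loss-drop-identity₂ : ∀ l E h b → l - b ≡ l - (E + E) + ½ * (h + h) + (2ℚ * (E - b) + (b - h))
  loss-drop-identity₂ = solve 4 (λ l E h b → l :- b := l :- (E :+ E) :+ cst ½ :* (h :+ h) :+ (cst 2ℚ :* (E :- b) :+ (b :- h))) refl

  regularise-identity₂ : ∀ x L L′ y → 0ℚ * y - L + ((L - x) - L′) + L′ ≡ 0ℚ - x
  regularise-identity₂ = solve 4 (λ x L L′ y → cst 0ℚ :* y :- L :+ (L :- x :- L′) :+ L′ := cst 0ℚ :- x) refl

  regularise-identity₃ : ∀ r x y b L → r * (x * y) ≡ L - x * b + (((1ℚ + r) * (x * y) - L) + x * (b - y))
  regularise-identity₃ = solve 5 (λ r x y b L → r :* (x :* y) := L :- x :* b :+ ((cst 1ℚ :+ r) :* (x :* y) :- L :+ x :* (b :- y))) refl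

  module _ {n : ℕ} (A : Fin n → Fin n → ℚ) (A-sym : ∀ x y → A x y ≡ A y x) (A² : ∀ x y → A x y * A x y ≤ 1ℚ)
           (ε : ℚ) (0<ε : 0ℚ < ε) where

    0≤ε = <⇒≤ 0<ε

    ∣V∣² : ℚ
    ∣V∣² = ∑² {n} {n} (λ _ _ → 1ℚ)

    0≤V² : 0ℚ ≤ ∣V∣²
    0≤V² = ∑²-≥0 {n} {n} (λ _ _ → 0≤1)

    module Round {k : ℕ} (c : Fin n → Fin k) (φ : Fin k → Fin k → ℚ) (φ-sym : ∀ a b → φ a b ≡ φ b a) where

      open Partition A c φ

      e : Fin n → Fin n → ℚ
      e x y = A x y - φ (c x) (c y)

      e-sym : ∀ x y → e x y ≡ e y x
      e-sym x y = cong₂ _-_ (A-sym x y) (φ-sym (c x) (c y))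

      -- The squared distance from A to its step function; it falls where the usual index of a
      -- partition rises.
      loss : ℚ
      loss = ∑² (λ x y → e x y * e x y)

      cap : Fin k → Fin k → ℚ
      cap a b = ε * (size a * size b)

      Witness : Fin k → Fin k → Subset n → Subset n → Set
      Witness a b S T = cap a b < dev a b (lookup S) (lookup T) ⊎ cap a b < - dev a b (lookup S) (lookup T)

      Irregular : Fin k → Fin k → Set
      Irregular a b = ∃[ S ] ∃[ T ] Witness a b S T

      irregular? : ∀ a b → Dec (Irregular a b)
      irregular? a b = anySubset? (λ S → anySubset? (λ T → (cap a b <? dev a b (lookup S) (lookup T)) ⊎-dec (cap a b <? - dev a b (lookup S) (lookup T))))

      -- `s` is ±ε with the sign of the witnessed deviation and 0 on regular pairs, so that one
      -- formula treats both kinds.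
      record Step (a b : Fin k) : Set where
        field
          bad : Bool
          s : ℚ
          S T : Fin n → Bool
          gain : 𝟙 bad * (ε * cap a b) ≤ s * dev a b S T
          s² : s * s ≤ 𝟙 bad * (ε * ε)
          regular : bad ≡ false → ¬ Irregular a b

      step : ∀ a b → Step a b
      step a b = from (irregular? a b)
        where
        from : Dec (Irregular a b) → Step a b
        from (yes (S , T , inj₁ h)) = record { bad = true ; s = ε ; S = lookup S ; T = lookup T
          ; gain = *-identityˡ (ε * cap a b) ≡≤ *-mono-≥0 ε 0≤ε (<⇒≤ h) ; s² = ≤-reflexive (sym (*-identityˡ (ε * ε))) ; regular = λ () }
        from (yes (S , T , inj₂ h)) = record { bad = true ; s = - ε ; S = lookup S ; T = lookup T
          ; gain = *-identityˡ (ε * cap a b) ≡≤ *-mono-≥0 ε 0≤ε (<⇒≤ h) ≤≡ step-identity ε (dev a b (lookup S) (lookup T)) ; s² = ≤-reflexive (step-identity₂ ε) ; regular = λ () }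
        from (no h) = record { bad = false ; s = 0ℚ ; S = λ _ → false ; T = λ _ → false
          ; gain = ≤-reflexive (trans (*-zeroˡ (ε * cap a b)) (sym (*-zeroˡ (dev a b (λ _ → false) (λ _ → false))))) ; s² = ≤-reflexive (sym (*-zeroˡ (ε * ε))) ; regular = λ _ → h }

      module St a b = Step (step a b)

      bad : Fin k → Fin k → Bool
      bad = St.bad

      badMass : ℚ
      badMass = ∑² (λ x y → 𝟙 (bad (c x) (c y)))

      H : Fin n → Fin n → ℚ
      H x y = St.s (c x) (c y) * (𝟙 (St.S (c x) (c y) x) * 𝟙 (St.T (c x) (c y) y))

      c′ : Fin n → Fin (next k)
      c′ x = combine (c x) (combine (funToFin (λ b → toBit (St.S (c x) b x))) (funToFin (λ b → toBit (St.T b (c x) x))))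

      class : Fin (next k) → Fin k
      class p = proj₁ (remQuot {k} (2 ℕ.^ k ℕ.* 2 ℕ.^ k) p)

      bits : Fin (next k) → Fin (2 ℕ.^ k) × Fin (2 ℕ.^ k)
      bits p = remQuot {2 ℕ.^ k} (2 ℕ.^ k) (proj₂ (remQuot {k} (2 ℕ.^ k ℕ.* 2 ℕ.^ k) p))

      inS inT : Fin (next k) → Fin k → Bool
      inS p b = fromBit (finToFun {2} {k} (proj₁ (bits p)) b)
      inT p b = fromBit (finToFun {2} {k} (proj₂ (bits p)) b)

      class-c′ : ∀ x → class (c′ x) ≡ c x
      class-c′ x = cong proj₁ (Fin.remQuot-combine (c x) _)

      bits-c′ : ∀ x → bits (c′ x) ≡ (funToFin (λ b → toBit (St.S (c x) b x)) , funToFin (λ b → toBit (St.T b (c x) x)))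
      bits-c′ x = trans (cong (λ z → remQuot {2 ℕ.^ k} (2 ℕ.^ k) (proj₂ z)) (Fin.remQuot-combine (c x) _)) (Fin.remQuot-combine {2 ℕ.^ k} _ _)

      inS-c′ : ∀ x b → inS (c′ x) b ≡ St.S (c x) b x
      inS-c′ x b = trans (cong (λ z → fromBit (finToFun {2} {k} (proj₁ z) b)) (bits-c′ x)) (trans (cong fromBit (Fin.finToFun-funToFin (λ b → toBit (St.S (c x) b x)) b)) (fromBit-toBit _))

      inT-c′ : ∀ x b → inT (c′ x) b ≡ St.T b (c x) x
      inT-c′ x b = trans (cong (λ z → fromBit (finToFun {2} {k} (proj₂ z) b)) (bits-c′ x)) (trans (cong fromBit (Fin.finToFun-funToFin (λ b → toBit (St.T b (c x) x)) b)) (fromBit-toBit _))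

      -- Instead of averaging anew, the density moves by ±ε on the witness rectangle. The witnesses
      -- of (a,b) and (b,a) are unrelated, so the two corrections are averaged to keep `φ′`
      -- symmetric.
      h₀ φ′ : Fin (next k) → Fin (next k) → ℚ
      h₀ p q = St.s (class p) (class q) * (𝟙 (inS p (class q)) * 𝟙 (inT q (class p)))
      φ′ p q = φ (class p) (class q) + ½ * (h₀ p q + h₀ q p)

      φ′-sym : ∀ p q → φ′ p q ≡ φ′ q p
      φ′-sym p q = cong₂ _+_ (φ-sym (class p) (class q)) (cong (½ *_) (+-comm (h₀ p q) (h₀ q p)))

      h₀-c′ : ∀ x y → h₀ (c′ x) (c′ y) ≡ H x y
      h₀-c′ x y = trans (cong₂ (λ a b → St.s a b * (𝟙 (inS (c′ x) b) * 𝟙 (inT (c′ y) a))) (class-c′ x) (class-c′ y))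
        (cong₂ (λ u v → St.s (c x) (c y) * (𝟙 u * 𝟙 v)) (inS-c′ x (c y)) (inT-c′ y (c x)))

      φ′-c′ : ∀ x y → φ′ (c′ x) (c′ y) ≡ φ (c x) (c y) + ½ * (H x y + H y x)
      φ′-c′ x y = cong₂ _+_ (cong₂ φ (class-c′ x) (class-c′ y)) (cong (½ *_) (cong₂ _+_ (h₀-c′ x y) (h₀-c′ y x)))

      ∑eH : ε * ε * badMass ≤ ∑² (λ x y → e x y * H x y)
      ∑eH = begin
        ε * ε * badMass ≡⟨ cong (ε * ε *_) (∑²-class c (λ a b _ _ → 𝟙 (bad a b))) ⟩
        ε * ε * ∑² (λ a b → ∑² (λ x y → δ (c x) a * δ (c y) b * 𝟙 (bad a b))) ≡⟨ sym (∑²-* (ε * ε) _) ⟩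
        ∑² (λ a b → ε * ε * ∑² (λ x y → δ (c x) a * δ (c y) b * 𝟙 (bad a b))) ≡⟨ ∑²-cong (λ a b → cong (ε * ε *_) (eq₁ a b)) ⟩
        ∑² (λ a b → ε * ε * (𝟙 (bad a b) * (size a * size b))) ≤⟨ ∑²-mono (λ a b → ∑eH-identity ε (𝟙 (bad a b)) (size a * size b) ≡≤ St.gain a b) ⟩
        ∑² (λ a b → St.s a b * dev a b (St.S a b) (St.T a b)) ≡⟨ ∑²-cong eq₂ ⟩
        ∑² (λ a b → ∑² (λ x y → δ (c x) a * δ (c y) b * ((A x y - φ a b) * (St.s a b * (𝟙 (St.S a b x) * 𝟙 (St.T a b y)))))) ≡⟨ sym (∑²-class c (λ a b x y → (A x y - φ a b) * (St.s a b * (𝟙 (St.S a b x) * 𝟙 (St.T a b y))))) ⟩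
        ∑² (λ x y → e x y * H x y) ∎
        where
        open ≤-Reasoning
        eq₁ : ∀ a b → ∑² (λ x y → δ (c x) a * δ (c y) b * 𝟙 (bad a b)) ≡ 𝟙 (bad a b) * (size a * size b)
        eq₁ a b = trans (∑²-cong (λ x y → ∑eH-identity₂ (δ (c x) a) (δ (c y) b) (𝟙 (bad a b)))) (trans (∑²-* (𝟙 (bad a b)) _) (cong (𝟙 (bad a b) *_) (∑²-× (λ x → δ (c x) a) (λ y → δ (c y) b))))
        eq₂ : ∀ a b → St.s a b * dev a b (St.S a b) (St.T a b) ≡ ∑² (λ x y → δ (c x) a * δ (c y) b * ((A x y - φ a b) * (St.s a b * (𝟙 (St.S a b x) * 𝟙 (St.T a b y)))))
        eq₂ a b = trans (sym (∑²-* (St.s a b) _)) (∑²-cong (λ x y → ∑eH-identity₃ (St.s a b) (δ (c x) a * δ (c y) b) (𝟙 (St.S a b x)) (𝟙 (St.T a b y)) (A x y - φ a b)))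

      ∑H² : ∑² (λ x y → H x y * H x y) ≤ ε * ε * badMass
      ∑H² = ≤-trans (∑²-mono term) (∑²-* (ε * ε) (λ x y → 𝟙 (bad (c x) (c y))) ≡≤ ≤-refl)
        where
        term : ∀ x y → H x y * H x y ≤ ε * ε * 𝟙 (bad (c x) (c y))
        term x y = ≤-trans (∑H²-identity s i j ≡≤ *-mono-≥0 (s * s) (sq≥0 s) (*-mono² (sq≥0 i) 0≤1 (sq≤1 (St.S (c x) (c y) x)) (sq≤1 (St.T (c x) (c y) y))))
                   (*-identityʳ (s * s) ≡≤ St.s² (c x) (c y) ≤≡ *-comm _ (ε * ε))
          where
          s = St.s (c x) (c y)
          i = 𝟙 (St.S (c x) (c y) x)
          j = 𝟙 (St.T (c x) (c y) y)
          sq≤1 : ∀ b → 𝟙 b * 𝟙 b ≤ 1ℚ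
          sq≤1 b = 𝟙-sq b ≡≤ 𝟙≤1 b

      loss′ : ℚ
      loss′ = ∑² (λ x y → (A x y - φ′ (c′ x) (c′ y)) * (A x y - φ′ (c′ x) (c′ y)))

      -- Subtracting H changes the loss by -2∑eH + ∑H², where ∑eH is at least and ∑H² at most
      -- ε²·`badMass`. Symmetrising H does no harm: e is symmetric and squaring is convex.
      loss-drop : loss′ ≤ loss - ε * ε * badMass
      loss-drop = ≤-trans (∑²-mono term) (eq ≡≤ lin (0≤2 ⊛ 0≤- ∑eH ⊕ 0≤- ∑H²) (loss-drop-identity₂ loss (∑² eH) (∑² HH) (ε * ε * badMass)))
        where
        eH HH : Fin n → Fin n → ℚ
        eH x y = e x y * H x y
        HH x y = H x y * H x y
        T : Fin n → Fin n → ℚ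
        T x y = e x y * e x y - (eH x y + e x y * H y x) + ½ * (HH x y + HH y x)
        term : ∀ x y → (A x y - φ′ (c′ x) (c′ y)) * (A x y - φ′ (c′ x) (c′ y)) ≤ T x y
        term x y = cong (λ z → (A x y - z) * (A x y - z)) (φ′-c′ x y) ≡≤
                   lin (nonNegative⁻¹ (½ * ½) ⊛ sq≥0 (H x y - H y x)) (loss-drop-identity (A x y) (φ (c x) (c y)) (H x y) (H y x))
        eq : ∑² T ≡ loss - (∑² eH + ∑² eH) + ½ * (∑² HH + ∑² HH)
        eq = trans (∑²-+ (λ x y → e x y * e x y - (eH x y + e x y * H y x)) (λ x y → ½ * (HH x y + HH y x)))
          (cong₂ _+_
            (trans (∑²-- (λ x y → e x y * e x y) (λ x y → eH x y + e x y * H y x)) (cong (λ z → loss - z)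
               (trans (∑²-+ eH (λ x y → e x y * H y x)) (cong (∑² eH +_) (trans (∑ᶠ-swap (λ x y → e x y * H y x)) (∑²-cong (λ y x → cong (_* H y x) (e-sym x y))))))))
            (trans (∑²-* ½ (λ x y → HH x y + HH y x)) (cong (½ *_) (trans (∑²-+ HH (λ x y → HH y x)) (cong (∑² HH +_) (∑ᶠ-swap (λ x y → HH y x)))))))

      good : badMass ≤ ε * ∣V∣² → Regular A ε k
      good h = record { k≤K = ℕ.≤-refl ; c = c ; φ = φ ; φ-sym = φ-sym ; bad = bad ; bad-mass = h
        ; dev≤ = λ a b b≡ S T → ≮⇒≥ (λ lt → St.regular a b b≡ (tabulate S , tabulate T , inj₁ (subst (cap a b <_) (dev-tab a b S T) lt)))
        ; -dev≤ = λ a b b≡ S T → ≮⇒≥ (λ lt → St.regular a b b≡ (tabulate S , tabulate T , inj₂ (subst (λ z → cap a b < - z) (dev-tab a b S T) lt))) }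
        where
        dev-tab : ∀ a b S T → dev a b S T ≡ dev a b (lookup (tabulate S)) (lookup (tabulate T))
        dev-tab a b S T = ∑²-cong (λ x y → cong₂ (λ u v → δ (c x) a * δ (c y) b * (𝟙 u * 𝟙 v * (A x y - φ a b))) (sym (lookup∘tabulate S x)) (sym (lookup∘tabulate T y)))

    regularise : ∀ r {k} (c : Fin n → Fin k) φ (φ-sym : ∀ a b → φ a b ≡ φ b a) →
      Round.loss c φ φ-sym ≤ ι r * (ε * ε * (ε * ∣V∣²)) → Regular A ε (bound r k)
    regularise r {k} c φ φ-sym loss≤ = from r loss≤ (badMass ≤? ε * ∣V∣²)
      where
      open Round c φ φ-sym
      0≤loss′ : 0ℚ ≤ loss′
      0≤loss′ = ∑²-≥0 {n} {n} (λ x y → sq≥0 (A x y - φ′ (c′ x) (c′ y)))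
      weaken : ∀ {K K′} → K ℕ.≤ K′ → Regular A ε K → Regular A ε K′
      weaken h R = record { Regular R hiding (k≤K) ; k≤K = ℕ.≤-trans (Regular.k≤K R) h }
      from : ∀ r → loss ≤ ι r * (ε * ε * (ε * ∣V∣²)) → Dec (badMass ≤ ε * ∣V∣²) → Regular A ε (bound r k)
      from r _ (yes h) = weaken (k≤bound r k) (good h)
      from zero h (no b) = ⊥-elim (b (≤-trans (*-cancel-≤ (ε * ε) (0<* 0<ε 0<ε) le) (0≤ε ⊛ 0≤V²)))
        where
        le : ε * ε * badMass ≤ ε * ε * 0ℚ
        le = -≥0 (0≤- h ⊕ 0≤- loss-drop ⊕ 0≤loss′ ≤≡ regularise-identity₂ (ε * ε * badMass) loss loss′ (ε * ε * (ε * ∣V∣²))) ≤≡ sym (*-zeroʳ (ε * ε))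
      from (suc r) h (no b) = regularise r c′ φ′ φ′-sym (≤-trans loss-drop (lin (0≤- h ⊕ (0≤ε ⊛ 0≤ε) ⊛ 0≤- (≰⇒≥ b)) (regularise-identity₃ (ι r) (ε * ε) (ε * ∣V∣²) badMass loss)))
        where
        ≰⇒≥ : ∀ {a b} → ¬ (a ≤ b) → b ≤ a
        ≰⇒≥ h = <⇒≤ (≰⇒> h)

  rounds : ∀ ε → 0ℚ < ε → ∃[ R ] 1ℚ ≤ ι R * (ε * ε * ε)
  rounds ε 0<ε = from (inv (ε * ε * ε) (0<* (0<* 0<ε 0<ε) 0<ε))
    where
    from : ∃[ d ] (0ℚ < d × ε * ε * ε * d ≡ 1ℚ) → ∃[ R ] 1ℚ ≤ ι R * (ε * ε * ε)
    from (d , 0<d , e) = proj₁ (archimedes d) , (trans (sym e) (*-comm (ε * ε * ε) d) ≡≤ *-mono-≥0ʳ (ε * ε * ε) (<⇒≤ (0<* (0<* 0<ε 0<ε) 0<ε)) (proj₂ (archimedes d)))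

  -- One class with φ = 0 has loss at most n². Every failed round removes more than ε³n² of it, and
  -- the loss stays nonnegative, so about ε⁻³ rounds suffice.
  regularity : ∀ ε → 0ℚ < ε → ∃[ K ] (∀ {n} (A : Fin n → Fin n → ℚ) → (∀ x y → A x y ≡ A y x) → (∀ x y → A x y * A x y ≤ 1ℚ) → Regular A ε K)
  regularity ε 0<ε = bound R 1 , λ A A-sym A² → regularise A A-sym A² ε 0<ε R (λ _ → zero) (λ _ _ → 0ℚ) (λ _ _ → refl)
      (≤-trans (∑²-mono (λ x y → cong (λ z → z * z) (lem (A x y)) ≡≤ A² x y)) (sym (*-identityˡ _) ≡≤ *-mono-≥0ʳ (∣V∣² A A-sym A² ε 0<ε) (0≤V² A A-sym A² ε 0<ε) 1≤ ≤≡ lem₂ (ι R) ε (∣V∣² A A-sym A² ε 0<ε)))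
    where
    R = proj₁ (rounds ε 0<ε)
    1≤ = proj₂ (rounds ε 0<ε)
    lem : ∀ a → a - 0ℚ ≡ a
    lem = solve 1 (λ a → a :- cst 0ℚ := a) refl
    lem₂ : ∀ r e v → r * (e * e * e) * v ≡ r * (e * e * (e * v))
    lem₂ = solve 3 (λ r e v → r :* (e :* e :* e) :* v := r :* (e :* e :* (e :* v))) refl

-- Linear programming duality over the rationals.

module LP where

  open Sums
  open Num
  open Fins
  open import Data.List using (tabulate)

  opaque
    unfolding ∑ᶠ

    ∑ᶠ-zero : (f : Fin 0 → ℚ) → ∑ᶠ f ≡ 0ℚ
    ∑ᶠ-zero f = refl

    ∑ᶠ-suc : ∀ {n} (f : Fin (suc n) → ℚ) → ∑ᶠ f ≡ f zero + ∑ᶠ (λ i → f (suc i))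
    ∑ᶠ-suc {n} f = cong (f zero +_) (trans (cong (λ xs → ∑ xs f) (sym (map-tabulate (λ i → i) suc))) (∑-map suc (allFin n) f))

  ∑ᶠ-↑ : ∀ m {n} (f : Fin (m ℕ.+ n) → ℚ) → ∑ᶠ f ≡ ∑ᶠ (λ i → f (i ↑ˡ n)) + ∑ᶠ (λ j → f (m ↑ʳ j))
  ∑ᶠ-↑ zero f = trans (sym (+-identityˡ (∑ᶠ f))) (cong (_+ ∑ᶠ f) (sym (∑ᶠ-zero _)))
  ∑ᶠ-↑ (suc m) {n} f = trans (∑ᶠ-suc f) (trans (cong (f zero +_) (∑ᶠ-↑ m (λ i → f (suc i))))
    (trans (sym (+-assoc (f zero) _ _)) (cong (_+ ∑ᶠ (λ j → f (suc m ↑ʳ j))) (sym (∑ᶠ-suc (λ i → f (i ↑ˡ n)))))))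

  ∑ᶠ-combine : ∀ m {n} (f : Fin (m ℕ.* n) → ℚ) → ∑ᶠ f ≡ ∑² (λ i j → f (combine {m} {n} i j))
  ∑ᶠ-combine zero f = trans (∑ᶠ-zero f) (sym (∑ᶠ-zero _))
  ∑ᶠ-combine (suc m) {n} f = trans (∑ᶠ-↑ n f) (trans (cong (∑ᶠ (λ j → f (combine {suc m} {n} zero j)) +_) (∑ᶠ-combine m (λ i → f (n ↑ʳ i)))) (sym (∑ᶠ-suc (λ i → ∑ᶠ (λ j → f (combine {suc m} {n} i j))))))

  -- The value 0 at 0 only serves totality; where it could enter a formula later, another factor
  -- vanishes.
  recip : ℚ → ℚ
  recip x = from (x ≟ 0ℚ)
    where from : Dec (x ≡ 0ℚ) → ℚ
          from (yes _) = 0ℚ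
          from (no p) = (1/ x) {{≢-nonZero p}}

  recip-pos : ∀ {x} → 0ℚ < x → x * recip x ≡ 1ℚ × 0ℚ < recip x
  recip-pos {x} p with x ≟ 0ℚ
  ... | yes refl = ⊥-elim (<-irrefl refl p)
  ... | no q = *-inverseʳ x {{≢-nonZero q}} , positive⁻¹ _ {{1/pos⇒pos x {{positive p}}}}

  recip-neg : ∀ {x} → x < 0ℚ → x * recip x ≡ 1ℚ × recip x < 0ℚ
  recip-neg {x} p with x ≟ 0ℚ
  ... | yes refl = ⊥-elim (<-irrefl refl p)
  ... | no q = *-inverseʳ x {{≢-nonZero q}} , negative⁻¹ _ {{1/neg⇒neg x {{negative p}}}}

  -- Helly's theorem on the line, the core of an elimination step. Without any bounds the point
  -- defaults to 0.
  between : ∀ ls us → (∀ {l u} → l ∈ ls → u ∈ us → l ≤ u) → ∃[ x ] (All (_≤ x) ls × All (x ≤_) us)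
  between [] [] h = 0ℚ , [] , []
  between [] (u ∷ us) h = proj₁ rec ⊓ u , [] , p⊓q≤q (proj₁ rec) u ∷ All.map (≤-trans (p⊓q≤p (proj₁ rec) u)) (proj₂ (proj₂ rec))
    where rec = between [] us (λ ())
  between (l ∷ ls) us h = proj₁ rec ⊔ l , p≤q⊔p (proj₁ rec) l ∷ All.map (λ q → ≤-trans q (p≤p⊔q (proj₁ rec) l)) (proj₁ (proj₂ rec)) ,
      All.tabulate (λ {u} u∈ → ⊔-lub (All.lookup (proj₂ (proj₂ rec)) u∈) (h (here refl) u∈))
    where rec = between ls us (λ l∈ u∈ → h (there l∈) u∈)

  Con : ℕ → Set
  Con N = (Fin N → ℚ) × ℚ

  dot : ∀ {N} → (Fin N → ℚ) → (Fin N → ℚ) → ℚ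
  dot a x = ∑ᶠ (λ i → a i * x i)

  Sat : ∀ {N} → (Fin N → ℚ) → Con N → Set
  Sat x (a , b) = dot a x ≤ b

  comb : ∀ {N} → ℚ → Con N → ℚ → Con N → Con N
  comb s (a , b) t (a′ , b′) = (λ i → s * a i + t * a′ i) , s * b + t * b′

  record Cone {N} (P : Con N → Set) : Set where
    field
      P-comb : ∀ {s t c d} → 0ℚ ≤ s → 0ℚ ≤ t → P c → P d → P (comb s c t d)

  Lift-cone-identity : ∀ s t → s * 0ℚ + t * 0ℚ ≡ 0ℚ
  Lift-cone-identity = solve 2 (λ s t → s :* cst 0ℚ :+ t :* cst 0ℚ := cst 0ℚ) refl

  elim-P-identity : ∀ x y → - y * x + x * y ≡ 0ℚ
  elim-P-identity = solve 2 (λ x y → :- y :* x :+ x :* y := cst 0ℚ) refl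

  sat-elim-identity : ∀ s t b b′ d d′ → s * b + t * b′ - (s * d + t * d′) ≡ s * (b - d) + t * (b′ - d′)
  sat-elim-identity = solve 6 (λ s t b b′ d d′ → s :* b :+ t :* b′ :- (s :* d :+ t :* d′) := s :* (b :- d) :+ t :* (b′ :- d′)) refl

  sat-elim-identity₂ : ∀ s a t a′ x → (s * a + t * a′) * x ≡ s * (a * x) + t * (a′ * x)
  sat-elim-identity₂ = solve 5 (λ s a t a′ x → (s :* a :+ t :* a′) :* x := s :* (a :* x) :+ t :* (a′ :* x)) refl

  sep′-identity : ∀ u l → u ≡ l + (1ℚ * u - 1ℚ * l)
  sep′-identity = solve 2 (λ u l → u := l :+ (cst 1ℚ :* u :- cst 1ℚ :* l)) refl

  sep′-identity₂ : ∀ p q rp rq sp sq → rq * sq + (q * rq * (rp * sp) - p * rp * (rq * sq)) ≡ rq * sq + rp * - rq * (- q * sp + p * sq)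
  sep′-identity₂ = solve 6 (λ p q rp rq sp sq → rq :* sq :+ (q :* rq :* (rp :* sp) :- p :* rp :* (rq :* sq)) := rq :* sq :+ rp :* (:- rq) :* (:- q :* sp :+ p :* sq)) refl

  extend-identity : ∀ h x₀ d b → b ≡ h * x₀ + d + (- h * x₀ + (b - d))
  extend-identity = solve 4 (λ h x₀ d b → b := h :* x₀ :+ d :+ (:- h :* x₀ :+ (b :- d))) refl

  check-identity : ∀ h x r s → - h * x + h * r * s ≡ h * (r * s - x)
  check-identity = solve 4 (λ h x r s → :- h :* x :+ h :* r :* s := h :* (r :* s :- x)) refl

  check-identity₂ : ∀ h x r s → - h * x + h * r * s ≡ - h * (x - r * s)
  check-identity₂ = solve 4 (λ h x r s → :- h :* x :+ h :* r :* s := :- h :* (x :- r :* s)) refl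

  module Eliminate {N : ℕ} where

    hd : Con (suc N) → ℚ
    hd (a , _) = a zero

    tl : Con (suc N) → Con N
    tl (a , b) = (λ i → a (suc i)) , b

    elim : Con (suc N) → Con (suc N) → Con (suc N)
    elim p q = comb (- hd q) p (hd p) q

    ups downs zer : List (Con (suc N)) → List (Con (suc N))
    ups = filter (λ c → 0ℚ <? hd c)
    downs = filter (λ c → hd c <? 0ℚ)
    zer = filter (λ c → hd c ≟ 0ℚ)

    reduced : List (Con (suc N)) → List (Con N)
    reduced cs = map tl (zer cs) ++ concatMap (λ p → map (λ q → tl (elim p q)) (downs cs)) (ups cs)

    -- Remembers from which constraint in one more variable a reduced one came, so that a
    -- contradiction found at the end is still a nonnegative combination of the original
    -- constraints.
    Lift : (Con (suc N) → Set) → Con N → Set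
    Lift P c = ∃[ d ] (P d × hd d ≡ 0ℚ × tl d ≡ c)

    Lift-cone : ∀ {P} → Cone P → Cone (Lift P)
    Lift-cone {P} C = record { P-comb = λ { {s} {t} 0≤s 0≤t (d , Pd , d0 , refl) (d′ , Pd′ , d0′ , refl) →
        comb s d t d′ , Cone.P-comb C 0≤s 0≤t Pd Pd′ , trans (cong₂ (λ x y → s * x + t * y) d0 d0′) (Lift-cone-identity s t) , refl } }

    reduced-P : ∀ {P} → Cone P → ∀ {cs} → All P cs → All (Lift P) (reduced cs)
    reduced-P {P} C {cs} Ps = All.++⁺ (All.map⁺ (All.tabulate zer-P)) (All.concat⁺ (All.map⁺ (All.tabulate (λ {p} p∈ → All.map⁺ (All.tabulate (λ {q} q∈ → elim-P p∈ q∈))))))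
      where
      zer-P : ∀ {c} → c ∈ zer cs → Lift P (tl c)
      zer-P {c} c∈ = c , All.lookup Ps (proj₁ (∈-filter⁻ (λ c → hd c ≟ 0ℚ) {xs = cs} c∈)) , proj₂ (∈-filter⁻ (λ c → hd c ≟ 0ℚ) {xs = cs} c∈) , refl
      elim-P : ∀ {p q} → p ∈ ups cs → q ∈ downs cs → Lift P (tl (elim p q))
      elim-P {p} {q} p∈ q∈ = from (∈-filter⁻ (λ c → 0ℚ <? hd c) {xs = cs} p∈) (∈-filter⁻ (λ c → hd c <? 0ℚ) {xs = cs} q∈)
        where
        from : p ∈ cs × 0ℚ < hd p → q ∈ cs × hd q < 0ℚ → Lift P (tl (elim p q))
        from (p∈ , 0<p) (q∈ , q<0) = elim p q , Cone.P-comb C (neg-antimono-≤ (<⇒≤ q<0)) (<⇒≤ 0<p) (All.lookup Ps p∈) (All.lookup Ps q∈) , elim-P-identity (hd p) (hd q) , refl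

    cons : ℚ → (Fin N → ℚ) → Fin (suc N) → ℚ
    cons x₀ x zero = x₀
    cons x₀ x (suc i) = x i

    dot-suc : ∀ (c : Con (suc N)) x₀ x → dot (proj₁ c) (cons x₀ x) ≡ hd c * x₀ + dot (proj₁ (tl c)) x
    dot-suc c x₀ x = ∑ᶠ-suc _

    -- Given the other variables, constraints with negative leading coefficient are lower bounds for
    -- the first and those with positive one upper bounds; the eliminated constraints say that no
    -- lower bound exceeds an upper one.
    extend : ∀ cs x → All (Sat x) (reduced cs) → ∃[ x′ ] All (Sat x′) cs
    extend cs x sat = from (between (map bnd (downs cs)) (map bnd (ups cs)) sep)
      where
      slack : Con (suc N) → ℚ
      slack c = proj₂ c - dot (proj₁ (tl c)) x
      bnd : Con (suc N) → ℚ
      bnd c = recip (hd c) * slack c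
      sat-elim : ∀ {p q} → p ∈ ups cs → q ∈ downs cs → 0ℚ ≤ - hd q * slack p + hd p * slack q
      sat-elim {p} {q} p∈ q∈ = 0≤- (All.lookup sat (∈-++⁺ʳ (map tl (zer cs)) (∈-concatMap⁺ (λ p → map (λ q → tl (elim p q)) (downs cs)) (Any.map (λ { refl → ∈-map⁺ (λ q → tl (elim p q)) q∈ }) p∈)))) ≤≡
          trans (cong (λ z → proj₂ (elim p q) - z) dots) (sat-elim-identity (- hd q) (hd p) (proj₂ p) (proj₂ q) (dot (proj₁ (tl p)) x) (dot (proj₁ (tl q)) x))
        where
        dots : dot (proj₁ (tl (elim p q))) x ≡ - hd q * dot (proj₁ (tl p)) x + hd p * dot (proj₁ (tl q)) x
        dots = trans (∑ᶠ-cong (λ i → sat-elim-identity₂ (- hd q) (proj₁ p (suc i)) (hd p) (proj₁ q (suc i)) (x i)))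
          (trans (∑ᶠ-+ (λ i → - hd q * (proj₁ p (suc i) * x i)) (λ i → hd p * (proj₁ q (suc i) * x i))) (cong₂ _+_ (∑ᶠ-* (- hd q) _) (∑ᶠ-* (hd p) _)))
      sep′ : ∀ {p q} → p ∈ ups cs → q ∈ downs cs → bnd q ≤ bnd p
      sep′ {p} {q} p∈ q∈ = lin (<⇒≤ (proj₂ rp) ⊛ neg-antimono-≤ (<⇒≤ (proj₂ rq)) ⊛ sat-elim p∈ q∈)
          (trans (sep′-identity (bnd p) (bnd q)) (trans (cong₂ (λ u v → bnd q + (u * bnd p - v * bnd q)) (sym (proj₁ rq)) (sym (proj₁ rp))) (sep′-identity₂ (hd p) (hd q) (recip (hd p)) (recip (hd q)) (slack p) (slack q))))
        where
        rp = recip-pos (proj₂ (∈-filter⁻ (λ c → 0ℚ <? hd c) {xs = cs} p∈))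
        rq = recip-neg (proj₂ (∈-filter⁻ (λ c → hd c <? 0ℚ) {xs = cs} q∈))
      sep : ∀ {l u} → l ∈ map bnd (downs cs) → u ∈ map bnd (ups cs) → l ≤ u
      sep l∈ u∈ = from (∈-map⁻ bnd l∈) (∈-map⁻ bnd u∈)
        where from : ∀ {l u} → ∃[ q ] (q ∈ downs cs × l ≡ bnd q) → ∃[ p ] (p ∈ ups cs × u ≡ bnd p) → l ≤ u
              from (q , q∈ , refl) (p , p∈ , refl) = sep′ p∈ q∈
      from : ∃[ x₀ ] (All (_≤ x₀) (map bnd (downs cs)) × All (x₀ ≤_) (map bnd (ups cs))) → ∃[ x′ ] All (Sat x′) cs
      from (x₀ , lo , hi) = cons x₀ x , All.tabulate (λ {c} c∈ → dot-suc c x₀ x ≡≤ check c c∈ (<-cmp (hd c) 0ℚ))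
        where
        open import Relation.Binary.Definitions using (Tri; tri<; tri≈; tri>)
        check : ∀ c → c ∈ cs → Tri (hd c < 0ℚ) (hd c ≡ 0ℚ) (0ℚ < hd c) → hd c * x₀ + dot (proj₁ (tl c)) x ≤ proj₂ c
        check c c∈ (tri≈ _ eq _) = trans (cong (λ z → z * x₀ + dot (proj₁ (tl c)) x) eq) (trans (cong (_+ dot (proj₁ (tl c)) x) (*-zeroˡ x₀)) (+-identityˡ _)) ≡≤
          All.lookup sat (∈-++⁺ˡ (∈-map⁺ tl (∈-filter⁺ (λ c → hd c ≟ 0ℚ) c∈ eq)))
        check c c∈ (tri> _ _ gt) = lin (<⇒≤ gt ⊛ 0≤- (All.lookup hi (∈-map⁺ bnd (∈-filter⁺ (λ c → 0ℚ <? hd c) c∈ gt))))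
            (trans (extend-identity (hd c) x₀ (dot (proj₁ (tl c)) x) (proj₂ c)) (cong (hd c * x₀ + dot (proj₁ (tl c)) x +_) (trans (cong (- hd c * x₀ +_) (trans (sym (*-identityˡ (slack c))) (cong (_* slack c) (sym (proj₁ (recip-pos gt)))))) (check-identity (hd c) x₀ (recip (hd c)) (slack c)))))
        check c c∈ (tri< lt _ _) = lin (neg-antimono-≤ (<⇒≤ lt) ⊛ 0≤- (All.lookup lo (∈-map⁺ bnd (∈-filter⁺ (λ c → hd c <? 0ℚ) c∈ lt))))
            (trans (extend-identity (hd c) x₀ (dot (proj₁ (tl c)) x) (proj₂ c)) (cong (hd c * x₀ + dot (proj₁ (tl c)) x +_) (trans (cong (- hd c * x₀ +_) (trans (sym (*-identityˡ (slack c))) (cong (_* slack c) (sym (proj₁ (recip-neg lt)))))) (check-identity₂ (hd c) x₀ (recip (hd c)) (slack c)))))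

  -- Farkas' lemma by Fourier–Motzkin elimination; P records which nonnegative combinations of the constraints were formed.
  farkas : ∀ N (P : Con N → Set) → Cone P → ∀ cs → All P cs →
    (∃[ x ] All (Sat x) cs) ⊎ (∃[ c ] (P c × (∀ i → proj₁ c i ≡ 0ℚ) × proj₂ c < 0ℚ))
  farkas zero P C cs Ps with All.all? (λ c → 0ℚ ≤? proj₂ c) cs
  ... | yes h = inj₁ ((λ ()) , All.map (λ {c} p → ∑ᶠ-zero (λ i → proj₁ c i * _) ≡≤ p) h)
  ... | no h = inj₂ (from (All.¬All⇒Any¬ (λ c → 0ℚ ≤? proj₂ c) cs h) Ps)
    where
    from : ∀ {cs} → Any.Any (λ c → ¬ (0ℚ ≤ proj₂ c)) cs → All P cs → ∃[ c ] (P c × (∀ i → proj₁ c i ≡ 0ℚ) × proj₂ c < 0ℚ)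
    from (here p) (Pc ∷ _) = _ , Pc , (λ ()) , ≰⇒> p
    from (there m) (_ ∷ Ps) = from m Ps
  farkas (suc N) P C cs Ps = [ inj₁ ∘ (λ { (x , sat) → extend cs x sat }) , inj₂ ∘ lift ]′ (farkas N (Lift P) (Lift-cone C) (reduced cs) (reduced-P C Ps))
    where
    open Eliminate
    lift : ∃[ c ] (Lift P c × (∀ i → proj₁ c i ≡ 0ℚ) × proj₂ c < 0ℚ) → ∃[ c ] (P c × (∀ i → proj₁ c i ≡ 0ℚ) × proj₂ c < 0ℚ)
    lift (_ , (d , Pd , d0 , refl) , zs , lt) = d , Pd , (λ { zero → d0 ; (suc i) → zs i }) , lt

  ∑-lin-identity : ∀ f u v s t → f * (s * u + t * v) ≡ s * (f * u) + t * (f * v)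
  ∑-lin-identity = solve 5 (λ f u v s t → f :* (s :* u :+ t :* v) := s :* (f :* u) :+ t :* (f :* v)) refl

  Cert-comb-identity : ∀ s t u v γ γ′ b → s * (u - γ * b) + t * (v - γ′ * b) ≡ s * u + t * v - (s * γ + t * γ′) * b
  Cert-comb-identity = solve 7 (λ s t u v γ γ′ b → s :* (u :- γ :* b) :+ t :* (v :- γ′ :* b) := s :* u :+ t :* v :- (s :* γ :+ t :* γ′) :* b) refl

  Cert-comb-identity₂ : ∀ s t u v γ γ′ c → s * (γ * c - u) + t * (γ′ * c - v) ≡ (s * γ + t * γ′) * c - (s * u + t * v)
  Cert-comb-identity₂ = solve 7 (λ s t u v γ γ′ c → s :* (γ :* c :- u) :+ t :* (γ′ :* c :- v) := (s :* γ :+ t :* γ′) :* c :- (s :* u :+ t :* v)) refl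

  certs-identity : ∀ b → - b ≡ 0ℚ - 1ℚ * b
  certs-identity = solve 1 (λ b → :- b := cst 0ℚ :- cst 1ℚ :* b) refl

  certs-identity₂ : ∀ c → c ≡ 1ℚ * c - 0ℚ
  certs-identity₂ = solve 1 (λ c → c := cst 1ℚ :* c :- cst 0ℚ) refl

  certs-identity₃ : ∀ m b → m ≡ m - 0ℚ * b
  certs-identity₃ = solve 2 (λ m b → m := m :- cst 0ℚ :* b) refl

  certs-identity₄ : ∀ c → 0ℚ ≡ 0ℚ * c - 0ℚ
  certs-identity₄ = solve 1 (λ c → cst 0ℚ := cst 0ℚ :* c :- cst 0ℚ) refl

  certs-identity₅ : ∀ c → 0ℚ ≡ 0ℚ - 0ℚ * c
  certs-identity₅ = solve 1 (λ c → cst 0ℚ := cst 0ℚ :- cst 0ℚ :* c) refl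

  certs-identity₆ : ∀ c → c - 0ℚ ≡ c
  certs-identity₆ = solve 1 (λ c → c :- cst 0ℚ := c) refl

  certs-identity₇ : ∀ c m → - m ≡ 0ℚ * c - m
  certs-identity₇ = solve 2 (λ c m → :- m := cst 0ℚ :* c :- m) refl

  Mβ≤0-identity : ∀ c s → 0ℚ ≡ s + (0ℚ * c - s)
  Mβ≤0-identity = solve 2 (λ c s → cst 0ℚ := s :+ (cst 0ℚ :* c :- s)) refl

  left-identity : ∀ g b β → g * (b * β) ≡ g * b * β
  left-identity = solve 3 (λ g b β → g :* (b :* β) := g :* b :* β) refl

  right-identity : ∀ m a b → m * a * b ≡ m * b * a
  right-identity = solve 3 (λ m a b → m :* a :* b := m :* b :* a) refl

  0≤-identity : ∀ g a b → g * a - g * b ≡ g * (a - b)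
  0≤-identity = solve 3 (λ g a b → g :* a :- g :* b := g :* (a :- b)) refl

  ∑-downs-identity : ∀ f h → - f * h ≡ - 1ℚ * (f * h)
  ∑-downs-identity = solve 2 (λ f h → :- f :* h := :- (cst 1ℚ) :* (f :* h)) refl

  ∑-downs-identity₂ : ∀ s → - 1ℚ * s ≡ - s
  ∑-downs-identity₂ = solve 1 (λ s → :- (cst 1ℚ) :* s := :- s) refl

  neg-flip-identity : ∀ a b → a ≡ b + (- b - - a)
  neg-flip-identity = solve 2 (λ a b → a := b :+ (:- b :- :- a)) refl

  opaque-identity : ∀ c s → - (s - c) ≡ - s + c
  opaque-identity = solve 2 (λ c s → :- (s :- c) := :- s :+ c) refl

  module Duality {p q : ℕ} (M : Fin p → Fin q → ℚ) (C : Fin p → ℚ) (b : Fin q → ℚ)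
    (M≥0 : ∀ i j → 0ℚ ≤ M i j) (M-col : ∀ j → ∃[ i ] 0ℚ < M i j) (C≥0 : ∀ i → 0ℚ ≤ C i) (b≥0 : ∀ j → 0ℚ ≤ b j) where

    -- Nothing is optimised: feasibility of y, feasibility of g, and the inequality between dual and
    -- primal value form one linear system, whose solutions are the optimal pairs by weak duality.
    record Optimum : Set where
      field
        y : Fin q → ℚ
        g : Fin p → ℚ
        y≥0 : ∀ j → 0ℚ ≤ y j
        g≥0 : ∀ i → 0ℚ ≤ g i
        load : ∀ i → ∑ᶠ (λ j → M i j * y j) ≤ C i
        cover : ∀ j → b j ≤ ∑ᶠ (λ i → M i j * g i)
        value : ∑ᶠ (λ i → C i * g i) ≤ ∑ᶠ (λ j → b j * y j)

    N : ℕ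
    N = q ℕ.+ p

    con : (Fin q → ℚ) → (Fin p → ℚ) → ℚ → Con N
    con f g r = (λ i → [ f , g ]′ (splitAt q i)) , r

    dot-con : ∀ f g r x → dot (proj₁ (con f g r)) x ≡ ∑ᶠ (λ j → f j * x (j ↑ˡ p)) + ∑ᶠ (λ i → g i * x (q ↑ʳ i))
    dot-con f g r x = trans (∑ᶠ-↑ q _) (cong₂ _+_
      (∑ᶠ-cong (λ j → cong (λ z → [ f , g ]′ z * x (j ↑ˡ p)) (Fin.splitAt-↑ˡ q j p)))
      (∑ᶠ-cong (λ i → cong (λ z → [ f , g ]′ z * x (q ↑ʳ i)) (Fin.splitAt-↑ʳ q p i))))

    -- The nonnegative combinations of the system: α, β, γ multiply load, cover and value
    -- constraints. Multipliers of y ≥ 0 and g ≥ 0 are absorbed by the inequalities in `on-y` and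
    -- `on-g`.
    record Cert (c : Con N) : Set where
      field
        α : Fin p → ℚ
        β : Fin q → ℚ
        γ : ℚ
        α≥0 : ∀ i → 0ℚ ≤ α i
        β≥0 : ∀ j → 0ℚ ≤ β j
        γ≥0 : 0ℚ ≤ γ
        on-y : ∀ j → proj₁ c (j ↑ˡ p) ≤ ∑ᶠ (λ i → M i j * α i) - γ * b j
        on-g : ∀ i → proj₁ c (q ↑ʳ i) ≤ γ * C i - ∑ᶠ (λ j → M i j * β j)
        on-b : ∑ᶠ (λ i → C i * α i) - ∑ᶠ (λ j → b j * β j) ≤ proj₂ c

    ∑-lin : ∀ {n} (f u v : Fin n → ℚ) s t → ∑ᶠ (λ i → f i * (s * u i + t * v i)) ≡ s * ∑ᶠ (λ i → f i * u i) + t * ∑ᶠ (λ i → f i * v i)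
    ∑-lin f u v s t = trans (∑ᶠ-cong (λ i → ∑-lin-identity (f i) (u i) (v i) s t)) (trans (∑ᶠ-+ (λ i → s * (f i * u i)) (λ i → t * (f i * v i))) (cong₂ _+_ (∑ᶠ-* s _) (∑ᶠ-* t _)))

    Cert-comb : ∀ {s t c d} → 0ℚ ≤ s → 0ℚ ≤ t → Cert c → Cert d → Cert (comb s c t d)
    Cert-comb {s} {t} 0≤s 0≤t X Y = record
      { α = λ i → s * X.α i + t * Y.α i
      ; β = λ j → s * X.β j + t * Y.β j
      ; γ = s * X.γ + t * Y.γ
      ; α≥0 = λ i → 0≤s ⊛ X.α≥0 i ⊕ 0≤t ⊛ Y.α≥0 i
      ; β≥0 = λ j → 0≤s ⊛ X.β≥0 j ⊕ 0≤t ⊛ Y.β≥0 j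
      ; γ≥0 = 0≤s ⊛ X.γ≥0 ⊕ 0≤t ⊛ Y.γ≥0
      ; on-y = λ j → ≤-trans (+-mono-≤ (*-mono-≥0 s 0≤s (X.on-y j)) (*-mono-≥0 t 0≤t (Y.on-y j)))
          (≤-reflexive (trans (Cert-comb-identity s t (∑ᶠ (λ i → M i j * X.α i)) (∑ᶠ (λ i → M i j * Y.α i)) X.γ Y.γ (b j)) (cong (_- (s * X.γ + t * Y.γ) * b j) (sym (∑-lin (λ i → M i j) X.α Y.α s t)))))
      ; on-g = λ i → ≤-trans (+-mono-≤ (*-mono-≥0 s 0≤s (X.on-g i)) (*-mono-≥0 t 0≤t (Y.on-g i)))
          (≤-reflexive (trans (Cert-comb-identity₂ s t (∑ᶠ (λ j → M i j * X.β j)) (∑ᶠ (λ j → M i j * Y.β j)) X.γ Y.γ (C i)) (cong (λ z → (s * X.γ + t * Y.γ) * C i - z) (sym (∑-lin (M i) X.β Y.β s t)))))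
      ; on-b = ≤-trans (≤-reflexive (trans (cong₂ _-_ (∑-lin C X.α Y.α s t) (∑-lin b X.β Y.β s t)) (sat-elim-identity s t (∑ᶠ (λ i → C i * X.α i)) (∑ᶠ (λ i → C i * Y.α i)) (∑ᶠ (λ j → b j * X.β j)) (∑ᶠ (λ j → b j * Y.β j)))))
          (+-mono-≤ (*-mono-≥0 s 0≤s X.on-b) (*-mono-≥0 t 0≤t Y.on-b))
      }
      where
      module X = Cert X
      module Y = Cert Y

    Cert-cone : Cone Cert
    Cert-cone = record { P-comb = Cert-comb }

    ∑-*0 : ∀ {n} (f : Fin n → ℚ) → ∑ᶠ (λ i → f i * 0ℚ) ≡ 0ℚ
    ∑-*0 f = trans (∑ᶠ-*ʳ 0ℚ f) (*-zeroʳ (∑ᶠ f))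

    ∑-*δ : ∀ {n} (f : Fin n → ℚ) i → ∑ᶠ (λ j → f j * δ i j) ≡ f i
    ∑-*δ f i = trans (∑ᶠ-cong (λ j → *-comm (f j) (δ i j))) (∑ᶠ-δ i f)

    loadC g≥C : Fin p → Con N
    coverC y≥C : Fin q → Con N
    loadC i = con (M i) (λ _ → 0ℚ) (C i)
    coverC j = con (λ _ → 0ℚ) (λ i → - M i j) (- b j)
    y≥C j = con (λ j′ → - δ j j′) (λ _ → 0ℚ) 0ℚ
    g≥C i = con (λ _ → 0ℚ) (λ i′ → - δ i i′) 0ℚ
    valueC : Con N
    valueC = con (λ j → - b j) C 0ℚ

    cs : List (Con N)
    cs = valueC ∷ map loadC (allFin p) ++ map coverC (allFin q) ++ map y≥C (allFin q) ++ map g≥C (allFin p)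

    at-y : ∀ (f : Fin q → ℚ) (g : Fin p → ℚ) j → [ f , g ]′ (splitAt q (j ↑ˡ p)) ≡ f j
    at-y f g j = cong [ f , g ]′ (Fin.splitAt-↑ˡ q j p)

    at-g : ∀ (f : Fin q → ℚ) (g : Fin p → ℚ) i → [ f , g ]′ (splitAt q (q ↑ʳ i)) ≡ g i
    at-g f g i = cong [ f , g ]′ (Fin.splitAt-↑ʳ q p i)

    cert : ∀ (α : Fin p → ℚ) (β : Fin q → ℚ) γ f g r → (∀ i → 0ℚ ≤ α i) → (∀ j → 0ℚ ≤ β j) → 0ℚ ≤ γ →
      (∀ j → f j ≤ ∑ᶠ (λ i → M i j * α i) - γ * b j) → (∀ i → g i ≤ γ * C i - ∑ᶠ (λ j → M i j * β j)) →
      ∑ᶠ (λ i → C i * α i) - ∑ᶠ (λ j → b j * β j) ≤ r → Cert (con f g r)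
    cert α β γ f g r p₁ p₂ p₃ p₄ p₅ p₆ = record { α = α ; β = β ; γ = γ ; α≥0 = p₁ ; β≥0 = p₂ ; γ≥0 = p₃
      ; on-y = λ j → at-y f g j ≡≤ p₄ j ; on-g = λ i → at-g f g i ≡≤ p₅ i ; on-b = p₆ }

    neg-≤0 : ∀ {x} → 0ℚ ≤ x → - x ≤ 0ℚ
    neg-≤0 = neg-antimono-≤

    certs : All Cert cs
    certs =
      cert (λ _ → 0ℚ) (λ _ → 0ℚ) 1ℚ (λ j → - b j) C 0ℚ (λ _ → ≤-refl) (λ _ → ≤-refl) 0≤1
        (λ j → ≤-reflexive (trans (certs-identity (b j)) (cong (_- 1ℚ * b j) (sym (∑-*0 (λ i → M i j))))))
        (λ i → ≤-reflexive (trans (certs-identity₂ (C i)) (cong (λ z → 1ℚ * C i - z) (sym (∑-*0 (M i))))))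
        (≤-reflexive (cong₂ _-_ (∑-*0 C) (∑-*0 b)))
      ∷ All.++⁺ (All.map⁺ {f = loadC} (All.tabulate {xs = allFin p} (λ {i} _ → cert (δ i) (λ _ → 0ℚ) 0ℚ (M i) (λ _ → 0ℚ) (C i) (δ≥0 i) (λ _ → ≤-refl) ≤-refl
            (λ j → ≤-reflexive (trans (certs-identity₃ (M i j) (b j)) (cong (_- 0ℚ * b j) (sym (∑-*δ (λ i → M i j) i)))))
            (λ i′ → ≤-reflexive (trans (certs-identity₄ (C i′)) (cong (λ z → 0ℚ * C i′ - z) (sym (∑-*0 (M i′))))))
            (≤-reflexive (trans (cong₂ _-_ (∑-*δ C i) (∑-*0 b)) (certs-identity₆ (C i)))))))
        (All.++⁺ (All.map⁺ {f = coverC} (All.tabulate {xs = allFin q} (λ {j} _ → cert (λ _ → 0ℚ) (δ j) 0ℚ (λ _ → 0ℚ) (λ i → - M i j) (- b j) (λ _ → ≤-refl) (δ≥0 j) ≤-refl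
            (λ j′ → ≤-reflexive (trans (certs-identity₅ (b j′)) (cong (_- 0ℚ * b j′) (sym (∑-*0 (λ i → M i j′))))))
            (λ i → ≤-reflexive (trans (certs-identity₇ (C i) (M i j)) (cong (λ z → 0ℚ * C i - z) (sym (∑-*δ (M i) j)))))
            (≤-reflexive (trans (cong₂ _-_ (∑-*0 C) (∑-*δ b j)) (+-identityˡ (- b j)))))))
        (All.++⁺ (All.map⁺ {f = y≥C} (All.tabulate {xs = allFin q} (λ {j} _ → cert (λ _ → 0ℚ) (λ _ → 0ℚ) 0ℚ (λ j′ → - δ j j′) (λ _ → 0ℚ) 0ℚ (λ _ → ≤-refl) (λ _ → ≤-refl) ≤-refl
            (λ j′ → ≤-trans (neg-≤0 (δ≥0 j j′)) (≤-reflexive (trans (certs-identity₅ (b j′)) (cong (_- 0ℚ * b j′) (sym (∑-*0 (λ i → M i j′)))))))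
            (λ i′ → ≤-reflexive (trans (certs-identity₄ (C i′)) (cong (λ z → 0ℚ * C i′ - z) (sym (∑-*0 (M i′))))))
            (≤-reflexive (cong₂ _-_ (∑-*0 C) (∑-*0 b))))))
          (All.map⁺ {f = g≥C} (All.tabulate {xs = allFin p} (λ {i} _ → cert (λ _ → 0ℚ) (λ _ → 0ℚ) 0ℚ (λ _ → 0ℚ) (λ i′ → - δ i i′) 0ℚ (λ _ → ≤-refl) (λ _ → ≤-refl) ≤-refl
            (λ j′ → ≤-reflexive (trans (certs-identity₅ (b j′)) (cong (_- 0ℚ * b j′) (sym (∑-*0 (λ i → M i j′))))))
            (λ i′ → ≤-trans (neg-≤0 (δ≥0 i i′)) (≤-reflexive (trans (certs-identity₄ (C i′)) (cong (λ z → 0ℚ * C i′ - z) (sym (∑-*0 (M i′)))))))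
            (≤-reflexive (cong₂ _-_ (∑-*0 C) (∑-*0 b))))))))

    -- If γ = 0, then Mβ ≤ 0 and the positive entry in each column force β = 0, so the right-hand
    -- side is nonnegative. If γ > 0, estimating ∑ αMβ from both sides is weak duality for β/γ and
    -- α/γ, with the same conclusion.
    no-cert : ¬ (∃[ c ] (Cert c × (∀ i → proj₁ c i ≡ 0ℚ) × proj₂ c < 0ℚ))
    no-cert (c , X , zs , lt) with γ ≤? 0ℚ
      where open Cert X
    ... | yes γ≤0 = <-irrefl refl (≤-<-trans 0≤D (≤-<-trans on-b lt))
      where
      open Cert X
      γ≡0 : γ ≡ 0ℚ
      γ≡0 = ≤-antisym γ≤0 γ≥0
      Mβ≤0 : ∀ i → ∑ᶠ (λ j → M i j * β j) ≤ 0ℚ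
      Mβ≤0 i = lin (sym (zs (q ↑ʳ i)) ≡≤ on-g i) (trans (Mβ≤0-identity (C i) (∑ᶠ (λ j → M i j * β j))) (cong (λ z → ∑ᶠ (λ j → M i j * β j) + (z * C i - ∑ᶠ (λ j → M i j * β j))) (sym γ≡0)))
      β≡0 : ∀ j → β j ≡ 0ℚ
      β≡0 j = ≤-antisym (*-cancel-≤ (M i j) (proj₂ (M-col j)) (≤-trans (∑ᶠ-∈≤ {f = λ j → M i j * β j} j (λ j → M≥0 i j ⊛ β≥0 j)) (Mβ≤0 i) ≤≡ sym (*-zeroʳ (M i j)))) (β≥0 j)
        where i = proj₁ (M-col j)
      0≤D : 0ℚ ≤ ∑ᶠ (λ i → C i * α i) - ∑ᶠ (λ j → b j * β j)
      0≤D = ∑ᶠ-≥0 (λ i → C≥0 i ⊛ α≥0 i) ≤≡ trans (sym (+-identityʳ _)) (cong (λ z → ∑ᶠ (λ i → C i * α i) - z) (sym (trans (∑ᶠ-cong (λ j → cong (b j *_) (β≡0 j))) (∑-*0 b))))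
    ... | no γ≰0 = <-irrefl refl (<-≤-trans downs 0≤)
      where
      open Cert X
      A′ = ∑ᶠ (λ i → C i * α i)
      B′ = ∑ᶠ (λ j → b j * β j)
      downs : γ * (A′ - B′) < 0ℚ
      downs = <-respʳ-≡ (*-zeroʳ γ) (*-monoʳ-<-pos γ {{positive (≰⇒> γ≰0)}} (≤-<-trans on-b lt))
      left : γ * B′ ≤ ∑² (λ j i → M i j * α i * β j)
      left = sym (∑ᶠ-* γ _) ≡≤ ∑ᶠ-mono (λ j → (left-identity γ (b j) (β j) ≡≤ *-mono-≥0ʳ (β j) (β≥0 j) (-≥0 {γ * b j} {∑ᶠ (λ i → M i j * α i)} (sym (zs (j ↑ˡ p)) ≡≤ on-y j))) ≤≡ sym (∑ᶠ-*ʳ (β j) (λ i → M i j * α i)))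
      right : ∑² (λ j i → M i j * α i * β j) ≤ γ * A′
      right = trans (∑ᶠ-swap (λ j i → M i j * α i * β j)) (∑ᶠ-cong (λ i → trans (∑ᶠ-cong (λ j → right-identity (M i j) (α i) (β j))) (∑ᶠ-*ʳ (α i) (λ j → M i j * β j)))) ≡≤
              ∑ᶠ-mono (λ i → *-mono-≥0ʳ (α i) (α≥0 i) (-≥0 {∑ᶠ (λ j → M i j * β j)} {γ * C i} (sym (zs (q ↑ʳ i)) ≡≤ on-g i)) ≤≡ *-assoc γ (C i) (α i)) ≤≡ ∑ᶠ-* γ (λ i → C i * α i)
      0≤ : 0ℚ ≤ γ * (A′ - B′)
      0≤ = 0≤- (≤-trans left right) ≤≡ 0≤-identity γ A′ B′

    opaque

      optimum : Optimum
      optimum = from (farkas N Cert Cert-cone cs certs)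
        where
        from : (∃[ x ] All (Sat x) cs) ⊎ (∃[ c ] (Cert c × (∀ i → proj₁ c i ≡ 0ℚ) × proj₂ c < 0ℚ)) → Optimum
        from (inj₂ r) = ⊥-elim (no-cert r)
        from (inj₁ (x , sat)) = record
          { y = y ; g = g
          ; y≥0 = λ j →
              downs≥0 (trans (sym (trans (cong₂ _+_ (∑-δy j) (∑-0* g)) (+-identityʳ (- y j)))) (sym (dot-con (λ j′ → - δ j j′) (λ _ → 0ℚ) 0ℚ x)) ≡≤ get (there (∈-++⁺ʳ (map loadC (allFin p)) (∈-++⁺ʳ (map coverC (allFin q)) (∈-++⁺ˡ (∈-map⁺ y≥C (∈-allFin j)))))))
          ; g≥0 = λ i → downs≥0 (trans (sym (trans (cong₂ _+_ (∑-0* y) (∑-δg i)) (+-identityˡ (- g i)))) (sym (dot-con (λ _ → 0ℚ) (λ i′ → - δ i i′) 0ℚ x)) ≡≤ get (there (∈-++⁺ʳ (map loadC (allFin p)) (∈-++⁺ʳ (map coverC (allFin q)) (∈-++⁺ʳ (map y≥C (allFin q)) (∈-map⁺ g≥C (∈-allFin i)))))))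
          ; load = λ i → trans (sym (trans (cong (∑ᶠ (λ j → M i j * y j) +_) (∑-0* g)) (+-identityʳ (∑ᶠ (λ j → M i j * y j))))) (sym (dot-con (M i) (λ _ → 0ℚ) (C i) x)) ≡≤ get (there (∈-++⁺ˡ (∈-map⁺ loadC (∈-allFin i))))
          ; cover = λ j → neg-flip (trans (sym (trans (cong₂ _+_ (∑-0* y) (∑-downs (λ i → M i j) g)) (+-identityˡ _))) (sym (dot-con (λ _ → 0ℚ) (λ i → - M i j) (- b j) x)) ≡≤ get (there (∈-++⁺ʳ (map loadC (allFin p)) (∈-++⁺ˡ (∈-map⁺ coverC (∈-allFin j))))))
          ; value = -≥0 (downs≥0 (trans (trans (opaque-identity (∑ᶠ (λ i → C i * g i)) (∑ᶠ (λ j → b j * y j))) (cong (_+ ∑ᶠ (λ i → C i * g i)) (sym (∑-downs b y)))) (sym (dot-con (λ j → - b j) C 0ℚ x)) ≡≤ get (here refl)))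
          }
          where
          y : Fin q → ℚ
          y j = x (j ↑ˡ p)
          g : Fin p → ℚ
          g i = x (q ↑ʳ i)
          get : ∀ {c} → c ∈ cs → Sat x c
          get = All.lookup sat
          ∑-0* : ∀ {n} (f : Fin n → ℚ) → ∑ᶠ (λ i → 0ℚ * f i) ≡ 0ℚ
          ∑-0* f = trans (∑ᶠ-* 0ℚ f) (*-zeroˡ (∑ᶠ f))
          ∑-downs : ∀ {n} (f h : Fin n → ℚ) → ∑ᶠ (λ i → - f i * h i) ≡ - ∑ᶠ (λ i → f i * h i)
          ∑-downs f h = trans (∑ᶠ-cong (λ i → ∑-downs-identity (f i) (h i))) (trans (∑ᶠ-* (- 1ℚ) (λ i → f i * h i)) (∑-downs-identity₂ _))
          ∑-δy : ∀ j → ∑ᶠ (λ j′ → - δ j j′ * y j′) ≡ - y j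
          ∑-δy j = trans (∑-downs (δ j) y) (cong -_ (∑ᶠ-δ j y))
          ∑-δg : ∀ i → ∑ᶠ (λ i′ → - δ i i′ * g i′) ≡ - g i
          ∑-δg i = trans (∑-downs (δ i) g) (cong -_ (∑ᶠ-δ i g))
          neg-flip : ∀ {a b} → - a ≤ - b → b ≤ a
          neg-flip {a} {b} h = lin (0≤- h) (neg-flip-identity a b)
          downs≥0 : ∀ {a} → - a ≤ 0ℚ → 0ℚ ≤ a
          downs≥0 h = neg-flip h

-- Fractional triangle packings of the reduced graph, and Krivelevich's rounding.

module Classes where

  open Sums
  open Num
  open Fins
  open LP

  ∑³ : ∀ {k} → (Fin k → Fin k → Fin k → ℚ) → ℚ
  ∑³ f = ∑ᶠ (λ a → ∑² (f a))

  module _ {k : ℕ} where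

    ∑³-cong : {f g : Fin k → Fin k → Fin k → ℚ} → (∀ a b c → f a b c ≡ g a b c) → ∑³ f ≡ ∑³ g
    ∑³-cong h = ∑ᶠ-cong (λ a → ∑²-cong (h a))

    ∑³-mono : {f g : Fin k → Fin k → Fin k → ℚ} → (∀ a b c → f a b c ≤ g a b c) → ∑³ f ≤ ∑³ g
    ∑³-mono h = ∑ᶠ-mono (λ a → ∑²-mono (h a))

    ∑³-+ : (f g : Fin k → Fin k → Fin k → ℚ) → ∑³ (λ a b c → f a b c + g a b c) ≡ ∑³ f + ∑³ g
    ∑³-+ f g = trans (∑ᶠ-cong (λ a → ∑²-+ (f a) (g a))) (∑ᶠ-+ (λ a → ∑² (f a)) (λ a → ∑² (g a)))

    ∑³-* : ∀ s (f : Fin k → Fin k → Fin k → ℚ) → ∑³ (λ a b c → s * f a b c) ≡ s * ∑³ f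
    ∑³-* s f = trans (∑ᶠ-cong (λ a → ∑²-* s (f a))) (∑ᶠ-* s (λ a → ∑² (f a)))

    ∑³-swap₁₂ : (f : Fin k → Fin k → Fin k → ℚ) → ∑³ f ≡ ∑³ (λ b a c → f a b c)
    ∑³-swap₁₂ f = ∑ᶠ-swap (λ a b → ∑ᶠ (f a b))

    ∑³-swap₂₃ : (f : Fin k → Fin k → Fin k → ℚ) → ∑³ f ≡ ∑³ (λ a c b → f a b c)
    ∑³-swap₂₃ f = ∑ᶠ-cong (λ a → ∑ᶠ-swap (f a))

    ∑³-rot : (f : Fin k → Fin k → Fin k → ℚ) → ∑³ f ≡ ∑³ (λ b c a → f a b c)
    ∑³-rot f = trans (∑³-swap₁₂ f) (∑³-swap₂₃ (λ b a c → f a b c))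

  weak-duality-identity : ∀ x → x + x + x ≡ 3ℚ * x
  weak-duality-identity = solve 1 (λ x → x :+ x :+ x := cst 3ℚ :* x) refl

  zero-term-identity : ∀ x y z → 0ℚ ≡ x * 0ℚ + y * 0ℚ + z * 0ℚ
  zero-term-identity = solve 3 (λ x y z → cst 0ℚ := x :* cst 0ℚ :+ y :* cst 0ℚ :+ z :* cst 0ℚ) refl

  weak-duality-identity₂ : ∀ x y z w → (x + y + z) * w ≡ x * w + y * w + z * w
  weak-duality-identity₂ = solve 4 (λ x y z w → (x :+ y :+ z) :* w := x :* w :+ y :* w :+ z :* w) refl

  ∑gap≤0-identity : ∀ x y → 3ℚ * y - 3ℚ * x ≡ 3ℚ * 0ℚ - 3ℚ * (x - y)
  ∑gap≤0-identity = solve 2 (λ x y → cst 3ℚ :* y :- cst 3ℚ :* x := cst 3ℚ :* cst 0ℚ :- cst 3ℚ :* (x :- y)) refl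

  saturated-identity : ∀ g x y → 0ℚ - (g * x - g * y) ≡ g * y - g * x
  saturated-identity = solve 3 (λ g x y → cst 0ℚ :- (g :* x :- g :* y) := g :* y :- g :* x) refl

  load₁-identity : ∀ p q r w → p * w + q * w + r * w ≡ (p + q + r) * w
  load₁-identity = solve 4 (λ p q r w → p :* w :+ q :* w :+ r :* w := (p :+ q :+ r) :* w) refl

  Yc-rot-identity : ∀ x y z → x + y + z ≡ z + x + y
  Yc-rot-identity = solve 3 (λ x y z → x :+ y :+ z := z :+ x :+ y) refl

  Yc-zero-identity : ∀ x y → 0ℚ * x * y ≡ 0ℚ
  Yc-zero-identity = solve 2 (λ x y → cst 0ℚ :* x :* y := cst 0ℚ) refl

  Yc-zero-identity₂ : ∀ x y → x * 0ℚ * y ≡ 0ℚ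
  Yc-zero-identity₂ = solve 2 (λ x y → x :* cst 0ℚ :* y := cst 0ℚ) refl

  ∑³Y-identity : ∀ x → ½ * (x + x) ≡ x
  ∑³Y-identity = solve 1 (λ x → cst ½ :* (x :+ x) := x) refl

  cov-identity : ∀ ab bc ca ba ac cb → ½ * ((ab + bc + ca) + (ba + ac + cb)) ≡ ½ * (ab + ba) + ½ * (bc + cb) + ½ * (ac + ca)
  cov-identity = solve 6 (λ ab bc ca ba ac cb → cst ½ :* (ab :+ bc :+ ca :+ (ba :+ ac :+ cb)) := cst ½ :* (ab :+ ba) :+ cst ½ :* (bc :+ cb) :+ cst ½ :* (ac :+ ca)) refl

  Cg-identity : ∀ x y c → ½ * (x + y) * c ≡ ½ * (c * x + c * y)
  Cg-identity = solve 3 (λ x y c → cst ½ :* (x :+ y) :* c := cst ½ :* (c :* x :+ c :* y)) refl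

  leaf-identity : ∀ p V v → 2ℚ * v ≡ 3ℚ * (0ℚ + ½ * p) + (1½ * (V - p) + 1½ * (v - V) + ½ * (V + (v - V)))
  leaf-identity = solve 3 (λ p V v → cst 2ℚ :* v := cst 3ℚ :* (cst 0ℚ :+ cst ½ :* p) :+ (cst 1½ :* (V :- p) :+ cst 1½ :* (v :- V) :+ cst ½ :* (V :+ (v :- V)))) refl

  leaf-identity₂ : ∀ x y z → x + y + z ≡ y + x + z
  leaf-identity₂ = solve 3 (λ x y z → x :+ y :+ z := y :+ x :+ z) refl

  size′-identity : ∀ m x h → m ≡ x + ((1ℚ + m - (x + h)) + (h - 1ℚ))
  size′-identity = solve 3 (λ m x h → m := x :+ (cst 1ℚ :+ m :- (x :+ h) :+ (h :- cst 1ℚ))) refl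

  Cg-split-identity : ∀ g x y c → g * ((x + y) * c) ≡ g * (x * c) + g * (y * c)
  Cg-split-identity = solve 4 (λ g x y c → g :* ((x :+ y) :* c) := g :* (x :* c) :+ g :* (y :* c)) refl

  bnd′-identity : ∀ v x h V → v - 3ℚ * h ≡ 3ℚ * x + ((v - V) + (V - 3ℚ * (x + h)))
  bnd′-identity = solve 4 (λ v x h V → v :- cst 3ℚ :* h := cst 3ℚ :* x :+ (v :- V :+ (V :- cst 3ℚ :* (x :+ h)))) refl

  combine′-identity : ∀ h a m v H → 2ℚ * v ≡ 3ℚ * (h + a + m) + ((2ℚ * (v - 3ℚ * H) - 3ℚ * (a + m)) + (3ℚ + 3ℚ) * (H - ½ * h))
  combine′-identity = solve 5 (λ h a m v H → cst 2ℚ :* v := cst 3ℚ :* (h :+ a :+ m) :+ (cst 2ℚ :* (v :- cst 3ℚ :* H) :- cst 3ℚ :* (a :+ m) :+ (cst 3ℚ :+ cst 3ℚ) :* (H :- cst ½ :* h))) refl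

  module ClassLP {k : ℕ} (C : Fin k → Fin k → ℚ) (C-sym : ∀ a b → C a b ≡ C b a) (C≥0 : ∀ a b → 0ℚ ≤ C a b) where

    Pairs : Set
    Pairs = Fin k → Fin k → Bool

    Symmetric : Pairs → Set
    Symmetric s = ∀ a b → s a b ≡ s b a

    mass : Pairs → ℚ
    mass s = ∑² (λ a b → 𝟙 (s a b) * C a b)

    -- A symmetric weight on ordered triples, with repetitions allowed. Each triangle on distinct
    -- classes is counted six times, and the sum of all loads equals the value.
    record ClassPacking (s : Pairs) : Set where
      field
        Y : Fin k → Fin k → Fin k → ℚ
        Y≥0 : ∀ a b c → 0ℚ ≤ Y a b c
        Y-swap : ∀ a b c → Y a b c ≡ Y b a c
        Y-rot : ∀ a b c → Y a b c ≡ Y b c a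
        Y-supp : ∀ a b c → s a b ≡ false → Y a b c ≡ 0ℚ
        Y-load : ∀ a b → ∑ᶠ (Y a b) ≤ C a b

      load≤ : ∀ a b → ∑ᶠ (Y a b) ≤ 𝟙 (s a b) * C a b
      load≤ a b with s a b in eq
      ... | true = Y-load a b ≤≡ sym (*-identityˡ (C a b))
      ... | false = ≤-reflexive (trans (trans (∑ᶠ-cong (λ c → trans (Y-supp a b c eq) (sym (*-zeroʳ 0ℚ)))) (trans (∑ᶠ-* 0ℚ (λ _ → 0ℚ)) (*-zeroˡ (∑ᶠ {k} (λ _ → 0ℚ))))) (sym (*-zeroˡ (C a b))))

      value : ℚ
      value = ∑³ Y

      value≥0 : 0ℚ ≤ value
      value≥0 = ∑ᶠ-≥0 (λ a → ∑²-≥0 (Y≥0 a))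

    Cover : Pairs → (Fin k → Fin k → ℚ) → Set
    Cover s g = ∀ a b c → s a b ≡ true → s b c ≡ true → s a c ≡ true → 1ℚ ≤ g a b + g b c + g a c

    module _ {s : Pairs} {g : Fin k → Fin k → ℚ} (cov : Cover s g) (P : ClassPacking s) where
      open ClassPacking P

      -- On the support of `Y` the cover inequality is available, and by symmetry of `Y` its three
      -- terms contribute the same sum.
      weak-duality : value ≤ 3ℚ * ∑² (λ a b → g a b * ∑ᶠ (Y a b))
      weak-duality = ≤-trans (∑³-mono term) (≤-reflexive (begin
          ∑³ (λ a b c → g a b * Y a b c + g b c * Y b c a + g a c * Y a c b) ≡⟨ ∑³-+ _ _ ⟩
          ∑³ (λ a b c → g a b * Y a b c + g b c * Y b c a) + ∑³ (λ a b c → g a c * Y a c b) ≡⟨ cong₂ _+_ (∑³-+ _ _) (∑³-swap₂₃ (λ a b c → g a c * Y a c b)) ⟩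
          G + ∑³ (λ a b c → g b c * Y b c a) + G ≡⟨ cong (λ z → G + z + G) (∑³-rot (λ a b c → g b c * Y b c a)) ⟩
          G + ∑³ (λ b c a → g b c * Y b c a) + G ≡⟨ weak-duality-identity G ⟩
          3ℚ * G ≡⟨ cong (3ℚ *_) (∑²-cong (λ a b → ∑ᶠ-* (g a b) (Y a b))) ⟩
          3ℚ * ∑² (λ a b → g a b * ∑ᶠ (Y a b)) ∎))
        where
        open ≡-Reasoning
        G = ∑³ (λ a b c → g a b * Y a b c)
        zero-term : ∀ a b c → Y a b c ≡ 0ℚ → Y a b c ≤ g a b * Y a b c + g b c * Y b c a + g a c * Y a c b
        zero-term a b c e = ≤-reflexive (trans e (trans (zero-term-identity (g a b) (g b c) (g a c)) (cong₂ (λ z w → z + g a c * w) (cong₂ (λ z w → g a b * z + g b c * w) (sym e) (trans (sym e) (Y-rot a b c))) (trans (sym e) (trans (Y-rot a b c) (trans (Y-rot b c a) (Y-swap c a b)))))))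
        term : ∀ a b c → Y a b c ≤ g a b * Y a b c + g b c * Y b c a + g a c * Y a c b
        term a b c with s a b in e₁ | s b c in e₂ | s a c in e₃
        ... | false | _ | _ = zero-term a b c (Y-supp a b c e₁)
        ... | true | false | _ = zero-term a b c (trans (Y-rot a b c) (Y-supp b c a e₂))
        ... | true | true | false = zero-term a b c (trans (Y-rot a b c) (trans (Y-rot b c a) (trans (Y-swap c a b) (Y-supp a c b e₃))))
        ... | true | true | true = sym (*-identityˡ (Y a b c)) ≡≤ *-mono-≥0ʳ (Y a b c) (Y≥0 a b c) (cov a b c e₁ e₂ e₃) ≤≡
              trans (weak-duality-identity₂ (g a b) (g b c) (g a c) (Y a b c)) (cong₂ (λ z w → g a b * Y a b c + g b c * z + g a c * w) (Y-rot a b c) (trans (Y-rot a b c) (trans (Y-rot b c a) (Y-swap c a b))))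

    record Solution (s : Pairs) : Set where
      field
        packing : ClassPacking s
        g : Fin k → Fin k → ℚ
        g≥0 : ∀ a b → 0ℚ ≤ g a b
        g-sym : ∀ a b → g a b ≡ g b a
        g-cover : Cover s g
        strong : 3ℚ * ∑² (λ a b → g a b * (𝟙 (s a b) * C a b)) ≤ ClassPacking.value packing

      positives : Pairs
      positives a b = s a b ∧ lt 0ℚ (g a b)

      -- Complementary slackness: pairs of positive dual weight are saturated.
      saturated : mass positives ≤ ClassPacking.value packing
      saturated = ∑²-mono term
        where
        open ClassPacking packing
        gap : Fin k → Fin k → ℚ
        gap a b = g a b * (𝟙 (s a b) * C a b) - g a b * ∑ᶠ (Y a b)
        gap≥0 : ∀ a b → 0ℚ ≤ gap a b
        gap≥0 a b = 0≤- (*-mono-≥0 (g a b) (g≥0 a b) (load≤ a b))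
        ∑gap≤0 : ∑² gap ≤ 0ℚ
        ∑gap≤0 = *-cancel-≤ 3ℚ (positive⁻¹ 3ℚ) (cong (3ℚ *_) (∑²-- _ _) ≡≤ -≥0 (0≤- (≤-trans strong (weak-duality {s} {g} g-cover packing)) ≤≡ ∑gap≤0-identity (∑² (λ a b → g a b * (𝟙 (s a b) * C a b))) (∑² (λ a b → g a b * ∑ᶠ (Y a b)))))
        gap≤0 : ∀ a b → gap a b ≤ 0ℚ
        gap≤0 a b = ≤-trans (≤-trans (∑ᶠ-∈≤ {f = gap a} b (gap≥0 a)) (∑ᶠ-∈≤ {f = λ a → ∑ᶠ (gap a)} a (λ a → ∑ᶠ-≥0 (gap≥0 a)))) ∑gap≤0
        term : ∀ a b → 𝟙 (positives a b) * C a b ≤ ∑ᶠ (Y a b)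
        term a b with s a b in e | lt 0ℚ (g a b) in e′
        ... | false | _ = *-zeroˡ (C a b) ≡≤ ∑ᶠ-≥0 (Y≥0 a b)
        ... | true | false = *-zeroˡ (C a b) ≡≤ ∑ᶠ-≥0 (Y≥0 a b)
        ... | true | true = *-cancel-≤ (g a b) (lt-true e′) (-≥0 (0≤- (gap≤0 a b) ≤≡ trans (saturated-identity (g a b) (𝟙 (s a b) * C a b) (∑ᶠ (Y a b))) (cong (λ z → g a b * ∑ᶠ (Y a b) - g a b * (𝟙 z * C a b)) e)))

    module Solve (s : Pairs) (s-sym : Symmetric s) where

      Cs : Fin k → Fin k → ℚ
      Cs a b = 𝟙 (s a b) * C a b

      Cs≥0 : ∀ a b → 0ℚ ≤ Cs a b
      Cs≥0 a b = 𝟙≥0 (s a b) ⊛ C≥0 a b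

      Cs-sym : ∀ a b → Cs a b ≡ Cs b a
      Cs-sym a b = cong₂ (λ u v → 𝟙 u * v) (s-sym a b) (C-sym a b)

      -- Incidence of the arc (x,y) with the oriented triangle a → b → c → a. Orienting keeps the
      -- program plain; symmetry is restored afterwards by averaging.
      M₀ : Fin k → Fin k → Fin k → Fin k → Fin k → ℚ
      M₀ x y a b c = δ x a * δ y b + δ x b * δ y c + δ x c * δ y a

      ok : Fin k → Fin k → Fin k → ℚ
      ok a b c = 𝟙 (s a b) * 𝟙 (s b c) * 𝟙 (s a c)

      ok≥0 : ∀ a b c → 0ℚ ≤ ok a b c
      ok≥0 a b c = 𝟙≥0 (s a b) ⊛ 𝟙≥0 (s b c) ⊛ 𝟙≥0 (s a c)

      ok≤1 : ∀ a b c → ok a b c ≤ 1ℚ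
      ok≤1 a b c = *-mono² (𝟙≥0 (s a b) ⊛ 𝟙≥0 (s b c)) 0≤1 (*-mono² (𝟙≥0 (s a b)) 0≤1 (𝟙≤1 (s a b)) (𝟙≤1 (s b c))) (𝟙≤1 (s a c))

      two : Fin (k ℕ.* k) → Fin k × Fin k
      two = remQuot k

      three : Fin (k ℕ.* (k ℕ.* k)) → Fin k × Fin k × Fin k
      three j = proj₁ (remQuot {k} (k ℕ.* k) j) , two (proj₂ (remQuot {k} (k ℕ.* k) j))

      two-combine : ∀ x y → two (combine x y) ≡ (x , y)
      two-combine x y = Fin.remQuot-combine x y

      three-combine : ∀ a b c → three (combine a (combine b c)) ≡ (a , b , c)
      three-combine a b c = trans (cong (λ z → proj₁ z , two (proj₂ z)) (Fin.remQuot-combine a (combine b c))) (cong (a ,_) (two-combine b c))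

      M′ : Fin k × Fin k → Fin k × Fin k × Fin k → ℚ
      M′ (x , y) (a , b , c) = M₀ x y a b c

      M₀≥0 : ∀ x y a b c → 0ℚ ≤ M₀ x y a b c
      M₀≥0 x y a b c = δ≥0 x a ⊛ δ≥0 y b ⊕ δ≥0 x b ⊛ δ≥0 y c ⊕ δ≥0 x c ⊛ δ≥0 y a

      δ-refl : ∀ (x : Fin k) → δ x x ≡ 1ℚ
      δ-refl x with x Fin.≟ x
      ... | yes _ = refl
      ... | no p = ⊥-elim (p refl)

      M₀-col : ∀ a b c → 0ℚ < M₀ a b a b c
      M₀-col a b c = <-≤-trans (positive⁻¹ 1ℚ) (sym (cong₂ _*_ (δ-refl a) (δ-refl b)) ≡≤ lin (δ≥0 a b ⊛ δ≥0 b c ⊕ δ≥0 a c ⊛ δ≥0 b a) (+-assoc (δ a a * δ b b) (δ a b * δ b c) (δ a c * δ b a)))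

      ok′ : Fin k × Fin k × Fin k → ℚ
      ok′ (a , b , c) = ok a b c

      Cs′ : Fin k × Fin k → ℚ
      Cs′ (a , b) = Cs a b

      M′≥0 : ∀ z w → 0ℚ ≤ M′ z w
      M′≥0 (x , y) (a , b , c) = M₀≥0 x y a b c

      Cs′≥0 : ∀ z → 0ℚ ≤ Cs′ z
      Cs′≥0 (a , b) = Cs≥0 a b

      ok′≥0 : ∀ w → 0ℚ ≤ ok′ w
      ok′≥0 (a , b , c) = ok≥0 a b c

      M′-col : ∀ j → ∃[ i ] (0ℚ < M′ (two i) (three j))
      M′-col j = column (three j)
        where
        column : ∀ w → ∃[ i ] (0ℚ < M′ (two i) w)
        column (a , b , c) = combine a b , subst (λ z → 0ℚ < M′ z (a , b , c)) (sym (two-combine a b)) (M₀-col a b c)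

      module D = Duality {k ℕ.* k} {k ℕ.* (k ℕ.* k)} (λ i j → M′ (two i) (three j)) (λ i → Cs′ (two i)) (λ j → ok′ (three j))
        (λ i j → M′≥0 (two i) (three j))
        M′-col
        (λ i → Cs′≥0 (two i)) (λ j → ok′≥0 (three j))

      open D.Optimum D.optimum using () renaming (y to yᵢ; g to gᵢ; y≥0 to yᵢ≥0; g≥0 to gᵢ≥0; load to loadᵢ; cover to coverᵢ; value to valueᵢ)

      ∑-three : ∀ (f : Fin k × Fin k × Fin k → Fin (k ℕ.* (k ℕ.* k)) → ℚ) → ∑ᶠ (λ j → f (three j) j) ≡ ∑³ (λ a b c → f (a , b , c) (combine a (combine b c)))
      ∑-three f = trans (∑ᶠ-combine k _) (∑ᶠ-cong (λ a → trans (∑ᶠ-combine k _) (∑²-cong (λ b c → cong (λ z → f z (combine a (combine b c))) (three-combine a b c)))))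

      ∑-two : ∀ (f : Fin k × Fin k → Fin (k ℕ.* k) → ℚ) → ∑ᶠ (λ i → f (two i) i) ≡ ∑² (λ a b → f (a , b) (combine a b))
      ∑-two f = trans (∑ᶠ-combine k _) (∑²-cong (λ a b → cong (λ z → f z (combine a b)) (two-combine a b)))

      -- Worthless triples are removed, then the weight is summed over rotations and averaged over
      -- the reflection.
      y₀ y₁ Yc Y : Fin k → Fin k → Fin k → ℚ
      y₀ a b c = yᵢ (combine a (combine b c))
      y₁ a b c = ok a b c * y₀ a b c
      Yc a b c = y₁ a b c + y₁ c a b + y₁ b c a
      Y a b c = ½ * (Yc a b c + Yc b a c)

      g₀ g : Fin k → Fin k → ℚ
      g₀ x y = gᵢ (combine x y)
      g x y = ½ * (g₀ x y + g₀ y x)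

      y₁≥0 : ∀ a b c → 0ℚ ≤ y₁ a b c
      y₁≥0 a b c = ok≥0 a b c ⊛ yᵢ≥0 _

      pick₃ : ∀ (f : Fin k → Fin k → Fin k → ℚ) x y → ∑³ (λ a b c → δ x a * δ y b * f a b c) ≡ ∑ᶠ (f x y)
      pick₃ f x y = trans (∑ᶠ-cong (λ a → ∑ᶠ-cong (λ b → ∑ᶠ-* (δ x a * δ y b) (f a b)))) (∑²-δ x y (λ a b → ∑ᶠ (f a b)))

      load₁ : ∀ x y → ∑ᶠ (Yc x y) ≤ Cs x y
      load₁ x y = ≤-trans (≤-reflexive eq) (≤-trans (∑³-mono (λ a b c → *-mono-≥0 _ (M₀≥0 x y a b c) (*-mono-≥0ʳ _ (yᵢ≥0 _) (ok≤1 a b c) ≤≡ *-identityˡ (y₀ a b c))))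
          (trans (sym (∑-three (λ z j → M′ (x , y) z * yᵢ j))) (∑ᶠ-cong (λ j → cong (λ z → M′ z (three j) * yᵢ j) (sym (two-combine x y)))) ≡≤ loadᵢ (combine x y) ≤≡ cong Cs′ (two-combine x y)))
        where
        open ≡-Reasoning
        eq : ∑ᶠ (Yc x y) ≡ ∑³ (λ a b c → M₀ x y a b c * y₁ a b c)
        eq = begin
          ∑ᶠ (Yc x y) ≡⟨ trans (∑ᶠ-+ (λ c → y₁ x y c + y₁ c x y) (λ c → y₁ y c x)) (cong (_+ ∑ᶠ (λ c → y₁ y c x)) (∑ᶠ-+ (y₁ x y) (λ c → y₁ c x y))) ⟩
          ∑ᶠ (y₁ x y) + ∑ᶠ (λ c → y₁ c x y) + ∑ᶠ (λ c → y₁ y c x)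
            ≡⟨ cong₂ _+_ (cong₂ _+_ (sym (pick₃ y₁ x y)) (sym (pick₃ (λ b c a → y₁ a b c) x y))) (sym (pick₃ (λ c a b → y₁ a b c) x y)) ⟩
          ∑³ (λ a b c → δ x a * δ y b * y₁ a b c) + ∑³ (λ b c a → δ x b * δ y c * y₁ a b c) + ∑³ (λ c a b → δ x c * δ y a * y₁ a b c)
            ≡⟨ cong₂ _+_ (cong (∑³ (λ a b c → δ x a * δ y b * y₁ a b c) +_) (sym (∑³-rot (λ a b c → δ x b * δ y c * y₁ a b c)))) (∑³-rot (λ c a b → δ x c * δ y a * y₁ a b c)) ⟩
          ∑³ (λ a b c → δ x a * δ y b * y₁ a b c) + ∑³ (λ a b c → δ x b * δ y c * y₁ a b c) + ∑³ (λ a b c → δ x c * δ y a * y₁ a b c)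
            ≡⟨ sym (trans (∑³-+ _ _) (cong (_+ ∑³ (λ a b c → δ x c * δ y a * y₁ a b c)) (∑³-+ _ _))) ⟩
          ∑³ (λ a b c → δ x a * δ y b * y₁ a b c + δ x b * δ y c * y₁ a b c + δ x c * δ y a * y₁ a b c)
            ≡⟨ ∑³-cong (λ a b c → load₁-identity (δ x a * δ y b) (δ x b * δ y c) (δ x c * δ y a) (y₁ a b c)) ⟩
          ∑³ (λ a b c → M₀ x y a b c * y₁ a b c) ∎

      cover₀ : ∀ a b c → ok a b c ≤ g₀ a b + g₀ b c + g₀ c a
      cover₀ a b c = cong ok′ (sym (three-combine a b c)) ≡≤ coverᵢ (combine a (combine b c)) ≤≡ trans (∑-two (λ z i → M′ z (three (combine a (combine b c))) * gᵢ i))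
          (trans (∑²-cong (λ x y → cong (λ z → M′ (x , y) z * g₀ x y) (three-combine a b c))) eq)
        where
        open ≡-Reasoning
        at : ∀ a b → ∑² (λ x y → δ x a * δ y b * g₀ x y) ≡ g₀ a b
        at a b = trans (∑²-cong (λ x y → cong₂ (λ u v → u * v * g₀ x y) (δ-sym x a) (δ-sym y b))) (∑²-δ a b g₀)
        eq : ∑² (λ x y → M₀ x y a b c * g₀ x y) ≡ g₀ a b + g₀ b c + g₀ c a
        eq = trans (∑²-cong (λ x y → weak-duality-identity₂ (δ x a * δ y b) (δ x b * δ y c) (δ x c * δ y a) (g₀ x y)))
            (trans (∑²-+ _ _) (cong₂ _+_ (trans (∑²-+ _ _) (cong₂ _+_ (at a b) (at b c))) (at c a)))

      y₁-zero : ∀ a b c → ok a b c ≡ 0ℚ → y₁ a b c ≡ 0ℚ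
      y₁-zero a b c e = trans (cong (_* y₀ a b c) e) (*-zeroˡ (y₀ a b c))

      Yc-rot : ∀ a b c → Yc a b c ≡ Yc b c a
      Yc-rot a b c = Yc-rot-identity (y₁ a b c) (y₁ c a b) (y₁ b c a)

      Yc-zero : ∀ a b c → s a b ≡ false → Yc a b c ≡ 0ℚ
      Yc-zero a b c e = cong₂ _+_ (cong₂ _+_ (y₁-zero a b c (trans (cong (λ z → 𝟙 z * 𝟙 (s b c) * 𝟙 (s a c)) e) (Yc-zero-identity (𝟙 (s b c)) (𝟙 (s a c)))))
          (y₁-zero c a b (trans (cong (λ z → 𝟙 (s c a) * 𝟙 z * 𝟙 (s c b)) e) (Yc-zero-identity₂ (𝟙 (s c a)) (𝟙 (s c b))))))
          (y₁-zero b c a (trans (cong (λ z → 𝟙 (s b c) * 𝟙 (s c a) * 𝟙 z) (trans (s-sym b a) e)) (*-zeroʳ (𝟙 (s b c) * 𝟙 (s c a)))))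

      ∑³Yc : ∑³ Yc ≡ 3ℚ * ∑³ y₁
      ∑³Yc = trans (∑³-+ _ _) (trans (cong₂ _+_ (trans (∑³-+ _ _) (cong (∑³ y₁ +_) (sym (∑³-rot y₁)))) (∑³-rot (λ a b c → y₁ b c a))) (weak-duality-identity (∑³ y₁)))

      ∑³Y : ∑³ Y ≡ ∑³ Yc
      ∑³Y = trans (∑³-* ½ (λ a b c → Yc a b c + Yc b a c)) (trans (cong (½ *_) (trans (∑³-+ Yc (λ a b c → Yc b a c)) (cong (∑³ Yc +_) (∑³-swap₁₂ (λ a b c → Yc b a c))))) (∑³Y-identity (∑³ Yc)))


      0≤½ : 0ℚ ≤ ½
      0≤½ = nonNegative⁻¹ ½

      Cs≤C : ∀ a b → Cs a b ≤ C a b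
      Cs≤C a b = *-mono-≥0ʳ (C a b) (C≥0 a b) (𝟙≤1 (s a b)) ≤≡ *-identityˡ (C a b)

      packing : ClassPacking s
      packing = record
        { Y = Y
        ; Y≥0 = λ a b c → 0≤½ ⊛ ((y₁≥0 a b c ⊕ y₁≥0 c a b ⊕ y₁≥0 b c a) ⊕ (y₁≥0 b a c ⊕ y₁≥0 c b a ⊕ y₁≥0 a c b))
        ; Y-swap = λ a b c → cong (½ *_) (+-comm (Yc a b c) (Yc b a c))
        ; Y-rot = λ a b c → cong (½ *_) (cong₂ _+_ (Yc-rot a b c) (sym (Yc-rot c b a)))
        ; Y-supp = λ a b c e → trans (cong₂ (λ u v → ½ * (u + v)) (Yc-zero a b c e) (Yc-zero b a c (trans (s-sym b a) e))) refl
        ; Y-load = λ a b → trans (∑ᶠ-* ½ (λ c → Yc a b c + Yc b a c)) (cong (½ *_) (∑ᶠ-+ (Yc a b) (Yc b a))) ≡≤ *-mono-≥0 ½ 0≤½ (+-mono-≤ (≤-trans (load₁ a b) (Cs≤C a b)) (≤-trans (load₁ b a) (Cs≤C b a ≤≡ C-sym b a))) ≤≡ ∑³Y-identity (C a b)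
        }

      solution : Solution s
      solution = record
        { packing = packing
        ; g = g
        ; g≥0 = λ a b → 0≤½ ⊛ (gᵢ≥0 _ ⊕ gᵢ≥0 _)
        ; g-sym = λ a b → cong (½ *_) (+-comm (g₀ a b) (g₀ b a))
        ; g-cover = cov
        ; strong = trans (cong (3ℚ *_) Cg) refl ≡≤ *-mono-≥0 3ℚ 0≤3 value₀ ≤≡ sym (trans ∑³Y ∑³Yc)
        }
        where
        cov : Cover s g
        cov a b c e₁ e₂ e₃ = ∑³Y-identity 1ℚ ≡≤ *-mono-≥0 ½ 0≤½ (+-mono-≤ (sym (ok≡1 a b c e₁ e₂ e₃) ≡≤ cover₀ a b c) (sym (ok≡1 b a c (trans (s-sym b a) e₁) e₃ e₂) ≡≤ cover₀ b a c)) ≤≡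
            cov-identity (g₀ a b) (g₀ b c) (g₀ c a) (g₀ b a) (g₀ a c) (g₀ c b)
          where
          ok≡1 : ∀ a b c → s a b ≡ true → s b c ≡ true → s a c ≡ true → ok a b c ≡ 1ℚ
          ok≡1 a b c e₁ e₂ e₃ rewrite e₁ | e₂ | e₃ = refl
        value₀ : ∑² (λ a b → Cs a b * g₀ a b) ≤ ∑³ y₁
        value₀ = sym (∑-two (λ z i → Cs′ z * gᵢ i)) ≡≤ valueᵢ ≤≡ ∑-three (λ z j → ok′ z * yᵢ j)
        Cg : ∑² (λ a b → g a b * (𝟙 (s a b) * C a b)) ≡ ∑² (λ a b → Cs a b * g₀ a b)
        Cg = trans (∑²-cong (λ a b → trans (Cg-identity (g₀ a b) (g₀ b a) (Cs a b)) (cong (λ z → ½ * (Cs a b * g₀ a b + z * g₀ b a)) (Cs-sym a b))))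
            (trans (∑²-* ½ (λ a b → Cs a b * g₀ a b + Cs b a * g₀ b a)) (trans (cong (½ *_) (trans (∑²-+ _ _) (cong (∑² (λ a b → Cs a b * g₀ a b) +_) (∑ᶠ-swap (λ a b → Cs b a * g₀ b a))))) (∑³Y-identity _)))

    -- Pairs in `A` enter the cover completely. Of those in `M` only half is paid for, since later a
    -- cut of the vertices leaves at most half of their edges inside its parts. With ordered
    -- counting, `cost` is τ ≤ 2ν*.
    record Rounding (s : Pairs) (v : ℚ) : Set where
      field
        A M : Pairs
        A-sym : Symmetric A
        M-sym : Symmetric M
        cost : 3ℚ * (mass A + ½ * mass M) ≤ 2ℚ * v
        hits : ∀ a b c → s a b ≡ true → s b c ≡ true → s a c ≡ true →
               (A a b ≡ true ⊎ A b c ≡ true ⊎ A a c ≡ true) ⊎ (M a b ≡ true × M b c ≡ true × M a c ≡ true)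

    -- `v` is any upper bound on packings, not the optimum itself; this is what lets the recursion
    -- pass on the reduced bound `v′`.
    module Round (s : Pairs) (s-sym : Symmetric s) (solution : Solution s) (v : ℚ) (bnd : ∀ (P : ClassPacking s) → ClassPacking.value P ≤ v) where
      open Solution solution
      open ClassPacking packing
      heavy light : Pairs
      heavy a b = s a b ∧ not (lt (g a b) ½)
      light a b = s a b ∧ not (heavy a b)
      heavy-sym : Symmetric heavy
      heavy-sym a b = cong₂ (λ u v → u ∧ not (lt v ½)) (s-sym a b) (g-sym a b)
      light-sym : Symmetric light
      light-sym a b = cong₂ (λ u v → u ∧ not v) (s-sym a b) (heavy-sym a b)
      split : ∀ a b → 𝟙 (s a b) ≡ 𝟙 (light a b) + 𝟙 (heavy a b)
      split a b with s a b | lt (g a b) ½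
      ... | false | _ = refl
      ... | true | false = refl
      ... | true | true = refl
      s∧¬heavy⇒light : ∀ a b → s a b ≡ true → heavy a b ≡ false → light a b ≡ true
      s∧¬heavy⇒light a b e h = cong₂ (λ u v → u ∧ not v) e h

      light-cover : Cover light g
      light-cover a b c e₁ e₂ e₃ = g-cover a b c (up a b e₁) (up b c e₂) (up a c e₃)
        where up : ∀ a b → light a b ≡ true → s a b ≡ true
              up a b e with s a b
              ... | true = refl

      -- Two weights below ½ leave a positive third one, so all pairs in triangles have positive
      -- weight. These are saturated, hence their mass is at most the value, and half of it is cheap
      -- enough.
      leaf : ¬ (∃[ a ] ∃[ b ] (heavy a b ≡ true)) → Rounding s v
      leaf none = record
        { A = λ _ _ → false ; M = positives ; A-sym = λ _ _ → refl ; M-sym = λ a b → cong₂ (λ u v → u ∧ lt 0ℚ v) (s-sym a b) (g-sym a b)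
        ; cost = cong (λ z → 3ℚ * (z + ½ * mass positives)) mass-false ≡≤ lin (nonNegative⁻¹ 1½ ⊛ 0≤- saturated ⊕ nonNegative⁻¹ 1½ ⊛ 0≤- (bnd packing) ⊕ nonNegative⁻¹ ½ ⊛ (value≥0 ⊕ 0≤- (bnd packing))) (leaf-identity (mass positives) value v)
        ; hits = λ a b c e₁ e₂ e₃ → inj₂ (pos₁ a b c e₁ e₂ e₃ , pos₂ a b c e₁ e₂ e₃ , pos₃ a b c e₁ e₂ e₃) }
        where
        mass-false : mass (λ _ _ → false) ≡ 0ℚ
        mass-false = trans (∑²-* 0ℚ C) (*-zeroˡ (∑² C))
        g<½ : ∀ a b → s a b ≡ true → g a b < ½
        g<½ a b e with lt (g a b) ½ in eq
        ... | true = lt-true eq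
        ... | false = ⊥-elim (none (a , b , cong₂ (λ u v → u ∧ not v) e eq))
        pos-of : ∀ a b x y → s a b ≡ true → 1ℚ ≤ g a b + x + y → x < ½ → y < ½ → positives a b ≡ true
        pos-of a b x y e h x< y< with lt 0ℚ (g a b) in e′
        ... | true = cong (_∧ true) e
        ... | false = ⊥-elim (<-irrefl refl (≤-<-trans (≤-trans h (≤-trans (≤-reflexive (+-assoc (g a b) x y)) (+-monoˡ-≤ (x + y) (lt-false e′)))) (<-respˡ-≡ (sym (+-identityˡ (x + y))) (+-mono-< x< y<))))
        module _ a b c (e₁ : s a b ≡ true) (e₂ : s b c ≡ true) (e₃ : s a c ≡ true) where
          h = g-cover a b c e₁ e₂ e₃
          pos₁ = pos-of a b (g b c) (g a c) e₁ h (g<½ b c e₂) (g<½ a c e₃)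
          pos₂ = pos-of b c (g a b) (g a c) e₂ (h ≤≡ leaf-identity₂ (g a b) (g b c) (g a c)) (g<½ a b e₁) (g<½ a c e₃)
          pos₃ = pos-of a c (g a b) (g b c) e₃ (h ≤≡ Yc-rot-identity (g a b) (g b c) (g a c)) (g<½ a b e₁) (g<½ b c e₂)

      ∈≤∑² : ∀ (p : Pairs) a b → p a b ≡ true → 1ℚ ≤ ∑² (λ a b → 𝟙 (p a b))
      ∈≤∑² p a b e = ≤-trans (cong 𝟙 (sym e) ≡≤ ∑ᶠ-∈≤ {f = λ b → 𝟙 (p a b)} b (λ b → 𝟙≥0 (p a b))) (∑ᶠ-∈≤ {f = λ a → ∑ᶠ (λ b → 𝟙 (p a b))} a (λ a → ∑ᶠ-≥0 (λ b → 𝟙≥0 (p a b))))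

      heavy⇒ : ∀ {a b} → heavy a b ≡ true → s a b ≡ true
      heavy⇒ {a} {b} e with s a b
      ... | true = refl

      Hg : ℚ
      Hg = ∑² (λ a b → g a b * (𝟙 (heavy a b) * C a b))
      Lg : ℚ
      Lg = ∑² (λ a b → g a b * (𝟙 (light a b) * C a b))
      v′ : ℚ
      v′ = v - 3ℚ * Hg
      size′ : ∀ m {a b} → heavy a b ≡ true → ∑² (λ a b → 𝟙 (s a b)) ≤ ι (suc m) → ∑² (λ a b → 𝟙 (light a b)) ≤ ι m
      size′ m {a} {b} e size = lin (0≤- size ⊕ 0≤- (∈≤∑² heavy a b e)) (trans (size′-identity (ι m) (∑² (λ a b → 𝟙 (light a b))) (∑² (λ a b → 𝟙 (heavy a b)))) (cong (λ z → ∑² (λ a b → 𝟙 (light a b)) + ((1ℚ + ι m - z) + (∑² (λ a b → 𝟙 (heavy a b)) - 1ℚ))) (sym (trans (∑²-cong split) (∑²-+ _ _)))))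
      Cg-split : ∑² (λ a b → g a b * (𝟙 (s a b) * C a b)) ≡ Lg + Hg
      Cg-split = trans (∑²-cong (λ a b → trans (cong (λ z → g a b * (z * C a b)) (split a b)) (Cg-split-identity (g a b) (𝟙 (light a b)) (𝟙 (heavy a b)) (C a b)))) (∑²-+ _ _)
      -- The old dual still covers the light pairs, where it is cheaper by the weight of the heavy
      -- ones.
      bnd′ : ∀ (P : ClassPacking light) → ClassPacking.value P ≤ v′
      bnd′ P = ≤-trans (weak-duality {light} {g} light-cover P) (≤-trans (*-mono-≥0 3ℚ 0≤3 (∑²-mono (λ a b → *-mono-≥0 (g a b) (g≥0 a b) (ClassPacking.load≤ P a b))))
          (lin (0≤- (bnd packing) ⊕ 0≤- strong) (trans (bnd′-identity v Lg Hg value) (cong (λ z → 3ℚ * Lg + ((v - value) + (value - 3ℚ * z))) (sym Cg-split)))))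
      -- Heavy pairs have mass at most 2·`Hg`, so taking them costs at most 6·`Hg`, which is twice
      -- the drop from `v` to `v′`.
      combine′ : Rounding light v′ → Rounding s v
      combine′ R = record
        { A = λ a b → heavy a b ∨ R.A a b ; M = R.M
        ; A-sym = λ a b → cong₂ _∨_ (heavy-sym a b) (R.A-sym a b) ; M-sym = R.M-sym
        ; cost = ≤-trans (*-mono-≥0 3ℚ 0≤3 (+-monoˡ-≤ (½ * mass R.M) mass∨)) (lin (0≤- R.cost ⊕ nonNegative⁻¹ 6ℚ ⊛ 0≤- half) (combine′-identity (mass heavy) (mass R.A) (½ * mass R.M) v Hg))
        ; hits = hits }
        where
        module R = Rounding R
        half : ½ * mass heavy ≤ Hg
        half = sym (∑²-* ½ _) ≡≤ ∑²-mono term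
          where
          term : ∀ a b → ½ * (𝟙 (heavy a b) * C a b) ≤ g a b * (𝟙 (heavy a b) * C a b)
          term a b with s a b | lt (g a b) ½ in e′
          ... | true | false = *-mono-≥0ʳ (1ℚ * C a b) (0≤1 ⊛ C≥0 a b) (lt-false e′)
          ... | true | true = ≤-reflexive (trans (cong (½ *_) (*-zeroˡ (C a b))) (trans (*-zeroʳ ½) (sym (trans (cong (g a b *_) (*-zeroˡ (C a b))) (*-zeroʳ (g a b))))))
          ... | false | _ = ≤-reflexive (trans (cong (½ *_) (*-zeroˡ (C a b))) (trans (*-zeroʳ ½) (sym (trans (cong (g a b *_) (*-zeroˡ (C a b))) (*-zeroʳ (g a b))))))
        mass∨ : mass (λ a b → heavy a b ∨ R.A a b) ≤ mass heavy + mass R.A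
        mass∨ = ∑²-mono (λ a b → *-mono-≥0ʳ (C a b) (C≥0 a b) (∨≤ (heavy a b) (R.A a b)) ≤≡ *-distribʳ-+ (C a b) (𝟙 (heavy a b)) (𝟙 (R.A a b))) ≤≡ ∑²-+ _ _
          where ∨≤ : ∀ x y → 𝟙 (x ∨ y) ≤ 𝟙 x + 𝟙 y
                ∨≤ true y = lin (𝟙≥0 y) refl
                ∨≤ false y = ≤-reflexive (sym (+-identityˡ (𝟙 y)))
        hits : ∀ a b c → s a b ≡ true → s b c ≡ true → s a c ≡ true →
             ((heavy a b ∨ R.A a b) ≡ true ⊎ (heavy b c ∨ R.A b c) ≡ true ⊎ (heavy a c ∨ R.A a c) ≡ true) ⊎ (R.M a b ≡ true × R.M b c ≡ true × R.M a c ≡ true)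
        hits a b c e₁ e₂ e₃ = from (heavy a b) refl (heavy b c) refl (heavy a c) refl
          where
          ∨ʳ : ∀ x {y} → y ≡ true → x ∨ y ≡ true
          ∨ʳ x e = trans (cong (x ∨_) e) (Bool.∨-zeroʳ x)
          from : ∀ x → heavy a b ≡ x → ∀ y → heavy b c ≡ y → ∀ z → heavy a c ≡ z →
              ((heavy a b ∨ R.A a b) ≡ true ⊎ (heavy b c ∨ R.A b c) ≡ true ⊎ (heavy a c ∨ R.A a c) ≡ true) ⊎ (R.M a b ≡ true × R.M b c ≡ true × R.M a c ≡ true)
          from true p _ _ _ _ = inj₁ (inj₁ (cong (_∨ R.A a b) p))
          from false _ true p _ _ = inj₁ (inj₂ (inj₁ (cong (_∨ R.A b c) p)))
          from false _ false _ true p = inj₁ (inj₂ (inj₂ (cong (_∨ R.A a c) p)))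
          from false p false q false r with R.hits a b c (s∧¬heavy⇒light a b e₁ p) (s∧¬heavy⇒light b c e₂ q) (s∧¬heavy⇒light a c e₃ r)
          ... | inj₁ (inj₁ x) = inj₁ (inj₁ (∨ʳ (heavy a b) x))
          ... | inj₁ (inj₂ (inj₁ x)) = inj₁ (inj₂ (inj₁ (∨ʳ (heavy b c) x)))
          ... | inj₁ (inj₂ (inj₂ x)) = inj₁ (inj₂ (inj₂ (∨ʳ (heavy a c) x)))
          ... | inj₂ x = inj₂ x

    -- Krivelevich's rounding: pairs of dual weight ≥ ½ are taken into the cover and removed; when none is left,
    -- all pairs in triangles are saturated and half of them suffice.
    roundCover : ∀ m s → Symmetric s → ∑² (λ a b → 𝟙 (s a b)) ≤ ι m → ∀ v → (∀ (P : ClassPacking s) → ClassPacking.value P ≤ v) → Rounding s v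
    roundCover m s s-sym size v bnd = decide m size (Fin.any? (λ a → Fin.any? (λ b → heavy a b Bool.≟ true)))
      where
      open Round s s-sym (Solve.solution s s-sym) v bnd
      decide : ∀ m → ∑² (λ a b → 𝟙 (s a b)) ≤ ι m → Dec (∃[ a ] ∃[ b ] (heavy a b ≡ true)) → Rounding s v
      decide _ _ (no none) = leaf none
      decide zero size (yes (a , b , e)) = ⊥-elim (<-irrefl refl (<-≤-trans (positive⁻¹ 1ℚ) (≤-trans (∈≤∑² s a b (heavy⇒ e)) size)))
      decide (suc m) size (yes (a , b , e)) = combine′ (roundCover m light light-sym (size′ m e size) v′ bnd′)

-- Rounding quadratic forms to bipartitions.

module Cut where

  open Sums
  open Num
  open Fins

  sgn : Bool → ℚ
  sgn true = 1ℚ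
  sgn false = - 1ℚ

  same : Bool → Bool → Bool
  same true b = b
  same false b = not b

  𝟙-same : ∀ a b → 𝟙 (same a b) ≡ ½ * (1ℚ + sgn a * sgn b)
  𝟙-same true true = refl
  𝟙-same true false = refl
  𝟙-same false true = refl
  𝟙-same false false = refl

  same-sym : ∀ a b → same a b ≡ same b a
  same-sym true true = refl
  same-sym true false = refl
  same-sym false true = refl
  same-sym false false = refl

  two-of-three : ∀ a b c → same a b ≡ true ⊎ same b c ≡ true ⊎ same a c ≡ true
  two-of-three true true c = inj₁ refl
  two-of-three false false c = inj₁ refl
  two-of-three true false true = inj₂ (inj₂ refl)
  two-of-three true false false = inj₂ (inj₁ refl)
  two-of-three false true true = inj₂ (inj₁ refl)
  two-of-three false true false = inj₂ (inj₂ refl)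

  affine-identity : ∀ s b x y → (1ℚ + s) * (b * (x * y)) + (1ℚ - s) * (b * (x * y)) ≡ 2ℚ * (b * (x * y))
  affine-identity = solve 4 (λ s b x y → (cst 1ℚ :+ s) :* (b :* (x :* y)) :+ (cst 1ℚ :- s) :* (b :* (x :* y)) := cst 2ℚ :* (b :* (x :* y))) refl

  affine-identity₂ : ∀ s b y → (1ℚ + s) * (b * (1ℚ * y)) + (1ℚ - s) * (b * (- 1ℚ * y)) ≡ 2ℚ * (b * (s * y))
  affine-identity₂ = solve 3 (λ s b y → (cst 1ℚ :+ s) :* (b :* (cst 1ℚ :* y)) :+ (cst 1ℚ :- s) :* (b :* (:- (cst 1ℚ) :* y)) := cst 2ℚ :* (b :* (s :* y))) refl

  affine-identity₃ : ∀ s b x → (1ℚ + s) * (b * (x * 1ℚ)) + (1ℚ - s) * (b * (x * - 1ℚ)) ≡ 2ℚ * (b * (x * s))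
  affine-identity₃ = solve 3 (λ s b x → (cst 1ℚ :+ s) :* (b :* (x :* cst 1ℚ)) :+ (cst 1ℚ :- s) :* (b :* (x :* (:- (cst 1ℚ)))) := cst 2ℚ :* (b :* (x :* s))) refl

  affine-identity₄ : ∀ s x → (1ℚ + s) * (0ℚ * (1ℚ * 1ℚ)) + (1ℚ - s) * (0ℚ * (- 1ℚ * - 1ℚ)) ≡ 2ℚ * (0ℚ * (s * s))
  affine-identity₄ = solve 2 (λ s x → (cst 1ℚ :+ s) :* (cst 0ℚ :* (cst 1ℚ :* cst 1ℚ)) :+ (cst 1ℚ :- s) :* (cst 0ℚ :* (:- (cst 1ℚ) :* (:- (cst 1ℚ)))) := cst 2ℚ :* (cst 0ℚ :* (s :* s))) refl

  round-coordinate-identity : ∀ s p q F → (1ℚ + s) * p + (1ℚ - s) * q - 2ℚ * F ≡ (1ℚ + s) * (p - F) + (1ℚ - s) * (q - F)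
  round-coordinate-identity = solve 4 (λ s p q F → (cst 1ℚ :+ s) :* p :+ (cst 1ℚ :- s) :* q :- cst 2ℚ :* F := (cst 1ℚ :+ s) :* (p :- F) :+ (cst 1ℚ :- s) :* (q :- F)) refl

  0≤1+s-identity : ∀ s → s - - 1ℚ ≡ 1ℚ + s
  0≤1+s-identity = solve 1 (λ s → s :- :- (cst 1ℚ) := cst 1ℚ :+ s) refl

  other-identity : ∀ s m → 2ℚ * m ≡ (1ℚ + s) * m + (1ℚ - s) * m
  other-identity = solve 2 (λ s m → cst 2ℚ :* m := (cst 1ℚ :+ s) :* m :+ (cst 1ℚ :- s) :* m) refl

  ∑-same-identity : ∀ b s → b * (½ * (1ℚ + s)) ≡ ½ * (b + b * s)
  ∑-same-identity = solve 2 (λ b s → b :* (cst ½ :* (cst 1ℚ :+ s)) := cst ½ :* (b :+ b :* s)) refl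

  module _ {n : ℕ} (B : Fin n → Fin n → ℚ) (B-diag : ∀ x → B x x ≡ 0ℚ) where

    form : (Fin n → ℚ) → ℚ
    form f = ∑² (λ x y → B x y * (f x * f y))

    Bounded : (Fin n → ℚ) → Set
    Bounded f = ∀ x → - 1ℚ ≤ f x × f x ≤ 1ℚ

    IsSign : ℚ → Set
    IsSign q = ∃[ b ] q ≡ sgn b

    set : Fin n → ℚ → (Fin n → ℚ) → Fin n → ℚ
    set v t f x = if does (v Fin.≟ x) then t else f x

    -- The form is affine in each coordinate, so f v is a convex combination of the endpoints.
    affine : ∀ v f → (1ℚ + f v) * form (set v 1ℚ f) + (1ℚ - f v) * form (set v (- 1ℚ) f) ≡ 2ℚ * form f
    affine v f = trans (sym (cong₂ _+_ (∑²-* (1ℚ + f v) _) (∑²-* (1ℚ - f v) _))) (trans (sym (∑²-+ _ _)) (trans (∑²-cong term) (∑²-* 2ℚ _)))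
      where
      term : ∀ x y → (1ℚ + f v) * (B x y * (set v 1ℚ f x * set v 1ℚ f y)) + (1ℚ - f v) * (B x y * (set v (- 1ℚ) f x * set v (- 1ℚ) f y)) ≡ 2ℚ * (B x y * (f x * f y))
      term x y with v Fin.≟ x | v Fin.≟ y
      ... | no _ | no _ = affine-identity (f v) (B x y) (f x) (f y)
      ... | yes refl | no _ = affine-identity₂ (f v) (B v y) (f y)
      ... | no _ | yes refl = affine-identity₃ (f v) (B x v) (f x)
      ... | yes refl | yes refl = trans (cong (λ b → (1ℚ + f v) * (b * (1ℚ * 1ℚ)) + (1ℚ - f v) * (b * (- 1ℚ * - 1ℚ))) (B-diag v)) (trans (affine-identity₄ (f v) 0ℚ) (cong (λ b → 2ℚ * (b * (f v * f v))) (sym (B-diag v))))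

    set-bounded : ∀ v b f → Bounded f → Bounded (set v (sgn b) f)
    set-bounded v b f h x with v Fin.≟ x
    ... | no _ = h x
    set-bounded v true f h x | yes _ = nonPositive⁻¹ (- 1ℚ) ⟨≤⟩ 0≤1 , ≤-refl
      where _⟨≤⟩_ = ≤-trans
    set-bounded v false f h x | yes _ = ≤-refl , ≤-trans (nonPositive⁻¹ (- 1ℚ)) 0≤1

    set-sign : ∀ v b f x → IsSign (f x) ⊎ v ≡ x → IsSign (set v (sgn b) f x)
    set-sign v b f x h with v Fin.≟ x
    ... | yes _ = b , refl
    set-sign v b f x (inj₁ h) | no _ = h
    set-sign v b f x (inj₂ e) | no ¬e = ⊥-elim (¬e e)

    round-coordinate : ∀ v f → Bounded f → ∃[ b ] form (set v (sgn b) f) ≤ form f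
    round-coordinate v f h = from (form (set v 1ℚ f) ≤? form f)
      where
      p = form (set v 1ℚ f)
      q = form (set v (- 1ℚ) f)
      from : Dec (p ≤ form f) → ∃[ b ] form (set v (sgn b) f) ≤ form f
      from (yes le) = true , le
      from (no ¬p) = false , other (q ≤? form f)
        where
        F<p = ≰⇒> ¬p
        s = f v
        0≤1+s : 0ℚ ≤ 1ℚ + s
        0≤1+s = 0≤- (proj₁ (h v)) ≤≡ 0≤1+s-identity s
        zero-sum : 0ℚ ≡ (1ℚ + s) * (p - form f) + (1ℚ - s) * (q - form f)
        zero-sum = trans (sym (trans (cong (_- 2ℚ * form f) (affine v f)) (+-inverseʳ (2ℚ * form f)))) (round-coordinate-identity s p q (form f))
        other : Dec (q ≤ form f) → q ≤ form f
        other (yes le) = le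
        other (no ¬q) = ⊥-elim (<-irrefl refl (<-≤-trans lt₁ (≤-reflexive (sym sum2))))
          where
          F<q = ≰⇒> ¬q
          sum2 : 0ℚ ≡ (1ℚ + s) * (p - form f) + (1ℚ - s) * (q - form f)
          sum2 = zero-sum
          m = (p - form f) ⊓ (q - form f)
          0<- : ∀ {a b} → a < b → 0ℚ < b - a
          0<- {a} {b} a<b = subst (_< b - a) (+-inverseʳ a) (+-monoˡ-< (- a) a<b)
          0<m : 0ℚ < m
          0<m = from′ (⊓-sel (p - form f) (q - form f))
            where from′ : m ≡ p - form f ⊎ m ≡ q - form f → 0ℚ < m
                  from′ (inj₁ e) = subst (0ℚ <_) (sym e) (0<- F<p)
                  from′ (inj₂ e) = subst (0ℚ <_) (sym e) (0<- F<q)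
          lt₁ : 0ℚ < (1ℚ + s) * (p - form f) + (1ℚ - s) * (q - form f)
          lt₁ = <-≤-trans (0<* (positive⁻¹ 2ℚ) 0<m) (other-identity s m ≡≤ +-mono-≤ (*-mono-≥0 (1ℚ + s) 0≤1+s (p⊓q≤p (p - form f) (q - form f))) (*-mono-≥0 (1ℚ - s) (0≤- (proj₂ (h v))) (p⊓q≤q (p - form f) (q - form f))))

    round-list : ∀ vs f → Bounded f → ∃[ h ] (form h ≤ form f × (∀ x → IsSign (f x) ⊎ x ∈ vs → IsSign (h x)))
    round-list [] f bf = f , ≤-refl , λ { x (inj₁ s) → s ; x (inj₂ ()) }
    round-list (v ∷ vs) f bf = from (round-coordinate v f bf)
      where
      from : ∃[ b ] form (set v (sgn b) f) ≤ form f → ∃[ h ] (form h ≤ form f × (∀ x → IsSign (f x) ⊎ x ∈ v ∷ vs → IsSign (h x)))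
      from (b , le) = from′ (round-list vs (set v (sgn b) f) (set-bounded v b f bf))
        where
        from′ : ∃[ h ] (form h ≤ form (set v (sgn b) f) × (∀ x → IsSign (set v (sgn b) f x) ⊎ x ∈ vs → IsSign (h x))) → _
        from′ (h , le′ , sg) = h , ≤-trans le′ le , λ { x (inj₁ s) → sg x (inj₁ (set-sign v b f x (inj₁ s)))
                                                       ; x (inj₂ (here e)) → sg x (inj₁ (set-sign v b f x (inj₂ (sym e))))
                                                       ; x (inj₂ (there m)) → sg x (inj₂ m) }

    -- Coordinates are moved to ±1 one at a time, each to the better end. From the zero vector this
    -- gives a cut with at most half the weight inside its parts; from test vectors it transfers
    -- hardness against cuts to all of [-1,1]ⁿ.
    signs : ∀ f → Bounded f → ∃[ σ ] form (λ x → sgn (σ x)) ≤ form f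
    signs f bf = from (round-list (allFin n) f bf)
      where
      from : ∃[ h ] (form h ≤ form f × (∀ x → IsSign (f x) ⊎ x ∈ allFin n → IsSign (h x))) → ∃[ σ ] form (λ x → sgn (σ x)) ≤ form f
      from (h , le , sg) = (λ x → proj₁ (sg x (inj₂ (∈-allFin x)))) , (∑²-cong (λ x y → cong₂ (λ u v → B x y * (u * v)) (sym (proj₂ (sg x (inj₂ (∈-allFin x))))) (sym (proj₂ (sg y (inj₂ (∈-allFin y)))))) ≡≤ le)

    ∑-same : ∀ (σ : Fin n → Bool) → ∑² (λ x y → B x y * 𝟙 (same (σ x) (σ y))) ≡ ½ * (∑² B + form (λ x → sgn (σ x)))
    ∑-same σ = trans (∑²-cong (λ x y → trans (cong (B x y *_) (𝟙-same (σ x) (σ y))) (∑-same-identity (B x y) (sgn (σ x) * sgn (σ y))))) (trans (∑²-* ½ _) (cong (½ *_) (∑²-+ B _)))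

-- Good class pairs and the cleaned graph.

module Reduced where

  open Sums
  open Num
  open Fins
  open Classes
  open LP using (recip; recip-pos)
  open Cut
  open Regularity using (module Partition)

  ∑ᶠ1≡ι : ∀ n → ∑ᶠ {n} (λ _ → 1ℚ) ≡ ι n
  ∑ᶠ1≡ι n = trans (∑ᶠ-def _) (trans (∑1≡ι (allFin n)) (cong ι (length-tabulate {n = n} (λ x → x))))

  bcase : ∀ b → b ≡ true ⊎ b ≡ false
  bcase true = inj₁ refl
  bcase false = inj₂ refl

  true≢false : ∀ {b} → b ≡ true → b ≡ false → ⊥
  true≢false refl ()

  ∧-true : ∀ {x y} → x ∧ y ≡ true → x ≡ true × y ≡ true
  ∧-true {true} {true} _ = refl , refl

  not-true : ∀ {x} → not x ≡ true → x ≡ false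
  not-true {false} _ = refl

  deviation≡-identity : ∀ d p x → d * (p * x) ≡ p * (d * x)
  deviation≡-identity = solve 3 (λ d p x → d :* (p :* x) := p :* (d :* x)) refl

  -deviation≤-identity : ∀ x → - x ≡ - 1ℚ * x
  -deviation≤-identity = solve 1 (λ x → :- x := :- (cst 1ℚ) :* x) refl

  -deviation≤-identity₂ : ∀ p x → - 1ℚ * (p * x) ≡ p * (- x)
  -deviation≤-identity₂ = solve 2 (λ p x → :- (cst 1ℚ) :* (p :* x) := p :* (:- x)) refl

  deviationK-identity : ∀ k a f → k * (1ℚ * 1ℚ * (a - f)) ≡ a * k - k * f
  deviationK-identity = solve 3 (λ k a f → k :* (cst 1ℚ :* cst 1ℚ :* (a :- f)) := a :* k :- k :* f) refl

  edge≤mass-identity : ∀ e m v → m + v ≡ e + (v - (e - m))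
  edge≤mass-identity = solve 3 (λ e m v → m :+ v := e :+ (v :- (e :- m))) refl

  mass≤edge-identity : ∀ e m v → e + v ≡ m + (v - (- (e - m)))
  mass≤edge-identity = solve 3 (λ e m v → e :+ v := m :+ (v :- :- (e :- m))) refl

  good-or-identity : ∀ q s t → 1ℚ + q + s + t + 0ℚ ≡ 1ℚ + (q + s + t)
  good-or-identity = solve 3 (λ q s t → cst 1ℚ :+ q :+ s :+ t :+ cst 0ℚ := cst 1ℚ :+ (q :+ s :+ t)) refl

  good-or-identity₂ : ∀ s t r → 0ℚ + 1ℚ + s + t + r ≡ 1ℚ + (s + t + r)
  good-or-identity₂ = solve 3 (λ s t r → cst 0ℚ :+ cst 1ℚ :+ s :+ t :+ r := cst 1ℚ :+ (s :+ t :+ r)) refl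

  good-or-identity₃ : ∀ s t → 0ℚ + 0ℚ + s + t + 1ℚ ≡ 1ℚ + (s + t)
  good-or-identity₃ = solve 2 (λ s t → cst 0ℚ :+ cst 0ℚ :+ s :+ t :+ cst 1ℚ := cst 1ℚ :+ (s :+ t)) refl

  good-or-identity₄ : ∀ t → 0ℚ + 0ℚ + 1ℚ + t + 0ℚ ≡ 1ℚ + t
  good-or-identity₄ = solve 1 (λ t → cst 0ℚ :+ cst 0ℚ :+ cst 1ℚ :+ t :+ cst 0ℚ := cst 1ℚ :+ t) refl

  small-mass-identity : ∀ s n k → s * n * k ≡ k * s * n
  small-mass-identity = solve 3 (λ s n k → s :* n :* k := k :* s :* n) refl

  removed≤-identity : ∀ e d v → e * v + e * v + e * v + e * v + (e * v + d * v) ≡ (d + (3ℚ + 2ℚ) * e) * v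
  removed≤-identity = solve 3 (λ e d v → e :* v :+ e :* v :+ e :* v :+ e :* v :+ (e :* v :+ d :* v) := (d :+ (cst 3ℚ :+ cst 2ℚ) :* e) :* v) refl

  small₂-identity : ∀ n e → n * (e * n) ≡ e * (n * n)
  small₂-identity = solve 2 (λ n e → n :* (e :* n) := e :* (n :* n)) refl

  sparse≤-identity : ∀ e f v w → v + w ≡ e + ((v - (e - f)) + (w - f))
  sparse≤-identity = solve 4 (λ e f v w → v :+ w := e :+ (v :- (e :- f) :+ (w :- f))) refl

  form≥-identity : ∀ m b F → F ≡ - b + (2ℚ * (½ * (m + F)) - (m - b))
  form≥-identity = solve 3 (λ m b F → F := :- b :+ (cst 2ℚ :* (cst ½ :* (m :+ F)) :- (m :- b))) refl

  edge-good-identity : ∀ a b → a * (1ℚ - b) ≡ a - a * b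
  edge-good-identity = solve 2 (λ a b → a :* (cst 1ℚ :- b) := a :- a :* b) refl

  good-mass≥-identity : ∀ e m v → m ≡ e - v + (m + v - e)
  good-mass≥-identity = solve 3 (λ e m v → m := e :- v :+ (m :+ v :- e)) refl

  removed≤B-identity : ∀ d e v b → b ≡ int 8000 / 1 * ((d + (3ℚ + 2ℚ) * e) * v) + ((b - int 48000 / 1 * (d * v)) * (int 1 / 6) + (b - int 48000 / 1 * (e * v)) * (int 5 / 6))
  removed≤B-identity = solve 4 (λ d e v b → b := cst (int 8000 / 1) :* ((d :+ (cst 3ℚ :+ cst 2ℚ) :* e) :* v) :+ ((b :- cst (int 48000 / 1) :* (d :* v)) :* cst (int 1 / 6) :+ (b :- cst (int 48000 / 1) :* (e :* v)) :* cst (int 5 / 6))) refl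

  cherry-identity : ∀ g → 0ℚ + g + 0ℚ ≡ g
  cherry-identity = solve 1 (λ g → cst 0ℚ :+ g :+ cst 0ℚ := g) refl

  vec-bounded-identity : ∀ z t → z - t ≡ - 1ℚ + (z + (1ℚ - t))
  vec-bounded-identity = solve 2 (λ z t → z :- t := :- (cst 1ℚ) :+ (z :+ (cst 1ℚ :- t))) refl

  vec-bounded-identity₂ : ∀ z t → 1ℚ ≡ z - t + ((1ℚ - z) + t)
  vec-bounded-identity₂ = solve 2 (λ z t → cst 1ℚ := z :- t :+ (cst 1ℚ :- z :+ t)) refl

  form-vec-identity : ∀ a x y t → a * ((x - t) * (y - t)) ≡ a * (x * y) - (t * (a * x) + t * (a * y)) + t * t * a
  form-vec-identity = solve 4 (λ a x y t → a :* ((x :- t) :* (y :- t)) := a :* (x :* y) :- (t :* (a :* x) :+ t :* (a :* y)) :+ t :* t :* a) refl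

  form-vec-identity₂ : ∀ t a → t * a + t * a ≡ 2ℚ * t * a
  form-vec-identity₂ = solve 2 (λ t a → t :* a :+ t :* a := cst 2ℚ :* t :* a) refl

  neg-N-identity : ∀ n b → - (n * b) ≡ n * (- b)
  neg-N-identity = solve 2 (λ n b → :- (n :* b) := n :* (:- b)) refl

  T₂≥-identity : ∀ q w → q * q ≡ 2ℚ * w * q - w * w + (q - w) * (q - w)
  T₂≥-identity = solve 2 (λ q w → q :* q := cst 2ℚ :* w :* q :- w :* w :+ (q :- w) :* (q :- w)) refl

  eZ≥-identity : ∀ β v m e → e ≡ int 1 / 3 * β * v + ((int 6 / 1 * e - m) * (int 1 / 6) + (m - 2ℚ * β * v) * (int 1 / 6))
  eZ≥-identity = solve 4 (λ β v m e → e := cst (int 1 / 3) :* β :* v :+ ((cst (int 6 / 1) :* e :- m) :* cst (int 1 / 6) :+ (m :- cst 2ℚ :* β :* v) :* cst (int 1 / 6))) refl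

  more-identity : ∀ β N e m v → int 1 / 3 * β * N * ((e - int 1 / 3 * β * v) + (int 6 / 1 * e - m) * (int 1 / 6)) ≡ 2ℚ * (int 1 / 3 * β * N) * e - int 1 / 3 * β * (int 1 / 3 * β) * v * N - N * (int 1 / 18 * β * m)
  more-identity = solve 5 (λ β N e m v → cst (int 1 / 3) :* β :* N :* (e :- cst (int 1 / 3) :* β :* v :+ (cst (int 6 / 1) :* e :- m) :* cst (int 1 / 6)) := cst 2ℚ :* (cst (int 1 / 3) :* β :* N) :* e :- cst (int 1 / 3) :* β :* (cst (int 1 / 3) :* β) :* v :* N :- N :* (cst (int 1 / 18) :* β :* m)) refl

  more-identity₂ : ∀ β N e m → 2ℚ * (int 1 / 3 * β * N) * e - int 1 / 3 * β * (int 1 / 3 * β) * (N * N) * N - N * (int 1 / 18 * β * m) ≡ 2ℚ * (int 1 / 3 * β * N) * e - int 1 / 3 * β * N * (int 1 / 3 * β * N) * N - N * (int 1 / 18 * β * m)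
  more-identity₂ = solve 4 (λ β N e m → cst 2ℚ :* (cst (int 1 / 3) :* β :* N) :* e :- cst (int 1 / 3) :* β :* (cst (int 1 / 3) :* β) :* (N :* N) :* N :- N :* (cst (int 1 / 18) :* β :* m) := cst 2ℚ :* (cst (int 1 / 3) :* β :* N) :* e :- cst (int 1 / 3) :* β :* N :* (cst (int 1 / 3) :* β :* N) :* N :- N :* (cst (int 1 / 18) :* β :* m)) refl

  ones-edges-identity : ∀ a T₁ T₂ p s d Q w → (a - T₁) + (T₁ - p * T₂ + s - (- d)) + p * ((T₂ - Q) + (Q - w)) ≡ a + s + d - p * w
  ones-edges-identity = solve 8 (λ a T₁ T₂ p s d Q w → a :- T₁ :+ (T₁ :- p :* T₂ :+ s :- :- d) :+ p :* (T₂ :- Q :+ (Q :- w)) := a :+ s :+ d :- p :* w) refl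

  ones-edges-identity₂ : ∀ N r e d β M → N * e ≡ N * (int 1 / 324 * (β * β * M) - d - r) + (N * (r + e) + N * (int 1 / 18 * β * (int 1 / 18 * β) * M) + N * d - 2ℚ * (int 1 / 18 * β) * (N * (int 1 / 18 * β * M)))
  ones-edges-identity₂ = solve 6 (λ N r e d β M → N :* e := N :* (cst (int 1 / 324) :* (β :* β :* M) :- d :- r) :+ (N :* (r :+ e) :+ N :* (cst (int 1 / 18) :* β :* (cst (int 1 / 18) :* β) :* M) :+ N :* d :- cst 2ℚ :* (cst (int 1 / 18) :* β) :* (N :* (cst (int 1 / 18) :* β :* M)))) refl

  weight-split-identity : ∀ g x y c → g * ((x + y) * c) ≡ g * (x * c) + g * (y * c)
  weight-split-identity = solve 4 (λ g x y c → g :* ((x :+ y) :* c) := g :* (x :* c) :+ g :* (y :* c)) refl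

  lite-bound-identity : ∀ V x y m → V - 3ℚ * m ≡ 3ℚ * x + ((V - 3ℚ * (y + x)) + 3ℚ * (y - m))
  lite-bound-identity = solve 4 (λ V x y m → V :- cst 3ℚ :* m := cst 3ℚ :* x :+ (V :- cst 3ℚ :* (y :+ x) :+ cst 3ℚ :* (y :- m))) refl

  cover-bound-identity : ∀ V m w r X → V ≡ int 3 / 4 * X + int 3 / 2 * m - int 3 / 2 * (r + 3ℚ * w) + (int 3 / 2 * r - int 3 / 4 * X + int 3 / 2 * (m + 3ℚ * w) + (V - 3ℚ * m))
  cover-bound-identity = solve 5 (λ V m w r X → V := cst (int 3 / 4) :* X :+ cst (int 3 / 2) :* m :- cst (int 3 / 2) :* (r :+ cst 3ℚ :* w) :+ (cst (int 3 / 2) :* r :- cst (int 3 / 4) :* X :+ cst (int 3 / 2) :* (m :+ cst 3ℚ :* w) :+ (V :- cst 3ℚ :* m))) refl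

  cover-bound-identity₂ : ∀ r E₁ E₂ E₃ X → int 3 / 4 * (2ℚ * (r + E₁ + E₂ + ½ * E₃) - X) ≡ int 3 / 2 * r - int 3 / 4 * X + int 3 / 2 * (E₁ + E₂ + ½ * E₃)
  cover-bound-identity₂ = solve 5 (λ r E₁ E₂ E₃ X → cst (int 3 / 4) :* (cst 2ℚ :* (r :+ E₁ :+ E₂ :+ cst ½ :* E₃) :- X) := cst (int 3 / 2) :* r :- cst (int 3 / 4) :* X :+ cst (int 3 / 2) :* (E₁ :+ E₂ :+ cst ½ :* E₃)) refl

  cover-bound-identity₃ : ∀ E₂ w a b → (a + w - E₂) + (b - a) ≡ b + w - E₂
  cover-bound-identity₃ = solve 4 (λ E₂ w a b → a :+ w :- E₂ :+ (b :- a) := b :+ w :- E₂) refl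

  cover-bound-identity₄ : ∀ E₃ w a b → ½ * ((a + w - E₃) + (b - a) + w) ≡ ½ * b + w - ½ * E₃
  cover-bound-identity₄ = solve 4 (λ E₃ w a b → cst ½ :* (a :+ w :- E₃ :+ (b :- a) :+ w) := cst ½ :* b :+ w :- cst ½ :* E₃) refl

  cover-bound-identity₅ : ∀ E₁ E₂ h m w p q → int 3 / 2 * (E₁ + E₂ + h) + int 3 / 2 * (m + w - E₁ + (p + w - E₂) + (q + w - h)) ≡ int 3 / 2 * (m + 3ℚ * w) + int 3 / 2 * (p + q)
  cover-bound-identity₅ = solve 7 (λ E₁ E₂ h m w p q → cst (int 3 / 2) :* (E₁ :+ E₂ :+ h) :+ cst (int 3 / 2) :* (m :+ w :- E₁ :+ (p :+ w :- E₂) :+ (q :+ w :- h)) := cst (int 3 / 2) :* (m :+ cst 3ℚ :* w) :+ cst (int 3 / 2) :* (p :+ q)) refl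

  cover-bound-identity₆ : ∀ V m p q → int 3 / 2 * (p + q) + ½ * (2ℚ * (V - 3ℚ * m) - 3ℚ * (p + q)) ≡ V - 3ℚ * m
  cover-bound-identity₆ = solve 4 (λ V m p q → cst (int 3 / 2) :* (p :+ q) :+ cst ½ :* (cst 2ℚ :* (V :- cst 3ℚ :* m) :- cst 3ℚ :* (p :+ q)) := V :- cst 3ℚ :* m) refl

  cover-bound-identity₇ : ∀ a b c d → a + (b + c) + d ≡ a + b + (c + d)
  cover-bound-identity₇ = solve 4 (λ a b c d → a :+ (b :+ c) :+ d := a :+ b :+ (c :+ d)) refl

  K≤-identity : ∀ a p q r m h → a * (p + (q + (r + m * h))) ≡ a * p + a * q + a * r + a * m * h
  K≤-identity = solve 6 (λ a p q r m h → a :* (p :+ (q :+ (r :+ m :* h))) := a :* p :+ a :* q :+ a :* r :+ a :* m :* h) refl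

  value≥-identity : ∀ V M p z r w B → V ≡ int 3 / 4 * M + int 1 / 300 * B + ((V - p) + (int 1 / 5 * M - z) + ((z + p) - (M - r - w)) + (B - int 8000 / 1 * r) * (int 1 / 8000) + (B - int 48000 / 1 * w) * (int 1 / 48000) + (M - B) * (int 1 / 20) + B * (int 1 / 20 - int 1 / 300 - int 1 / 8000 - int 1 / 48000))
  value≥-identity = solve 7 (λ V M p z r w B → V := cst (int 3 / 4) :* M :+ cst (int 1 / 300) :* B :+ (V :- p :+ (cst (int 1 / 5) :* M :- z) :+ (z :+ p :- (M :- r :- w)) :+ (B :- cst (int 8000 / 1) :* r) :* cst (int 1 / 8000) :+ (B :- cst (int 48000 / 1) :* w) :* cst (int 1 / 48000) :+ (M :- B) :* cst (int 1 / 20) :+ B :* (cst (int 1 / 20) :- cst (int 1 / 300) :- cst (int 1 / 8000) :- cst (int 1 / 48000)))) refl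

  M≤6eZ-identity : ∀ M m e w B → int 6 / 1 * e ≡ M + ((m - int 1 / 5 * M) * (int 6 / 1) + (e + w - m) * (int 6 / 1) + (B - int 48000 / 1 * w) * (int 6 / 48000) + (M - B) * (int 6 / 48000) + M * (int 1 / 5 - int 6 / 48000))
  M≤6eZ-identity = solve 5 (λ M m e w B → cst (int 6 / 1) :* e := M :+ ((m :- cst (int 1 / 5) :* M) :* cst (int 6 / 1) :+ (e :+ w :- m) :* cst (int 6 / 1) :+ (B :- cst (int 48000 / 1) :* w) :* cst (int 6 / 48000) :+ (M :- B) :* cst (int 6 / 48000) :+ M :* (cst (int 1 / 5) :- cst (int 6 / 48000)))) refl

  value≥-identity₂ : ∀ V M m e r w B → V ≡ int 3 / 4 * M + int 1 / 300 * B + ((V - (int 3 / 4 * (M - int 1 / 5000 * B) + int 3 / 2 * m - int 3 / 2 * (r + 3ℚ * w))) + int 3 / 2 * ((m - (e - w)) + (e - (int 1 / 324 * B - int 1 / 5000 * B - r))) + (B - int 8000 / 1 * r) * (int 3 / 8000) + (B - int 48000 / 1 * w) * (int 6 / 48000) + B * (int 1 / 216 - int 9 / 20000 - int 3 / 8000 - int 6 / 48000 - int 1 / 300))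
  value≥-identity₂ = solve 7 (λ V M m e r w B → V := cst (int 3 / 4) :* M :+ cst (int 1 / 300) :* B :+ (V :- (cst (int 3 / 4) :* (M :- cst (int 1 / 5000) :* B) :+ cst (int 3 / 2) :* m :- cst (int 3 / 2) :* (r :+ cst 3ℚ :* w)) :+ cst (int 3 / 2) :* (m :- (e :- w) :+ (e :- (cst (int 1 / 324) :* B :- cst (int 1 / 5000) :* B :- r))) :+ (B :- cst (int 8000 / 1) :* r) :* cst (int 3 / 8000) :+ (B :- cst (int 48000 / 1) :* w) :* cst (int 6 / 48000) :+ B :* (cst (int 1 / 216) :- cst (int 9 / 20000) :- cst (int 3 / 8000) :- cst (int 6 / 48000) :- cst (int 1 / 300)))) refl

  φ≤2-identity : ∀ p a f → p * (1ℚ * 1ℚ * (a - f)) ≡ p * a - p * f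
  φ≤2-identity = solve 3 (λ p a f → p :* (cst 1ℚ :* cst 1ℚ :* (a :- f)) := p :* a :- p :* f) refl

  φ≤2-identity₂ : ∀ s ε f e → s * (1ℚ + ε) ≡ s * f + ((ε * s - - (e - s * f)) + (s - e))
  φ≤2-identity₂ = solve 4 (λ s ε f e → s :* (cst 1ℚ :+ ε) := s :* f :+ (ε :* s :- :- (e :- s :* f) :+ (s :- e))) refl

  u-swap-identity : ∀ p q r x y z → p * q * r * (x * y * z) ≡ p * r * q * (y * x * z)
  u-swap-identity = solve 6 (λ p q r x y z → p :* q :* r :* (x :* y :* z) := p :* r :* q :* (y :* x :* z)) refl

  u-rot-identity : ∀ p q r x y z → p * q * r * (x * y * z) ≡ q * r * p * (y * z * x)
  u-rot-identity = solve 6 (λ p q r x y z → p :* q :* r :* (x :* y :* z) := q :* r :* p :* (y :* z :* x)) refl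

  u-zero-identity : ∀ z r → z * 0ℚ * r ≡ 0ℚ
  u-zero-identity = solve 2 (λ z r → z :* cst 0ℚ :* r := cst 0ℚ) refl

  u-product-identity : ∀ f s z → 0ℚ * f * s ≡ z * 0ℚ
  u-product-identity = solve 3 (λ f s z → cst 0ℚ :* f :* s := z :* cst 0ℚ) refl

  u-product-identity₂ : ∀ y p q r f g h → y * (p * q * r * 1ℚ) * (f * g * h) ≡ y * ((f * p) * (g * q) * (h * r))
  u-product-identity₂ = solve 7 (λ y p q r f g h → y :* (p :* q :* r :* cst 1ℚ) :* (f :* g :* h) := y :* (f :* p :* (g :* q) :* (h :* r))) refl

  u-product-identity₃ : ∀ y R x y′ z F X Y′ Z → y * (R * (x * y′ * z)) * F * (X * (Y′ * Z)) ≡ y * (R * ((X * x) * (Y′ * y′) * (Z * z))) * F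
  u-product-identity₃ = solve 9 (λ y R x y′ z F X Y′ Z → y :* (R :* (x :* y′ :* z)) :* F :* (X :* (Y′ :* Z)) := y :* (R :* (X :* x :* (Y′ :* y′) :* (Z :* z))) :* F) refl

  uφφ≥0-identity : ∀ x y → 0ℚ * x * y ≡ 0ℚ
  uφφ≥0-identity = solve 2 (λ x y → cst 0ℚ :* x :* y := cst 0ℚ) refl

  uφφ≤-identity : ∀ u → 2ℚ * u * 2ℚ ≡ 4ℚ * u
  uφφ≤-identity = solve 1 (λ u → cst 2ℚ :* u :* cst 2ℚ := cst 4ℚ :* u) refl

  uφφ≤-identity₂ : ∀ x y → 0ℚ * x * y ≡ 4ℚ * 0ℚ
  uφφ≤-identity₂ = solve 2 (λ x y → cst 0ℚ :* x :* y := cst 4ℚ :* cst 0ℚ) refl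

  target≤-identity : ∀ φ s s′ u f g q → φ * (s * s′) * (u * f * g * q) ≡ u * (φ * f * g) * (s * (s′ * q))
  target≤-identity = solve 7 (λ φ s s′ u f g q → φ :* (s :* s′) :* (u :* f :* g :* q) := u :* (φ :* f :* g) :* (s :* (s′ :* q))) refl

  target≤-identity₂ : ∀ z p → z * (1ℚ * p) ≡ p * z
  target≤-identity₂ = solve 2 (λ z p → z :* (cst 1ℚ :* p) := p :* z) refl

  target≤-identity₃ : ∀ x y z → 0ℚ * x * y * z ≡ 0ℚ * 0ℚ
  target≤-identity₃ = solve 3 (λ x y z → cst 0ℚ :* x :* y :* z := cst 0ℚ :* cst 0ℚ) refl

  d²U≤-identity : ∀ z → 1ℚ ≡ 1ℚ - z + z
  d²U≤-identity = solve 1 (λ z → cst 1ℚ := cst 1ℚ :- z :+ z) refl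

  d²U≤-identity₂ : ∀ d u → d * d * u ≡ u * d * d
  d²U≤-identity₂ = solve 2 (λ d u → d :* d :* u := u :* d :* d) refl

  u-small-identity : ∀ u d s → u * (d * d * s) ≡ u * d * d * s
  u-small-identity = solve 3 (λ u d s → u :* (d :* d :* s) := u :* d :* d :* s) refl

  w-swap-identity : ∀ a b e → a * b * e ≡ a * e * b
  w-swap-identity = solve 3 (λ a b e → a :* b :* e := a :* e :* b) refl

  w-rot-identity : ∀ a b e → a * b * e ≡ b * e * a
  w-rot-identity = solve 3 (λ a b e → a :* b :* e := b :* e :* a) refl

  ∑w≥-identity : ∀ V a b e ε U → V + a + b + e ≡ V - int 7 / 1 * (ε * U) + ((ε * U - - a) + (ε * (2ℚ * U) - - b) + (ε * (4ℚ * U) - - e))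
  ∑w≥-identity = solve 6 (λ V a b e ε U → V :+ a :+ b :+ e := V :- cst (int 7 / 1) :* (ε :* U) :+ (ε :* U :- :- a :+ (ε :* (cst 2ℚ :* U) :- :- b) :+ (ε :* (cst 4ℚ :* U) :- :- e))) refl

  ∑w≥-identity₂ : ∀ U a b e f g h → U * (a * b * e) ≡ U * (f * g * h) + U * (a * e * (b - g)) + U * g * (a * 1ℚ * (e - h)) + U * g * h * (1ℚ * 1ℚ * (a - f))
  ∑w≥-identity₂ = solve 7 (λ U a b e f g h → U :* (a :* b :* e) := U :* (f :* g :* h) :+ U :* (a :* e :* (b :- g)) :+ U :* g :* (a :* cst 1ℚ :* (e :- h)) :+ U :* g :* h :* (cst 1ℚ :* cst 1ℚ :* (a :- f))) refl

  overload≤-identity : ∀ e u → e * u + e * (2ℚ * u) ≡ 3ℚ * (e * u)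
  overload≤-identity = solve 2 (λ e u → e :* u :+ e :* (cst 2ℚ :* u) := cst 3ℚ :* (e :* u)) refl

  overload≤-identity₂ : ∀ U s a e f g → U * (s * a * (e - f)) + U * f * (s * 1ℚ * (a - g)) ≡ s * (U * (e * a) - U * f * g)
  overload≤-identity₂ = solve 6 (λ U s a e f g → U :* (s :* a :* (e :- f)) :+ U :* f :* (s :* cst 1ℚ :* (a :- g)) := s :* (U :* (e :* a) :- U :* f :* g)) refl

  overload≤-identity₃ : ∀ z ℓ t g → g - t ≡ z * ℓ + ((1ℚ - z) * (ℓ - 1ℚ) + (1ℚ - z - t) + (g - ℓ))
  overload≤-identity₃ = solve 4 (λ z ℓ t g → g :- t := z :* ℓ :+ ((cst 1ℚ :- z) :* (ℓ :- cst 1ℚ) :+ (cst 1ℚ :- z :- t) :+ (g :- ℓ))) refl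

  w′-supp-identity : ∀ u a b o → u * (0ℚ * a * b) * o ≡ 0ℚ
  w′-supp-identity = solve 4 (λ u a b o → u :* (cst 0ℚ :* a :* b) :* o := cst 0ℚ) refl

  w′-small-identity : ∀ η s u → η * s * u ≡ η * (u * s)
  w′-small-identity = solve 3 (λ η s u → η :* s :* u := η :* (u :* s)) refl

  ∑w′≥-identity : ∀ a b o → a ≡ b - o + (a + o - b)
  ∑w′≥-identity = solve 3 (λ a b o → a := b :- o :+ (a :+ o :- b)) refl

  ∑w′≥-identity₂ : ∀ a → a + a + a ≡ 3ℚ * a
  ∑w′≥-identity₂ = solve 1 (λ a → a :+ a :+ a := cst 3ℚ :* a) refl

  three-identity : ∀ a b q r → 0ℚ * a * b + (1ℚ + q + r) ≡ 1ℚ + (q + r)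
  three-identity = solve 4 (λ a b q r → cst 0ℚ :* a :* b :+ (cst 1ℚ :+ q :+ r) := cst 1ℚ :+ (q :+ r)) refl

  three-identity₂ : ∀ b r → 1ℚ * 0ℚ * b + (0ℚ + 1ℚ + r) ≡ 1ℚ + r
  three-identity₂ = solve 2 (λ b r → cst 1ℚ :* cst 0ℚ :* b :+ (cst 0ℚ :+ cst 1ℚ :+ r) := cst 1ℚ :+ r) refl

  ∑w′≥-identity₃ : ∀ w a p q r → w * (a + (p + q + r)) ≡ w * a + (p * w + q * w + r * w)
  ∑w′≥-identity₃ = solve 5 (λ w a p q r → w :* (a :+ (p :+ q :+ r)) := w :* a :+ (p :* w :+ q :* w :+ r :* w)) refl

  lifted-identity : ∀ ζ D X ε U o W W′ V → ζ * D * W′ ≡ ζ * D * X - int 16 / 1 * (ε * V) + (ζ * D * ((W′ - (W - 3ℚ * o)) + (W - (X - int 7 / 1 * (ε * U)))) + D * (3ℚ * (3ℚ * (ε * U) - ζ * o) + int 7 / 1 * (1ℚ - ζ) * (ε * U)) + int 16 / 1 * ε * (V - D * U))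
  lifted-identity = solve 9 (λ ζ D X ε U o W W′ V → ζ :* D :* W′ := ζ :* D :* X :- cst (int 16 / 1) :* (ε :* V) :+ (ζ :* D :* (W′ :- (W :- cst 3ℚ :* o) :+ (W :- (X :- cst (int 7 / 1) :* (ε :* U)))) :+ D :* (cst 3ℚ :* (cst 3ℚ :* (ε :* U) :- ζ :* o) :+ cst (int 7 / 1) :* (cst 1ℚ :- ζ) :* (ε :* U)) :+ cst (int 16 / 1) :* ε :* (V :- D :* U))) refl

  module Reduction {n k : ℕ} (adj : Fin n → Fin n → Bool) (adj-sym : ∀ x y → adj x y ≡ adj y x) (adj-irr : ∀ x → adj x x ≡ false)
    (c : Fin n → Fin k) (φ : Fin k → Fin k → ℚ) (φ-sym : ∀ a b → φ a b ≡ φ b a) (bad : Fin k → Fin k → Bool)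
    (ε d σ : ℚ) (0≤ε : 0ℚ ≤ ε) (0<d : 0ℚ < d) (0≤σ : 0ℚ ≤ σ) (kσ≤ε : ι k * σ ≤ ε)
    (bad-mass : ∑² (λ x y → 𝟙 (bad (c x) (c y))) ≤ ε * ∑² {n} {n} (λ _ _ → 1ℚ))
    (dev≤ : ∀ a b → bad a b ≡ false → ∀ S T → Partition.dev (λ x y → 𝟙 (adj x y)) c φ a b S T ≤ ε * (Partition.size (λ x y → 𝟙 (adj x y)) c φ a * Partition.size (λ x y → 𝟙 (adj x y)) c φ b))
    (-dev≤ : ∀ a b → bad a b ≡ false → ∀ S T → - Partition.dev (λ x y → 𝟙 (adj x y)) c φ a b S T ≤ ε * (Partition.size (λ x y → 𝟙 (adj x y)) c φ a * Partition.size (λ x y → 𝟙 (adj x y)) c φ b))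
    where

    A : Fin n → Fin n → ℚ
    A x y = 𝟙 (adj x y)

    A-sym : ∀ x y → A x y ≡ A y x
    A-sym x y = cong 𝟙 (adj-sym x y)

    A≥0 : ∀ x y → 0ℚ ≤ A x y
    A≥0 x y = 𝟙≥0 (adj x y)

    A≤1 : ∀ x y → A x y ≤ 1ℚ
    A≤1 x y = 𝟙≤1 (adj x y)

    open Partition A c φ using (size; dev)

    0≤d = <⇒≤ 0<d

    N V² M : ℚ
    N = ∑ᶠ {n} (λ _ → 1ℚ)
    V² = ∑² {n} {n} (λ _ _ → 1ℚ)
    M = ∑² A

    0≤N : 0ℚ ≤ N
    0≤N = ∑ᶠ-≥0 (λ _ → 0≤1)

    ∑²-const : ∀ q → ∑² {n} {n} (λ _ _ → q) ≡ q * V²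
    ∑²-const q = trans (∑²-cong (λ _ _ → sym (*-identityʳ q))) (∑²-* q (λ _ _ → 1ℚ))

    V²≡ : V² ≡ N * N
    V²≡ = ∑²-× {n} {n} (λ _ → 1ℚ) (λ _ → 1ℚ)

    0≤V² : 0ℚ ≤ V²
    0≤V² = ∑²-≥0 {n} {n} (λ _ _ → 0≤1)

    size≥0 : ∀ a → 0ℚ ≤ size a
    size≥0 a = ∑ᶠ-≥0 (λ x → δ≥0 (c x) a)

    class-sum₁ : ∀ (p : Fin k → ℚ) → ∑ᶠ (λ x → p (c x)) ≡ ∑ᶠ (λ a → p a * size a)
    class-sum₁ p = trans (∑ᶠ-class c (λ a _ → p a)) (∑ᶠ-cong (λ a → trans (∑ᶠ-*ʳ (p a) (λ x → δ (c x) a)) (*-comm (size a) (p a))))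

    class-sum : ∀ (p : Fin k → Fin k → ℚ) → ∑² (λ x y → p (c x) (c y)) ≡ ∑² (λ a b → p a b * (size a * size b))
    class-sum p = trans (∑²-class c (λ a b _ _ → p a b)) (∑²-cong (λ a b → trans (∑ᶠ-cong (λ x → ∑ᶠ-*ʳ (p a b) (λ y → δ (c x) a * δ (c y) b)))
        (trans (∑ᶠ-*ʳ (p a b) (λ x → ∑ᶠ (λ y → δ (c x) a * δ (c y) b))) (trans (*-comm _ (p a b)) (cong (p a b *_) (∑²-× (λ x → δ (c x) a) (λ y → δ (c y) b)))))))

    module _ (p : Fin k → Fin k → ℚ) (p≥0 : ∀ a b → 0ℚ ≤ p a b) (p-bad : ∀ a b → bad a b ≡ true → p a b ≡ 0ℚ) (S T : Fin n → Bool) where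

      -- Regularity in summed form: class pairs carry nonnegative weights vanishing on bad pairs,
      -- and a single S and T serve all classes at once. In the applications S and T depend on a
      -- third vertex held fixed.
      deviation : ℚ
      deviation = ∑² (λ y z → p (c y) (c z) * (𝟙 (S y) * 𝟙 (T z) * (A y z - φ (c y) (c z))))

      deviation≡ : deviation ≡ ∑² (λ a b → p a b * dev a b S T)
      deviation≡ = trans (∑²-class c (λ a b y z → p a b * (𝟙 (S y) * 𝟙 (T z) * (A y z - φ a b)))) (∑²-cong (λ a b → trans (∑²-cong (λ y z → deviation≡-identity (δ (c y) a * δ (c z) b) (p a b) (𝟙 (S y) * 𝟙 (T z) * (A y z - φ a b)))) (∑²-* (p a b) _)))

      bound≡ : ∑² (λ a b → p a b * (ε * (size a * size b))) ≡ ε * ∑² (λ y z → p (c y) (c z))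
      bound≡ = trans (∑²-cong (λ a b → deviation≡-identity (p a b) ε (size a * size b))) (trans (∑²-* ε _) (cong (ε *_) (sym (class-sum p))))

      weigh : ∀ (f g : Fin k → Fin k → ℚ) → (∀ a b → bad a b ≡ false → f a b ≤ g a b) → ∀ a b → p a b * f a b ≤ p a b * g a b
      weigh f g h a b = from (bcase (bad a b))
        where from : bad a b ≡ true ⊎ bad a b ≡ false → p a b * f a b ≤ p a b * g a b
              from (inj₁ e) = ≤-reflexive (trans (cong (_* f a b) (p-bad a b e)) (trans (*-zeroˡ (f a b)) (sym (trans (cong (_* g a b) (p-bad a b e)) (*-zeroˡ (g a b))))))
              from (inj₂ e) = *-mono-≥0 (p a b) (p≥0 a b) (h a b e)

      deviation≤ : deviation ≤ ε * ∑² (λ y z → p (c y) (c z))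
      deviation≤ = deviation≡ ≡≤ ∑²-mono (weigh (λ a b → dev a b S T) (λ a b → ε * (size a * size b)) (λ a b e → dev≤ a b e S T)) ≤≡ bound≡

      -deviation≤ : - deviation ≤ ε * ∑² (λ y z → p (c y) (c z))
      -deviation≤ = trans (cong -_ deviation≡) (trans (-deviation≤-identity _) (trans (sym (∑²-* (- 1ℚ) (λ a b → p a b * dev a b S T))) (∑²-cong (λ a b → -deviation≤-identity₂ (p a b) (dev a b S T))))) ≡≤
          ∑²-mono (weigh (λ a b → - dev a b S T) (λ a b → ε * (size a * size b)) (λ a b e → -dev≤ a b e S T)) ≤≡ bound≡

    small big : Fin k → Bool
    small a = lt (size a) (σ * N)
    big a = not (small a)

    -- `bad` need not be symmetric, so both orders are tested. Large classes are required so that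
    -- the weight of a single triangle will be small.
    good : Fin k → Fin k → Bool
    good a b = (not (bad a b) ∧ not (bad b a)) ∧ (not (lt (φ a b) d) ∧ (big a ∧ big b))

    good-sym : ∀ a b → good a b ≡ good b a
    good-sym a b = cong₂ _∧_ (Bool.∧-comm (not (bad a b)) (not (bad b a))) (cong₂ (λ u v → not (lt u d) ∧ v) (φ-sym a b) (Bool.∧-comm (big a) (big b)))

    record Good (a b : Fin k) : Set where
      field
        not-bad : bad a b ≡ false
        dense : d ≤ φ a b
        bigˡ : σ * N ≤ size a
        bigʳ : σ * N ≤ size b

    good⇒ : ∀ {a b} → good a b ≡ true → Good a b
    good⇒ {a} {b} e with bad a b in e₀ | bad b a | lt (φ a b) d in e₁ | lt (size a) (σ * N) in e₂ | lt (size b) (σ * N) in e₃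
    ... | false | false | false | false | false = record { not-bad = e₀ ; dense = lt-false e₁ ; bigˡ = lt-false e₂ ; bigʳ = lt-false e₃ }

    C : Fin k → Fin k → ℚ
    C a b = 𝟙 (good a b) * (φ a b * (size a * size b))

    C≥0 : ∀ a b → 0ℚ ≤ C a b
    C≥0 a b = from (bcase (good a b))
      where from : good a b ≡ true ⊎ good a b ≡ false → 0ℚ ≤ C a b
            from (inj₁ e) = 𝟙≥0 (good a b) ⊛ (≤-trans 0≤d (Good.dense (good⇒ e)) ⊛ (size≥0 a ⊛ size≥0 b))
            from (inj₂ e) = ≤-reflexive (sym (trans (cong (λ z → 𝟙 z * (φ a b * (size a * size b))) e) (*-zeroˡ (φ a b * (size a * size b)))))

    C-sym : ∀ a b → C a b ≡ C b a
    C-sym a b = cong₂ (λ u v → 𝟙 u * v) (good-sym a b) (cong₂ _*_ (φ-sym a b) (*-comm (size a) (size b)))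

    open ClassLP C C-sym C≥0 public

    edgeMass : Pairs → ℚ
    edgeMass K = ∑² (λ x y → A x y * 𝟙 (K (c x) (c y)))

    Sub : Pairs → Set
    Sub K = ∀ a b → K a b ≡ true → good a b ≡ true

    𝟙≤V² : ∀ (K : Pairs) → ∑² (λ x y → 𝟙 (K (c x) (c y))) ≤ V²
    𝟙≤V² K = ∑²-mono (λ x y → 𝟙≤1 (K (c x) (c y)))

    module _ (K : Pairs) (sub : Sub K) where

      sub-bad : ∀ a b → bad a b ≡ true → 𝟙 (K a b) ≡ 0ℚ
      sub-bad a b e = from (bcase (K a b))
        where from : K a b ≡ true ⊎ K a b ≡ false → 𝟙 (K a b) ≡ 0ℚ
              from (inj₁ h) = ⊥-elim (true≢false e (Good.not-bad (good⇒ (sub a b h))))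
              from (inj₂ h) = cong 𝟙 h

      mass≡ : mass K ≡ ∑² (λ x y → 𝟙 (K (c x) (c y)) * φ (c x) (c y))
      mass≡ = trans (∑²-cong (λ a b → trans (sym (*-assoc (𝟙 (K a b)) (𝟙 (good a b)) (φ a b * (size a * size b)))) (trans (cong (_* (φ a b * (size a * size b))) (absorb a b)) (sym (*-assoc (𝟙 (K a b)) (φ a b) (size a * size b))))))
                (sym (class-sum (λ a b → 𝟙 (K a b) * φ a b)))
        where
        absorb : ∀ a b → 𝟙 (K a b) * 𝟙 (good a b) ≡ 𝟙 (K a b)
        absorb a b = from (bcase (K a b))
          where from : K a b ≡ true ⊎ K a b ≡ false → 𝟙 (K a b) * 𝟙 (good a b) ≡ 𝟙 (K a b)
                from (inj₁ h) = trans (cong (λ z → 𝟙 (K a b) * 𝟙 z) (sub a b h)) (*-identityʳ (𝟙 (K a b)))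
                from (inj₂ h) = trans (cong (λ z → 𝟙 z * 𝟙 (good a b)) h) (trans (*-zeroˡ (𝟙 (good a b))) (sym (cong 𝟙 h)))

      deviationK : deviation (λ a b → 𝟙 (K a b)) (λ a b → 𝟙≥0 (K a b)) sub-bad (λ _ → true) (λ _ → true) ≡ edgeMass K - mass K
      deviationK = trans (∑²-cong (λ x y → deviationK-identity (𝟙 (K (c x) (c y))) (A x y) (φ (c x) (c y)))) (trans (∑²-- (λ x y → A x y * 𝟙 (K (c x) (c y))) (λ x y → 𝟙 (K (c x) (c y)) * φ (c x) (c y))) (cong (λ z → edgeMass K - z) (sym mass≡)))

      edge≤mass : edgeMass K ≤ mass K + ε * V²
      edge≤mass = lin (*-mono-≥0 ε 0≤ε (𝟙≤V² K) ⟨-⟩ (sym deviationK ≡≤ deviation≤ (λ a b → 𝟙 (K a b)) (λ a b → 𝟙≥0 (K a b)) sub-bad (λ _ → true) (λ _ → true))) (edge≤mass-identity (edgeMass K) (mass K) (ε * V²))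
        where _⟨-⟩_ : ∀ {a b e} → a ≤ b → e ≤ a → 0ℚ ≤ b - e
              p ⟨-⟩ q = 0≤- (≤-trans q p)

      mass≤edge : mass K ≤ edgeMass K + ε * V²
      mass≤edge = lin (0≤- (≤-trans (cong -_ (sym deviationK) ≡≤ -deviation≤ (λ a b → 𝟙 (K a b)) (λ a b → 𝟙≥0 (K a b)) sub-bad (λ _ → true) (λ _ → true)) (*-mono-≥0 ε 0≤ε (𝟙≤V² K)))) (mass≤edge-identity (edgeMass K) (mass K) (ε * V²))

    removed : ℚ
    removed = edgeMass (λ a b → not (good a b))

    sparse : Pairs
    sparse a b = not (bad a b) ∧ lt (φ a b) d

    good-or : ∀ a b → 𝟙 (not (good a b)) ≤ 𝟙 (bad a b) + 𝟙 (bad b a) + 𝟙 (small a) + 𝟙 (small b) + 𝟙 (sparse a b)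
    good-or a b with bad a b | bad b a | lt (φ a b) d | lt (size a) (σ * N) | lt (size b) (σ * N)
    ... | false | false | false | false | false = ≤-refl
    ... | true | q | _ | s | t = lin (𝟙≥0 q ⊕ 𝟙≥0 s ⊕ 𝟙≥0 t) (good-or-identity (𝟙 q) (𝟙 s) (𝟙 t))
    ... | false | true | r | s | t = lin (𝟙≥0 s ⊕ 𝟙≥0 t ⊕ 𝟙≥0 r) (good-or-identity₂ (𝟙 s) (𝟙 t) (𝟙 r))
    ... | false | false | true | s | t = lin (𝟙≥0 s ⊕ 𝟙≥0 t) (good-or-identity₃ (𝟙 s) (𝟙 t))
    ... | false | false | false | true | t = lin (𝟙≥0 t) (good-or-identity₄ (𝟙 t))
    ... | false | false | false | false | true = ≤-refl

    small-mass : ∑ᶠ (λ x → 𝟙 (small (c x))) ≤ ε * N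
    small-mass = class-sum₁ (λ a → 𝟙 (small a)) ≡≤ ≤-trans (∑ᶠ-mono term) (trans (∑ᶠ-cong {k} (λ _ → sym (*-identityʳ (σ * N)))) (trans (∑ᶠ-* (σ * N) (λ _ → 1ℚ)) (trans (cong (σ * N *_) (∑ᶠ1≡ι k)) (small-mass-identity σ N (ι k)))) ≡≤ *-mono-≥0ʳ N 0≤N kσ≤ε)
      where
      term : ∀ a → 𝟙 (small a) * size a ≤ σ * N
      term a = from (bcase (small a))
        where from : small a ≡ true ⊎ small a ≡ false → 𝟙 (small a) * size a ≤ σ * N
              from (inj₁ e) = trans (cong (λ z → 𝟙 z * size a) e) (*-identityˡ (size a)) ≡≤ <⇒≤ (lt-true e)
              from (inj₂ e) = trans (cong (λ z → 𝟙 z * size a) e) (*-zeroˡ (size a)) ≡≤ 0≤σ ⊛ 0≤N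

    -- Four ε come from bad pairs, their transposes, and small classes on either side; the fifth is
    -- the regularity error in passing from a density below d to a number of edges.
    removed≤ : removed ≤ (d + 5ℚ * ε) * V²
    removed≤ = begin
        removed ≤⟨ ∑²-mono term ⟩
        ∑² (λ x y → 𝟙 (bad (c x) (c y)) + 𝟙 (bad (c y) (c x)) + 𝟙 (small (c x)) + 𝟙 (small (c y)) + A x y * 𝟙 (sparse (c x) (c y)))
          ≡⟨ trans (∑²-+ _ _) (cong (_+ edgeMass sparse) (trans (∑²-+ _ _) (cong (_+ ∑² {n} {n} (λ _ y → 𝟙 (small (c y)))) (trans (∑²-+ _ _) (cong (_+ ∑² {n} {n} (λ x _ → 𝟙 (small (c x)))) (∑²-+ _ _)))))) ⟩
        ∑² (λ x y → 𝟙 (bad (c x) (c y))) + ∑² (λ x y → 𝟙 (bad (c y) (c x))) + ∑² {n} {n} (λ x _ → 𝟙 (small (c x))) + ∑² {n} {n} (λ _ y → 𝟙 (small (c y))) + edgeMass sparse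
          ≤⟨ +-mono-≤ (+-mono-≤ (+-mono-≤ (+-mono-≤ bad-mass (sym (∑ᶠ-swap (λ x y → 𝟙 (bad (c x) (c y)))) ≡≤ bad-mass)) (∑ᶠ-swap (λ x _ → 𝟙 (small (c x))) ≡≤ small₂)) small₂) sparse≤ ⟩
        ε * V² + ε * V² + ε * V² + ε * V² + (ε * V² + d * V²) ≡⟨ removed≤-identity ε d V² ⟩
        (d + 5ℚ * ε) * V² ∎
      where
      open ≤-Reasoning
      term : ∀ x y → A x y * 𝟙 (not (good (c x) (c y))) ≤ 𝟙 (bad (c x) (c y)) + 𝟙 (bad (c y) (c x)) + 𝟙 (small (c x)) + 𝟙 (small (c y)) + A x y * 𝟙 (sparse (c x) (c y))
      term x y = from (bcase (adj x y))
        where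
        p = 𝟙 (bad (c x) (c y))
        q = 𝟙 (bad (c y) (c x))
        r = 𝟙 (small (c x))
        s = 𝟙 (small (c y))
        t = 𝟙 (sparse (c x) (c y))
        from : adj x y ≡ true ⊎ adj x y ≡ false → A x y * 𝟙 (not (good (c x) (c y))) ≤ p + q + r + s + A x y * t
        from (inj₁ e) = trans (cong (λ z → 𝟙 z * 𝟙 (not (good (c x) (c y)))) e) (*-identityˡ _) ≡≤ good-or (c x) (c y) ≤≡ cong (p + q + r + s +_) (sym (trans (cong (λ z → 𝟙 z * t) e) (*-identityˡ t)))
        from (inj₂ e) = trans (cong (λ z → 𝟙 z * 𝟙 (not (good (c x) (c y)))) e) (*-zeroˡ (𝟙 (not (good (c x) (c y))))) ≡≤ 𝟙≥0 (bad (c x) (c y)) ⊕ 𝟙≥0 (bad (c y) (c x)) ⊕ 𝟙≥0 (small (c x)) ⊕ 𝟙≥0 (small (c y)) ⊕ A≥0 x y ⊛ 𝟙≥0 (sparse (c x) (c y))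
      small₂ : ∑² {n} {n} (λ _ y → 𝟙 (small (c y))) ≤ ε * V²
      small₂ = trans (∑²-cong (λ _ y → sym (*-identityˡ (𝟙 (small (c y)))))) (∑²-× {n} {n} (λ _ → 1ℚ) (λ y → 𝟙 (small (c y)))) ≡≤ *-mono-≥0 N 0≤N small-mass ≤≡ trans (small₂-identity N ε) (cong (ε *_) (sym V²≡))
      sparse-bad : ∀ a b → bad a b ≡ true → 𝟙 (sparse a b) ≡ 0ℚ
      sparse-bad a b e = cong (λ z → 𝟙 (not z ∧ lt (φ a b) d)) e
      sparse≤ : edgeMass sparse ≤ ε * V² + d * V²
      sparse≤ = lin (0≤- (≤-trans (sym (trans (∑²-cong (λ x y → deviationK-identity (𝟙 (sparse (c x) (c y))) (A x y) (φ (c x) (c y)))) (∑²-- (λ x y → A x y * 𝟙 (sparse (c x) (c y))) (λ x y → 𝟙 (sparse (c x) (c y)) * φ (c x) (c y)))) ≡≤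
                  deviation≤ (λ a b → 𝟙 (sparse a b)) (λ a b → 𝟙≥0 (sparse a b)) sparse-bad (λ _ → true) (λ _ → true)) (*-mono-≥0 ε 0≤ε (𝟙≤V² sparse))) ⊕ 0≤- φ≤) (sparse≤-identity (edgeMass sparse) (∑² (λ x y → 𝟙 (sparse (c x) (c y)) * φ (c x) (c y))) (ε * V²) (d * V²))
        where
        φ≤ : ∑² (λ x y → 𝟙 (sparse (c x) (c y)) * φ (c x) (c y)) ≤ d * V²
        φ≤ = ∑²-mono (λ x y → one (c x) (c y)) ≤≡ ∑²-const d
          where
          one : ∀ a b → 𝟙 (sparse a b) * φ a b ≤ d
          one a b = from (bcase (sparse a b))
            where
            from : sparse a b ≡ true ⊎ sparse a b ≡ false → 𝟙 (sparse a b) * φ a b ≤ d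
            from (inj₁ e) = trans (cong (λ z → 𝟙 z * φ a b) e) (*-identityˡ (φ a b)) ≡≤ <⇒≤ (lt-true (∧₂ (not (bad a b)) e))
              where ∧₂ : ∀ x {y} → x ∧ y ≡ true → y ≡ true
                    ∧₂ true h = h
            from (inj₂ e) = trans (cong (λ z → 𝟙 z * φ a b) e) (*-zeroˡ (φ a b)) ≡≤ 0≤d

    Hits : (Fin n → Fin n → Bool) → Set
    Hits K = ∀ x y z → adj x y ≡ true → adj y z ≡ true → adj x z ≡ true → K x y ≡ true ⊎ K y z ≡ true ⊎ K x z ≡ true

    -- Lower bound for the linear program from hardness.

    module Bound (β : ℚ) (0<β : 0ℚ < β) (β≤1 : β ≤ 1ℚ) (0<N : 0ℚ < N) (ε≤d : ε ≤ d)
      (dV²≤ : int 48000 / 1 * (d * V²) ≤ β * β * M) (βV²≤ : 2ℚ * β * V² ≤ M)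
      (hard : ∀ K → (∀ x y → K x y ≡ K y x) → Hits K → M - int 1 / 5000 * (β * β * M) ≤ 2ℚ * ∑² (λ x y → A x y * 𝟙 (K x y)))
      (solution : Solution good) where

      open Solution solution
      V : ℚ
      V = ClassPacking.value packing

      0≤β = <⇒≤ 0<β

      0≤M : 0ℚ ≤ M
      0≤M = ∑²-≥0 A≥0

      B δB : ℚ
      B = β * β * M
      δB = int 1 / 5000 * B

      A-diag : ∀ x → A x x ≡ 0ℚ
      A-diag x = cong 𝟙 (adj-irr x)

      -- Every bipartition of the vertices yields a cover, so A is almost positive semidefinite on [-1,1]-vectors.
      form≥ : ∀ f → Bounded A A-diag f → - δB ≤ form A A-diag f
      form≥ f bf = from (signs A A-diag f bf)
        where
        from : ∃[ s ] form A A-diag (λ x → sgn (s x)) ≤ form A A-diag f → - δB ≤ form A A-diag f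
        from (s , le) = ≤-trans (lin (0≤- (hard (λ x y → same (s x) (s y)) (λ x y → same-sym (s x) (s y)) (λ x y z _ _ _ → two-of-three (s x) (s y) (s z)) ≤≡ cong (2ℚ *_) (∑-same A A-diag s))) (form≥-identity M δB F)) le
          where F = form A A-diag (λ x → sgn (s x))

      zeros ones lite : Pairs
      zeros a b = good a b ∧ not (lt 0ℚ (g a b))
      ones a b = good a b ∧ not (lt (g a b) 1ℚ)
      lite a b = good a b ∧ lt (g a b) 1ℚ

      zeros⇒ : ∀ {a b} → zeros a b ≡ true → good a b ≡ true × g a b ≤ 0ℚ
      zeros⇒ {a} {b} e = proj₁ (∧-true e) , lt-false (not-true (proj₂ (∧-true {good a b} e)))

      ones-sub : Sub ones
      ones-sub a b e = proj₁ (∧-true e)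

      zeros-sub : Sub zeros
      zeros-sub a b e = proj₁ (∧-true e)

      split-by : ∀ u v → 𝟙 u ≡ 𝟙 (u ∧ not v) + 𝟙 (u ∧ v)
      split-by false _ = refl
      split-by true true = refl
      split-by true false = refl

      mass-split : mass good ≡ mass zeros + mass positives
      mass-split = trans (∑²-cong (λ a b → trans (cong (_* C a b) (split-by (good a b) (lt 0ℚ (g a b)))) (*-distribʳ-+ (C a b) (𝟙 (zeros a b)) (𝟙 (positives a b))))) (∑²-+ _ _)

      edge-good : edgeMass good ≡ M - removed
      edge-good = trans (∑²-cong (λ x y → trans (cong (A x y *_) (flip (good (c x) (c y)))) (edge-good-identity (A x y) (𝟙 (not (good (c x) (c y))))))) (∑²-- A (λ x y → A x y * 𝟙 (not (good (c x) (c y)))))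
        where
              flip : ∀ b → 𝟙 b ≡ 1ℚ - 𝟙 (not b)
              flip true = refl
              flip false = refl

      good-mass≥ : M - removed - ε * V² ≤ mass good
      good-mass≥ = lin (0≤- (edge≤mass good (λ _ _ e → e))) (trans (good-mass≥-identity (edgeMass good) (mass good) (ε * V²)) (cong (λ z → z - ε * V² + (mass good + ε * V² - edgeMass good)) edge-good))

      εV²≤ : int 48000 / 1 * (ε * V²) ≤ B
      εV²≤ = ≤-trans (*-mono-≥0 (int 48000 / 1) (nonNegative⁻¹ (int 48000 / 1)) (*-mono-≥0ʳ V² 0≤V² ε≤d)) dV²≤

      removed≤B : int 8000 / 1 * removed ≤ B
      removed≤B = ≤-trans (*-mono-≥0 (int 8000 / 1) (nonNegative⁻¹ (int 8000 / 1)) removed≤) (lin (0≤- dV²≤ ⊛ nonNegative⁻¹ (int 1 / 6) ⊕ 0≤- εV²≤ ⊛ nonNegative⁻¹ (int 5 / 6)) (removed≤B-identity d ε V² B))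

      B≤M : B ≤ M
      B≤M = *-mono-≥0ʳ M 0≤M (*-mono² 0≤β 0≤1 β≤1 β≤1) ≤≡ *-identityˡ M

      -- Row v is the indicator of the neighbourhood of v within the pairs of dual weight 0, the set
      -- U of the test vector.
      z : Fin n → Fin n → ℚ
      z v x = 𝟙 (adj v x ∧ zeros (c v) (c x))

      z≥0 : ∀ v x → 0ℚ ≤ z v x
      z≥0 v x = 𝟙≥0 (adj v x ∧ zeros (c v) (c x))

      z≤1 : ∀ v x → z v x ≤ 1ℚ
      z≤1 v x = 𝟙≤1 (adj v x ∧ zeros (c v) (c x))

      ∑z : ∑² z ≡ edgeMass zeros
      ∑z = ∑²-cong (λ v x → 𝟙-∧ (adj v x) (zeros (c v) (c x)))

      -- With weight 0 on the classes of vx and vy, the covering constraint leaves all of the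
      -- required 1 to xy.
      cherry : ∀ v x y → z v x * z v y ≤ 𝟙 (not (good (c x) (c y))) + 𝟙 (ones (c x) (c y))
      cherry v x y = from (bcase (good (c x) (c y))) (bcase (lt (g (c x) (c y)) 1ℚ)) (bcase (zeros (c v) (c x))) (bcase (zeros (c v) (c y)))
        where
        zz≤1 : z v x * z v y ≤ 1ℚ
        zz≤1 = *-mono² (z≥0 v x) 0≤1 (z≤1 v x) (z≤1 v y)
        rhs = 𝟙 (not (good (c x) (c y))) + 𝟙 (ones (c x) (c y))
        0≤rhs : 0ℚ ≤ rhs
        0≤rhs = 𝟙≥0 (not (good (c x) (c y))) ⊕ 𝟙≥0 (ones (c x) (c y))
        z0 : ∀ u → zeros (c v) (c u) ≡ false → z v u ≡ 0ℚ
        z0 u e = trans (𝟙-∧ (adj v u) (zeros (c v) (c u))) (trans (cong (λ b → A v u * 𝟙 b) e) (*-zeroʳ (A v u)))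
        from : good (c x) (c y) ≡ true ⊎ good (c x) (c y) ≡ false → lt (g (c x) (c y)) 1ℚ ≡ true ⊎ lt (g (c x) (c y)) 1ℚ ≡ false →
               zeros (c v) (c x) ≡ true ⊎ zeros (c v) (c x) ≡ false → zeros (c v) (c y) ≡ true ⊎ zeros (c v) (c y) ≡ false → z v x * z v y ≤ rhs
        from (inj₂ e) _ _ _ = ≤-trans zz≤1 (lin (𝟙≥0 (ones (c x) (c y))) (cong (λ b → 𝟙 (not b) + 𝟙 (ones (c x) (c y))) e))
        from (inj₁ e) (inj₂ f) _ _ = ≤-trans zz≤1 (≤-reflexive (sym (trans (cong₂ (λ u w → 𝟙 (not u) + 𝟙 (u ∧ not w)) e f) refl)))
        from _ _ (inj₂ e) _ = trans (cong (_* z v y) (z0 x e)) (*-zeroˡ (z v y)) ≡≤ 0≤rhs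
        from _ _ _ (inj₂ e) = trans (cong (z v x *_) (z0 y e)) (*-zeroʳ (z v x)) ≡≤ 0≤rhs
        from (inj₁ e) (inj₁ f) (inj₁ p) (inj₁ q) = ⊥-elim (<-irrefl refl (≤-<-trans (≤-trans (g-cover (c v) (c x) (c y) (proj₁ (zeros⇒ p)) e (proj₁ (zeros⇒ q)))
            (+-mono-≤ (+-monoˡ-≤ (g (c x) (c y)) (proj₂ (zeros⇒ p))) (proj₂ (zeros⇒ q)))) (<-respˡ-≡ (sym (cherry-identity (g (c x) (c y)))) (lt-true f))))

      ones-sym : ∀ a b → ones a b ≡ ones b a
      ones-sym a b = cong₂ (λ u v → u ∧ not (lt v 1ℚ)) (good-sym a b) (g-sym a b)

      lite-sym : ∀ a b → lite a b ≡ lite b a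
      lite-sym a b = cong₂ (λ u v → u ∧ lt v 1ℚ) (good-sym a b) (g-sym a b)

      ∑const : ∀ q → ∑ᶠ {n} (λ _ → q) ≡ N * q
      ∑const q = trans (∑ᶠ-cong {n} (λ _ → sym (*-identityˡ q))) (∑ᶠ-*ʳ q (λ _ → 1ℚ))

      deg zdeg : Fin n → ℚ
      deg x = ∑ᶠ (A x)
      zdeg x = ∑ᶠ (λ v → z v x)

      -- `λ₀` = βN/3 is a lower bound for the average of `zdeg` once `eZ` ≥ M/6, because M ≥ 2βN².
      -- The choice t = β/18 maximises 2t·β/18 - t².
      e₁ eZ t λ₀ : ℚ
      e₁ = edgeMass ones
      eZ = edgeMass zeros
      t = int 1 / 18 * β
      λ₀ = int 1 / 3 * β * N

      0≤t : 0ℚ ≤ t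
      0≤t = nonNegative⁻¹ (int 1 / 18) ⊛ 0≤β

      t≤1 : t ≤ 1ℚ
      t≤1 = *-mono² (nonNegative⁻¹ (int 1 / 18)) 0≤1 (toWitness {a? = int 1 / 18 ≤? 1ℚ} _) β≤1
        where open import Relation.Nullary.Decidable using (toWitness)

      vec : Fin n → Fin n → ℚ
      vec v x = z v x - t

      vec-bounded : ∀ v → Bounded A A-diag (vec v)
      vec-bounded v x = lin (z≥0 v x ⊕ 0≤- t≤1) (vec-bounded-identity (z v x) t) , lin (0≤- (z≤1 v x) ⊕ 0≤t) (vec-bounded-identity₂ (z v x) t)

      Azz Az : Fin n → ℚ
      Azz v = ∑² (λ x y → A x y * (z v x * z v y))
      Az v = ∑² (λ x y → A x y * z v x)

      form-vec : ∀ v → form A A-diag (vec v) ≡ Azz v - 2ℚ * t * Az v + t * t * M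
      form-vec v = trans (∑²-cong (λ x y → form-vec-identity (A x y) (z v x) (z v y) t)) (trans (∑²-+ _ _) (cong₂ _+_
          (trans (∑²-- (λ x y → A x y * (z v x * z v y)) (λ x y → t * (A x y * z v x) + t * (A x y * z v y))) (cong (λ w → Azz v - w) (trans (∑²-+ _ _) (trans (cong₂ _+_ (∑²-* t _) (trans (∑²-* t _) (cong (t *_) flip))) (form-vec-identity₂ t (Az v))))))
          (∑²-* (t * t) A)))
        where
        flip : ∑² (λ x y → A x y * z v y) ≡ Az v
        flip = trans (∑ᶠ-swap (λ x y → A x y * z v y)) (∑²-cong (λ y x → cong (_* z v y) (A-sym x y)))

      T₁ T₂ : ℚ
      T₁ = ∑ᶠ Azz
      T₂ = ∑ᶠ Az

      sum-form : - (N * δB) ≤ T₁ - 2ℚ * t * T₂ + N * (t * t * M)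
      sum-form = neg-N ≡≤ ∑ᶠ-mono (λ v → form≥ (vec v) (vec-bounded v) ≤≡ form-vec v) ≤≡
          trans (∑ᶠ-+ (λ v → Azz v - 2ℚ * t * Az v) (λ _ → t * t * M)) (cong₂ _+_ (trans (∑ᶠ-- Azz (λ v → 2ℚ * t * Az v)) (cong (λ w → T₁ - w) (∑ᶠ-* (2ℚ * t) Az))) (∑const (t * t * M)))
        where
        neg-N : - (N * δB) ≡ ∑ᶠ {n} (λ _ → - δB)
        neg-N = trans (neg-N-identity N δB) (sym (∑const (- δB)))

      T₁≤ : T₁ ≤ N * (removed + e₁)
      T₁≤ = ≤-trans (∑ᶠ-mono (λ v → ≤-trans (∑²-mono (λ x y → *-mono-≥0 (A x y) (A≥0 x y) (cherry v x y) ≤≡ *-distribˡ-+ (A x y) _ _)) (≤-reflexive (∑²-+ _ _)))) (≤-reflexive (∑const (removed + e₁)))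

      -- `T₂` is the sum of `zdeg`·`deg`, hence at least that of `zdeg`². The tangent at `λ₀`
      -- replaces Cauchy-Schwarz and avoids a division.
      T₂≥ : 2ℚ * λ₀ * eZ - λ₀ * λ₀ * N ≤ T₂
      T₂≥ = begin
          2ℚ * λ₀ * eZ - λ₀ * λ₀ * N ≡⟨ cong (λ w → 2ℚ * λ₀ * w - λ₀ * λ₀ * N) (trans (sym ∑z) (∑ᶠ-swap z)) ⟩
          2ℚ * λ₀ * ∑ᶠ zdeg - λ₀ * λ₀ * N ≡⟨ sym (trans (∑ᶠ-- _ _) (cong₂ _-_ (∑ᶠ-* (2ℚ * λ₀) zdeg) (trans (∑const (λ₀ * λ₀)) (*-comm N (λ₀ * λ₀))))) ⟩
          ∑ᶠ (λ x → 2ℚ * λ₀ * zdeg x - λ₀ * λ₀) ≤⟨ ∑ᶠ-mono (λ x → lin (sq≥0 (zdeg x - λ₀)) (T₂≥-identity (zdeg x) λ₀)) ⟩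
          ∑ᶠ (λ x → zdeg x * zdeg x) ≤⟨ ∑ᶠ-mono (λ x → *-mono-≥0 (zdeg x) (∑ᶠ-≥0 (λ v → z≥0 v x)) (zdeg≤deg x)) ⟩
          ∑ᶠ (λ x → zdeg x * deg x) ≡⟨ trans (∑ᶠ-cong (λ x → sym (∑ᶠ-*ʳ (deg x) (λ v → z v x)))) (∑ᶠ-swap (λ x v → z v x * deg x)) ⟩
          ∑ᶠ (λ v → ∑ᶠ (λ x → z v x * deg x)) ≡⟨ ∑ᶠ-cong (λ v → ∑ᶠ-cong (λ x → trans (*-comm (z v x) (deg x)) (sym (∑ᶠ-*ʳ (z v x) (A x))))) ⟩
          T₂ ∎
        where
        open ≤-Reasoning
        zdeg≤deg : ∀ x → zdeg x ≤ deg x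
        zdeg≤deg x = ∑ᶠ-mono (λ v → ≤-trans (𝟙-∧ (adj v x) (zeros (c v) (c x)) ≡≤ *-mono-≥0 (A v x) (A≥0 v x) (𝟙≤1 (zeros (c v) (c x))) ≤≡ *-identityʳ (A v x)) (≤-reflexive (A-sym v x)))

      -- Summed over v, the lower bound on the form reads T₁ ≥ 2tT₂ - Nt²M - NδB. With T₂ ≥ N(β/18)M
      -- and t = β/18 the right side is N(β²M/324 - δB), while T₁ counts cherries, each closed by a
      -- removed edge or one of dual weight at least 1.
      ones-edges : M ≤ int 6 / 1 * eZ → int 1 / 324 * B - δB - removed ≤ e₁
      ones-edges M≤6eZ = *-cancel-≤ N 0<N (lin (0≤- T₁≤ ⊕ 0≤- sum-form ⊕ 0≤2 ⊛ 0≤t ⊛ (0≤- T₂≥ ⊕ more))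
          (trans (ones-edges-identity₂ N removed e₁ δB β M) (cong (N * (int 1 / 324 * B - δB - removed) +_) (sym (ones-edges-identity (N * (removed + e₁)) T₁ T₂ (2ℚ * t) (N * (t * t * M)) (N * δB) Q (N * (int 1 / 18 * β * M)))))))
        where
        Q = 2ℚ * λ₀ * eZ - λ₀ * λ₀ * N
        eZ≥ : int 1 / 3 * β * V² ≤ eZ
        eZ≥ = lin (0≤- M≤6eZ ⊛ nonNegative⁻¹ (int 1 / 6) ⊕ 0≤- βV²≤ ⊛ nonNegative⁻¹ (int 1 / 6)) (eZ≥-identity β V² M eZ)
        more : 0ℚ ≤ Q - N * (int 1 / 18 * β * M)
        more = nonNegative⁻¹ (int 1 / 3) ⊛ 0≤β ⊛ 0≤N ⊛ (0≤- eZ≥ ⊕ 0≤- M≤6eZ ⊛ nonNegative⁻¹ (int 1 / 6)) ≤≡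
               trans (more-identity β N eZ M V²) (cong (λ w → 2ℚ * (int 1 / 3 * β * N) * eZ - int 1 / 3 * β * (int 1 / 3 * β) * w * N - N * (int 1 / 18 * β * M)) V²≡ ∙ more-identity₂ β N eZ M)
          where
          _∙_ : ∀ {a b c : ℚ} → a ≡ b → b ≡ c → a ≡ c
          _∙_ = trans

      weight : Pairs → ℚ
      weight K = ∑² (λ a b → g a b * (𝟙 (K a b) * C a b))

      weight-split : weight good ≡ weight ones + weight lite
      weight-split = trans (∑²-cong (λ a b → trans (cong (λ u → g a b * (u * C a b)) (split-by (good a b) (lt (g a b) 1ℚ))) (weight-split-identity (g a b) (𝟙 (ones a b)) (𝟙 (lite a b)) (C a b)))) (∑²-+ _ _)

      mass≤weight : mass ones ≤ weight ones
      mass≤weight = ∑²-mono (λ a b → term a b (bcase (ones a b)))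
        where
        term : ∀ a b → ones a b ≡ true ⊎ ones a b ≡ false → 𝟙 (ones a b) * C a b ≤ g a b * (𝟙 (ones a b) * C a b)
        term a b (inj₁ e) = sym (*-identityˡ (𝟙 (ones a b) * C a b)) ≡≤ *-mono-≥0ʳ (𝟙 (ones a b) * C a b) (𝟙≥0 (ones a b) ⊛ C≥0 a b) (lt-false (not-true (proj₂ (∧-true {good a b} e))))
        term a b (inj₂ e) = trans (cong (λ u → 𝟙 u * C a b) e) (*-zeroˡ (C a b)) ≡≤ g≥0 a b ⊛ (𝟙≥0 (ones a b) ⊛ C≥0 a b)

      -- `g` also covers the triangles of the lite pairs, and of the dual value at least
      -- 3·`mass ones` sits on the pairs left out.
      lite-bound : ∀ (P : ClassPacking lite) → ClassPacking.value P ≤ V - 3ℚ * mass ones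
      lite-bound P = ≤-trans (weak-duality {lite} {g} cov P) (≤-trans (*-mono-≥0 3ℚ 0≤3 (∑²-mono (λ a b → *-mono-≥0 (g a b) (g≥0 a b) (ClassPacking.load≤ P a b))))
          (lin (0≤- strong ⊕ 0≤3 ⊛ 0≤- mass≤weight) (trans (lite-bound-identity V (weight lite) (weight ones) (mass ones)) (cong (λ u → 3ℚ * weight lite + ((V - 3ℚ * u) + 3ℚ * (weight ones - mass ones))) (sym weight-split)))))
        where
        cov : Cover lite g
        cov a b e e₁ e₂ e₃ = g-cover a b e (proj₁ (∧-true e₁)) (proj₁ (∧-true e₂)) (proj₁ (∧-true e₃))

      -- The cover consisting of all removed edges, all pairs of dual weight ≥ 1, and a rounding of what is left.
      cover-bound : Rounding lite (V - 3ℚ * mass ones) → int 3 / 4 * (M - δB) + int 3 / 2 * mass ones - int 3 / 2 * (removed + 3ℚ * (ε * V²)) ≤ V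
      -- Rounding the zero vector produces the cut that keeps at most half of the `M₁` edges inside
      -- its parts.
      cover-bound R = from (signs B₀ B₀-diag (λ _ → 0ℚ) (λ _ → nonPositive⁻¹ (- 1ℚ) , 0≤1))
        where
        open Rounding R renaming (A to A₀; M to M₀; A-sym to A₀-sym; M-sym to M₀-sym)
        -- Restricted to good pairs, where numbers of edges and masses agree up to ε`V²`.
        A₁ M₁ : Pairs
        A₁ a b = good a b ∧ A₀ a b
        M₁ a b = good a b ∧ M₀ a b
        mass-∧ : ∀ (K : Pairs) → mass (λ a b → good a b ∧ K a b) ≤ mass K
        mass-∧ K = ∑²-mono (λ a b → *-mono-≥0ʳ (C a b) (C≥0 a b) (𝟙-∧ (good a b) (K a b) ≡≤ *-mono-≥0ʳ (𝟙 (K a b)) (𝟙≥0 (K a b)) (𝟙≤1 (good a b)) ≤≡ *-identityˡ (𝟙 (K a b))))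
        B₀ : Fin n → Fin n → ℚ
        B₀ x y = A x y * 𝟙 (M₁ (c x) (c y))
        B₀-diag : ∀ x → B₀ x x ≡ 0ℚ
        B₀-diag x = trans (cong (_* 𝟙 (M₁ (c x) (c x))) (A-diag x)) (*-zeroˡ (𝟙 (M₁ (c x) (c x))))
        form-0 : form B₀ B₀-diag (λ _ → 0ℚ) ≡ 0ℚ
        form-0 = trans (∑²-cong (λ x y → trans (*-comm (B₀ x y) 0ℚ) refl)) (trans (∑²-* 0ℚ B₀) (*-zeroˡ (∑² B₀)))
        from : ∃[ s ] form B₀ B₀-diag (λ x → sgn (s x)) ≤ form B₀ B₀-diag (λ _ → 0ℚ) → int 3 / 4 * (M - δB) + int 3 / 2 * mass ones - int 3 / 2 * (removed + 3ℚ * (ε * V²)) ≤ V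
        -- Hardness scaled by ¾ charges 3/2·`mass ones` for taking these pairs, while the rounding
        -- bound has dropped by 3·`mass ones`; the difference is the gain.
        from (s , le) = lin {r = int 3 / 4 * r₁ + int 3 / 2 * (r₂ + r₃ + r₄ + ½ * (r₅ + r₆ + w)) + ½ * r₇}
              (nonNegative⁻¹ (int 3 / 4) ⊛ 0≤- (≤-trans (hard K K-sym hits′) (*-mono-≥0 2ℚ 0≤2 K≤))
               ⊕ nonNegative⁻¹ (int 3 / 2) ⊛ (0≤- (edge≤mass ones ones-sub) ⊕ 0≤- (edge≤mass A₁ (λ _ _ e → proj₁ (∧-true e))) ⊕ 0≤- (mass-∧ A₀)
                 ⊕ nonNegative⁻¹ ½ ⊛ (0≤- (edge≤mass M₁ (λ _ _ e → proj₁ (∧-true e))) ⊕ 0≤- (mass-∧ M₀) ⊕ 0≤ε ⊛ 0≤V²)) ⊕ nonNegative⁻¹ ½ ⊛ 0≤- cost)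
              (trans (cover-bound-identity V m₁ w removed X) (cong (int 3 / 4 * X + int 3 / 2 * m₁ - int 3 / 2 * (removed + 3ℚ * w) +_) (sym sum≡)))
          where
          E₁ = edgeMass ones
          E₂ = edgeMass A₁
          E₃ = edgeMass M₁
          m₁ = mass ones
          w = ε * V²
          X = M - δB
          r₁ = 2ℚ * (removed + E₁ + E₂ + ½ * E₃) - X
          r₂ = m₁ + w - E₁
          r₃ = mass A₁ + w - E₂
          r₄ = mass A₀ - mass A₁
          r₅ = mass M₁ + w - E₃
          r₆ = mass M₀ - mass M₁
          r₇ = 2ℚ * (V - 3ℚ * m₁) - 3ℚ * (mass A₀ + ½ * mass M₀)
          sum≡ : int 3 / 4 * r₁ + int 3 / 2 * (r₂ + r₃ + r₄ + ½ * (r₅ + r₆ + w)) + ½ * r₇ ≡ int 3 / 2 * removed - int 3 / 4 * X + int 3 / 2 * (m₁ + 3ℚ * w) + (V - 3ℚ * m₁)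
          sum≡ = begin
            int 3 / 4 * r₁ + int 3 / 2 * (r₂ + r₃ + r₄ + ½ * (r₅ + r₆ + w)) + ½ * r₇
              ≡⟨ cong₂ (λ u y → u + int 3 / 2 * y + ½ * r₇) (cover-bound-identity₂ removed E₁ E₂ E₃ X) (cong₂ _+_ (trans (+-assoc r₂ r₃ r₄) (cong (r₂ +_) (cover-bound-identity₃ E₂ w (mass A₁) (mass A₀)))) (cover-bound-identity₄ E₃ w (mass M₁) (mass M₀))) ⟩
            rX + int 3 / 2 * (E₁ + E₂ + ½ * E₃) + int 3 / 2 * (r₂ + (mass A₀ + w - E₂) + (½ * mass M₀ + w - ½ * E₃)) + ½ * r₇
              ≡⟨ cong (_+ ½ * r₇) (trans (+-assoc rX (int 3 / 2 * (E₁ + E₂ + ½ * E₃)) (int 3 / 2 * (r₂ + (mass A₀ + w - E₂) + (½ * mass M₀ + w - ½ * E₃)))) (cong (rX +_) (cover-bound-identity₅ E₁ E₂ (½ * E₃) m₁ w (mass A₀) (½ * mass M₀)))) ⟩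
            rX + (int 3 / 2 * (m₁ + 3ℚ * w) + int 3 / 2 * (mass A₀ + ½ * mass M₀)) + ½ * r₇
              ≡⟨ trans (cover-bound-identity₇ rX (int 3 / 2 * (m₁ + 3ℚ * w)) (int 3 / 2 * (mass A₀ + ½ * mass M₀)) (½ * r₇)) (cong (rX + int 3 / 2 * (m₁ + 3ℚ * w) +_) (cover-bound-identity₆ V m₁ (mass A₀) (½ * mass M₀))) ⟩
            rX + int 3 / 2 * (m₁ + 3ℚ * w) + (V - 3ℚ * m₁) ∎
            where
            open ≡-Reasoning
            rX = int 3 / 2 * removed - int 3 / 4 * X
          K₄ K : Fin n → Fin n → Bool
          K₄ x y = M₁ (c x) (c y) ∧ same (s x) (s y)
          K x y = not (good (c x) (c y)) ∨ (ones (c x) (c y) ∨ (A₁ (c x) (c y) ∨ K₄ x y))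
          K-sym : ∀ x y → K x y ≡ K y x
          K-sym x y = cong₂ _∨_ (cong not (good-sym (c x) (c y))) (cong₂ _∨_ (ones-sym (c x) (c y)) (cong₂ _∨_ (cong₂ _∧_ (good-sym (c x) (c y)) (A₀-sym (c x) (c y))) (cong₂ _∧_ (cong₂ _∧_ (good-sym (c x) (c y)) (M₀-sym (c x) (c y))) (same-sym (s x) (s y)))))
          hits′ : Hits K
          hits′ x y z _ _ _ = from′ (bcase (good (c x) (c y))) (bcase (good (c y) (c z))) (bcase (good (c x) (c z)))
            where
            ∨₁ : ∀ {p q} → p ≡ true → p ∨ q ≡ true
            ∨₁ refl = refl
            ∨₂ : ∀ p {q} → q ≡ true → p ∨ q ≡ true
            ∨₂ true _ = refl
            ∨₂ false e = e
            by-bad : ∀ {x y} → good (c x) (c y) ≡ false → K x y ≡ true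
            by-bad e = ∨₁ (cong not e)
            by-one : ∀ {x y} → good (c x) (c y) ≡ true → lt (g (c x) (c y)) 1ℚ ≡ false → K x y ≡ true
            by-one {x} {y} p e = ∨₂ (not (good (c x) (c y))) (∨₁ (cong₂ (λ u v → u ∧ not v) p e))
            by-A : ∀ {x y} → good (c x) (c y) ≡ true → A₀ (c x) (c y) ≡ true → K x y ≡ true
            by-A {x} {y} p e = ∨₂ (not (good (c x) (c y))) (∨₂ (ones (c x) (c y)) (∨₁ (cong₂ _∧_ p e)))
            by-M : ∀ {x y} → good (c x) (c y) ≡ true → M₀ (c x) (c y) ≡ true → same (s x) (s y) ≡ true → K x y ≡ true
            by-M {x} {y} p e h = ∨₂ (not (good (c x) (c y))) (∨₂ (ones (c x) (c y)) (∨₂ (A₁ (c x) (c y)) (cong₂ _∧_ (cong₂ _∧_ p e) h)))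
            Goal = K x y ≡ true ⊎ K y z ≡ true ⊎ K x z ≡ true
            from′ : good (c x) (c y) ≡ true ⊎ good (c x) (c y) ≡ false → good (c y) (c z) ≡ true ⊎ good (c y) (c z) ≡ false → good (c x) (c z) ≡ true ⊎ good (c x) (c z) ≡ false → Goal
            from′ (inj₂ e) _ _ = inj₁ (by-bad {x} {y} e)
            from′ _ (inj₂ e) _ = inj₂ (inj₁ (by-bad {y} {z} e))
            from′ _ _ (inj₂ e) = inj₂ (inj₂ (by-bad {x} {z} e))
            from′ (inj₁ p) (inj₁ q) (inj₁ r) = from″ (bcase (lt (g (c x) (c y)) 1ℚ)) (bcase (lt (g (c y) (c z)) 1ℚ)) (bcase (lt (g (c x) (c z)) 1ℚ))
              where
              from‴ : (A₀ (c x) (c y) ≡ true ⊎ A₀ (c y) (c z) ≡ true ⊎ A₀ (c x) (c z) ≡ true) ⊎ (M₀ (c x) (c y) ≡ true × M₀ (c y) (c z) ≡ true × M₀ (c x) (c z) ≡ true) → Goal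
              from‴ (inj₁ (inj₁ e)) = inj₁ (by-A {x} {y} p e)
              from‴ (inj₁ (inj₂ (inj₁ e))) = inj₂ (inj₁ (by-A {y} {z} q e))
              from‴ (inj₁ (inj₂ (inj₂ e))) = inj₂ (inj₂ (by-A {x} {z} r e))
              from‴ (inj₂ (e₁ , e₂ , e₃)) = cut (two-of-three (s x) (s y) (s z))
                where cut : same (s x) (s y) ≡ true ⊎ same (s y) (s z) ≡ true ⊎ same (s x) (s z) ≡ true → Goal
                      cut (inj₁ h) = inj₁ (by-M {x} {y} p e₁ h)
                      cut (inj₂ (inj₁ h)) = inj₂ (inj₁ (by-M {y} {z} q e₂ h))
                      cut (inj₂ (inj₂ h)) = inj₂ (inj₂ (by-M {x} {z} r e₃ h))
              from″ : lt (g (c x) (c y)) 1ℚ ≡ true ⊎ lt (g (c x) (c y)) 1ℚ ≡ false → lt (g (c y) (c z)) 1ℚ ≡ true ⊎ lt (g (c y) (c z)) 1ℚ ≡ false → lt (g (c x) (c z)) 1ℚ ≡ true ⊎ lt (g (c x) (c z)) 1ℚ ≡ false → Goal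
              from″ (inj₂ e) _ _ = inj₁ (by-one {x} {y} p e)
              from″ _ (inj₂ e) _ = inj₂ (inj₁ (by-one {y} {z} q e))
              from″ _ _ (inj₂ e) = inj₂ (inj₂ (by-one {x} {z} r e))
              from″ (inj₁ e₁) (inj₁ e₂) (inj₁ e₃) = from‴ (hits (c x) (c y) (c z) (cong₂ _∧_ p e₁) (cong₂ _∧_ q e₂) (cong₂ _∧_ r e₃))
          ∨≤ : ∀ x y → 𝟙 (x ∨ y) ≤ 𝟙 x + 𝟙 y
          ∨≤ true y = lin (𝟙≥0 y) refl
          ∨≤ false y = ≤-reflexive (sym (+-identityˡ (𝟙 y)))
          K≤ : ∑² (λ x y → A x y * 𝟙 (K x y)) ≤ removed + E₁ + E₂ + ½ * E₃
          K≤ = ≤-trans (∑²-mono (λ x y → term x y)) (trans (∑²-+ (λ x y → k₁ x y + k₂ x y + k₃ x y) k₄) (cong₂ _+_ (trans (∑²-+ (λ x y → k₁ x y + k₂ x y) k₃) (cong (_+ E₂) (∑²-+ k₁ k₂))) refl) ≡≤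
                 +-monoʳ-≤ (removed + E₁ + E₂) (∑-same B₀ B₀-diag s ≡≤ *-mono-≥0 ½ (nonNegative⁻¹ ½) (≤-trans (+-monoʳ-≤ E₃ (le ≤≡ form-0)) (≤-reflexive (+-identityʳ E₃)))))
            where
            k₁ k₂ k₃ k₄ : Fin n → Fin n → ℚ
            k₁ x y = A x y * 𝟙 (not (good (c x) (c y)))
            k₂ x y = A x y * 𝟙 (ones (c x) (c y))
            k₃ x y = A x y * 𝟙 (A₁ (c x) (c y))
            k₄ x y = B₀ x y * 𝟙 (same (s x) (s y))
            term : ∀ x y → A x y * 𝟙 (K x y) ≤ k₁ x y + k₂ x y + k₃ x y + k₄ x y
            term x y = *-mono-≥0 (A x y) (A≥0 x y) (≤-trans (∨≤ g₁ (g₂ ∨ (g₃ ∨ K₄ x y))) (+-monoʳ-≤ (𝟙 g₁) (≤-trans (∨≤ g₂ (g₃ ∨ K₄ x y)) (+-monoʳ-≤ (𝟙 g₂) (∨≤ g₃ (K₄ x y)))))) ≤≡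
                  trans (cong (λ u → A x y * (𝟙 g₁ + (𝟙 g₂ + (𝟙 g₃ + u)))) (𝟙-∧ (M₁ (c x) (c y)) (same (s x) (s y)))) (K≤-identity (A x y) (𝟙 g₁) (𝟙 g₂) (𝟙 g₃) (𝟙 (M₁ (c x) (c y))) (𝟙 (same (s x) (s y))))
              where
              g₁ = not (good (c x) (c y))
              g₂ = ones (c x) (c y)
              g₃ = A₁ (c x) (c y)

      rounding : Rounding lite (V - 3ℚ * mass ones)
      rounding = from (archimedes (∑² (λ a b → 𝟙 (lite a b))))
        where from : ∃[ m ] ∑² (λ a b → 𝟙 (lite a b)) ≤ ι m → Rounding lite (V - 3ℚ * mass ones)
              from (m , h) = roundCover m lite lite-sym h (V - 3ℚ * mass ones) lite-bound

      -- If the zero pairs have at most a fifth of the mass, saturation puts V near 4M/5, and the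
      -- margin M/20 dominates everything. Otherwise `eZ` ≥ M/6, so `ones` gains 3/2·1/324 = 1/216
      -- of B, of which 1/300 survives the errors.
      value≥ : int 3 / 4 * M + int 1 / 300 * B ≤ V
      value≥ = from (mass zeros ≤? int 1 / 5 * M)
        where
        w = ε * V²
        from : Dec (mass zeros ≤ int 1 / 5 * M) → int 3 / 4 * M + int 1 / 300 * B ≤ V
        from (yes h) = lin (0≤- saturated ⊕ 0≤- h ⊕ 0≤- good-mass≥ ⊕ 0≤- removed≤B ⊛ nonNegative⁻¹ (int 1 / 8000) ⊕ 0≤- εV²≤ ⊛ nonNegative⁻¹ (int 1 / 48000) ⊕ 0≤- B≤M ⊛ nonNegative⁻¹ (int 1 / 20) ⊕ 0≤B ⊛ nonNegative⁻¹ q)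
            (trans (value≥-identity V M (mass positives) (mass zeros) removed w B) (cong (λ u → int 3 / 4 * M + int 1 / 300 * B + ((V - mass positives) + (int 1 / 5 * M - mass zeros) + (u - (M - removed - w)) + (B - int 8000 / 1 * removed) * (int 1 / 8000) + (B - int 48000 / 1 * w) * (int 1 / 48000) + (M - B) * (int 1 / 20) + B * q)) (sym mass-split)))
          where
          q : ℚ
          q = int 1 / 20 - int 1 / 300 - int 1 / 8000 - int 1 / 48000
          0≤B : 0ℚ ≤ B
          0≤B = 0≤β ⊛ 0≤β ⊛ 0≤M
        from (no h) = lin (0≤- (cover-bound rounding) ⊕ nonNegative⁻¹ (int 3 / 2) ⊛ (0≤- (mass≥ ) ⊕ 0≤- (ones-edges M≤6eZ)) ⊕ 0≤- removed≤B ⊛ nonNegative⁻¹ (int 3 / 8000) ⊕ 0≤- εV²≤ ⊛ nonNegative⁻¹ (int 6 / 48000) ⊕ 0≤B ⊛ nonNegative⁻¹ q)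
            (value≥-identity₂ V M (mass ones) e₁ removed w B)
          where
          q : ℚ
          q = int 1 / 216 - int 9 / 20000 - int 3 / 8000 - int 6 / 48000 - int 1 / 300
          0≤B : 0ℚ ≤ B
          0≤B = 0≤β ⊛ 0≤β ⊛ 0≤M
          mass≥ : e₁ - w ≤ mass ones
          mass≥ = lin (0≤- (edge≤mass ones ones-sub)) (good-mass≥-identity e₁ (mass ones) w)
          M≤6eZ : M ≤ int 6 / 1 * eZ
          M≤6eZ = lin (0≤- (<⇒≤ (≰⇒> h)) ⊛ nonNegative⁻¹ (int 6 / 1) ⊕ 0≤- (mass≤edge zeros zeros-sub) ⊛ nonNegative⁻¹ (int 6 / 1) ⊕ 0≤- εV²≤ ⊛ nonNegative⁻¹ (int 6 / 48000) ⊕ 0≤- B≤M ⊛ nonNegative⁻¹ (int 6 / 48000) ⊕ 0≤M ⊛ nonNegative⁻¹ (int 1 / 5 - int 6 / 48000)) (M≤6eZ-identity M (mass zeros) eZ w B)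

    -- Spreading a class packing over the triangles of the graph.

    module Lift (P : ClassPacking good) (ζ : ℚ) (0<ζ : 0ℚ < ζ) (ζ≤1 : ζ ≤ 1ℚ) (ε≤1 : ε ≤ 1ℚ) (0<σN : 0ℚ < σ * N) where

      open ClassPacking P

      0≤ζ = <⇒≤ 0<ζ

      0≤1-ζ : 0ℚ ≤ 1ℚ - ζ
      0≤1-ζ = 0≤- ζ≤1

      Good₃ : Fin k → Fin k → Fin k → Set
      Good₃ a b e = Good a b × Good b e × Good a e

      triple : ∀ a b e → Y a b e ≡ 0ℚ ⊎ Good₃ a b e
      triple a b e = from (bcase (good a b)) (bcase (good b e)) (bcase (good a e))
        where
        from : good a b ≡ true ⊎ good a b ≡ false → good b e ≡ true ⊎ good b e ≡ false → good a e ≡ true ⊎ good a e ≡ false → Y a b e ≡ 0ℚ ⊎ Good₃ a b e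
        from (inj₂ h) _ _ = inj₁ (Y-supp a b e h)
        from _ (inj₂ h) _ = inj₁ (trans (Y-rot a b e) (Y-supp b e a h))
        from _ _ (inj₂ h) = inj₁ (trans (Y-rot a b e) (trans (Y-rot b e a) (trans (Y-swap e a b) (Y-supp a e b h))))
        from (inj₁ h) (inj₁ h′) (inj₁ h″) = inj₂ (good⇒ h , good⇒ h′ , good⇒ h″)

      0<φ : ∀ {a b} → Good a b → 0ℚ < φ a b
      0<φ G = <-≤-trans 0<d (Good.dense G)

      0<sizeˡ : ∀ {a b} → Good a b → 0ℚ < size a
      0<sizeˡ G = <-≤-trans 0<σN (Good.bigˡ G)

      0<sizeʳ : ∀ {a b} → Good a b → 0ℚ < size b
      0<sizeʳ G = <-≤-trans 0<σN (Good.bigʳ G)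

      ∑δδ : ∀ a b → ∑² (λ x y → δ (c x) a * δ (c y) b) ≡ size a * size b
      ∑δδ a b = ∑²-× (λ x → δ (c x) a) (λ y → δ (c y) b)

      -- `φ` is no true density and may exceed 1, but testing regularity on the whole classes gives
      -- 1 + ε as a bound.
      φ≤2 : ∀ {a b} → Good a b → φ a b ≤ 2ℚ
      φ≤2 {a} {b} G = *-cancel-≤ s (0<* (0<sizeˡ G) (0<sizeʳ G)) (≤-trans (lin (0≤- (-dev≤ a b (Good.not-bad G) (λ _ → true) (λ _ → true)) ⊕ 0≤- e≤) (trans (φ≤2-identity₂ s ε (φ a b) e) (cong (λ u → s * φ a b + ((ε * s - - u) + (s - e))) (sym dev≡)))) (*-mono-≥0 s (<⇒≤ (0<* (0<sizeˡ G) (0<sizeʳ G))) (+-monoʳ-≤ 1ℚ ε≤1)))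
        where
        s e : ℚ
        s = size a * size b
        e = ∑² (λ x y → δ (c x) a * δ (c y) b * A x y)
        e≤ : e ≤ s
        e≤ = ∑²-mono (λ x y → *-mono-≥0 (δ (c x) a * δ (c y) b) (δ≥0 (c x) a ⊛ δ≥0 (c y) b) (A≤1 x y) ≤≡ *-identityʳ (δ (c x) a * δ (c y) b)) ≤≡ ∑δδ a b
        dev≡ : dev a b (λ _ → true) (λ _ → true) ≡ e - s * φ a b
        dev≡ = trans (∑²-cong (λ x y → φ≤2-identity (δ (c x) a * δ (c y) b) (A x y) (φ a b))) (trans (∑²-- _ _) (cong (λ u → e - u) (trans (∑ᶠ-cong (λ x → ∑ᶠ-*ʳ (φ a b) (λ y → δ (c x) a * δ (c y) b))) (trans (∑ᶠ-*ʳ (φ a b) (λ x → ∑ᶠ (λ y → δ (c x) a * δ (c y) b))) (cong (_* φ a b) (∑δδ a b))))))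

      rφ : Fin k → Fin k → ℚ
      rφ a b = recip (φ a b)

      rs : Fin k → ℚ
      rs a = recip (size a)

      -- (1 - ζ)Y divided by the expected number φφφ·|a||b||e| of triangles in the three classes.
      -- The slack ζ is what makes overloaded edges rare.
      u : Fin k → Fin k → Fin k → ℚ
      u a b e = (1ℚ - ζ) * Y a b e * (rφ a b * rφ b e * rφ a e * (rs a * rs b * rs e))

      rφ-sym : ∀ a b → rφ a b ≡ rφ b a
      rφ-sym a b = cong recip (φ-sym a b)

      u-swap : ∀ a b e → u a b e ≡ u b a e
      u-swap a b e = cong₂ (λ y r → (1ℚ - ζ) * y * r) (Y-swap a b e) (trans (cong (λ r → r * rφ b e * rφ a e * (rs a * rs b * rs e)) (rφ-sym a b)) (u-swap-identity (rφ b a) (rφ b e) (rφ a e) (rs a) (rs b) (rs e)))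

      u-rot : ∀ a b e → u a b e ≡ u b e a
      u-rot a b e = cong₂ (λ y r → (1ℚ - ζ) * y * r) (Y-rot a b e) (trans (cong₂ (λ r r′ → r * rφ b e * r′ * (rs a * rs b * rs e)) (rφ-sym a b) (rφ-sym a e)) (u-rot-identity (rφ b a) (rφ b e) (rφ e a) (rs a) (rs b) (rs e)))

      u-zero : ∀ a b e → Y a b e ≡ 0ℚ → u a b e ≡ 0ℚ
      u-zero a b e h = trans (cong (λ y → (1ℚ - ζ) * y * (rφ a b * rφ b e * rφ a e * (rs a * rs b * rs e))) h) (u-zero-identity (1ℚ - ζ) (rφ a b * rφ b e * rφ a e * (rs a * rs b * rs e)))

      u≥0 : ∀ a b e → 0ℚ ≤ u a b e
      u≥0 a b e = from (triple a b e)
        where from : Y a b e ≡ 0ℚ ⊎ Good₃ a b e → 0ℚ ≤ u a b e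
              from (inj₁ h) = ≤-reflexive (sym (u-zero a b e h))
              from (inj₂ (G , H , I)) = 0≤1-ζ ⊛ Y≥0 a b e ⊛ (r G ⊛ r H ⊛ r I ⊛ (q (0<sizeˡ G) ⊛ q (0<sizeʳ G) ⊛ q (0<sizeʳ H)))
                where q : ∀ {x} → 0ℚ < x → 0ℚ ≤ recip x
                      q p = <⇒≤ (proj₂ (recip-pos p))
                      r : ∀ {a b} → Good a b → 0ℚ ≤ rφ a b
                      r G = q (0<φ G)

      u-product : ∀ a b e → u a b e * (φ a b * φ b e * φ a e) * (size a * (size b * size e)) ≡ (1ℚ - ζ) * Y a b e
      u-product a b e = from (triple a b e)
        where
        from : Y a b e ≡ 0ℚ ⊎ Good₃ a b e → u a b e * (φ a b * φ b e * φ a e) * (size a * (size b * size e)) ≡ (1ℚ - ζ) * Y a b e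
        from (inj₁ h) = trans (cong (λ v → v * (φ a b * φ b e * φ a e) * (size a * (size b * size e))) (u-zero a b e h)) (trans (u-product-identity (φ a b * φ b e * φ a e) (size a * (size b * size e)) (1ℚ - ζ)) (cong ((1ℚ - ζ) *_) (sym h)))
        from (inj₂ (G , H , I)) = trans (u-product-identity₃ ((1ℚ - ζ) * Y a b e) (rφ a b * rφ b e * rφ a e) (rs a) (rs b) (rs e) (φ a b * φ b e * φ a e) (size a) (size b) (size e))
           (trans (cong (λ v → (1ℚ - ζ) * Y a b e * (rφ a b * rφ b e * rφ a e * v) * (φ a b * φ b e * φ a e)) (cong₂ _*_ (cong₂ _*_ (proj₁ (recip-pos (0<sizeˡ G))) (proj₁ (recip-pos (0<sizeʳ G)))) (proj₁ (recip-pos (0<sizeʳ H)))))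
           (trans (u-product-identity₂ ((1ℚ - ζ) * Y a b e) (rφ a b) (rφ b e) (rφ a e) (φ a b) (φ b e) (φ a e))
           (trans (cong (λ v → (1ℚ - ζ) * Y a b e * v) (cong₂ _*_ (cong₂ _*_ (proj₁ (recip-pos (0<φ G))) (proj₁ (recip-pos (0<φ H)))) (proj₁ (recip-pos (0<φ I))))) (*-identityʳ ((1ℚ - ζ) * Y a b e)))))

      f : Fin n → Fin n → ℚ
      f x y = φ (c x) (c y)

      U : Fin n → Fin n → Fin n → ℚ
      U x y z = u (c x) (c y) (c z)

      ∑U : ℚ
      ∑U = ∑³ U

      u-bad : ∀ a b e → bad a b ≡ true → u a b e ≡ 0ℚ
      u-bad a b e h = from (triple a b e)
        where from : Y a b e ≡ 0ℚ ⊎ Good₃ a b e → u a b e ≡ 0ℚ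
              from (inj₁ h′) = u-zero a b e h′
              from (inj₂ (G , _)) = ⊥-elim (true≢false h (Good.not-bad G))

      u-swap₂₃ : ∀ a b e → u a b e ≡ u a e b
      u-swap₂₃ a b e = trans (u-rot a b e) (trans (u-rot b e a) (u-swap e a b))

      uφ≥0 : ∀ a b e → 0ℚ ≤ u a b e * φ b e
      uφ≥0 a b e = from (triple a b e)
        where from : Y a b e ≡ 0ℚ ⊎ Good₃ a b e → 0ℚ ≤ u a b e * φ b e
              from (inj₁ h) = ≤-reflexive (sym (trans (cong (_* φ b e) (u-zero a b e h)) (*-zeroˡ (φ b e))))
              from (inj₂ (_ , H , _)) = u≥0 a b e ⊛ <⇒≤ (0<φ H)

      uφ≤ : ∀ a b e → u a b e * φ b e ≤ 2ℚ * u a b e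
      uφ≤ a b e = from (triple a b e)
        where from : Y a b e ≡ 0ℚ ⊎ Good₃ a b e → u a b e * φ b e ≤ 2ℚ * u a b e
              from (inj₁ h) = ≤-reflexive (trans (cong (_* φ b e) (u-zero a b e h)) (trans (*-zeroˡ (φ b e)) (sym (trans (cong (2ℚ *_) (u-zero a b e h)) (*-zeroʳ 2ℚ)))))
              from (inj₂ (_ , H , _)) = *-mono-≥0 (u a b e) (u≥0 a b e) (φ≤2 H) ≤≡ *-comm (u a b e) 2ℚ

      uφφ≥0 : ∀ a b e → 0ℚ ≤ u a b e * φ b e * φ a e
      uφφ≥0 a b e = from (triple a b e)
        where from : Y a b e ≡ 0ℚ ⊎ Good₃ a b e → 0ℚ ≤ u a b e * φ b e * φ a e
              from (inj₁ h) = ≤-reflexive (sym (trans (cong (λ v → v * φ b e * φ a e) (u-zero a b e h)) (uφφ≥0-identity (φ b e) (φ a e))))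
              from (inj₂ (_ , H , I)) = u≥0 a b e ⊛ <⇒≤ (0<φ H) ⊛ <⇒≤ (0<φ I)

      uφφ≤ : ∀ a b e → u a b e * φ b e * φ a e ≤ 4ℚ * u a b e
      uφφ≤ a b e = from (triple a b e)
        where
              from : Y a b e ≡ 0ℚ ⊎ Good₃ a b e → u a b e * φ b e * φ a e ≤ 4ℚ * u a b e
              from (inj₁ h) = ≤-reflexive (trans (cong (λ v → v * φ b e * φ a e) (u-zero a b e h)) (trans (uφφ≤-identity₂ (φ b e) (φ a e)) (cong (4ℚ *_) (sym (u-zero a b e h)))))
              from (inj₂ (_ , H , I)) = ≤-trans (*-mono² (uφ≥0 a b e) 0≤2 (uφ≤ a b e) (φ≤2 I)) (≤-reflexive (uφφ≤-identity (u a b e)))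

      -- The sum is the load an edge between a and b would get if adjacency to the third vertex
      -- equalled the densities. Multiplied by φ(a,b)|a||b| it becomes the load of the class pair.
      target≤ : ∀ a b → ∑ᶠ (λ z → u a b (c z) * φ b (c z) * φ a (c z)) ≤ 1ℚ - ζ
      target≤ a b = class-sum₁ (λ e → u a b e * φ b e * φ a e) ≡≤ from (bcase (good a b))
        where
        t = ∑ᶠ (λ e → u a b e * φ b e * φ a e * size e)
        from : good a b ≡ true ⊎ good a b ≡ false → t ≤ 1ℚ - ζ
        from (inj₁ h) = *-cancel-≤ (φ a b * (size a * size b)) (0<* (0<φ G) (0<* (0<sizeˡ G) (0<sizeʳ G)))
            (trans (sym (∑ᶠ-* (φ a b * (size a * size b)) _)) (trans (∑ᶠ-cong (λ e → trans (target≤-identity (φ a b) (size a) (size b) (u a b e) (φ b e) (φ a e) (size e)) (u-product a b e))) (∑ᶠ-* (1ℚ - ζ) (Y a b))) ≡≤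
             *-mono-≥0 (1ℚ - ζ) 0≤1-ζ (Y-load a b) ≤≡ trans (cong (λ v → (1ℚ - ζ) * (𝟙 v * (φ a b * (size a * size b)))) h) (target≤-identity₂ (1ℚ - ζ) (φ a b * (size a * size b))))
          where G = good⇒ h
        from (inj₂ h) = trans (∑ᶠ-cong (λ e → trans (cong (λ v → v * φ b e * φ a e * size e) (u-zero a b e (Y-supp a b e h))) (target≤-identity₃ (φ b e) (φ a e) (size e)))) (trans (∑ᶠ-* 0ℚ (λ _ → 0ℚ)) (*-zeroˡ (∑ᶠ {k} (λ _ → 0ℚ)))) ≡≤ 0≤1-ζ

      -- All regularity errors are multiples of ε∑U; two densities of at least d on the support turn
      -- the target loads into a bound for ∑U.
      d²U≤ : d * d * ∑U ≤ V²
      d²U≤ = sym (∑³-* (d * d) U) ≡≤ ≤-trans (∑³-mono (λ x y z → term (c x) (c y) (c z))) (≤-trans (∑²-mono (λ x y → ≤-trans (target≤ (c x) (c y)) (lin 0≤ζ (d²U≤-identity ζ)))) ≤-refl)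
        where
        term : ∀ a b e → d * d * u a b e ≤ u a b e * φ b e * φ a e
        term a b e = from (triple a b e)
          where from : Y a b e ≡ 0ℚ ⊎ Good₃ a b e → d * d * u a b e ≤ u a b e * φ b e * φ a e
                from (inj₁ h) = trans (cong (d * d *_) (u-zero a b e h)) (*-zeroʳ (d * d)) ≡≤ uφφ≥0 a b e
                from (inj₂ (_ , H , I)) = d²U≤-identity₂ d (u a b e) ≡≤ *-mono² (u≥0 a b e ⊛ 0≤d) (<⇒≤ (0<φ I)) (*-mono-≥0 (u a b e) (u≥0 a b e) (Good.dense H)) (Good.dense I)

      -- The class e alone contributes at least u·d²·σN to a target load, which is at most 1.
      u-small : ∀ a b e → u a b e * (d * d * (σ * N)) ≤ 1ℚ
      u-small a b e = from (triple a b e)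
        where
        from : Y a b e ≡ 0ℚ ⊎ Good₃ a b e → u a b e * (d * d * (σ * N)) ≤ 1ℚ
        from (inj₁ h) = trans (cong (_* (d * d * (σ * N))) (u-zero a b e h)) (*-zeroˡ (d * d * (σ * N))) ≡≤ 0≤1
        from (inj₂ (_ , H , I)) = u-small-identity (u a b e) d (σ * N) ≡≤ ≤-trans (*-mono² (u≥0 a b e ⊛ 0≤d ⊛ 0≤d) (size≥0 e) (*-mono² (u≥0 a b e ⊛ 0≤d) (<⇒≤ (0<φ I)) (*-mono-≥0 (u a b e) (u≥0 a b e) (Good.dense H)) (Good.dense I)) (Good.bigʳ H))
            (≤-trans (∑ᶠ-∈≤ {f = λ e → u a b e * φ b e * φ a e * size e} e (λ e → uφφ≥0 a b e ⊛ size≥0 e)) (sym (class-sum₁ (λ e → u a b e * φ b e * φ a e)) ≡≤ ≤-trans (target≤ a b) (lin 0≤ζ (d²U≤-identity ζ))))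

      neg-∑ᶠ : ∀ (h : Fin n → ℚ) → - ∑ᶠ h ≡ ∑ᶠ (λ x → - h x)
      neg-∑ᶠ h = trans (-deviation≤-identity (∑ᶠ h)) (trans (sym (∑ᶠ-* (- 1ℚ) h)) (∑ᶠ-cong (λ x → sym (-deviation≤-identity (h x)))))

      module _ (S T : Fin n → Fin n → Bool) where

        -- Errors of replacing the adjacency of yz, and then that of xz, by the density. With x,
        -- respectively y, held fixed, each is a weighted deviation over class pairs.
        dev₁ dev₂ : ℚ
        dev₁ = ∑³ (λ x y z → U x y z * (𝟙 (S x y) * 𝟙 (T x z) * (A y z - f y z)))
        dev₂ = ∑³ (λ x y z → U x y z * f y z * (𝟙 (S x y) * 𝟙 true * (A x z - f x z)))

        dev₁≤ : dev₁ ≤ ε * ∑U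
        dev₁≤ = ∑ᶠ-mono (λ x → deviation≤ (λ b e → u (c x) b e) (λ b e → u≥0 (c x) b e) (λ b e h → trans (u-rot (c x) b e) (u-bad b e (c x) h)) (S x) (T x)) ≤≡ ∑ᶠ-* ε (λ x → ∑² (U x))

        -dev₁≤ : - dev₁ ≤ ε * ∑U
        -dev₁≤ = neg-∑ᶠ (λ x → ∑² (λ y z → U x y z * (𝟙 (S x y) * 𝟙 (T x z) * (A y z - f y z)))) ≡≤ ∑ᶠ-mono (λ x → -deviation≤ (λ b e → u (c x) b e) (λ b e → u≥0 (c x) b e) (λ b e h → trans (u-rot (c x) b e) (u-bad b e (c x) h)) (S x) (T x)) ≤≡ ∑ᶠ-* ε (λ x → ∑² (U x))

        Uf≤ : ∑ᶠ (λ y → ∑² (λ x z → U x y z * f y z)) ≤ 2ℚ * ∑U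
        Uf≤ = ∑³-mono (λ y x z → uφ≤ (c x) (c y) (c z)) ≤≡ trans (∑³-* 2ℚ (λ y x z → U x y z)) (cong (2ℚ *_) (∑³-swap₁₂ (λ y x z → U x y z)))

        inner₂ : Fin n → ℚ
        inner₂ y = ∑² (λ x z → U x y z * f y z * (𝟙 (S x y) * 𝟙 true * (A x z - f x z)))

        dev₂≡ : dev₂ ≡ ∑ᶠ inner₂
        dev₂≡ = ∑³-swap₁₂ (λ x y z → U x y z * f y z * (𝟙 (S x y) * 𝟙 true * (A x z - f x z)))

        zero₂ : ∀ y a e → bad a e ≡ true → u a (c y) e * φ (c y) e ≡ 0ℚ
        zero₂ y a e h = trans (cong (_* φ (c y) e) (trans (u-swap₂₃ a (c y) e) (u-bad a e (c y) h))) (*-zeroˡ (φ (c y) e))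

        dev₂≤ : dev₂ ≤ ε * (2ℚ * ∑U)
        dev₂≤ = dev₂≡ ≡≤ ≤-trans (∑ᶠ-mono (λ y → deviation≤ (λ a e → u a (c y) e * φ (c y) e) (λ a e → uφ≥0 a (c y) e) (zero₂ y) (λ x → S x y) (λ _ → true)))
                  (∑ᶠ-* ε (λ y → ∑² (λ x z → U x y z * f y z)) ≡≤ *-mono-≥0 ε 0≤ε Uf≤)

        -dev₂≤ : - dev₂ ≤ ε * (2ℚ * ∑U)
        -dev₂≤ = trans (cong -_ dev₂≡) (neg-∑ᶠ inner₂) ≡≤ ≤-trans (∑ᶠ-mono (λ y → -deviation≤ (λ a e → u a (c y) e * φ (c y) e) (λ a e → uφ≥0 a (c y) e) (zero₂ y) (λ x → S x y) (λ _ → true)))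
                  (∑ᶠ-* ε (λ y → ∑² (λ x z → U x y z * f y z)) ≡≤ *-mono-≥0 ε 0≤ε Uf≤)

      dev₃ : ℚ
      dev₃ = ∑³ (λ z x y → U x y z * f y z * f x z * (𝟙 true * 𝟙 true * (A x y - f x y)))

      -dev₃≤ : - dev₃ ≤ ε * (4ℚ * ∑U)
      -dev₃≤ = neg-∑ᶠ (λ z → ∑² (λ x y → U x y z * f y z * f x z * (𝟙 true * 𝟙 true * (A x y - f x y)))) ≡≤
          ≤-trans (∑ᶠ-mono (λ z → -deviation≤ (λ a b → u a b (c z) * φ b (c z) * φ a (c z)) (λ a b → uφφ≥0 a b (c z)) (zero₃ z) (λ _ → true) (λ _ → true)))
          (∑ᶠ-* ε (λ z → ∑² (λ x y → U x y z * f y z * f x z)) ≡≤ *-mono-≥0 ε 0≤ε (∑³-mono (λ z x y → uφφ≤ (c x) (c y) (c z)) ≤≡ trans (∑³-* 4ℚ (λ z x y → U x y z)) (cong (4ℚ *_) (trans (∑³-rot (λ z x y → U x y z)) refl))))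
        where
        zero₃ : ∀ z a b → bad a b ≡ true → u a b (c z) * φ b (c z) * φ a (c z) ≡ 0ℚ
        zero₃ z a b h = trans (cong (λ v → v * φ b (c z) * φ a (c z)) (u-bad a b (c z) h)) (uφφ≥0-identity (φ b (c z)) (φ a (c z)))

      class-sum₃ : ∀ (p : Fin k → Fin k → Fin k → ℚ) → ∑³ (λ x y z → p (c x) (c y) (c z)) ≡ ∑³ (λ a b e → p a b e * (size a * (size b * size e)))
      class-sum₃ p = trans (∑ᶠ-cong (λ x → class-sum (p (c x)))) (trans (class-sum₁ (λ a → ∑² (λ b e → p a b e * (size b * size e))))
          (∑ᶠ-cong (λ a → trans (*-comm _ (size a)) (trans (sym (∑²-* (size a) (λ b e → p a b e * (size b * size e)))) (∑²-cong (λ b e → deviation≡-identity (size a) (p a b e) (size b * size e)))))))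

      w : Fin n → Fin n → Fin n → ℚ
      w x y z = U x y z * (A x y * A y z * A x z)

      w≥0 : ∀ x y z → 0ℚ ≤ w x y z
      w≥0 x y z = u≥0 (c x) (c y) (c z) ⊛ (A≥0 x y ⊛ A≥0 y z ⊛ A≥0 x z)

      w-swap : ∀ x y z → w x y z ≡ w y x z
      w-swap x y z = cong₂ _*_ (u-swap (c x) (c y) (c z)) (trans (cong (λ a → a * A y z * A x z) (A-sym x y)) (w-swap-identity (A y x) (A y z) (A x z)))

      w-rot : ∀ x y z → w x y z ≡ w y z x
      w-rot x y z = cong₂ _*_ (u-rot (c x) (c y) (c z)) (trans (cong₂ (λ a b → a * A y z * b) (A-sym x y) (A-sym x z)) (w-rot-identity (A y x) (A y z) (A z x)))

      -- The three adjacency factors are replaced by densities one at a time. Replaced factors are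
      -- at most 2, so the errors are 1, 2 and 4 times ε∑U.
      ∑w≥ : (1ℚ - ζ) * value - int 7 / 1 * (ε * ∑U) ≤ ∑³ w
      ∑w≥ = lin (0≤- (-dev₁≤ adj adj) ⊕ 0≤- (-dev₂≤ adj adj) ⊕ 0≤- -dev₃≤) (trans ∑w≡ (trans (cong (λ v → v + dev₁ adj adj + dev₂ adj adj + dev₃) Ufff) (∑w≥-identity ((1ℚ - ζ) * value) (dev₁ adj adj) (dev₂ adj adj) dev₃ ε ∑U)))
        where
        Ufff : ∑³ (λ x y z → U x y z * (f x y * f y z * f x z)) ≡ (1ℚ - ζ) * value
        Ufff = trans (class-sum₃ (λ a b e → u a b e * (φ a b * φ b e * φ a e))) (trans (∑³-cong u-product) (∑³-* (1ℚ - ζ) Y))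
        t₀ t₁ t₂ t₃ : Fin n → Fin n → Fin n → ℚ
        t₀ x y z = U x y z * (f x y * f y z * f x z)
        t₁ x y z = U x y z * (A x y * A x z * (A y z - f y z))
        t₂ x y z = U x y z * f y z * (A x y * 1ℚ * (A x z - f x z))
        t₃ x y z = U x y z * f y z * f x z * (1ℚ * 1ℚ * (A x y - f x y))
        ∑w≡ : ∑³ w ≡ ∑³ t₀ + dev₁ adj adj + dev₂ adj adj + dev₃
        ∑w≡ = trans (∑³-cong (λ x y z → ∑w≥-identity₂ (U x y z) (A x y) (A y z) (A x z) (f x y) (f y z) (f x z)))
          (trans (∑³-+ (λ x y z → t₀ x y z + t₁ x y z + t₂ x y z) t₃) (cong₂ _+_ (trans (∑³-+ (λ x y z → t₀ x y z + t₁ x y z) t₂) (cong (_+ ∑³ t₂) (∑³-+ t₀ t₁))) (sym (∑³-rot (λ z x y → t₃ x y z)))))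

      ℓ : Fin n → Fin n → ℚ
      ℓ x y = ∑ᶠ (w x y)

      ℓ-sym : ∀ x y → ℓ x y ≡ ℓ y x
      ℓ-sym x y = ∑ᶠ-cong (w-swap x y)

      over : Fin n → Fin n → Bool
      over x y = lt 1ℚ (ℓ x y)

      over-sym : ∀ x y → over x y ≡ over y x
      over-sym x y = cong (lt 1ℚ) (ℓ-sym x y)

      overload : ℚ
      overload = ∑² (λ x y → 𝟙 (over x y) * ℓ x y)

      -- An overloaded edge carries load ζ above the target 1 − ζ of its class pair, and regularity bounds the total excess.
      overload≤ : ζ * overload ≤ 3ℚ * (ε * ∑U)
      overload≤ = begin
          ζ * overload ≡⟨ sym (∑²-* ζ (λ x y → 𝟙 (over x y) * ℓ x y)) ⟩
          ∑² (λ x y → ζ * (𝟙 (over x y) * ℓ x y)) ≤⟨ ∑²-mono (λ x y → term x y (bcase (over x y))) ⟩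
          ∑² (λ x y → ∑ᶠ (λ z → t₁ x y z + t₂ x y z)) ≡⟨ ∑³-+ t₁ t₂ ⟩
          dev₁ over adj + dev₂ over adj ≤⟨ +-mono-≤ (dev₁≤ over adj) (dev₂≤ over adj) ⟩
          ε * ∑U + ε * (2ℚ * ∑U) ≡⟨ overload≤-identity ε ∑U ⟩
          3ℚ * (ε * ∑U) ∎
        where
        open ≤-Reasoning
        t₁ t₂ : Fin n → Fin n → Fin n → ℚ
        t₁ x y z = U x y z * (𝟙 (over x y) * A x z * (A y z - f y z))
        t₂ x y z = U x y z * f y z * (𝟙 (over x y) * 1ℚ * (A x z - f x z))
        tgt : Fin n → Fin n → ℚ
        tgt x y = ∑ᶠ (λ z → U x y z * f y z * f x z)
        sum≡ : ∀ x y → ∑ᶠ (λ z → t₁ x y z + t₂ x y z) ≡ 𝟙 (over x y) * (∑ᶠ (λ z → U x y z * (A y z * A x z)) - tgt x y)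
        sum≡ x y = trans (∑ᶠ-cong (λ z → overload≤-identity₂ (U x y z) (𝟙 (over x y)) (A x z) (A y z) (f y z) (f x z))) (trans (∑ᶠ-* (𝟙 (over x y)) _) (cong (𝟙 (over x y) *_) (∑ᶠ-- (λ z → U x y z * (A y z * A x z)) (λ z → U x y z * f y z * f x z))))
        ℓ≤ : ∀ x y → ℓ x y ≤ ∑ᶠ (λ z → U x y z * (A y z * A x z))
        ℓ≤ x y = ∑ᶠ-mono (λ z → *-mono-≥0 (U x y z) (u≥0 (c x) (c y) (c z)) (*-mono-≥0ʳ (A x z) (A≥0 x z) (*-mono-≥0ʳ (A y z) (A≥0 y z) (A≤1 x y) ≤≡ *-identityˡ (A y z))))
        term : ∀ x y → over x y ≡ true ⊎ over x y ≡ false → ζ * (𝟙 (over x y) * ℓ x y) ≤ ∑ᶠ (λ z → t₁ x y z + t₂ x y z)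
        -- For ℓ ≥ 1 the excess ℓ - (1 - ζ) is at least ζℓ, not merely ζ; this controls the whole
        -- load of overloaded edges instead of their number.
        term x y (inj₁ h) = trans (cong (λ v → ζ * (𝟙 v * ℓ x y)) h) (cong (ζ *_) (*-identityˡ (ℓ x y))) ≡≤ lin (0≤1-ζ ⊛ 0≤- (<⇒≤ (lt-true h)) ⊕ 0≤- (target≤ (c x) (c y)) ⊕ 0≤- (ℓ≤ x y)) (overload≤-identity₃ ζ (ℓ x y) (tgt x y) (∑ᶠ (λ z → U x y z * (A y z * A x z)))) ≤≡
          sym (trans (sum≡ x y) (trans (cong (λ v → 𝟙 v * (∑ᶠ (λ z → U x y z * (A y z * A x z)) - tgt x y)) h) (*-identityˡ (∑ᶠ (λ z → U x y z * (A y z * A x z)) - tgt x y))))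
        term x y (inj₂ h) = ≤-reflexive (trans (trans (cong (λ v → ζ * (𝟙 v * ℓ x y)) h) (trans (cong (ζ *_) (*-zeroˡ (ℓ x y))) (*-zeroʳ ζ)))
          (sym (trans (sum≡ x y) (trans (cong (λ v → 𝟙 v * (∑ᶠ (λ z → U x y z * (A y z * A x z)) - tgt x y)) h) (*-zeroˡ (∑ᶠ (λ z → U x y z * (A y z * A x z)) - tgt x y))))))

      ok : Fin n → Fin n → ℚ
      ok x y = 𝟙 (not (over x y))

      ok≥0 : ∀ x y → 0ℚ ≤ ok x y
      ok≥0 x y = 𝟙≥0 (not (over x y))

      ok≤1 : ∀ x y → ok x y ≤ 1ℚ
      ok≤1 x y = 𝟙≤1 (not (over x y))

      ok-sym : ∀ x y → ok x y ≡ ok y x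
      ok-sym x y = cong (λ v → 𝟙 (not v)) (over-sym x y)

      -- Triangles with an overloaded edge are discarded rather than rescaled: symmetry is kept, and
      -- at most three times the overload is lost.
      w′ : Fin n → Fin n → Fin n → ℚ
      w′ x y z = w x y z * (ok x y * ok y z * ok x z)

      ok₃≥0 : ∀ x y z → 0ℚ ≤ ok x y * ok y z * ok x z
      ok₃≥0 x y z = ok≥0 x y ⊛ ok≥0 y z ⊛ ok≥0 x z

      w′≥0 : ∀ x y z → 0ℚ ≤ w′ x y z
      w′≥0 x y z = w≥0 x y z ⊛ ok₃≥0 x y z

      w′-swap : ∀ x y z → w′ x y z ≡ w′ y x z
      w′-swap x y z = cong₂ _*_ (w-swap x y z) (trans (cong (λ a → a * ok y z * ok x z) (ok-sym x y)) (w-swap-identity (ok y x) (ok y z) (ok x z)))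

      w′-rot : ∀ x y z → w′ x y z ≡ w′ y z x
      w′-rot x y z = cong₂ _*_ (w-rot x y z) (trans (cong₂ (λ a b → a * ok y z * b) (ok-sym x y) (ok-sym x z)) (w-rot-identity (ok y x) (ok y z) (ok z x)))

      w′-supp : ∀ x y z → adj x y ≡ false → w′ x y z ≡ 0ℚ
      w′-supp x y z h = trans (cong (λ v → U x y z * (𝟙 v * A y z * A x z) * (ok x y * ok y z * ok x z)) h) (w′-supp-identity (U x y z) (A y z) (A x z) (ok x y * ok y z * ok x z))

      ok₃≤ : ∀ x y z → ok x y * ok y z * ok x z ≤ ok x y
      ok₃≤ x y z = *-mono² (ok≥0 x y ⊛ ok≥0 y z) 0≤1 (*-mono-≥0 (ok x y) (ok≥0 x y) (ok≤1 y z) ≤≡ *-identityʳ (ok x y)) (ok≤1 x z) ≤≡ *-identityʳ (ok x y)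

      w′-load : ∀ x y → ∑ᶠ (w′ x y) ≤ 1ℚ
      w′-load x y = ≤-trans (∑ᶠ-mono (λ z → *-mono-≥0 (w x y z) (w≥0 x y z) (ok₃≤ x y z))) (∑ᶠ-*ʳ (ok x y) (w x y) ≡≤ from (bcase (over x y)))
        where from : over x y ≡ true ⊎ over x y ≡ false → ℓ x y * ok x y ≤ 1ℚ
              from (inj₁ h) = trans (cong (λ v → ℓ x y * 𝟙 (not v)) h) (*-zeroʳ (ℓ x y)) ≡≤ 0≤1
              from (inj₂ h) = trans (cong (λ v → ℓ x y * 𝟙 (not v)) h) (*-identityʳ (ℓ x y)) ≡≤ lt-false h

      w′≤U : ∀ x y z → w′ x y z ≤ U x y z
      w′≤U x y z = ≤-trans (*-mono² (w≥0 x y z) 0≤1 (*-mono-≥0 (U x y z) (u≥0 (c x) (c y) (c z)) A₃≤1) (≤-trans (ok₃≤ x y z) (ok≤1 x y))) (≤-reflexive (trans (*-identityʳ _) (*-identityʳ (U x y z))))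
        where A₃≤1 : A x y * A y z * A x z ≤ 1ℚ
              A₃≤1 = *-mono² (A≥0 x y ⊛ A≥0 y z) 0≤1 (*-mono² (A≥0 x y) 0≤1 (A≤1 x y) (A≤1 y z)) (A≤1 x z)

      w′-small : ∀ η → 6ℚ ≤ η * (d * d * (σ * N)) → ∀ x y z → 6ℚ * w′ x y z ≤ η
      w′-small η h x y z = ≤-trans (*-mono-≥0 6ℚ (nonNegative⁻¹ 6ℚ) (w′≤U x y z)) (≤-trans (*-mono-≥0ʳ (U x y z) (u≥0 (c x) (c y) (c z)) h) (w′-small-identity η (d * d * (σ * N)) (U x y z) ≡≤ *-mono-≥0 η 0≤η (u-small (c x) (c y) (c z)) ≤≡ *-identityʳ η))
        where
        0<s = 0<* (0<* 0<d 0<d) 0<σN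
        0≤η : 0ℚ ≤ η
        0≤η = *-cancel-≤ (d * d * (σ * N)) 0<s (*-zeroʳ (d * d * (σ * N)) ≡≤ ≤-trans (nonNegative⁻¹ 6ℚ) (h ≤≡ *-comm η (d * d * (σ * N))))

      ∑w′≥ : ∑³ w - 3ℚ * overload ≤ ∑³ w′
      ∑w′≥ = lin (0≤- (∑³-mono term)) (trans (∑w′≥-identity (∑³ w′) (∑³ w) (3ℚ * overload)) (cong (λ v → ∑³ w - 3ℚ * overload + (v - ∑³ w)) (sym (trans (∑³-+ w′ (λ x y z → t₁ x y z + t₂ x y z + t₃ x y z)) (cong (∑³ w′ +_) sum≡)))))
        where
        o : Fin n → Fin n → ℚ
        o x y = 𝟙 (over x y)
        t₁ t₂ t₃ : Fin n → Fin n → Fin n → ℚ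
        t₁ x y z = o x y * w x y z
        t₂ x y z = o y z * w x y z
        t₃ x y z = o x z * w x y z
        s₁ : ∑³ t₁ ≡ overload
        s₁ = ∑²-cong (λ x y → ∑ᶠ-* (o x y) (w x y))
        s₂ : ∑³ t₂ ≡ overload
        s₂ = trans (∑³-rot t₂) (trans (∑³-cong (λ y z x → cong (o y z *_) (w-rot x y z))) s₁)
        s₃ : ∑³ t₃ ≡ overload
        s₃ = trans (∑³-swap₂₃ t₃) (trans (∑³-cong (λ x z y → cong (o x z *_) (trans (w-rot x y z) (trans (w-rot y z x) (w-swap z x y))))) s₁)
        sum≡ : ∑³ (λ x y z → t₁ x y z + t₂ x y z + t₃ x y z) ≡ 3ℚ * overload
        sum≡ = trans (∑³-+ (λ x y z → t₁ x y z + t₂ x y z) t₃) (trans (cong₂ _+_ (trans (∑³-+ t₁ t₂) (cong₂ _+_ s₁ s₂)) s₃) (∑w′≥-identity₂ overload))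
        three : ∀ p q r → 1ℚ ≤ 𝟙 (not p) * 𝟙 (not q) * 𝟙 (not r) + (𝟙 p + 𝟙 q + 𝟙 r)
        three false false false = ≤-refl
        three true q r = lin (𝟙≥0 q ⊕ 𝟙≥0 r) (three-identity (𝟙 (not q)) (𝟙 (not r)) (𝟙 q) (𝟙 r))
        three false true r = lin (𝟙≥0 r) (three-identity₂ (𝟙 (not r)) (𝟙 r))
        three false false true = ≤-refl
        term : ∀ x y z → w x y z ≤ w′ x y z + (t₁ x y z + t₂ x y z + t₃ x y z)
        term x y z = sym (*-identityʳ (w x y z)) ≡≤ *-mono-≥0 (w x y z) (w≥0 x y z) (three (over x y) (over y z) (over x z)) ≤≡ ∑w′≥-identity₃ (w x y z) (ok x y * ok y z * ok x z) (o x y) (o y z) (o x z)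

      -- Multiplied through by ζd², since `overload` carries the factor ζ and ∑U the factor d². The
      -- constant is 16 = 7 + 3·3.
      lifted : ζ * (d * d) * ((1ℚ - ζ) * value) - int 16 / 1 * (ε * V²) ≤ ζ * (d * d) * ∑³ w′
      lifted = lin ((0≤ζ ⊛ (0≤d ⊛ 0≤d)) ⊛ (0≤- ∑w′≥ ⊕ 0≤- ∑w≥) ⊕ (0≤d ⊛ 0≤d) ⊛ (0≤3 ⊛ 0≤- overload≤ ⊕ nonNegative⁻¹ (int 7 / 1) ⊛ 0≤1-ζ ⊛ (0≤ε ⊛ 0≤U)) ⊕ nonNegative⁻¹ (int 16 / 1) ⊛ 0≤ε ⊛ 0≤- d²U≤)
          (lifted-identity ζ (d * d) ((1ℚ - ζ) * value) ε ∑U overload (∑³ w) (∑³ w′) V²)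
        where
        0≤U : 0ℚ ≤ ∑U
        0≤U = ∑ᶠ-≥0 (λ x → ∑²-≥0 (λ y z → u≥0 (c x) (c y) (c z)))

-- Lists of edges and triangles as sums; from weights back to a packing.

module GraphSide where

  open Sums
  open Num
  open Fins
  open Classes using (∑³; ∑³-cong; ∑³-mono; ∑³-+; ∑³-*; ∑³-swap₁₂; ∑³-swap₂₃; ∑³-rot)
  open Nibble
  open import Data.Bool using (T)
  open import Data.Bool.ListAction using (any)
  open import Data.List.Membership.Propositional using (find)

  T⇒≡ : ∀ {b} → T b → b ≡ true
  T⇒≡ {true} _ = refl

  ≡⇒T : ∀ {b} → b ≡ true → T b
  ≡⇒T refl = tt

  ∧-split : ∀ {a b} → a ∧ b ≡ true → a ≡ true × b ≡ true
  ∧-split {true} {true} _ = refl , refl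

  module _ {A : Set} where

    ∑-filterᵇ : ∀ (p : A → Bool) xs (f : A → ℚ) → ∑ (filterᵇ p xs) f ≡ ∑ xs (λ x → 𝟙 (p x) * f x)
    ∑-filterᵇ p [] f = refl
    ∑-filterᵇ p (x ∷ xs) f with p x
    ... | true = cong₂ _+_ (sym (*-identityˡ (f x))) (∑-filterᵇ p xs f)
    ... | false = trans (∑-filterᵇ p xs f) (trans (sym (+-identityˡ _)) (cong (_+ ∑ xs (λ x → 𝟙 (p x) * f x)) (sym (*-zeroˡ (f x)))))

    ∈-filterᵇ⁺ : ∀ (p : A → Bool) {xs x} → x ∈ xs → p x ≡ true → x ∈ filterᵇ p xs
    ∈-filterᵇ⁺ p x∈ e = ∈-filter⁺ (T? ∘ p) x∈ (≡⇒T e)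

    ∈-filterᵇ⁻ : ∀ (p : A → Bool) {xs x} → x ∈ filterᵇ p xs → x ∈ xs × p x ≡ true
    ∈-filterᵇ⁻ p {xs} h = proj₁ (∈-filter⁻ (T? ∘ p) {xs = xs} h) , T⇒≡ (proj₂ (∈-filter⁻ (T? ∘ p) {xs = xs} h))

    any-≤ : ∀ (p : A → Bool) xs → 𝟙 (any p xs) ≤ ∑ xs (λ x → 𝟙 (p x))
    any-≤ p [] = ≤-refl
    any-≤ p (x ∷ xs) with p x
    ... | true = lin (∑-≥0 xs (λ x → 𝟙≥0 (p x))) refl
    ... | false = any-≤ p xs ≤≡ sym (+-identityˡ _)

    any-∋ : ∀ (p : A → Bool) {xs x} → x ∈ xs → p x ≡ true → any p xs ≡ true
    any-∋ p {x ∷ xs} (here refl) e = cong (_∨ any p xs) e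
    any-∋ p {y ∷ xs} (there m) e = trans (cong (p y ∨_) (any-∋ p m e)) (Bool.∨-zeroʳ (p y))

  module _ {A B : Set} where

    ∑-concatMap : ∀ (f : A → List B) xs (g : B → ℚ) → ∑ (concatMap f xs) g ≡ ∑ xs (λ x → ∑ (f x) g)
    ∑-concatMap f [] g = refl
    ∑-concatMap f (x ∷ xs) g = trans (∑-++ (f x) (concatMap f xs) g) (cong (∑ (f x) g +_) (∑-concatMap f xs g))

    ∈-concatMap : ∀ (f : A → List B) {xs x b} → x ∈ xs → b ∈ f x → b ∈ concatMap f xs
    ∈-concatMap f x∈ b∈ = ∈-concatMap⁺ f (Any.map (λ { refl → b∈ }) x∈)

    Unique-concatMap : ∀ (f : A → List B) (key : B → A) → (∀ x {b} → b ∈ f x → key b ≡ x) → (∀ x → Unique (f x)) →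
                       ∀ {xs} → Unique xs → Unique (concatMap f xs)
    Unique-concatMap f key hk hu {[]} [] = []
    Unique-concatMap f key hk hu {x ∷ xs} (x∉ ∷ un) = Unique.++⁺ (hu x) (Unique-concatMap f key hk hu un) disj
      where
      disj : ∀ {b} → ¬ (b ∈ f x × b ∈ concatMap f xs)
      disj (b∈ , b∈′) with find (∈-concatMap⁻ f {xs = xs} b∈′)
      ... | y , y∈ , b∈fy = All.lookup x∉ y∈ (trans (sym (hk x b∈)) (hk y b∈fy))

  <ᵇ-true : ∀ {a b} → a ℕ.< b → (a ℕ.<ᵇ b) ≡ true
  <ᵇ-true h = T⇒≡ (ℕ.<⇒<ᵇ h)

  <ᵇ-false : ∀ {a b} → ¬ (a ℕ.< b) → (a ℕ.<ᵇ b) ≡ false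
  <ᵇ-false {a} {b} h with a ℕ.<ᵇ b in e
  ... | false = refl
  ... | true = ⊥-elim (h (ℕ.<ᵇ⇒< a b (≡⇒T e)))

  ∑²-half-identity : ∀ x → x + x ≡ 2ℚ * x
  ∑²-half-identity = solve 1 (λ x → x :+ x := cst 2ℚ :* x) refl

  ∑²-half-identity₂ : ∀ a → 0ℚ ≡ a * 0ℚ + a * 0ℚ
  ∑²-half-identity₂ = solve 1 (λ a → cst 0ℚ := a :* cst 0ℚ :+ a :* cst 0ℚ) refl

  ∑²-half-identity₃ : ∀ a → a ≡ 1ℚ * a + 0ℚ * a
  ∑²-half-identity₃ = solve 1 (λ a → a := cst 1ℚ :* a :+ cst 0ℚ :* a) refl

  ∑²-half-identity₄ : ∀ a → a ≡ 0ℚ * a + 1ℚ * a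
  ∑²-half-identity₄ = solve 1 (λ a → a := cst 0ℚ :* a :+ cst 1ℚ :* a) refl

  module _ {n : ℕ} where

    <ᶠ-true : ∀ {i j : Fin n} → (i <ᶠ j) ≡ true → toℕ i ℕ.< toℕ j
    <ᶠ-true {i} {j} e = ℕ.<ᵇ⇒< (toℕ i) (toℕ j) (≡⇒T e)

    <ᶠ-trans : ∀ {i j k : Fin n} → (i <ᶠ j) ≡ true → (j <ᶠ k) ≡ true → (i <ᶠ k) ≡ true
    <ᶠ-trans {i} {j} {k} p q = <ᵇ-true (ℕ.<-trans (<ᶠ-true {i} {j} p) (<ᶠ-true {j} {k} q))

    <ᶠ-irrefl : ∀ {i j : Fin n} → (i <ᶠ j) ≡ true → i ≢ j
    <ᶠ-irrefl {i} p refl = ℕ.<-irrefl refl (<ᶠ-true {i} {i} p)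

    <ᶠ-cases : ∀ (i j : Fin n) → i ≡ j ⊎ ((i <ᶠ j) ≡ true × (j <ᶠ i) ≡ false) ⊎ ((j <ᶠ i) ≡ true × (i <ᶠ j) ≡ false)
    <ᶠ-cases i j with ℕ.<-cmp (toℕ i) (toℕ j)
    ... | tri≈ _ e _ = inj₁ (Fin.toℕ-injective e)
    ... | tri< p _ q = inj₂ (inj₁ (<ᵇ-true p , <ᵇ-false q))
    ... | tri> q _ p = inj₂ (inj₂ (<ᵇ-true p , <ᵇ-false q))

    ∑²-half : ∀ (h : Fin n → Fin n → ℚ) → (∀ x y → h x y ≡ h y x) → (∀ x → h x x ≡ 0ℚ) → ∑² h ≡ 2ℚ * ∑² (λ i j → 𝟙 (i <ᶠ j) * h i j)
    ∑²-half h h-sym h-diag = trans (∑²-cong term) (trans (∑²-+ _ _) (trans (cong (∑² (λ i j → 𝟙 (i <ᶠ j) * h i j) +_) (trans (∑ᶠ-swap (λ i j → 𝟙 (j <ᶠ i) * h i j)) (∑²-cong (λ j i → cong (𝟙 (j <ᶠ i) *_) (h-sym i j))))) (∑²-half-identity (∑² (λ i j → 𝟙 (i <ᶠ j) * h i j)))))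
      where
      term : ∀ i j → h i j ≡ 𝟙 (i <ᶠ j) * h i j + 𝟙 (j <ᶠ i) * h i j
      term i j with <ᶠ-cases i j
      ... | inj₁ refl rewrite h-diag i = ∑²-half-identity₂ (𝟙 (i <ᶠ i))
      ... | inj₂ (inj₁ (p , q)) rewrite p | q = ∑²-half-identity₃ (h i j)
      ... | inj₂ (inj₂ (p , q)) rewrite p | q = ∑²-half-identity₄ (h i j)

  2edges-identity : ∀ a b c → a * b * (c * 1ℚ) ≡ a * (b * c)
  2edges-identity = solve 3 (λ a b c → a :* b :* (c :* cst 1ℚ) := a :* (b :* c)) refl

  inc-3-identity : ∀ e x y z → e * (x + y + z) ≡ x * e + y * e + z * e
  inc-3-identity = solve 4 (λ e x y z → e :* (x :+ y :+ z) := x :* e :+ y :* e :+ z :* e) refl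

  tri-O-identity : ∀ p q a b c w → p * (q * (a * (b * c))) * w ≡ p * q * (a * (b * (c * w)))
  tri-O-identity = solve 6 (λ p q a b c w → p :* (q :* (a :* (b :* c))) :* w := p :* q :* (a :* (b :* (c :* w)))) refl

  split-identity : ∀ x y z w → (x + y + z) * w ≡ x * w + y * w + z * w
  split-identity = solve 4 (λ x y z w → (x :+ y :+ z) :* w := x :* w :+ y :* w :+ z :* w) refl

  load-w-identity : ∀ t i w → t * (i * w) ≡ i * (t * w)
  load-w-identity = solve 3 (λ t i w → t :* (i :* w) := i :* (t :* w)) refl

  both≤-identity : ∀ a b c d e f → (a + b + c) * (d + e + f) ≡ (a * d + b * e + c * f) + ((a * e + a * f) + (b * d + b * f) + (c * d + c * e))
  both≤-identity = solve 6 (λ a b c d e f → (a :+ b :+ c) :* (d :+ e :+ f) := a :* d :+ b :* e :+ c :* f :+ (a :* e :+ a :* f :+ (b :* d :+ b :* f) :+ (c :* d :+ c :* e))) refl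

  ∑DW-identity : ∀ η x y z w → η ≡ (2ℚ * x + 2ℚ * y) + (z + w) + (((η - 6ℚ * x) + (η - 6ℚ * y)) * ⅓ + ((η - 6ℚ * z) + (η - 6ℚ * w)) * ⅙)
  ∑DW-identity = solve 5 (λ η x y z w → η := cst 2ℚ :* x :+ cst 2ℚ :* y :+ (z :+ w) :+ ((η :- cst 6ℚ :* x :+ (η :- cst 6ℚ :* y)) :* cst ⅓ :+ (η :- cst 6ℚ :* z :+ (η :- cst 6ℚ :* w)) :* cst ⅙)) refl

  ∑DW-identity₂ : ∀ p d q c r e f w → ((p * d + p * d) + (q * c + q * c) + (r * e + r * f)) * w ≡ (p * (2ℚ * (d * w)) + q * (2ℚ * (c * w))) + (r * (e * w) + r * (f * w))
  ∑DW-identity₂ = solve 8 (λ p d q c r e f w → (p :* d :+ p :* d :+ (q :* c :+ q :* c) :+ (r :* e :+ r :* f)) :* w := p :* (cst 2ℚ :* (d :* w)) :+ q :* (cst 2ℚ :* (c :* w)) :+ (r :* (e :* w) :+ r :* (f :* w))) refl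

  codeg-w-identity : ∀ x w y → 1ℚ * (x * w * y) ≡ x * y * w
  codeg-w-identity = solve 3 (λ x w y → cst 1ℚ :* (x :* w :* y) := x :* y :* w) refl

  W≤η-identity : ∀ w → 6ℚ * w ≡ w + w * (3ℚ + 2ℚ)
  W≤η-identity = solve 1 (λ w → cst 6ℚ :* w := w :+ w :* (cst 3ℚ :+ cst 2ℚ)) refl

  6orders-identity : ∀ a b c d e f → a + b + c + d + e + f ≡ 1ℚ + ((a - 1ℚ) + b + c + d + e + f)
  6orders-identity = solve 6 (λ a b c d e f → a :+ b :+ c :+ d :+ e :+ f := cst 1ℚ :+ (a :- cst 1ℚ :+ b :+ c :+ d :+ e :+ f)) refl

  6orders-identity₂ : ∀ a b c d e f → a + b + c + d + e + f ≡ 1ℚ + (a + (b - 1ℚ) + c + d + e + f)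
  6orders-identity₂ = solve 6 (λ a b c d e f → a :+ b :+ c :+ d :+ e :+ f := cst 1ℚ :+ (a :+ (b :- cst 1ℚ) :+ c :+ d :+ e :+ f)) refl

  6orders-identity₃ : ∀ a b c d e f → a + b + c + d + e + f ≡ 1ℚ + (a + b + (c - 1ℚ) + d + e + f)
  6orders-identity₃ = solve 6 (λ a b c d e f → a :+ b :+ c :+ d :+ e :+ f := cst 1ℚ :+ (a :+ b :+ (c :- cst 1ℚ) :+ d :+ e :+ f)) refl

  6orders-identity₄ : ∀ a b c d e f → a + b + c + d + e + f ≡ 1ℚ + (a + b + c + (d - 1ℚ) + e + f)
  6orders-identity₄ = solve 6 (λ a b c d e f → a :+ b :+ c :+ d :+ e :+ f := cst 1ℚ :+ (a :+ b :+ c :+ (d :- cst 1ℚ) :+ e :+ f)) refl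

  6orders-identity₅ : ∀ a b c d e f → a + b + c + d + e + f ≡ 1ℚ + (a + b + c + d + (e - 1ℚ) + f)
  6orders-identity₅ = solve 6 (λ a b c d e f → a :+ b :+ c :+ d :+ e :+ f := cst 1ℚ :+ (a :+ b :+ c :+ d :+ (e :- cst 1ℚ) :+ f)) refl

  6orders-identity₆ : ∀ a b c d e f → a + b + c + d + e + f ≡ 1ℚ + (a + b + c + d + e + (f - 1ℚ))
  6orders-identity₆ = solve 6 (λ a b c d e f → a :+ b :+ c :+ d :+ e :+ f := cst 1ℚ :+ (a :+ b :+ c :+ d :+ e :+ (f :- cst 1ℚ))) refl

  ∑³W≤-identity : ∀ a b c d e f w → (a + b + c + d + e + f) * w ≡ a * w + b * w + c * w + (d * w + e * w + f * w)
  ∑³W≤-identity = solve 7 (λ a b c d e f w → (a :+ b :+ c :+ d :+ e :+ f) :* w := a :* w :+ b :* w :+ c :* w :+ (d :* w :+ e :* w :+ f :* w)) refl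

  ∑³W≤-identity₂ : ∀ s → s + s + s + (s + s + s) ≡ 6ℚ * s
  ∑³W≤-identity₂ = solve 1 (λ s → s :+ s :+ s :+ (s :+ s :+ s) := cst 6ℚ :* s) refl

  packing-identity : ∀ t ε m → 6ℚ * (t - ε * m) ≡ 6ℚ * t - 3ℚ * ε * (2ℚ * m)
  packing-identity = solve 3 (λ t ε m → cst 6ℚ :* (t :- ε :* m) := cst 6ℚ :* t :- cst 3ℚ :* ε :* (cst 2ℚ :* m)) refl

  module WithGraph {n : ℕ} (G : Graph n) where

    A : Fin n → Fin n → ℚ
    A x y = 𝟙 (adj G x y)

    A-sym : ∀ x y → A x y ≡ A y x
    A-sym x y = cong 𝟙 (Graph.sym G x y)

    A-diag : ∀ x → A x x ≡ 0ℚ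
    A-diag x = cong 𝟙 (irrefl G x)

    pairs : List (Edge n)
    pairs = concatMap (λ i → map (i ,_) (allFin n)) (allFin n)

    triples : List (Triangle n)
    triples = concatMap (λ i → concatMap (λ j → map (λ k → (i , j , k)) (allFin n)) (allFin n)) (allFin n)

    ∑-pairs : ∀ f → ∑ pairs f ≡ ∑² (λ i j → f (i , j))
    ∑-pairs f = trans (∑-concatMap _ (allFin n) f) (trans (∑-cong (allFin n) (λ i → trans (∑-map (i ,_) (allFin n) f) (sym (∑ᶠ-def _)))) (sym (∑ᶠ-def _)))

    ∑-triples : ∀ f → ∑ triples f ≡ ∑³ (λ i j k → f (i , j , k))
    ∑-triples f = trans (∑-concatMap _ (allFin n) f) (trans (∑-cong (allFin n) (λ i → trans (∑-concatMap _ (allFin n) f)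
        (trans (∑-cong (allFin n) (λ j → trans (∑-map (λ k → (i , j , k)) (allFin n) f) (sym (∑ᶠ-def _)))) (sym (∑ᶠ-def _))))) (sym (∑ᶠ-def _)))

    ∑-edges : ∀ f → ∑ (edges G) f ≡ ∑² (λ i j → 𝟙 ((i <ᶠ j) ∧ adj G i j) * f (i , j))
    ∑-edges f = trans (∑-filterᵇ _ pairs f) (∑-pairs _)

    isTri : Fin n → Fin n → Fin n → Bool
    isTri i j k = (i <ᶠ j) ∧ (j <ᶠ k) ∧ adj G i j ∧ adj G j k ∧ adj G i k

    ∑-triangles : ∀ f → ∑ (triangles G) f ≡ ∑³ (λ i j k → 𝟙 (isTri i j k) * f (i , j , k))
    ∑-triangles f = trans (∑-filterᵇ _ triples f) (∑-triples _)

    edge∈ : ∀ {i j} → (i <ᶠ j) ≡ true → adj G i j ≡ true → (i , j) ∈ edges G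
    edge∈ {i} {j} p q = ∈-filterᵇ⁺ _ (∈-concatMap (λ i → map (i ,_) (allFin n)) (∈-allFin i) (∈-map⁺ (i ,_) (∈-allFin j))) (cong₂ _∧_ p q)

    edge∈⁻ : ∀ {i j} → (i , j) ∈ edges G → (i <ᶠ j) ≡ true × adj G i j ≡ true
    edge∈⁻ h = ∧-split (proj₂ (∈-filterᵇ⁻ _ {xs = pairs} h))

    tri∈⁻ : ∀ {i j k} → (i , j , k) ∈ triangles G → isTri i j k ≡ true
    tri∈⁻ h = proj₂ (∈-filterᵇ⁻ _ {xs = triples} h)

    isTri-split : ∀ {i j k} → isTri i j k ≡ true → (i <ᶠ j) ≡ true × (j <ᶠ k) ≡ true × adj G i j ≡ true × adj G j k ≡ true × adj G i k ≡ true
    isTri-split {i} {j} {k} e = p₁ , p₂ , p₃ , p₄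
      where
      p₁ = proj₁ (∧-split {i <ᶠ j} e)
      e₂ = proj₂ (∧-split {i <ᶠ j} e)
      p₂ = proj₁ (∧-split {j <ᶠ k} e₂)
      e₃ = proj₂ (∧-split {j <ᶠ k} e₂)
      p₃ = proj₁ (∧-split {adj G i j} e₃)
      p₄ = ∧-split {adj G j k} (proj₂ (∧-split {adj G i j} e₃))

    Unique-edges : Unique (edges G)
    Unique-edges = Unique.filter⁺ (T? ∘ _) (Unique-concatMap _ proj₁ (λ x m → keyed x (∈-map⁻ (x ,_) m)) (λ x → Unique.map⁺ (cong proj₂) (Unique.allFin⁺ n)) (Unique.allFin⁺ n))
      where keyed : ∀ x {b : Edge n} → ∃[ y ] (y ∈ allFin n × b ≡ (x , y)) → proj₁ b ≡ x
            keyed x (_ , _ , refl) = refl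

    Unique-triangles : Unique (triangles G)
    Unique-triangles = Unique.filter⁺ (T? ∘ _) (Unique-concatMap _ proj₁ (λ x m → outer x (find (∈-concatMap⁻ (inner x) {xs = allFin n} m)))
        (λ x → Unique-concatMap (inner x) (proj₁ ∘ proj₂) (λ y m → mid x y (∈-map⁻ (λ k → (x , y , k)) m)) (λ y → Unique.map⁺ (cong (proj₂ ∘ proj₂)) (Unique.allFin⁺ n)) (Unique.allFin⁺ n)) (Unique.allFin⁺ n))
      where
      inner : Fin n → Fin n → List (Triangle n)
      inner x y = map (λ k → (x , y , k)) (allFin n)
      mid : ∀ x y {b : Triangle n} → ∃[ z ] (z ∈ allFin n × b ≡ (x , y , z)) → proj₁ (proj₂ b) ≡ y
      mid x y (_ , _ , refl) = refl
      outer′ : ∀ x y {b : Triangle n} → ∃[ z ] (z ∈ allFin n × b ≡ (x , y , z)) → proj₁ b ≡ x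
      outer′ x y (_ , _ , refl) = refl
      outer : ∀ x {b : Triangle n} → ∃[ y ] (y ∈ allFin n × b ∈ inner x y) → proj₁ b ≡ x
      outer x (y , _ , m) = outer′ x y (∈-map⁻ (λ k → (x , y , k)) m)

    M : ℚ
    M = ∑² A

    2edges : ∀ (K : Fin n → Fin n → Bool) → (∀ x y → K x y ≡ K y x) →
      2ℚ * ι (length (filterᵇ (uncurry K) (edges G))) ≡ ∑² (λ x y → A x y * 𝟙 (K x y))
    2edges K K-sym = trans (cong (2ℚ *_) (trans (sym (∑1≡ι (filterᵇ (uncurry K) (edges G)))) (trans (∑-filterᵇ (uncurry K) (edges G) (λ _ → 1ℚ)) (trans (∑-edges (λ e → 𝟙 (uncurry K e) * 1ℚ)) (∑²-cong term)))))
        (sym (∑²-half (λ x y → A x y * 𝟙 (K x y)) (λ x y → cong₂ _*_ (A-sym x y) (cong 𝟙 (K-sym x y))) (λ x → trans (cong (_* 𝟙 (K x x)) (A-diag x)) (*-zeroˡ (𝟙 (K x x))))))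
      where
      term : ∀ i j → 𝟙 ((i <ᶠ j) ∧ adj G i j) * (𝟙 (K i j) * 1ℚ) ≡ 𝟙 (i <ᶠ j) * (A i j * 𝟙 (K i j))
      term i j = trans (cong (_* (𝟙 (K i j) * 1ℚ)) (𝟙-∧ (i <ᶠ j) (adj G i j))) (2edges-identity (𝟙 (i <ᶠ j)) (A i j) (𝟙 (K i j)))

    2numEdges : 2ℚ * ι (numEdges G) ≡ M
    2numEdges = trans (cong (2ℚ *_) (trans (sym (∑1≡ι (edges G))) (trans (∑-edges (λ _ → 1ℚ)) (∑²-cong (λ i j → trans (*-identityʳ _) (𝟙-∧ (i <ᶠ j) (adj G i j)))))))
      (sym (∑²-half A A-sym A-diag))

    Hits : (Fin n → Fin n → Bool) → Set
    Hits K = ∀ x y z → adj G x y ≡ true → adj G y z ≡ true → adj G x z ≡ true → K x y ≡ true ⊎ K y z ≡ true ⊎ K x z ≡ true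

    -- The edges of G selected by K form a triangle cover, and symmetric sums count each of them
    -- twice. The hypothesis on τ enters the proof only here.
    cover-bound : ∀ {t} → τt≥ G t → ∀ K → (∀ x y → K x y ≡ K y x) → Hits K → 2ℚ * t ≤ ∑² (λ x y → A x y * 𝟙 (K x y))
    cover-bound {t} τ K K-sym hits = *-mono-≥0 2ℚ 0≤2 (τ C (uniq , sub , all) ≤≡ ℕ→ℚ≡ι (length C)) ≤≡ 2edges K K-sym
      where
      Kᵖ : Edge n → Bool
      Kᵖ = uncurry K
      C : List (Edge n)
      C = filterᵇ Kᵖ (edges G)
      uniq : Unique C
      uniq = Unique.filter⁺ (T? ∘ Kᵖ) Unique-edges
      sub : All (_∈ edges G) C
      sub = All.tabulate (λ e∈ → proj₁ (∈-filterᵇ⁻ Kᵖ {xs = edges G} e∈))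
      hit : ∀ {t} → t ∈ triangles G → Any (_∈ C) (triEdges t)
      hit {i , j , k} t∈ = from (isTri-split {i} {j} {k} (tri∈⁻ t∈))
        where
        from : (i <ᶠ j) ≡ true × (j <ᶠ k) ≡ true × adj G i j ≡ true × adj G j k ≡ true × adj G i k ≡ true → Any (_∈ C) (triEdges (i , j , k))
        from (p , q , a , b , c) with hits i j k a b c
        ... | inj₁ h = here (∈-filterᵇ⁺ Kᵖ (edge∈ p a) h)
        ... | inj₂ (inj₁ h) = there (here (∈-filterᵇ⁺ Kᵖ (edge∈ q b) h))
        ... | inj₂ (inj₂ h) = there (there (here (∈-filterᵇ⁺ Kᵖ (edge∈ (<ᶠ-trans {i = i} {j} {k} p q) c) h)))
      all : All (λ t → Any (_∈ C) (triEdges t)) (triangles G)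
      all = All.tabulate hit

    eq : Fin n → Fin n → Bool
    eq x y = does (x Fin.≟ y)

    eq-refl : ∀ x → eq x x ≡ true
    eq-refl x with x Fin.≟ x
    ... | yes _ = refl
    ... | no p = ⊥-elim (p refl)

    inc : Triangle n → Edge n → Bool
    inc (i , j , k) (a , b) = (eq i a ∧ eq j b) ∨ ((eq j a ∧ eq k b) ∨ (eq i a ∧ eq k b))

    inc-∈ : ∀ t e → e ∈ triEdges t → inc t e ≡ true
    inc-∈ (i , j , k) _ (here refl) = cong (_∨ ((eq j i ∧ eq k j) ∨ (eq i i ∧ eq k j))) (cong₂ _∧_ (eq-refl i) (eq-refl j))
    inc-∈ (i , j , k) _ (there (here refl)) = trans (cong ((eq i j ∧ eq j k) ∨_) (cong (_∨ (eq i j ∧ eq k k)) (cong₂ _∧_ (eq-refl j) (eq-refl k)))) (Bool.∨-zeroʳ (eq i j ∧ eq j k))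
    inc-∈ (i , j , k) _ (there (there (here refl))) = trans (cong ((eq i i ∧ eq j k) ∨_) (trans (cong ((eq j i ∧ eq k k) ∨_) (cong₂ _∧_ (eq-refl i) (eq-refl k))) (Bool.∨-zeroʳ (eq j i ∧ eq k k)))) (Bool.∨-zeroʳ (eq i i ∧ eq j k))

    -- The additive version of `inc`, one term for each position of the edge in the triangle. It is
    -- an upper bound in general and exact on increasing triples.
    slots : Fin n → Fin n → Fin n → Fin n → Fin n → ℚ
    slots i j k a b = δ i a * δ j b + δ j a * δ k b + δ i a * δ k b

    ∨≤ : ∀ x y → 𝟙 (x ∨ y) ≤ 𝟙 x + 𝟙 y
    ∨≤ true y = lin (𝟙≥0 y) refl
    ∨≤ false y = ≤-reflexive (sym (+-identityˡ (𝟙 y)))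

    inc≤ : ∀ i j k a b → 𝟙 (inc (i , j , k) (a , b)) ≤ slots i j k a b
    inc≤ i j k a b = ≤-trans (≤-trans (∨≤ (p ∧ q) ((r ∧ s) ∨ (p ∧ s))) (+-monoʳ-≤ (𝟙 (p ∧ q)) (∨≤ (r ∧ s) (p ∧ s))))
        (≤-reflexive (trans (sym (+-assoc (𝟙 (p ∧ q)) (𝟙 (r ∧ s)) (𝟙 (p ∧ s)))) (cong₂ _+_ (cong₂ _+_ (𝟙-∧ p q) (𝟙-∧ r s)) (𝟙-∧ p s))))
      where
      p = eq i a
      q = eq j b
      r = eq j a
      s = eq k b

    slots≡ : ∀ p q r s → (p ≡ true → r ≡ true → ⊥) → (q ≡ true → s ≡ true → ⊥) →
             𝟙 ((p ∧ q) ∨ ((r ∧ s) ∨ (p ∧ s))) ≡ 𝟙 p * 𝟙 q + 𝟙 r * 𝟙 s + 𝟙 p * 𝟙 s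
    slots≡ true _ true _ h _ = ⊥-elim (h refl refl)
    slots≡ _ true _ true _ h = ⊥-elim (h refl refl)
    slots≡ true true false false _ _ = refl
    slots≡ true false false true _ _ = refl
    slots≡ true false false false _ _ = refl
    slots≡ false true true false _ _ = refl
    slots≡ false true false false _ _ = refl
    slots≡ false false true true _ _ = refl
    slots≡ false false true false _ _ = refl
    slots≡ false false false true _ _ = refl
    slots≡ false false false false _ _ = refl

    eq⇒ : ∀ {x y} → eq x y ≡ true → x ≡ y
    eq⇒ {x} {y} e with x Fin.≟ y
    ... | yes p = p

    -- For an edge a < b the third vertex lies after b, before a or between them, and the three
    -- cases exclude each other.
    at-most-one : ∀ p x y u v → (x ≡ true → y ≡ true → ⊥) → (y ≡ true → u ≡ true → ⊥) → (x ≡ true → v ≡ true → ⊥) →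
                  𝟙 p * 𝟙 x + 𝟙 y * 𝟙 p + 𝟙 u * 𝟙 v ≤ 1ℚ
    at-most-one _ true true _ _ h _ _ = ⊥-elim (h refl refl)
    at-most-one _ _ true true _ _ h _ = ⊥-elim (h refl refl)
    at-most-one _ true _ _ true _ _ h = ⊥-elim (h refl refl)
    at-most-one false false false false false _ _ _ = 0≤1
    at-most-one false false false false true _ _ _ = 0≤1
    at-most-one false false false true false _ _ _ = 0≤1
    at-most-one false false false true true _ _ _ = ≤-refl
    at-most-one false false true false false _ _ _ = 0≤1
    at-most-one false false true false true _ _ _ = 0≤1
    at-most-one false true false false false _ _ _ = 0≤1
    at-most-one false true false true false _ _ _ = 0≤1
    at-most-one true false false false false _ _ _ = 0≤1
    at-most-one true false false false true _ _ _ = 0≤1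
    at-most-one true false false true false _ _ _ = 0≤1
    at-most-one true false false true true _ _ _ = ≤-refl
    at-most-one true false true false false _ _ _ = ≤-refl
    at-most-one true false true false true _ _ _ = ≤-refl
    at-most-one true true false false false _ _ _ = ≤-refl
    at-most-one true true false true false _ _ _ = ≤-refl

    inc-3 : ∀ {t} → t ∈ triangles G → ∑ (edges G) (λ e → 𝟙 (inc t e)) ≡ 3ℚ
    inc-3 {i , j , k} t∈ = from (isTri-split {i} {j} {k} (tri∈⁻ t∈))
      where
      E : Fin n → Fin n → ℚ
      E a b = 𝟙 ((a <ᶠ b) ∧ adj G a b)
      from : (i <ᶠ j) ≡ true × (j <ᶠ k) ≡ true × adj G i j ≡ true × adj G j k ≡ true × adj G i k ≡ true → ∑ (edges G) (λ e → 𝟙 (inc (i , j , k) e)) ≡ 3ℚ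
      from (p , q , a , b , c) = trans (∑-edges (λ e → 𝟙 (inc (i , j , k) e))) (trans (∑²-cong (λ x y → trans (cong (E x y *_) (slots≡ (eq i x) (eq j y) (eq j x) (eq k y)
            (λ e f → <ᶠ-irrefl {i = i} {j} p (trans (eq⇒ e) (sym (eq⇒ f)))) (λ e f → <ᶠ-irrefl {i = j} {k} q (trans (eq⇒ e) (sym (eq⇒ f)))))) (inc-3-identity (E x y) (δ i x * δ j y) (δ j x * δ k y) (δ i x * δ k y))))
          (trans (∑²-+ _ _) (cong₂ _+_ (trans (∑²-+ _ _) (cong₂ _+_ (trans (∑²-δ i j E) (one p a)) (trans (∑²-δ j k E) (one q b)))) (trans (∑²-δ i k E) (one (<ᶠ-trans {i = i} {j} {k} p q) c)))))
        where one : ∀ {x y} → (x <ᶠ y) ≡ true → adj G x y ≡ true → E x y ≡ 1ℚ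
              one p a = cong 𝟙 (cong₂ _∧_ p a)

    meets eqT : Triangle n → Triangle n → Bool
    meets s t = any (λ e → inc s e ∧ inc t e) (edges G)
    eqT s t = does (≡-dec Fin._≟_ (≡-dec Fin._≟_ Fin._≟_) s t)

    eqT-sym : ∀ s t → 𝟙 (eqT s t) ≡ 𝟙 (eqT t s)
    eqT-sym s t with ≡-dec Fin._≟_ (≡-dec Fin._≟_ Fin._≟_) s t | ≡-dec Fin._≟_ (≡-dec Fin._≟_ Fin._≟_) t s
    ... | yes _ | yes _ = refl
    ... | no _ | no _ = refl
    ... | yes p | no q = ⊥-elim (q (sym p))
    ... | no p | yes q = ⊥-elim (p (sym q))

    meets-≤ : ∀ s t → 𝟙 (meets s t) ≤ ∑ (edges G) (λ e → 𝟙 (inc s e) * 𝟙 (inc t e))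
    meets-≤ s t = any-≤ (λ e → inc s e ∧ inc t e) (edges G) ≤≡ ∑-cong (edges G) (λ e → 𝟙-∧ (inc s e) (inc t e))

    meets-∋ : ∀ s t {e} → e ∈ edges G → inc s e ≡ true → inc t e ≡ true → meets s t ≡ true
    meets-∋ s t e∈ p q = any-∋ (λ e → inc s e ∧ inc t e) e∈ (cong₂ _∧_ p q)

    eqT-∑ : ∀ {t} (f : Triangle n → ℚ) → t ∈ triangles G → ∑ (triangles G) (λ s → 𝟙 (eqT t s) * f s) ≡ f t
    eqT-∑ f t∈ = ∑-δ (≡-dec Fin._≟_ (≡-dec Fin._≟_ Fin._≟_)) f Unique-triangles t∈

    -- `W` is symmetric on ordered triples, whereas the nibble runs on increasing ones; `O` selects
    -- these.
    module Pack (ε : ℚ) (0<ε : 0ℚ < ε) (W : Fin n → Fin n → Fin n → ℚ) (W≥0 : ∀ x y z → 0ℚ ≤ W x y z)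
      (W-swap : ∀ x y z → W x y z ≡ W y x z) (W-rot : ∀ x y z → W x y z ≡ W y z x)
      (W-supp : ∀ x y z → adj G x y ≡ false → W x y z ≡ 0ℚ) (W-load : ∀ x y → ∑ᶠ (W x y) ≤ 1ℚ)
      (W-small : ∀ x y z → 6ℚ * W x y z ≤ Constants.η ε 0<ε) where

      open Constants ε 0<ε using (η; module Main)
      open Main (edges G) (triangles G) inc meets eqT inc-3 meets-≤ meets-∋ eqT-sym eqT-∑

      w : Triangle n → ℚ
      w (i , j , k) = W i j k

      O : Fin n → Fin n → Fin n → ℚ
      O i j k = 𝟙 (i <ᶠ j) * 𝟙 (j <ᶠ k)

      O≥0 : ∀ i j k → 0ℚ ≤ O i j k
      O≥0 i j k = 𝟙≥0 (i <ᶠ j) ⊛ 𝟙≥0 (j <ᶠ k)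

      W-swap₂₃ : ∀ x y z → W x y z ≡ W x z y
      W-swap₂₃ x y z = trans (W-rot x y z) (trans (W-rot y z x) (W-swap z x y))

      AW₁₂ : ∀ x y z → A x y * W x y z ≡ W x y z
      AW₁₂ x y z = from (bool-cases (adj G x y))
        where from : adj G x y ≡ false ⊎ adj G x y ≡ true → A x y * W x y z ≡ W x y z
              from (inj₁ e) = trans (cong (A x y *_) (W-supp x y z e)) (trans (*-zeroʳ (A x y)) (sym (W-supp x y z e)))
              from (inj₂ e) = trans (cong (λ b → 𝟙 b * W x y z) e) (*-identityˡ (W x y z))

      AW₂₃ : ∀ x y z → A y z * W x y z ≡ W x y z
      AW₂₃ x y z = trans (cong (A y z *_) (W-rot x y z)) (trans (AW₁₂ y z x) (sym (W-rot x y z)))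

      AW₁₃ : ∀ x y z → A x z * W x y z ≡ W x y z
      AW₁₃ x y z = trans (cong (A x z *_) (W-swap₂₃ x y z)) (trans (AW₁₂ x z y) (sym (W-swap₂₃ x y z)))

      tri-O : ∀ i j k → 𝟙 (isTri i j k) * W i j k ≡ O i j k * W i j k
      tri-O i j k = trans (cong (_* W i j k) split) (trans (tri-O-identity (𝟙 (i <ᶠ j)) (𝟙 (j <ᶠ k)) (A i j) (A j k) (A i k) (W i j k))
          (cong (O i j k *_) (trans (cong (A i j *_) (trans (cong (A j k *_) (AW₁₃ i j k)) (AW₂₃ i j k))) (AW₁₂ i j k))))
        where
        split : 𝟙 (isTri i j k) ≡ 𝟙 (i <ᶠ j) * (𝟙 (j <ᶠ k) * (A i j * (A j k * A i k)))
        split = trans (𝟙-∧ (i <ᶠ j) _) (cong (𝟙 (i <ᶠ j) *_) (trans (𝟙-∧ (j <ᶠ k) _) (cong (𝟙 (j <ᶠ k) *_) (trans (𝟙-∧ (adj G i j) _) (cong (A i j *_) (𝟙-∧ (adj G j k) (adj G i k)))))))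

      total-≡ : total w ≡ ∑³ (λ i j k → O i j k * W i j k)
      total-≡ = trans (∑-triangles w) (∑³-cong tri-O)

      slot≥0 : ∀ i j k a b → 0ℚ ≤ slots i j k a b
      slot≥0 i j k a b = δ≥0 i a ⊛ δ≥0 j b ⊕ δ≥0 j a ⊛ δ≥0 k b ⊕ δ≥0 i a ⊛ δ≥0 k b

      ∑³-δ₁₂ : ∀ a b (f : Fin n → Fin n → Fin n → ℚ) → ∑³ (λ i j k → δ i a * δ j b * f i j k) ≡ ∑ᶠ (f a b)
      ∑³-δ₁₂ a b f = trans (∑³-cong (λ i j k → cong₂ (λ u v → u * v * f i j k) (δ-sym i a) (δ-sym j b)))
        (trans (∑ᶠ-cong (λ i → ∑ᶠ-cong (λ j → ∑ᶠ-* (δ a i * δ b j) (f i j)))) (∑²-δ a b (λ i j → ∑ᶠ (f i j))))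

      ∑³-δ₂₃ : ∀ a b (f : Fin n → Fin n → Fin n → ℚ) → ∑³ (λ i j k → δ j a * δ k b * f i j k) ≡ ∑ᶠ (λ i → f i a b)
      ∑³-δ₂₃ a b f = trans (∑³-rot (λ i j k → δ j a * δ k b * f i j k)) (∑³-δ₁₂ a b (λ j k i → f i j k))

      ∑³-δ₁₃ : ∀ a b (f : Fin n → Fin n → Fin n → ℚ) → ∑³ (λ i j k → δ i a * δ k b * f i j k) ≡ ∑ᶠ (λ j → f a j b)
      ∑³-δ₁₃ a b f = trans (∑³-swap₂₃ (λ i j k → δ i a * δ k b * f i j k)) (∑³-δ₁₂ a b (λ i k j → f i j k))


      load-w : ∀ {e} → e ∈ edges G → load w e ≤ 1ℚ
      load-w {a , b} e∈ = begin
          ∑ (triangles G) (λ t → 𝟙 (inc t (a , b)) * w t) ≡⟨ ∑-triangles (λ t → 𝟙 (inc t (a , b)) * w t) ⟩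
          ∑³ (λ i j k → 𝟙 (isTri i j k) * (𝟙 (inc (i , j , k) (a , b)) * W i j k)) ≡⟨ ∑³-cong (λ i j k → trans (l (𝟙 (isTri i j k)) (𝟙 (inc (i , j , k) (a , b))) (W i j k)) (cong (𝟙 (inc (i , j , k) (a , b)) *_) (tri-O i j k))) ⟩
          ∑³ (λ i j k → 𝟙 (inc (i , j , k) (a , b)) * OW i j k) ≤⟨ ∑³-mono (λ i j k → *-mono-≥0ʳ (OW i j k) (O≥0 i j k ⊛ W≥0 i j k) (inc≤ i j k a b)) ⟩
          ∑³ (λ i j k → slots i j k a b * OW i j k) ≡⟨ ∑³-cong (λ i j k → split-identity (δ i a * δ j b) (δ j a * δ k b) (δ i a * δ k b) (OW i j k)) ⟩
          ∑³ (λ i j k → S₁ i j k + S₂ i j k + S₃ i j k) ≡⟨ trans (∑³-+ (λ i j k → S₁ i j k + S₂ i j k) S₃) (cong (_+ ∑³ S₃) (∑³-+ S₁ S₂)) ⟩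
          ∑³ S₁ + ∑³ S₂ + ∑³ S₃ ≡⟨ cong₂ _+_ (cong₂ _+_ (∑³-δ₁₂ a b OW) (∑³-δ₂₃ a b OW)) (∑³-δ₁₃ a b OW) ⟩
          ∑ᶠ (OW a b) + ∑ᶠ (λ i → OW i a b) + ∑ᶠ (λ j → OW a j b) ≡⟨ cong (_+ ∑ᶠ (λ j → OW a j b)) (sym (∑ᶠ-+ (OW a b) (λ i → OW i a b))) ⟩
          ∑ᶠ (λ z → OW a b z + OW z a b) + ∑ᶠ (λ j → OW a j b) ≡⟨ sym (∑ᶠ-+ (λ z → OW a b z + OW z a b) (λ j → OW a j b)) ⟩
          ∑ᶠ (λ z → OW a b z + OW z a b + OW a z b) ≤⟨ ∑ᶠ-mono term ⟩
          ∑ᶠ (W a b) ≤⟨ W-load a b ⟩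
          1ℚ ∎
        where
        OW : Fin n → Fin n → Fin n → ℚ
        OW i j k = O i j k * W i j k
        S₁ S₂ S₃ : Fin n → Fin n → Fin n → ℚ
        S₁ i j k = δ i a * δ j b * OW i j k
        S₂ i j k = δ j a * δ k b * OW i j k
        S₃ i j k = δ i a * δ k b * OW i j k
        open ≤-Reasoning
        a<b = proj₁ (edge∈⁻ e∈)
        l : ∀ t i w → t * (i * w) ≡ i * (t * w)
        l t i w = load-w-identity t i w
        term : ∀ z → OW a b z + OW z a b + OW a z b ≤ W a b z
        term z = cong₂ _+_ (cong (λ u → O a b z * W a b z + O z a b * u) (trans (W-rot z a b) refl)) (cong (O a z b *_) (W-swap₂₃ a z b)) ≡≤
            sym (split-identity (O a b z) (O z a b) (O a z b) (W a b z)) ≡≤ *-mono-≥0ʳ (W a b z) (W≥0 a b z) small ≤≡ *-identityˡ (W a b z)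
          where
          small : O a b z + O z a b + O a z b ≤ 1ℚ
          small = at-most-one (a <ᶠ b) (b <ᶠ z) (z <ᶠ a) (a <ᶠ z) (z <ᶠ b)
              (λ p q → cyc {z} {a} {b} q a<b p) (λ p q → cyc₂ {z} {a} p q) (λ p q → cyc₂ {b} {z} p q)
            where
            cyc₂ : ∀ {x y : Fin n} → (x <ᶠ y) ≡ true → (y <ᶠ x) ≡ true → ⊥
            cyc₂ {x} {y} p q = <ᶠ-irrefl {i = x} {x} (<ᶠ-trans {i = x} {y} {x} p q) refl
            cyc : ∀ {x y z : Fin n} → (x <ᶠ y) ≡ true → (y <ᶠ z) ≡ true → (z <ᶠ x) ≡ true → ⊥
            cyc {x} {y} {z} p q r = cyc₂ {x} {z} (<ᶠ-trans {i = x} {y} {z} p q) r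

      module _ (a b c d : Fin n) (e≢f : ¬ (a ≡ c × b ≡ d)) where

        -- Two distinct edges of a triangle occupy two distinct slots. Each of the six choices of
        -- slots determines all three vertices, so six values of W, each at most η/6, bound the
        -- codegree.
        D : Fin n → Fin n → Fin n → ℚ
        D i j k = (δ i a * δ j b * δ k d + δ i a * δ j b * δ k d) + (δ j a * δ k b * δ i c + δ j a * δ k b * δ i c) + (δ i a * δ k b * δ j d + δ i a * δ k b * δ j c)

        δδ≡0 : ∀ (x y : Fin n) → δ x a * δ y b * (δ x c * δ y d) ≡ 0ℚ
        δδ≡0 x y with x Fin.≟ a | y Fin.≟ b | x Fin.≟ c | y Fin.≟ d
        ... | yes p | yes q | yes r | yes s = ⊥-elim (e≢f (trans (sym p) r , trans (sym q) s))
        ... | yes _ | yes _ | yes _ | no _ = refl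
        ... | yes _ | yes _ | no _ | yes _ = refl
        ... | yes _ | yes _ | no _ | no _ = refl
        ... | yes _ | no _ | p | q = *-zeroˡ (𝟙 (does p) * 𝟙 (does q))
        ... | no _ | yes _ | p | q = *-zeroˡ (𝟙 (does p) * 𝟙 (does q))
        ... | no _ | no _ | p | q = *-zeroˡ (𝟙 (does p) * 𝟙 (does q))

        both≤ : ∀ i j k → 𝟙 (inc (i , j , k) (a , b)) * 𝟙 (inc (i , j , k) (c , d)) ≤ D i j k
        both≤ i j k = ≤-trans (*-mono² (𝟙≥0 (inc (i , j , k) (a , b))) (slot≥0 i j k c d) (inc≤ i j k a b) (inc≤ i j k c d))
            (both≤-identity E₁ E₂ E₃ F₁ F₂ F₃ ≡≤ cong₂ _+_ (cong₂ _+_ (cong₂ _+_ (δδ≡0 i j) (δδ≡0 j k)) (δδ≡0 i k)) refl ≡≤ +-identityˡ _ ≡≤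
             +-mono-≤ (+-mono-≤ (+-mono-≤ (dropˡ E₁ (δ j c) (δ k d) (E≥0 i j) (δ≤1 j c) (δ≥0 k d)) (dropˡ E₁ (δ i c) (δ k d) (E≥0 i j) (δ≤1 i c) (δ≥0 k d)))
                                (+-mono-≤ (dropʳ E₂ (δ i c) (δ j d) (E≥0 j k) (δ≤1 j d) (δ≥0 i c)) (dropʳ E₂ (δ i c) (δ k d) (E≥0 j k) (δ≤1 k d) (δ≥0 i c))))
                      (+-mono-≤ (dropˡ E₃ (δ i c) (δ j d) (E≥0 i k) (δ≤1 i c) (δ≥0 j d)) (dropʳ E₃ (δ j c) (δ k d) (E≥0 i k) (δ≤1 k d) (δ≥0 j c))))
          where
          E₁ = δ i a * δ j b
          E₂ = δ j a * δ k b
          E₃ = δ i a * δ k b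
          F₁ = δ i c * δ j d
          F₂ = δ j c * δ k d
          F₃ = δ i c * δ k d
          E≥0 : ∀ x y → 0ℚ ≤ δ x a * δ y b
          E≥0 x y = δ≥0 x a ⊛ δ≥0 y b
          δ≤1 : ∀ (x y : Fin n) → δ x y ≤ 1ℚ
          δ≤1 x y = 𝟙≤1 (does (x Fin.≟ y))
          dropˡ : ∀ E u v → 0ℚ ≤ E → u ≤ 1ℚ → 0ℚ ≤ v → E * (u * v) ≤ E * v
          dropˡ E u v p q r = *-mono-≥0 E p (*-mono-≥0ʳ v r q ≤≡ *-identityˡ v)
          dropʳ : ∀ E u v → 0ℚ ≤ E → v ≤ 1ℚ → 0ℚ ≤ u → E * (u * v) ≤ E * u
          dropʳ E u v p q r = *-mono-≥0 E p (*-mono-≥0 u r q ≤≡ *-identityʳ u)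


        ∑DW : ∑³ (λ i j k → D i j k * W i j k) ≤ η
        ∑DW = ≤-reflexive (trans (∑³-cong (λ i j k → ∑DW-identity₂ (δ i a * δ j b) (δ k d) (δ j a * δ k b) (δ i c) (δ i a * δ k b) (δ j d) (δ j c) (W i j k)))
            (trans (∑³-+ _ _) (cong₂ _+_ (trans (∑³-+ _ _) (cong₂ _+_ s₁ s₂)) (trans (∑³-+ _ _) (cong₂ _+_ s₃ s₄))))) ⟨≤⟩
            lin ((0≤- (W-small a b d) ⊕ 0≤- (W-small c a b)) ⊛ nonNegative⁻¹ ⅓ ⊕ (0≤- (W-small a d b) ⊕ 0≤- (W-small a c b)) ⊛ nonNegative⁻¹ ⅙) (∑DW-identity η (W a b d) (W c a b) (W a d b) (W a c b))
          where
          _⟨≤⟩_ = ≤-trans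
          at : ∀ x (h : Fin n → ℚ) → ∑ᶠ (λ y → δ y x * h y) ≡ h x
          at x h = trans (∑ᶠ-cong (λ y → cong (_* h y) (δ-sym y x))) (∑ᶠ-δ x h)
          s₁ : ∑³ (λ i j k → δ i a * δ j b * (2ℚ * (δ k d * W i j k))) ≡ 2ℚ * W a b d
          s₁ = trans (∑³-δ₁₂ a b (λ i j k → 2ℚ * (δ k d * W i j k))) (trans (∑ᶠ-* 2ℚ (λ k → δ k d * W a b k)) (cong (2ℚ *_) (at d (W a b))))
          s₂ : ∑³ (λ i j k → δ j a * δ k b * (2ℚ * (δ i c * W i j k))) ≡ 2ℚ * W c a b
          s₂ = trans (∑³-δ₂₃ a b (λ i j k → 2ℚ * (δ i c * W i j k))) (trans (∑ᶠ-* 2ℚ (λ i → δ i c * W i a b)) (cong (2ℚ *_) (at c (λ i → W i a b))))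
          s₃ : ∑³ (λ i j k → δ i a * δ k b * (δ j d * W i j k)) ≡ W a d b
          s₃ = trans (∑³-δ₁₃ a b (λ i j k → δ j d * W i j k)) (at d (λ j → W a j b))
          s₄ : ∑³ (λ i j k → δ i a * δ k b * (δ j c * W i j k)) ≡ W a c b
          s₄ = trans (∑³-δ₁₃ a b (λ i j k → δ j c * W i j k)) (at c (λ j → W a j b))

      codeg-w : ∀ t {e f} → e ∈ edges G → f ∈ edges G → inc t e ≡ false → inc t f ≡ true → ∑ (triangles G) (λ j → 𝟙 (inc j e) * w j * 𝟙 (inc j f)) ≤ η
      codeg-w t {a , b} {c , d} _ _ p q = begin
          ∑ (triangles G) F ≡⟨ ∑-triangles F ⟩
          ∑³ (λ i j k → 𝟙 (isTri i j k) * F (i , j , k)) ≤⟨ ∑³-mono term ⟩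
          ∑³ (λ i j k → D a b c d e≢f i j k * W i j k) ≤⟨ ∑DW a b c d e≢f ⟩
          η ∎
        where
        open ≤-Reasoning
        F : Triangle n → ℚ
        F j = 𝟙 (inc j (a , b)) * w j * 𝟙 (inc j (c , d))
        clash : true ≡ false → ⊥
        clash ()
        e≢f : ¬ (a ≡ c × b ≡ d)
        e≢f (r , s) = clash (trans (sym q) (trans (cong₂ (λ x y → inc t (x , y)) (sym r) (sym s)) p))
        term : ∀ i j k → 𝟙 (isTri i j k) * F (i , j , k) ≤ D a b c d e≢f i j k * W i j k
        term i j k = ≤-trans (*-mono-≥0ʳ (F (i , j , k)) (𝟙≥0 (inc (i , j , k) (a , b)) ⊛ W≥0 i j k ⊛ 𝟙≥0 (inc (i , j , k) (c , d))) (𝟙≤1 (isTri i j k)))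
          (≤-trans (≤-reflexive (codeg-w-identity (𝟙 (inc (i , j , k) (a , b))) (W i j k) (𝟙 (inc (i , j , k) (c , d))))) (*-mono-≥0ʳ (W i j k) (W≥0 i j k) (both≤ a b c d e≢f i j k)))

      W≤1 : ∀ i j k → W i j k ≤ 1ℚ
      W≤1 i j k = ≤-trans (∑ᶠ-∈≤ {f = W i j} k (W≥0 i j)) (W-load i j)

      W≤η : ∀ i j k → W i j k ≤ η
      W≤η i j k = ≤-trans (lin (W≥0 i j k ⊛ nonNegative⁻¹ 5ℚ) (W≤η-identity (W i j k))) (W-small i j k)

      small : Small η w
      small = record { w≥0 = λ { (i , j , k) → W≥0 i j k } ; load≤1 = load-w ; w≤η = λ { {i , j , k} _ → W≤η i j k } ; w≤1 = λ { {i , j , k} _ → W≤1 i j k } ; codeg = codeg-w }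

      W-eq₁₂ : ∀ x z → W x x z ≡ 0ℚ
      W-eq₁₂ x z = W-supp x x z (irrefl G x)

      S₆ : Fin n → Fin n → Fin n → ℚ
      S₆ x y z = O x y z + O x z y + O y x z + O y z x + O z x y + O z y x

      -- One of the six orders of distinct vertices is increasing, and W vanishes when two vertices
      -- coincide, since there are no loops.
      6orders : ∀ x y z → W x y z ≤ S₆ x y z * W x y z
      6orders x y z = from (<ᶠ-cases x y) (<ᶠ-cases y z) (<ᶠ-cases x z)
        where
        Cmp : Fin n → Fin n → Set
        Cmp i j = i ≡ j ⊎ ((i <ᶠ j) ≡ true × (j <ᶠ i) ≡ false) ⊎ ((j <ᶠ i) ≡ true × (i <ᶠ j) ≡ false)
        zeroed : W x y z ≡ 0ℚ → W x y z ≤ S₆ x y z * W x y z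
        zeroed e = ≤-reflexive (trans e (sym (trans (cong (S₆ x y z *_) e) (*-zeroʳ (S₆ x y z)))))
        one : ∀ {i j k} → (i <ᶠ j) ≡ true → (j <ᶠ k) ≡ true → 1ℚ ≤ O i j k
        one p q = ≤-reflexive (sym (cong₂ (λ u v → 𝟙 u * 𝟙 v) p q))
        ge : 1ℚ ≤ S₆ x y z → W x y z ≤ S₆ x y z * W x y z
        ge h = sym (*-identityˡ (W x y z)) ≡≤ *-mono-≥0ʳ (W x y z) (W≥0 x y z) h
        o₁ = O≥0 x y z
        o₂ = O≥0 x z y
        o₃ = O≥0 y x z
        o₄ = O≥0 y z x
        o₅ = O≥0 z x y
        o₆ = O≥0 z y x
        from : Cmp x y → Cmp y z → Cmp x z → W x y z ≤ S₆ x y z * W x y z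
        from (inj₁ refl) _ _ = zeroed (W-eq₁₂ x z)
        from _ (inj₁ refl) _ = zeroed (trans (W-rot x y y) (W-eq₁₂ y x))
        from _ _ (inj₁ refl) = zeroed (trans (W-swap₂₃ x y x) (W-eq₁₂ x y))
        from (inj₂ (inj₁ (p , _))) (inj₂ (inj₁ (q , _))) _ = ge (lin (0≤- (one {x} {y} {z} p q) ⊕ o₂ ⊕ o₃ ⊕ o₄ ⊕ o₅ ⊕ o₆) (6orders-identity (O x y z) (O x z y) (O y x z) (O y z x) (O z x y) (O z y x)))
        from (inj₂ (inj₁ (p , _))) (inj₂ (inj₂ (q , _))) (inj₂ (inj₁ (r , _))) = ge (lin (o₁ ⊕ 0≤- (one {x} {z} {y} r q) ⊕ o₃ ⊕ o₄ ⊕ o₅ ⊕ o₆) (6orders-identity₂ (O x y z) (O x z y) (O y x z) (O y z x) (O z x y) (O z y x)))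
        from (inj₂ (inj₁ (p , _))) (inj₂ (inj₂ (q , _))) (inj₂ (inj₂ (r , _))) = ge (lin (o₁ ⊕ o₂ ⊕ o₃ ⊕ o₄ ⊕ 0≤- (one {z} {x} {y} r p) ⊕ o₆) (6orders-identity₅ (O x y z) (O x z y) (O y x z) (O y z x) (O z x y) (O z y x)))
        from (inj₂ (inj₂ (p , _))) (inj₂ (inj₁ (q , _))) (inj₂ (inj₁ (r , _))) = ge (lin (o₁ ⊕ o₂ ⊕ 0≤- (one {y} {x} {z} p r) ⊕ o₄ ⊕ o₅ ⊕ o₆) (6orders-identity₃ (O x y z) (O x z y) (O y x z) (O y z x) (O z x y) (O z y x)))
        from (inj₂ (inj₂ (p , _))) (inj₂ (inj₁ (q , _))) (inj₂ (inj₂ (r , _))) = ge (lin (o₁ ⊕ o₂ ⊕ o₃ ⊕ 0≤- (one {y} {z} {x} q r) ⊕ o₅ ⊕ o₆) (6orders-identity₄ (O x y z) (O x z y) (O y x z) (O y z x) (O z x y) (O z y x)))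
        from (inj₂ (inj₂ (p , _))) (inj₂ (inj₂ (q , _))) _ = ge (lin (o₁ ⊕ o₂ ⊕ o₃ ⊕ o₄ ⊕ o₅ ⊕ 0≤- (one {z} {y} {x} q p)) (6orders-identity₆ (O x y z) (O x z y) (O y x z) (O y z x) (O z x y) (O z y x)))

      OW : Fin n → Fin n → Fin n → ℚ
      OW i j k = O i j k * W i j k

      ∑³W≤ : ∑³ W ≤ 6ℚ * total w
      ∑³W≤ = ≤-trans (∑³-mono 6orders) (≤-reflexive (begin
          ∑³ (λ x y z → S₆ x y z * W x y z) ≡⟨ ∑³-cong (λ x y z → ∑³W≤-identity (O x y z) (O x z y) (O y x z) (O y z x) (O z x y) (O z y x) (W x y z)) ⟩
          ∑³ (λ x y z → t₁ x y z + t₂ x y z + t₃ x y z + (t₄ x y z + t₅ x y z + t₆ x y z)) ≡⟨ ∑³-+ (λ x y z → t₁ x y z + t₂ x y z + t₃ x y z) (λ x y z → t₄ x y z + t₅ x y z + t₆ x y z) ⟩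
          ∑³ (λ x y z → t₁ x y z + t₂ x y z + t₃ x y z) + ∑³ (λ x y z → t₄ x y z + t₅ x y z + t₆ x y z) ≡⟨ cong₂ _+_ (three t₁ t₂ t₃) (three t₄ t₅ t₆) ⟩
          ∑³ t₁ + ∑³ t₂ + ∑³ t₃ + (∑³ t₄ + ∑³ t₅ + ∑³ t₆) ≡⟨ cong₂ _+_ (cong₂ _+_ (cong (S +_) e₂) e₃) (cong₂ _+_ (cong₂ _+_ e₄ e₅) e₆) ⟩
          S + S + S + (S + S + S) ≡⟨ ∑³W≤-identity₂ S ⟩
          6ℚ * S ≡⟨ cong (6ℚ *_) (sym total-≡) ⟩
          6ℚ * total w ∎))
        where
        open ≡-Reasoning
        S = ∑³ OW
        t₁ t₂ t₃ t₄ t₅ t₆ : Fin n → Fin n → Fin n → ℚ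
        t₁ x y z = O x y z * W x y z
        t₂ x y z = O x z y * W x y z
        t₃ x y z = O y x z * W x y z
        t₄ x y z = O y z x * W x y z
        t₅ x y z = O z x y * W x y z
        t₆ x y z = O z y x * W x y z
        three : ∀ (f g h : Fin n → Fin n → Fin n → ℚ) → ∑³ (λ x y z → f x y z + g x y z + h x y z) ≡ ∑³ f + ∑³ g + ∑³ h
        three f g h = trans (∑³-+ (λ x y z → f x y z + g x y z) h) (cong (_+ ∑³ h) (∑³-+ f g))
        e₂ : ∑³ t₂ ≡ S
        e₂ = trans (∑³-swap₂₃ t₂) (∑³-cong (λ x z y → cong (O x z y *_) (W-swap₂₃ x y z)))
        e₃ : ∑³ t₃ ≡ S
        e₃ = trans (∑³-swap₁₂ t₃) (∑³-cong (λ y x z → cong (O y x z *_) (W-swap x y z)))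
        e₄ : ∑³ t₄ ≡ S
        e₄ = trans (∑³-rot t₄) (∑³-cong (λ y z x → cong (O y z x *_) (W-rot x y z)))
        e₅ : ∑³ t₅ ≡ S
        e₅ = trans (∑³-rot t₅) (trans (∑³-rot (λ y z x → t₅ x y z)) (∑³-cong (λ z x y → cong (O z x y *_) (trans (W-rot x y z) (W-rot y z x)))))
        e₆ : ∑³ t₆ ≡ S
        e₆ = trans (∑³-rot t₆) (trans (∑³-swap₁₂ (λ y z x → t₆ x y z)) (∑³-cong (λ z y x → cong (O z y x *_) (trans (W-rot x y z) (W-swap y z x)))))

      triEdges⊆ : ∀ {t} → t ∈ triangles G → ∀ {e} → e ∈ triEdges t → e ∈ edges G
      triEdges⊆ {i , j , k} t∈ = from (isTri-split {i} {j} {k} (tri∈⁻ t∈))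
        where
        from : (i <ᶠ j) ≡ true × (j <ᶠ k) ≡ true × adj G i j ≡ true × adj G j k ≡ true × adj G i k ≡ true → ∀ {e} → e ∈ triEdges (i , j , k) → e ∈ edges G
        from (p , q , a , b , c) (here refl) = edge∈ p a
        from (p , q , a , b , c) (there (here refl)) = edge∈ q b
        from (p , q , a , b , c) (there (there (here refl))) = edge∈ (<ᶠ-trans {i = i} {j} {k} p q) c

      disjoint : ∀ {s t} → s ∈ triangles G → meets t s ≡ false → EdgeDisjoint s t
      disjoint {s} {t} s∈ ¬m = All.tabulate (λ {e} e∈s e∈t → clash (trans (sym ¬m) (meets-∋ t s (triEdges⊆ s∈ e∈s) (inc-∈ t e e∈t) (inc-∈ s e e∈s))))
        where clash : false ≡ true → ⊥
              clash ()

      disjoints : ∀ {P} → All (_∈ triangles G) P → Matching P → AllPairs EdgeDisjoint P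
      disjoints [] [] = []
      disjoints (s∈ ∷ mem) (h ∷ hs) = All.map (disjoint s∈) h ∷ disjoints mem hs

      packing : ∃[ P ] (IsTrianglePacking G P × ∑³ W - 3ℚ * ε * M ≤ 6ℚ * ι (length P))
      packing = from (nibble w small)
        where
        from : ∃[ P ] (All (λ t → t ∈ triangles G × 0ℚ < w t) P × Matching P × total w - ε * ∣P∣ ≤ ι (length P)) → ∃[ P ] (IsTrianglePacking G P × ∑³ W - 3ℚ * ε * M ≤ 6ℚ * ι (length P))
        from (P , mem , mat , len) = P , (All.map proj₁ mem , disjoints (All.map proj₁ mem) mat) ,
          ≤-trans (+-mono-≤ ∑³W≤ (≤-refl { - (3ℚ * ε * M)})) (cong (λ z → 6ℚ * total w - 3ℚ * ε * z) (sym (trans (cong (2ℚ *_) (∑1≡ι (edges G))) 2numEdges)) ≡≤ sym (packing-identity (total w) ε ∣P∣) ≡≤ *-mono-≥0 6ℚ (nonNegative⁻¹ 6ℚ) len)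

-- Choice of constants and assembly.

open Sums
open Num
open Fins
open Regularity using (Regular; regularity; module Partition)
open Classes
open Reduced using (module Reduction; ∑ᶠ1≡ι)
open GraphSide using (module WithGraph)
open Nibble using (module Constants)

Claim : ℚ → ℕ → ℚ → Set
Claim β N δ = ∀ (n : ℕ) (G : Graph n) → N ℕ.< n →
        β * ℕ→ℚ (n ^ 2) ≤ ℕ→ℚ (numEdges G) →
        τt≥ G ((1ℚ - δ) * ℕ→ℚ (numEdges G) * (int 1 / 2)) →
        νt≥ G ((1ℚ + β * β * (int 1 / 800)) * ℕ→ℚ (numEdges G) * (int 1 / 4))

module Edges {n : ℕ} (G : Graph n) where

  open WithGraph G public

  N V² : ℚ
  N = ∑ᶠ {n} (λ _ → 1ℚ)
  V² = ∑² {n} {n} (λ _ _ → 1ℚ)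

  m : ℚ
  m = ℕ→ℚ (numEdges G)

  2m≡M : 2ℚ * m ≡ M
  2m≡M = trans (cong (2ℚ *_) (ℕ→ℚ≡ι (numEdges G))) 2numEdges

  V²≡ : V² ≡ ℕ→ℚ (n ^ 2)
  V²≡ = trans (∑²-× {n} {n} (λ _ → 1ℚ) (λ _ → 1ℚ)) (trans (cong₂ _*_ (∑ᶠ1≡ι n) (trans (∑ᶠ1≡ι n) (cong ι (sym (ℕ.*-identityʳ n)))))
          (sym (trans (ℕ→ℚ≡ι (n ^ 2)) (ι-* n (n ℕ.* 1)))))

  M≤V² : M ≤ V²
  M≤V² = ∑²-mono (λ x y → 𝟙≤1 (adj G x y))

  dense : ∀ {β} → β * ℕ→ℚ (n ^ 2) ≤ m → 2ℚ * β * V² ≤ M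
  dense {β} h = cong (2ℚ * β *_) V²≡ ≡≤ *-assoc 2ℚ β (ℕ→ℚ (n ^ 2)) ≡≤ *-mono-≥0 2ℚ 0≤2 h ≤≡ 2m≡M

  0<N : ∀ {k} → k ℕ.< n → 0ℚ < N
  0<N {k} h = <-≤-trans (0<+ (positive⁻¹ 1ℚ) (ι≥0 k)) (ι-mono h ≤≡ sym (∑ᶠ1≡ι n))

-- Vacuous: 2βn² ≤ 2m ≤ n² is impossible for β > 1 and n > 0.
large-density : ∀ {β} → 0ℚ < β → ¬ (β ≤ 1ℚ) → Claim β 0 1ℚ
large-density {β} 0<β β≰1 n G 0<n dens _ = ⊥-elim (<-irrefl refl (<-≤-trans (0<* 0<N₀ 0<N₀) le))
  where
  open Edges G
  0<N₀ = 0<N 0<n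
  V²≡NN : V² ≡ N * N
  V²≡NN = ∑²-× {n} {n} (λ _ → 1ℚ) (λ _ → 1ℚ)
  le : N * N ≤ 0ℚ
  le = sym V²≡NN ≡≤ lin (0≤- M≤V² ⊕ 0≤- (dense {β} dens) ⊕ 0≤2 ⊛ 0≤- (<⇒≤ (≰⇒> β≰1)) ⊛ 0≤V²) (l β V² M)
    where
    0≤V² : 0ℚ ≤ V²
    0≤V² = ∑²-≥0 {n} {n} (λ _ _ → 0≤1)
    l : ∀ β v m → 0ℚ ≡ v + ((v - m) + (m - 2ℚ * β * v) + 2ℚ * (β - 1ℚ) * v)
    l = solve 3 (λ β v m → cst 0ℚ := v :+ (v :- m :+ (m :- cst 2ℚ :* β :* v) :+ cst 2ℚ :* (β :- cst 1ℚ) :* v)) refl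

N₀-choice-identity : ∀ s q r → s * (q * r) ≡ s * r * q
N₀-choice-identity = solve 3 (λ s q r → s :* (q :* r) := s :* r :* q) refl

dV²≤-identity : ∀ β v → int 48000 / 1 * (int 1 / 24000 * (β * β * β) * v) ≡ β * β * (2ℚ * β * v)
dV²≤-identity = solve 2 (λ β v → cst (int 48000 / 1) :* (cst (int 1 / 24000) :* (β :* β :* β) :* v) := β :* β :* (cst 2ℚ :* β :* v)) refl

hard-identity : ∀ β m → 2ℚ * m - int 1 / 5000 * (β * β * (2ℚ * m)) ≡ 2ℚ * (2ℚ * ((1ℚ - int 1 / 5000 * (β * β)) * m * (int 1 / 2)))
hard-identity = solve 2 (λ β m → cst 2ℚ :* m :- cst (int 1 / 5000) :* (β :* β :* (cst 2ℚ :* m)) := cst 2ℚ :* (cst 2ℚ :* ((cst 1ℚ :- cst (int 1 / 5000) :* (β :* β)) :* m :* cst (int 1 / 2)))) refl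

6≤-identity : ∀ N η D σ → N * (η * (D * σ)) ≡ η * (D * (σ * N))
6≤-identity = solve 4 (λ N η D σ → N :* (η :* (D :* σ)) := η :* (D :* (σ :* N))) refl

W≥-identity : ∀ D X W β v m → D * W ≡ D * (X - int 1 / 2000 * (β * β * m)) + ((D * W - (D * X - int 16 / 1 * (D * (int 1 / 16000 * (β * β * β)) * v))) + D * (β * β * (int 1 / 2000)) * (m - 2ℚ * β * v))
W≥-identity = solve 6 (λ D X W β v m → D :* W := D :* (X :- cst (int 1 / 2000) :* (β :* β :* m)) :+ (D :* W :- (D :* X :- cst (int 16 / 1) :* (D :* (cst (int 1 / 16000) :* (β :* β :* β)) :* v)) :+ D :* (β :* β :* cst (int 1 / 2000)) :* (m :- cst 2ℚ :* β :* v))) refl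

final-identity : ∀ W V β m → W - 3ℚ * (int 1 / 6000 * (β * β)) * m ≡ int 3 / 4 * m + int 3 / 3200 * (β * β * m) +
  ((W - ((1ℚ - int 1 / 4000 * (β * β)) * V - int 1 / 2000 * (β * β * m))) + (1ℚ - int 1 / 4000 * (β * β)) * (V - (int 3 / 4 * m + int 1 / 300 * (β * β * m)))
  + β * β * m * (int 1 / 300 - int 3 / 16000 - int 1 / 1000 - int 3 / 3200 - int 1 / 1200000) + β * β * m * (1ℚ - β * β) * (int 1 / 1200000))
final-identity = solve 4 (λ W V β m → W :- cst 3ℚ :* (cst (int 1 / 6000) :* (β :* β)) :* m := cst (int 3 / 4) :* m :+ cst (int 3 / 3200) :* (β :* β :* m) :+ (W :- ((cst 1ℚ :- cst (int 1 / 4000) :* (β :* β)) :* V :- cst (int 1 / 2000) :* (β :* β :* m)) :+ (cst 1ℚ :- cst (int 1 / 4000) :* (β :* β)) :* (V :- (cst (int 3 / 4) :* m :+ cst (int 1 / 300) :* (β :* β :* m))) :+ β :* β :* m :* (cst (int 1 / 300) :- cst (int 3 / 16000) :- cst (int 1 / 1000) :- cst (int 3 / 3200) :- cst (int 1 / 1200000)) :+ β :* β :* m :* (cst 1ℚ :- β :* β) :* cst (int 1 / 1200000))) refl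

claim-identity : ∀ β m → 6ℚ * ((1ℚ + β * β * (int 1 / 800)) * m * (int 1 / 4)) ≡ int 3 / 4 * (2ℚ * m) + int 3 / 3200 * (β * β * (2ℚ * m))
claim-identity = solve 2 (λ β m → cst 6ℚ :* ((cst 1ℚ :+ β :* β :* cst (int 1 / 800)) :* m :* cst (int 1 / 4)) := cst (int 3 / 4) :* (cst 2ℚ :* m) :+ cst (int 3 / 3200) :* (β :* β :* (cst 2ℚ :* m))) refl

module Parameters (β : ℚ) (0<β : 0ℚ < β) (β≤1 : β ≤ 1ℚ) where

  0≤β : 0ℚ ≤ β
  0≤β = <⇒≤ 0<β

  -- `d` is such that 48000·d·n² = 2β³n² ≤ β²M. `ε` makes the lifting error 16εn² at most
  -- ζd²·β²M/2000, and `εₙ` makes the nibble lose 3εₙM = β²M/2000. `ζ` costs 3/16000 of β²M on the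
  -- main term ¾M.
  β² β³ δ₀ d ζ ε εₙ : ℚ
  β² = β * β
  β³ = β * β * β
  δ₀ = int 1 / 5000 * β²
  d = int 1 / 24000 * β³
  ζ = int 1 / 4000 * β²
  ε = ζ * (d * d) * (int 1 / 16000 * β³)
  εₙ = int 1 / 6000 * β²

  0<β² : 0ℚ < β²
  0<β² = 0<* 0<β 0<β

  0<β³ : 0ℚ < β³
  0<β³ = 0<* 0<β² 0<β

  0<δ₀ : 0ℚ < δ₀
  0<δ₀ = 0<* (positive⁻¹ (int 1 / 5000)) 0<β²

  0<d : 0ℚ < d
  0<d = 0<* (positive⁻¹ (int 1 / 24000)) 0<β³

  0<ζ : 0ℚ < ζ
  0<ζ = 0<* (positive⁻¹ (int 1 / 4000)) 0<β²

  0<ε : 0ℚ < ε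
  0<ε = 0<* (0<* 0<ζ (0<* 0<d 0<d)) (0<* (positive⁻¹ (int 1 / 16000)) 0<β³)

  0<εₙ : 0ℚ < εₙ
  0<εₙ = 0<* (positive⁻¹ (int 1 / 6000)) 0<β²

  β²≤1 : β² ≤ 1ℚ
  β²≤1 = *-mono² 0≤β 0≤1 β≤1 β≤1

  β³≤1 : β³ ≤ 1ℚ
  β³≤1 = *-mono² (<⇒≤ 0<β²) 0≤1 β²≤1 β≤1

  scaled≤1 : ∀ q {x} → 0ℚ ≤ q → 0ℚ ≤ 1ℚ - q → x ≤ 1ℚ → q * x ≤ 1ℚ
  scaled≤1 q 0≤q q≤1 h = ≤-trans (*-mono-≥0 q 0≤q h) (*-identityʳ q ≡≤ -≥0 q≤1)

  ζ≤1 : ζ ≤ 1ℚ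
  ζ≤1 = scaled≤1 (int 1 / 4000) (nonNegative⁻¹ (int 1 / 4000)) (nonNegative⁻¹ (1ℚ - int 1 / 4000)) β²≤1

  d≤1 : d ≤ 1ℚ
  d≤1 = scaled≤1 (int 1 / 24000) (nonNegative⁻¹ (int 1 / 24000)) (nonNegative⁻¹ (1ℚ - int 1 / 24000)) β³≤1

  ε≤d : ε ≤ d
  ε≤d = *-mono² (<⇒≤ (0<* 0<ζ (0<* 0<d 0<d))) 0≤1 (*-mono² (<⇒≤ 0<ζ) (<⇒≤ 0<d) ζ≤1 (*-mono² (<⇒≤ 0<d) (<⇒≤ 0<d) d≤1 (≤-refl {d}) ≤≡ *-identityˡ d) ≤≡ *-identityˡ d)
          (scaled≤1 (int 1 / 16000) (nonNegative⁻¹ (int 1 / 16000)) (nonNegative⁻¹ (1ℚ - int 1 / 16000)) β³≤1) ≤≡ *-identityʳ d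

  ε≤1 : ε ≤ 1ℚ
  ε≤1 = ≤-trans ε≤d d≤1

  K : ℕ
  K = proj₁ (regularity ε 0<ε)

  -- There are at most K classes, so those below σN contain at most KσN ≤ εN vertices in total.
  σ-choice : ∃[ σ ] (0ℚ < σ × σ * ι K ≤ ε)
  σ-choice = shrink ε (ι K) 0<ε (ι≥0 K)

  σ : ℚ
  σ = proj₁ σ-choice

  0<σ : 0ℚ < σ
  0<σ = proj₁ (proj₂ σ-choice)

  η : ℚ
  η = Constants.η εₙ 0<εₙ

  q : ℚ
  q = η * (d * d * σ)

  0<q : 0ℚ < q
  0<q = 0<* (Constants.0<η εₙ 0<εₙ) (0<* (0<* 0<d 0<d) 0<σ)

  -- For n beyond this, ηd²σn ≥ 6: weights of at most 1/(d²σn) are then as small as the nibble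
  -- demands, including the factor 6 of the codegree bound.
  N₀-choice : ∃[ N₀ ] (6ℚ ≤ ι N₀ * q)
  N₀-choice = from (inv q 0<q)
    where
    from : ∃[ r ] (0ℚ < r × q * r ≡ 1ℚ) → ∃[ N₀ ] (6ℚ ≤ ι N₀ * q)
    from (r , 0<r , e) = proj₁ (archimedes (6ℚ * r)) , (sym (*-identityʳ 6ℚ) ≡≤ cong (6ℚ *_) (sym e) ≡≤ N₀-choice-identity 6ℚ q r ≡≤ *-mono-≥0ʳ q (<⇒≤ 0<q) (proj₂ (archimedes (6ℚ * r))))

  N₀ : ℕ
  N₀ = proj₁ N₀-choice

  claim : Claim β N₀ δ₀
  claim n G N₀<n dens τ = from (proj₂ (regularity ε 0<ε) A A-sym A²)
    where
    open Edges G
    A² : ∀ x y → A x y * A x y ≤ 1ℚ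
    A² x y = 𝟙-sq (adj G x y) ≡≤ 𝟙≤1 (adj G x y)
    from : Regular A ε K → νt≥ G ((1ℚ + β * β * (int 1 / 800)) * ℕ→ℚ (numEdges G) * (int 1 / 4))
    from reg = finish packing
      where
      open Regular reg renaming (k≤K to k≤)
      kσ≤ε : ι k * σ ≤ ε
      kσ≤ε = ≤-trans (*-mono-≥0ʳ σ (<⇒≤ 0<σ) (ι-mono k≤)) (*-comm (ι K) σ ≡≤ proj₂ (proj₂ σ-choice))
      module R = Reduction (adj G) (Graph.sym G) (irrefl G) c φ φ-sym bad ε d σ (<⇒≤ 0<ε) 0<d (<⇒≤ 0<σ) kσ≤ε bad-mass dev≤ -dev≤
      2βV²≤M : 2ℚ * β * V² ≤ M
      2βV²≤M = dense {β} dens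
      dV²≤ : int 48000 / 1 * (d * V²) ≤ β * β * M
      dV²≤ = dV²≤-identity β V² ≡≤ *-mono-≥0 (β * β) (<⇒≤ 0<β²) 2βV²≤M
      hard : ∀ K → (∀ x y → K x y ≡ K y x) → R.Hits K → M - int 1 / 5000 * (β * β * M) ≤ 2ℚ * ∑² (λ x y → A x y * 𝟙 (K x y))
      hard K K-sym hits = trans (cong (λ v → v - int 1 / 5000 * (β * β * v)) (sym 2m≡M)) (hard-identity β m) ≡≤ *-mono-≥0 2ℚ 0≤2 (cover-bound τ K K-sym hits)
      solution : R.Solution R.good
      solution = R.Solve.solution R.good R.good-sym
      module B = R.Bound β 0<β β≤1 (0<N N₀<n) ε≤d dV²≤ 2βV²≤M hard solution
      0<σN : 0ℚ < σ * N
      0<σN = 0<* 0<σ (0<N N₀<n)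
      P = R.Solution.packing solution
      module L = R.Lift P ζ 0<ζ ζ≤1 ε≤1 0<σN
      6≤ : 6ℚ ≤ η * (d * d * (σ * N))
      6≤ = ≤-trans (proj₂ N₀-choice) (*-mono-≥0ʳ q (<⇒≤ 0<q) (ι-mono (ℕ.<⇒≤ N₀<n) ≤≡ sym (∑ᶠ1≡ι n)) ≤≡ 6≤-identity N η (d * d) σ)
      open Pack εₙ 0<εₙ L.w′ L.w′≥0 L.w′-swap L.w′-rot L.w′-supp L.w′-load (L.w′-small η 6≤)
      V = R.ClassPacking.value P
      W = ∑³ L.w′
      B₀ = β * β * M
      0≤M : 0ℚ ≤ M
      0≤M = ∑²-≥0 (λ x y → 𝟙≥0 (adj G x y))
      0≤B₀ : 0ℚ ≤ B₀
      0≤B₀ = <⇒≤ 0<β² ⊛ 0≤M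
      W≥ : (1ℚ - ζ) * V - int 1 / 2000 * B₀ ≤ W
      W≥ = *-cancel-≤ (ζ * (d * d)) (0<* 0<ζ (0<* 0<d 0<d)) (lin (0≤- L.lifted ⊕ (<⇒≤ 0<ζ ⊛ (<⇒≤ 0<d ⊛ <⇒≤ 0<d)) ⊛ (<⇒≤ 0<β² ⊛ nonNegative⁻¹ (int 1 / 2000)) ⊛ 0≤- 2βV²≤M) (W≥-identity (ζ * (d * d)) ((1ℚ - ζ) * V) W β V² M))
      -- 3/3200 = ¾·1/800. It has to remain of the surplus 1/300 after the factor 1 - ζ and the two
      -- losses of 1/2000 from lifting and nibble.
      final : (int 3 / 4 * M + int 3 / 3200 * B₀) ≤ W - 3ℚ * εₙ * M
      final = lin (0≤- W≥ ⊕ (0≤- ζ≤1) ⊛ 0≤- B.value≥ ⊕ 0≤B₀ ⊛ nonNegative⁻¹ r ⊕ 0≤B₀ ⊛ 0≤- β²≤1 ⊛ nonNegative⁻¹ (int 1 / 1200000)) (final-identity W V β M)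
        where
        r : ℚ
        r = int 1 / 300 - int 3 / 16000 - int 1 / 1000 - int 3 / 3200 - int 1 / 1200000
      finish : ∃[ P ] (IsTrianglePacking G P × W - 3ℚ * εₙ * M ≤ 6ℚ * ι (length P)) → νt≥ G ((1ℚ + β * β * (int 1 / 800)) * ℕ→ℚ (numEdges G) * (int 1 / 4))
      finish (P , pk , le) = P , pk , (*-cancel-≤ 6ℚ (positive⁻¹ 6ℚ) (trans (claim-identity β m) (cong (λ v → int 3 / 4 * v + int 3 / 3200 * (β * β * v)) 2m≡M) ≡≤ ≤-trans final le) ≤≡ sym (ℕ→ℚ≡ι (length P)))

open import Data.Integer using (+_)

theorem1p7 : ∀ (β : ℚ) → 0ℚ < β →
    ∃[ N ] ∃[ δ ] (0ℚ < δ ×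
    (∀ (n : ℕ) (G : Graph n) → N ℕ.< n →
    β * ℕ→ℚ (n ^ 2) ≤ ℕ→ℚ (numEdges G) →
    τt≥ G ((1ℚ - δ) * ℕ→ℚ (numEdges G) * (+ 1 / 2)) →
    νt≥ G ((1ℚ + β * β * (+ 1 / 800)) * ℕ→ℚ (numEdges G) * (+ 1 / 4))))
theorem1p7 β 0<β = from (β ≤? 1ℚ)
  where
  from : Dec (β ≤ 1ℚ) → ∃[ N ] ∃[ δ ] (0ℚ < δ × Claim β N δ)
  from (yes β≤1) = Parameters.N₀ β 0<β β≤1 , Parameters.δ₀ β 0<β β≤1 , Parameters.0<δ₀ β 0<β β≤1 , Parameters.claim β 0<β β≤1
  from (no β≰1) = 0 , 1ℚ , positive⁻¹ 1ℚ , large-density 0<β β≰1
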